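{- Let $p,\ell$ be integers with $1\le \ell<p$. For every $\varepsilon>0$ there exists $n_0$ such that for every $n\ge n_0$ there is a graph $G$ whose vertex set is the disjoint union $W\cup Z$ with $|W|=|Z|=n$, such that $\alpha_p(G)\le \varepsilon n$, $e(G[W])\le \varepsilon n^2$, $e(G[Z])\le\varepsilon n^2$, and $\left|e_G(W,Z)-\frac{\ell}{p}n^2\right|\le \varepsilon n^2$. If additionally $\ell\le p/2$, then $G$ can moreover be taken to be $K_{p+\ell+1}$-free, and consequently $$\varrho_p(p+\ell+1)\ge \frac{\ell}{2p}.$$
   Context: For a graph $G$ and an integer $p\ge 1$, the $p$-independence number $\alpha_p(G)$ is the maximum size of a set $U\subseteq V(G)$ such that $G[U]$ contains no copy of $K_p$. $e_G(W,Z)$ denotes the number of edges of $G$ with one endpoint in $W$ and the other in $Z$. For integers $p\le q$ and $m\le n$, the Ramsey–Turán number $\mathsf{RT}_p(n,K_q,m)$ is the maximum number of edges in an $n$-vertex $K_q$-free graph $G$ with $\alpha_p(G)\le m$, and the Ramsey–Turán density is $\varrho_p(q):=\lim_{\varepsilon\to 0}\lim_{n\to\infty}\mathsf{RT}_p(n,K_q,\varepsilon n)/\binom{n}{2}$ (these limits exist). The quantity $\frac{\ell}{2p}$ equals the conjectured value $\varrho_p^*(p+\ell+1)$. -}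

module Defs where

open import Data.Nat as ℕ using (ℕ; zero; suc; _+_)
open import Data.Fin using (Fin)
open import Data.Fin.Subset using (Subset; _∈_; ∣_∣)
open import Data.Bool using (Bool; true; false; if_then_else_)
open import Data.List using (List; map; allFin)
open import Data.Nat.ListAction using (sum)
open import Data.Integer using (+_)
open import Data.Rational using (ℚ; 0ℚ) renaming (_/_ to _/ℚ_; _≤_ to _≤ℚ_; _*_ to _*ℚ_; _-_ to _-ℚ_)
open import Data.Product using (Σ; ∃; _×_)
open import Relation.Binary.PropositionalEquality using (_≡_; _≢_)
open import Relation.Nullary using (¬_; does)
open import Function.Definitions using (Injective)
import Data.Fin as F

record Graph (N : ℕ) : Set where
  field
    adj    : Fin N → Fin N → Bool
    symm   : ∀ i j → adj i j ≡ adj j i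
    irrefl : ∀ i → adj i i ≡ false
open Graph public

ℕ→ℚ : ℕ → ℚ
ℕ→ℚ k = + k /ℚ 1

-- the rational a / b  (b = 0 is never used; it is sent to 0)
ratio : ℕ → ℕ → ℚ
ratio a zero    = 0ℚ
ratio a (suc b) = + a /ℚ suc b

Σfin : (n : ℕ) → (Fin n → ℕ) → ℕ
Σfin n f = sum (map f (allFin n))

b2n : Bool → ℕ
b2n true  = 1
b2n false = 0

-- number of edges of G inside the vertex set described by an embedding
-- v : Fin k → Fin N (injective in our uses): pairs i < j with v i ~ v j
edgesWithin : ∀ {N} → Graph N → (k : ℕ) → (Fin k → Fin N) → ℕ
edgesWithin G k v =
  Σfin k (λ i → Σfin k (λ j → if does (i F.<? j) then b2n (adj G (v i) (v j)) else 0))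

-- number of edges of G between the images of v : Fin a → Fin N and w : Fin b → Fin N
-- (used for disjoint images)
edgesBetween : ∀ {N} → Graph N → (a b : ℕ) → (Fin a → Fin N) → (Fin b → Fin N) → ℕ
edgesBetween G a b v w = Σfin a (λ i → Σfin b (λ j → b2n (adj G (v i) (w j))))

edges : ∀ {N} → Graph N → ℕ
edges {N} G = edgesWithin G N (λ i → i)

IsClique : ∀ {N} → Graph N → (q : ℕ) → (Fin q → Fin N) → Set
IsClique G q f = Injective _≡_ _≡_ f × (∀ i j → i ≢ j → adj G (f i) (f j) ≡ true)

KFree : ∀ {N} → (q : ℕ) → Graph N → Set
KFree {N} q G = ¬ (Σ (Fin q → Fin N) λ f → IsClique G q f)

KFreeSet : ∀ {N} → (p : ℕ) → Graph N → Subset N → Set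
KFreeSet {N} p G U = ¬ (Σ (Fin p → Fin N) λ f → IsClique G p f × (∀ i → f i ∈ U))

αBound : ∀ {N} → (p : ℕ) → Graph N → ℚ → Set
αBound {N} p G m = ∀ (U : Subset N) → KFreeSet p G U → ℕ→ℚ ∣ U ∣ ≤ℚ m

choose2 : ℕ → ℕ
choose2 N = ℕ._/_ (N ℕ.* (N ℕ.∸ 1)) 2

-- ϱ_p(q) ≥ c, unfolded finitarily: for every ε > 0 and δ > 0 there is
-- n₀ such that for all n ≥ n₀ there is an n-vertex K_q-free graph G with
-- α_p(G) ≤ ε n and e(G) ≥ (c - δ) (n choose 2).
RTDensityAtLeast : (p q : ℕ) → ℚ → Set
RTDensityAtLeast p q c =
  ∀ (ε δ : ℚ) → 0ℚ Data.Rational.< ε → 0ℚ Data.Rational.< δ →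
  ∃ λ n₀ → ∀ n → n₀ ℕ.≤ n →
  Σ (Graph n) λ G → KFree q G × αBound p G (ε *ℚ ℕ→ℚ n)
    × ((c -ℚ δ) *ℚ ℕ→ℚ (choose2 n) ≤ℚ ℕ→ℚ (edges G))
  where import Data.Rational

{-# OPTIONS --safe #-}

-- Both classes are copies of a high-dimensional discrete torus, whose points are blown up to vertices.
-- The circle acts on the points by rotating all coordinates simultaneously, where each coordinate
-- runs through a closed polygonal curve.  Two vertices of one class are adjacent when one of them is close
-- to the image of the other under a rotation by t/p of a full turn with 0 < t < p.  A vertex x of W and a
-- vertex z of Z are adjacent when g(x,z) is clearly positive and g(x, z turned by ℓ/p) clearly negative,
-- where g is a sum over the coordinates of an approximate sine of the angle between x and z.
--
-- Independence: by a Poincaré inequality the distance to a set of positive density is small on average,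
-- so some point has all its p rotations close to the set, and the points of the set near them form a K_p.
--
-- Cliques: the members of a clique in W are close to distinct rotations of one point.  If there are more
-- than p/2 of them, the origin is a nonnegative combination of three of these directions; as g is close
-- to a sine wave under rotations, the positivity of g at all three confines the rotations present on the
-- other side to at most ℓ classes.  So a clique has at most p + ℓ vertices.
--
-- Density: when z turns once, g(x,z) is positive for half of the time, hence z is adjacent to x for ℓ/p of
-- the time, up to the points with g(x,z) near 0; these are rare by a Littlewood-Offord argument.  Close
-- pairs are rare in high dimension, so there are few edges inside the classes.
--
-- All angles are handled over ℤ, through powers of a rational rotation ((B² - 1) + 2Bi) / (B² + 1).
module Submission where

import Data.Bool.Properties as Bool
import Data.Fin as Fin
import Data.Fin.Properties as Fin
import Data.List as List
import Data.List.Properties as List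
import Data.List.Relation.Unary.All as ListAll
import Data.Fin.Subset as Subset
import Data.Vec as Vec
import Data.Vec.Properties as Vec
import Data.Nat as ℕ
import Data.Nat.DivMod as ℕ
import Data.Nat.ListAction as ℕ
import Data.Nat.Properties as ℕ
import Data.Nat.Tactic.RingSolver as ℕSolver
import Data.Rational as ℚ
import Data.Rational.Properties as ℚ
import Data.Rational.Unnormalised as ℚᵘ
import Data.Rational.Unnormalised.Properties as ℚᵘ
import Data.Integer.Properties as ℤ

-- The construction is in the spirit of the Bollobás-Erdős graph, with a discrete torus for the
-- sphere and a Poincaré inequality for isoperimetry. The obstacle in the clique bound is that
-- closeness of vertices says little about `g`: moving one argument by a squared distance `C` may
-- change `g` by far more than the threshold `R`. Only mixed second differences, where both
-- arguments move, are of order `s * C`. So the values at three clique members are added with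
-- nonnegative weights for which the exact rotations cancel. This kills the first-order term, and
-- the sum can be carried from a vertex to the exact rotation near it. The polygon is made for this:
-- its vertices are unit vectors, so every kernel on them extends bilinearly, and a rotation
-- permutes them. The constants are chosen in the order `p`, `d`; then distances in units of `n²`;
-- then the dimension `k = n`; last the accuracy `Λ` of the sine. This is not circular: the Poincaré
-- bound on distances is free of `k`, and the ratio `κ` of the largest to the smallest positive
-- sample of the sine is free of `Λ`.

module Prelude where

  open import Data.Nat using (ℕ; zero; suc) public
  open import Data.Integer using (ℤ; -[1+_]; -_; _+_; _*_; _-_; _≤_; +≤+; 0ℤ; 1ℤ) renaming (+_ to pos) public
  open import Data.Integer.Tactic.RingSolver using (solve-∀) public
  open import Data.Bool using (Bool; true; false; not) public
  open import Data.Fin using (Fin; zero; suc; toℕ) public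
  open import Data.List using (List; []; _∷_; length) public
  open import Data.List.Membership.Propositional using (_∈_) public
  open import Data.List.Relation.Unary.Any using (here; there) public
  open import Data.Vec using (Vec; []; _∷_; updateAt; lookup) public
  open import Data.Product using (_×_; _,_; proj₁; proj₂; Σ; ∃) public
  open import Data.Sum using (_⊎_; inj₁; inj₂; [_,_]′) public
  open import Data.Empty using (⊥; ⊥-elim) public
  open import Function using (_∘_) public
  open import Relation.Nullary using (Dec; does; yes; no; ¬_) public
  open import Relation.Binary.PropositionalEquality using (_≡_; _≢_; refl; sym; trans; cong; cong₂; subst; subst₂) public
  open import Data.Integer.Solver using (module +-*-Solver) public
  open +-*-Solver using (solve; _:=_; con; _:+_; _:*_; _:-_; :-_) public

-- Integer inequalities by certificates, and finite sums

module Sums where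

  open Prelude
  open import Data.Integer using (∣_∣)
  open import Data.List using (_++_; map)

  private variable
    A B : Set

  0≤⁺ : ∀ n → 0ℤ ≤ pos n
  0≤⁺ n = +≤+ ℕ.z≤n

  0≤+ : ∀ {a b} → 0ℤ ≤ a → 0ℤ ≤ b → 0ℤ ≤ a + b
  0≤+ = ℤ.+-mono-≤

  0≤* : ∀ {a b} → 0ℤ ≤ a → 0ℤ ≤ b → 0ℤ ≤ a * b
  0≤* {pos m} {pos n} _ _ = subst (0ℤ ≤_) (ℤ.pos-* m n) (0≤⁺ (m ℕ.* n))

  0≤² : ∀ a → 0ℤ ≤ a * a
  0≤² a with ℤ.≤-total 0ℤ a
  ... | inj₁ p = 0≤* p p
  ... | inj₂ p = subst (0ℤ ≤_) (eq a) (0≤* q q)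
    where
    q : 0ℤ ≤ - a
    q = ℤ.neg-mono-≤ p
    eq : ∀ a → - a * - a ≡ a * a
    eq = solve-∀

  0≤⇒≤ : ∀ {a b} → 0ℤ ≤ b - a → a ≤ b
  0≤⇒≤ = ℤ.0≤i-j⇒j≤i

  ≤⇒0≤ : ∀ {a b} → a ≤ b → 0ℤ ≤ b - a
  ≤⇒0≤ = ℤ.i≤j⇒0≤j-i

  -- Nearly every inequality below ends here: the difference of the two sides is displayed as a sum
  -- of products of nonnegative quantities, and the ring solver checks the identity. Hypotheses
  -- enter through `≤⇒0≤`.
  certify : ∀ {a b d} → 0ℤ ≤ d → d ≡ b - a → a ≤ b
  certify p eq = 0≤⇒≤ (subst (0ℤ ≤_) eq p)

  -- Abstract, since conversion checking would otherwise unfold proofs of ⊥.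
  abstract
    absurd : ∀ {d} → 0ℤ ≤ d → d ≡ - 1ℤ → ⊥
    absurd p refl with p
    ... | ()

  *-monoˡ : ∀ {a b} c → 0ℤ ≤ c → a ≤ b → c * a ≤ c * b
  *-monoˡ {a} {b} c p q = certify (0≤* p (≤⇒0≤ q)) (eq a b c)
    where
    eq : ∀ a b c → c * (b - a) ≡ c * b - c * a
    eq = solve-∀

  *-mono : ∀ {a b c d} → 0ℤ ≤ a → 0ℤ ≤ c → a ≤ b → c ≤ d → a * c ≤ b * d
  *-mono {a} {b} {c} {d} pa pc p q =
    certify (0≤+ (0≤* (≤⇒0≤ p) pc) (0≤* (ℤ.≤-trans pa p) (≤⇒0≤ q))) (eq a b c d)
    where
    eq : ∀ a b c d → (b - a) * c + b * (d - c) ≡ b * d - a * c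
    eq = solve-∀

  *-cancelˡ : ∀ {a b} c → 1ℤ ≤ c → c * a ≤ c * b → a ≤ b
  *-cancelˡ (pos (suc n)) _ p = ℤ.*-cancelˡ-≤-pos _ _ (pos (suc n)) p
  *-cancelˡ (pos zero) (+≤+ ()) _

  +-cancelˡ : ∀ {a b} c → c + a ≡ c + b → a ≡ b
  +-cancelˡ {a} {b} c p = trans (eq a c) (trans (cong (_- c) p) (sym (eq b c)))
    where
    eq : ∀ a c → a ≡ c + a - c
    eq = solve-∀

  ∣∣≤ : ∀ {a b} → a ≤ b → - a ≤ b → pos ∣ a ∣ ≤ b
  ∣∣≤ {pos n} p q = p
  ∣∣≤ { -[1+ n ] } p q = q

  ∑ : List A → (A → ℤ) → ℤ
  ∑ []       f = 0ℤ
  ∑ (x ∷ xs) f = f x + ∑ xs f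

  ∑-cong∈ : ∀ (xs : List A) {f g : A → ℤ} → (∀ x → x ∈ xs → f x ≡ g x) → ∑ xs f ≡ ∑ xs g
  ∑-cong∈ []       p = refl
  ∑-cong∈ (x ∷ xs) p = cong₂ _+_ (p x (here refl)) (∑-cong∈ xs (λ y m → p y (there m)))

  ∑-cong : ∀ (xs : List A) {f g : A → ℤ} → (∀ x → f x ≡ g x) → ∑ xs f ≡ ∑ xs g
  ∑-cong xs p = ∑-cong∈ xs (λ x _ → p x)

  ∑-mono∈ : ∀ (xs : List A) {f g : A → ℤ} → (∀ x → x ∈ xs → f x ≤ g x) → ∑ xs f ≤ ∑ xs g
  ∑-mono∈ []       p = ℤ.≤-refl
  ∑-mono∈ (x ∷ xs) p = ℤ.+-mono-≤ (p x (here refl)) (∑-mono∈ xs (λ y m → p y (there m)))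

  ∑-mono : ∀ (xs : List A) {f g : A → ℤ} → (∀ x → f x ≤ g x) → ∑ xs f ≤ ∑ xs g
  ∑-mono xs p = ∑-mono∈ xs (λ x _ → p x)

  ∑-0≤ : ∀ (xs : List A) {f : A → ℤ} → (∀ x → 0ℤ ≤ f x) → 0ℤ ≤ ∑ xs f
  ∑-0≤ []       p = ℤ.≤-refl
  ∑-0≤ (x ∷ xs) p = 0≤+ (p x) (∑-0≤ xs p)

  ∑-+ : ∀ (xs : List A) (f g : A → ℤ) → ∑ xs (λ x → f x + g x) ≡ ∑ xs f + ∑ xs g
  ∑-+ []       f g = refl
  ∑-+ (x ∷ xs) f g = trans (cong (f x + g x +_) (∑-+ xs f g)) (eq (f x) (g x) (∑ xs f) (∑ xs g))
    where
    eq : ∀ a b c d → a + b + (c + d) ≡ a + c + (b + d)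
    eq = solve-∀

  ∑-* : ∀ (xs : List A) c (f : A → ℤ) → ∑ xs (λ x → c * f x) ≡ c * ∑ xs f
  ∑-* []       c f = sym (ℤ.*-zeroʳ c)
  ∑-* (x ∷ xs) c f = trans (cong (c * f x +_) (∑-* xs c f)) (sym (ℤ.*-distribˡ-+ c (f x) (∑ xs f)))

  ∑-neg : ∀ (xs : List A) (f : A → ℤ) → ∑ xs (λ x → - f x) ≡ - ∑ xs f
  ∑-neg []       f = refl
  ∑-neg (x ∷ xs) f = trans (cong (- f x +_) (∑-neg xs f)) (sym (ℤ.neg-distrib-+ (f x) (∑ xs f)))

  ∑-- : ∀ (xs : List A) (f g : A → ℤ) → ∑ xs (λ x → f x - g x) ≡ ∑ xs f - ∑ xs g
  ∑-- xs f g = trans (∑-+ xs f (λ x → - g x)) (cong (∑ xs f +_) (∑-neg xs g))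

  ∑-const : ∀ (xs : List A) c → ∑ xs (λ _ → c) ≡ pos (length xs) * c
  ∑-const []       c = sym (ℤ.*-zeroˡ c)
  ∑-const (x ∷ xs) c = trans (cong (c +_) (∑-const xs c)) (eq (pos (length xs)) c)
    where
    eq : ∀ l c → c + l * c ≡ (1ℤ + l) * c
    eq = solve-∀

  ∑-0 : ∀ (xs : List A) → ∑ xs (λ _ → 0ℤ) ≡ 0ℤ
  ∑-0 xs = trans (∑-const xs 0ℤ) (ℤ.*-zeroʳ (pos (length xs)))

  ∑-swap : ∀ (xs : List A) (ys : List B) (f : A → B → ℤ) →
           ∑ xs (λ x → ∑ ys (f x)) ≡ ∑ ys (λ y → ∑ xs (λ x → f x y))
  ∑-swap []       ys f = sym (∑-0 ys)
  ∑-swap (x ∷ xs) ys f = trans (cong (∑ ys (f x) +_) (∑-swap xs ys f))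
                               (sym (∑-+ ys (f x) (λ y → ∑ xs (λ x′ → f x′ y))))

  ∑-++ : ∀ (xs ys : List A) (f : A → ℤ) → ∑ (xs ++ ys) f ≡ ∑ xs f + ∑ ys f
  ∑-++ []       ys f = sym (ℤ.+-identityˡ _)
  ∑-++ (x ∷ xs) ys f = trans (cong (f x +_) (∑-++ xs ys f)) (sym (ℤ.+-assoc (f x) _ _))

  ∑-map : ∀ (h : A → B) (xs : List A) (f : B → ℤ) → ∑ (map h xs) f ≡ ∑ xs (f ∘ h)
  ∑-map h []       f = refl
  ∑-map h (x ∷ xs) f = cong (f (h x) +_) (∑-map h xs f)

  ∑-member : ∀ {xs : List A} {x} (f : A → ℤ) → (∀ y → 0ℤ ≤ f y) → x ∈ xs → f x ≤ ∑ xs f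
  ∑-member {xs = x ∷ xs} f p (here refl) = certify (∑-0≤ xs p) (eq (f x) (∑ xs f))
    where
    eq : ∀ a b → b ≡ a + b - a
    eq = solve-∀
  ∑-member {xs = y ∷ xs} f p (there m) =
    ℤ.≤-trans (∑-member f p m) (certify (p y) (eq (f y) (∑ xs f)))
    where
    eq : ∀ a b → a ≡ a + b - b
    eq = solve-∀

  ∑-shifted² : ∀ (xs : List A) (f : A → ℤ) d →
    ∑ xs (λ x → (f x - d) * (f x - d)) ≡
    ∑ xs (λ x → f x * f x) - pos 2 * (d * ∑ xs f) + pos (length xs) * (d * d)
  ∑-shifted² []       f d = eq d
    where
    eq : ∀ d → 0ℤ ≡ 0ℤ - pos 2 * (d * 0ℤ) + 0ℤ * (d * d)
    eq = solve-∀
  ∑-shifted² (x ∷ xs) f d =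
    trans (cong ((f x - d) * (f x - d) +_) (∑-shifted² xs f d))
          (eq (f x) d (∑ xs (λ x → f x * f x)) (∑ xs f) (pos (length xs)))
    where
    eq : ∀ a d s t l → (a - d) * (a - d) + (s - pos 2 * (d * t) + l * (d * d)) ≡
                       a * a + s - pos 2 * (d * (a + t)) + (1ℤ + l) * (d * d)
    eq = solve 5 (λ a d s t l → (a :- d) :* (a :- d) :+ (s :- con (pos 2) :* (d :* t) :+ l :* (d :* d)) := a :* a :+ s :- con (pos 2) :* (d :* (a :+ t)) :+ (con 1ℤ :+ l) :* (d :* d)) refl

  -- Induction on the list: when `x` is added, the difference of the two sides grows by exactly the
  -- sum of all `(f y - f x)²`, which `∑-shifted²` expands.
  ∑-cauchy : ∀ (xs : List A) (f : A → ℤ) →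
             ∑ xs f * ∑ xs f ≤ pos (length xs) * ∑ xs (λ x → f x * f x)
  ∑-cauchy []       f = ℤ.≤-refl
  ∑-cauchy (x ∷ xs) f =
    certify (0≤+ (≤⇒0≤ (∑-cauchy xs f)) shifted)
      (eq (f x) (∑ xs (λ x → f x * f x)) (∑ xs f) (pos (length xs)))
    where
    shifted = subst (0ℤ ≤_) (∑-shifted² xs f (f x)) (∑-0≤ xs (λ y → 0≤² (f y - f x)))
    eq : ∀ a s t l → (l * s - t * t) + (s - pos 2 * (a * t) + l * (a * a)) ≡
                     (1ℤ + l) * (a * a + s) - (a + t) * (a + t)
    eq = solve 4 (λ a s t l → (l :* s :- t :* t) :+ (s :- con (pos 2) :* (a :* t) :+ l :* (a :* a)) := (con 1ℤ :+ l) :* (a :* a :+ s) :- (a :+ t) :* (a :+ t)) refl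

  range : ℕ → List ℕ
  range zero    = []
  range (suc n) = n ∷ range n

  length-range : ∀ n → length (range n) ≡ n
  length-range zero    = refl
  length-range (suc n) = cong suc (length-range n)

  ∈-range⁻ : ∀ {n i} → i ∈ range n → i ℕ.< n
  ∈-range⁻ {suc n} (here refl) = ℕ.≤-refl
  ∈-range⁻ {suc n} (there m)   = ℕ.m≤n⇒m≤1+n (∈-range⁻ m)

  ∈-range⁺ : ∀ {n i} → i ℕ.< n → i ∈ range n
  ∈-range⁺ {suc n} {i} (ℕ.s≤s p) with ℕ.m≤n⇒m<n∨m≡n p
  ... | inj₁ q    = there (∈-range⁺ q)
  ... | inj₂ refl = here refl

  ∑-range-const : ∀ n c → ∑ (range n) (λ _ → c) ≡ pos n * c
  ∑-range-const n c = trans (∑-const (range n) c) (cong (λ l → pos l * c) (length-range n))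

  ∑-range-suc : ∀ n (f : ℕ → ℤ) → f 0 + ∑ (range n) (f ∘ suc) ≡ ∑ (range (suc n)) f
  ∑-range-suc zero    f = refl
  ∑-range-suc (suc n) f = trans (eq (f 0) (f (suc n)) _) (cong (f (suc n) +_) (∑-range-suc n f))
    where
    eq : ∀ a b c → a + (b + c) ≡ b + (a + c)
    eq = solve-∀

  ∑-range-+ : ∀ m n (f : ℕ → ℤ) →
              ∑ (range (m ℕ.+ n)) f ≡ ∑ (range m) f + ∑ (range n) (λ i → f (m ℕ.+ i))
  ∑-range-+ m zero    f rewrite ℕ.+-identityʳ m = sym (ℤ.+-identityʳ _)
  ∑-range-+ m (suc n) f rewrite ℕ.+-suc m n =
    trans (cong (f (m ℕ.+ n) +_) (∑-range-+ m n f)) (eq (f (m ℕ.+ n)) (∑ (range m) f) (∑ (range n) (λ i → f (m ℕ.+ i))))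
    where
    eq : ∀ a b c → a + (b + c) ≡ b + (a + c)
    eq = solve-∀

  Periodic : ∀ {B : Set} → ℕ → (ℕ → B) → Set
  Periodic n f = ∀ i → f (i ℕ.+ n) ≡ f i

  ∑-periodic-suc : ∀ n {f : ℕ → ℤ} → Periodic n f → ∑ (range n) (f ∘ suc) ≡ ∑ (range n) f
  ∑-periodic-suc n {f} per = +-cancelˡ (f 0) (trans (∑-range-suc n f) (cong (_+ ∑ (range n) f) (per 0)))

  ∑-periodic : ∀ n {f : ℕ → ℤ} → Periodic n f → ∀ s → ∑ (range n) (λ i → f (i ℕ.+ s)) ≡ ∑ (range n) f
  ∑-periodic n {f} per zero    = ∑-cong (range n) (λ i → cong f (ℕ.+-identityʳ i))
  ∑-periodic n {f} per (suc s) =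
    trans (∑-cong (range n) (λ i → cong f (ℕ.+-suc i s)))
          (trans (∑-periodic-suc n {λ i → f (i ℕ.+ s)} per′) (∑-periodic n per s))
    where
    per′ : Periodic n (λ i → f (i ℕ.+ s))
    per′ i = trans (cong f (trans (ℕ.+-assoc i n s) (trans (cong (i ℕ.+_) (ℕ.+-comm n s)) (sym (ℕ.+-assoc i s n)))))
                   (per (i ℕ.+ s))

-- The discrete torus and a Poincaré inequality on it

module Grid where

  open Prelude
  open Sums
  open import Data.List using (map; cartesianProductWith)

  private variable
    k : ℕ

  cong₃ : ∀ {A B C D : Set} (f : A → B → C → D) {a a′ b b′ c c′} →
          a ≡ a′ → b ≡ b′ → c ≡ c′ → f a b c ≡ f a′ b′ c′
  cong₃ f refl refl refl = refl

  sumFin : (Fin k → ℤ) → ℤ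
  sumFin {zero}  f = 0ℤ
  sumFin {suc k} f = f zero + sumFin (f ∘ suc)

  sumFin-affine : ∀ c d (f : Fin k → ℤ) → sumFin (λ i → c * f i + d) ≡ c * sumFin f + pos k * d
  sumFin-affine {zero}  c d f = eq c d
    where
    eq : ∀ c d → 0ℤ ≡ c * 0ℤ + 0ℤ * d
    eq = solve-∀
  sumFin-affine {suc k} c d f =
    trans (cong (c * f zero + d +_) (sumFin-affine c d (f ∘ suc)))
          (eq c d (f zero) (sumFin (f ∘ suc)) (pos k))
    where
    eq : ∀ c d a s l → c * a + d + (c * s + l * d) ≡ c * (a + s) + (1ℤ + l) * d
    eq = solve 5 (λ c d a s l → c :* a :+ d :+ (c :* s :+ l :* d) := c :* (a :+ s) :+ (con 1ℤ :+ l) :* d) refl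

  shift : ℕ → Vec ℕ k → Vec ℕ k
  shift c = Vec.map (ℕ._+ c)

  PeriodicV : ∀ {B : Set} → ℕ → (Vec ℕ k → B) → Set
  PeriodicV n f = ∀ x i → f (updateAt x i (ℕ._+ n)) ≡ f x

  module _ (M : ℕ) where

    grid : ∀ k → List (Vec ℕ k)
    grid zero    = [] ∷ []
    grid (suc k) = cartesianProductWith _∷_ (range M) (grid k)

    size : ℕ → ℤ
    size k = pos (length (grid k))

    ∑-cartesian : ∀ {A B C : Set} (h : A → B → C) (xs : List A) (ys : List B) (f : C → ℤ) →
      ∑ (cartesianProductWith h xs ys) f ≡ ∑ xs (λ x → ∑ ys (λ y → f (h x y)))
    ∑-cartesian h []       ys f = refl
    ∑-cartesian h (x ∷ xs) ys f =
      trans (∑-++ (map (h x) ys) _ f) (cong₂ _+_ (∑-map (h x) ys f) (∑-cartesian h xs ys f))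

    ∑-grid : ∀ (f : Vec ℕ (suc k) → ℤ) →
      ∑ (grid (suc k)) f ≡ ∑ (range M) (λ u → ∑ (grid k) (λ v → f (u ∷ v)))
    ∑-grid {k} = ∑-cartesian _∷_ (range M) (grid k)

    size-∑ : ∀ k → ∑ (grid k) (λ _ → 1ℤ) ≡ size k
    size-∑ k = trans (∑-const (grid k) 1ℤ) (ℤ.*-identityʳ (size k))

    size-suc : ∀ k → size (suc k) ≡ pos M * size k
    size-suc k = trans (sym (size-∑ (suc k)))
      (trans (∑-grid (λ _ → 1ℤ))
        (trans (∑-range-const M (∑ (grid k) (λ _ → 1ℤ))) (cong (pos M *_) (size-∑ k))))

    -- `grid` lists one fundamental domain of a torus whose points are vectors of unreduced
    -- naturals. Invariance under a common shift is therefore a property of functions that are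
    -- periodic in every coordinate.
    ∑-grid-shift : ∀ c {f : Vec ℕ k → ℤ} → PeriodicV M f → ∑ (grid k) (f ∘ shift c) ≡ ∑ (grid k) f
    ∑-grid-shift {zero}  c per = refl
    ∑-grid-shift {suc k} c {f} per =
      trans (∑-grid (f ∘ shift c))
        (trans (∑-cong (range M) (λ u → ∑-grid-shift c {λ v → f (u ℕ.+ c ∷ v)} (λ v i → per (u ℕ.+ c ∷ v) (suc i))))
          (trans (∑-periodic M {λ u → ∑ (grid k) (λ v → f (u ∷ v))} (λ u → ∑-cong (grid k) (λ v → per (u ∷ v) zero)) c)
            (sym (∑-grid f))))

  module Poincaré (m : ℕ) where

    M : ℕ
    M = suc m

    private
      X : ∀ k → List (Vec ℕ k)
      X = grid M

      N : ℕ → ℤ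
      N = size M

    steps² : ℕ → (ℕ → ℤ) → ℤ
    steps² n f = ∑ (range n) (λ u → (f (suc u) - f u) * (f (suc u) - f u))

    telescope : ∀ u j (f : ℕ → ℤ) →
      ∑ (range j) (λ i → f (suc (u ℕ.+ i)) - f (u ℕ.+ i)) ≡ f (u ℕ.+ j) - f u
    telescope u zero    f rewrite ℕ.+-identityʳ u = sym (ℤ.+-inverseʳ (f u))
    telescope u (suc j) f rewrite ℕ.+-suc u j =
      trans (cong (f (suc (u ℕ.+ j)) - f (u ℕ.+ j) +_) (telescope u j f)) (eq (f (suc (u ℕ.+ j))) _ _)
      where
      eq : ∀ a b c → a - b + (b - c) ≡ a - c
      eq = solve-∀

    -- Cauchy-Schwarz along the path from `u` to `u + j`. Length and energy of the whole path from 0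
    -- are used, so that the bound is the same for all `u` with a given end point.
    path-bound : ∀ u j (f : ℕ → ℤ) →
      (f u - f (u ℕ.+ j)) * (f u - f (u ℕ.+ j)) ≤ pos (u ℕ.+ j) * steps² (u ℕ.+ j) f
    path-bound u j f = ℤ.≤-trans
      (ℤ.≤-reflexive (trans (eq (f u) (f (u ℕ.+ j))) (cong₂ _*_ (sym tel) (sym tel))))
      (ℤ.≤-trans (∑-cauchy (range j) _)
        (*-mono (0≤⁺ (length (range j))) (∑-0≤ (range j) (λ i → 0≤² (f (suc (u ℕ.+ i)) - f (u ℕ.+ i))))
          (ℤ.≤-trans (ℤ.≤-reflexive (cong pos (length-range j))) (+≤+ (ℕ.m≤n+m j u)))
          (certify (∑-0≤ (range u) (λ i → 0≤² (f (suc i) - f i)))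
                   (trans (eq′ (steps² u f) (∑ (range j) (λ i → (f (suc (u ℕ.+ i)) - f (u ℕ.+ i)) * (f (suc (u ℕ.+ i)) - f (u ℕ.+ i)))))
                          (cong (_- ∑ (range j) (λ i → (f (suc (u ℕ.+ i)) - f (u ℕ.+ i)) * (f (suc (u ℕ.+ i)) - f (u ℕ.+ i)))) (sym (∑-range-+ u j (λ v → (f (suc v) - f v) * (f (suc v) - f v)))))))))
      where
      tel = telescope u j f
      eq : ∀ a b → (a - b) * (a - b) ≡ (b - a) * (b - a)
      eq = solve-∀
      eq′ : ∀ a b → a ≡ a + b - b
      eq′ = solve-∀

    -- Induction on the number of points: the new value adds its squared distances to all earlier
    -- values, and `path-bound` controls each of them. The points form a path; the edge closing it
    -- to a cycle is left out.
    poincaré₁ : ∀ n (f : ℕ → ℤ) →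
      pos 2 * (pos (suc n) * ∑ (range (suc n)) (λ u → f u * f u) - ∑ (range (suc n)) f * ∑ (range (suc n)) f)
      ≤ pos (suc n) * pos (suc n) * pos (suc n) * steps² n f
    poincaré₁ zero    f = ℤ.≤-reflexive (eq (f 0))
      where
      eq : ∀ a → pos 2 * (1ℤ * (a * a + 0ℤ) - (a + 0ℤ) * (a + 0ℤ)) ≡ 1ℤ * 1ℤ * 1ℤ * 0ℤ
      eq = solve 1 (λ a → con (pos 2) :* (con 1ℤ :* (a :* a :+ con 0ℤ) :- (a :+ con 0ℤ) :* (a :+ con 0ℤ)) := con 1ℤ :* con 1ℤ :* con 1ℤ :* con 0ℤ) refl
    poincaré₁ (suc n) f =
      certify (0≤+ (0≤+ (≤⇒0≤ (poincaré₁ n f)) (0≤* (0≤⁺ 2) (≤⇒0≤ far)))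
                (0≤+ (0≤* (0≤* (0≤* (0≤⁺ (suc n)) (0≤⁺ (suc n))) (0≤⁺ (suc n))) (0≤² δ)) (0≤* (0≤+ (0≤+ (0≤* (0≤⁺ (suc n)) (0≤⁺ (suc n))) (0≤* (0≤⁺ 3) (0≤⁺ (suc n)))) (0≤⁺ 1)) pD′)))
        (eq (pos (suc n)) a (∑ (range (suc n)) (λ u → f u * f u)) (∑ (range (suc n)) f) D (δ * δ))
      where
      a = f (suc n)
      δ = f (suc n) - f n
      D = steps² n f
      D′ = steps² (suc n) f
      pD′ : 0ℤ ≤ D′
      pD′ = ∑-0≤ (range (suc n)) (λ u → 0≤² (f (suc u) - f u))
      far : ∑ (range (suc n)) (λ u → f u * f u) - pos 2 * (a * ∑ (range (suc n)) f) + pos (suc n) * (a * a)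
            ≤ pos (suc n) * (pos (suc n) * D′)
      far = subst (_≤ pos (suc n) * (pos (suc n) * D′))
        (trans (∑-shifted² (range (suc n)) f a) (cong (λ l → ∑ (range (suc n)) (λ u → f u * f u) - pos 2 * (a * ∑ (range (suc n)) f) + pos l * (a * a)) (length-range (suc n))))
        (ℤ.≤-trans (∑-mono∈ (range (suc n)) near)
                   (ℤ.≤-reflexive (∑-range-const (suc n) (pos (suc n) * D′))))
        where
        near : ∀ u → u ∈ range (suc n) → (f u - a) * (f u - a) ≤ pos (suc n) * D′
        near u u∈ with ℕ.m≤n⇒∃[o]m+o≡n (ℕ.<⇒≤ (∈-range⁻ u∈))
        ... | j , e = subst (λ l → (f u - f l) * (f u - f l) ≤ pos l * steps² l f) e (path-bound u j f)
      eq : ∀ M a s t D d² →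
        (M * M * M * D - pos 2 * (M * s - t * t))
        + pos 2 * (M * (M * (d² + D)) - (s - pos 2 * (a * t) + M * (a * a)))
        + (M * M * M * d² + (M * M + pos 3 * M + 1ℤ) * (d² + D))
        ≡ (1ℤ + M) * (1ℤ + M) * (1ℤ + M) * (d² + D)
          - pos 2 * ((1ℤ + M) * (a * a + s) - (a + t) * (a + t))
      eq = solve 6 (λ M a s t D d² → (M :* M :* M :* D :- con (pos 2) :* (M :* s :- t :* t)) :+ con (pos 2) :* (M :* (M :* (d² :+ D)) :- (s :- con (pos 2) :* (a :* t) :+ M :* (a :* a))) :+ (M :* M :* M :* d² :+ (M :* M :+ con (pos 3) :* M :+ con 1ℤ) :* (d² :+ D)) := (con 1ℤ :+ M) :* (con 1ℤ :+ M) :* (con 1ℤ :+ M) :* (d² :+ D) :- con (pos 2) :* ((con 1ℤ :+ M) :* (a :* a :+ s) :- (a :+ t) :* (a :+ t))) refl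

    -- The Dirichlet form of the grid graph: squared differences over the edges from `u` to `u + 1`
    -- in all directions, without the edges from `m` back to 0.
    energy : ∀ k → (Vec ℕ k → ℤ) → ℤ
    energy zero    f = 0ℤ
    energy (suc k) f =
      ∑ (range M) (λ u → energy k (λ v → f (u ∷ v)))
      + ∑ (range m) (λ u → ∑ (X k) (λ v → (f (suc u ∷ v) - f (u ∷ v)) * (f (suc u ∷ v) - f (u ∷ v))))

    -- Tensorisation: the variance splits into the mean of the fibre variances and the
    -- variance of the fibre means.
    poincaré : ∀ k (f : Vec ℕ k → ℤ) →
      pos 2 * (N k * ∑ (X k) (λ x → f x * f x) - ∑ (X k) f * ∑ (X k) f)
      ≤ pos M * pos M * N k * energy k f
    poincaré zero    f = ℤ.≤-reflexive (eq (f []) (pos M))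
      where
      eq : ∀ a M → pos 2 * (1ℤ * (a * a + 0ℤ) - (a + 0ℤ) * (a + 0ℤ)) ≡ M * M * 1ℤ * 0ℤ
      eq = solve 2 (λ a M → con (pos 2) :* (con 1ℤ :* (a :* a :+ con 0ℤ) :- (a :+ con 0ℤ) :* (a :+ con 0ℤ)) := M :* M :* con 1ℤ :* con 0ℤ) refl
    poincaré (suc k) f =
      ℤ.≤-trans (ℤ.≤-reflexive lhs) (ℤ.≤-trans
        (ℤ.+-mono-≤ (*-monoˡ (pos M) (0≤⁺ M) (∑-mono (range M) (λ u → poincaré k (λ v → f (u ∷ v)))))
          (ℤ.≤-trans (poincaré₁ m A)
            (*-monoˡ (pos M * pos M * pos M) (0≤* (0≤* (0≤⁺ M) (0≤⁺ M)) (0≤⁺ M)) (∑-mono (range m) means))))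
        (ℤ.≤-reflexive rhs))
      where
      A B : ℕ → ℤ
      A u = ∑ (X k) (λ v → f (u ∷ v))
      B u = ∑ (X k) (λ v → f (u ∷ v) * f (u ∷ v))
      E : ℕ → ℤ
      E u = energy k (λ v → f (u ∷ v))
      F : ℕ → ℤ
      F u = ∑ (X k) (λ v → (f (suc u ∷ v) - f (u ∷ v)) * (f (suc u ∷ v) - f (u ∷ v)))
      -- The difference of neighbouring fibre sums is a sum of differences, so Cauchy-Schwarz bounds
      -- the energy of the fibre sums by the energy in the first direction.
      means : ∀ u → (A (suc u) - A u) * (A (suc u) - A u) ≤ N k * F u
      means u = subst (λ z → z * z ≤ N k * F u) (∑-- (X k) (λ v → f (suc u ∷ v)) (λ v → f (u ∷ v)))
                  (∑-cauchy (X k) (λ v → f (suc u ∷ v) - f (u ∷ v)))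
      rhs₀ = pos M * ∑ (range M) (λ u → pos M * pos M * N k * E u)
             + pos M * pos M * pos M * ∑ (range m) (λ u → N k * F u)
      lhs₁ : ∀ M n S² S T → pos 2 * (M * n * S² - T * T) ≡
             M * (pos 2 * (n * S² - S)) + pos 2 * (M * S - T * T)
      lhs₁ = solve 5 (λ M n S² S T → con (pos 2) :* (M :* n :* S² :- T :* T) := M :* (con (pos 2) :* (n :* S² :- S)) :+ con (pos 2) :* (M :* S :- T :* T)) refl
      lhs : pos 2 * (N (suc k) * ∑ (X (suc k)) (λ x → f x * f x) - ∑ (X (suc k)) f * ∑ (X (suc k)) f)
            ≡ pos M * ∑ (range M) (λ u → pos 2 * (N k * B u - A u * A u))
              + pos 2 * (pos M * ∑ (range M) (λ u → A u * A u) - ∑ (range M) A * ∑ (range M) A)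
      lhs = trans
        (cong₃ (λ a b c → pos 2 * (a * b - c * c)) (size-suc M k) (∑-grid M (λ x → f x * f x)) (∑-grid M f))
        (trans (lhs₁ (pos M) (N k) (∑ (range M) B) (∑ (range M) (λ u → A u * A u)) (∑ (range M) A))
          (cong (λ z → pos M * z + V) (sym (trans (∑-* (range M) (pos 2) (λ u → N k * B u - A u * A u))
            (cong (pos 2 *_) (trans (∑-- (range M) (λ u → N k * B u) (λ u → A u * A u))
              (cong (_- ∑ (range M) (λ u → A u * A u)) (∑-* (range M) (N k) B))))))))
        where
        V = pos 2 * (pos M * ∑ (range M) (λ u → A u * A u) - ∑ (range M) A * ∑ (range M) A)
      rhs₁ : ∀ M n e g → M * (M * M * n * e) + M * M * M * (n * g) ≡ M * M * (M * n) * (e + g)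
      rhs₁ = solve 4 (λ M n e g → M :* (M :* M :* n :* e) :+ M :* M :* M :* (n :* g) := M :* M :* (M :* n) :* (e :+ g)) refl
      rhs : rhs₀ ≡ pos M * pos M * N (suc k) * energy (suc k) f
      rhs = trans (cong₂ (λ a b → pos M * a + pos M * pos M * pos M * b)
                         (∑-* (range M) (pos M * pos M * N k) E) (∑-* (range m) (N k) F))
        (trans (rhs₁ (pos M) (N k) (∑ (range M) E) (∑ (range m) F))
               (cong (λ z → pos M * pos M * z * energy (suc k) f) (sym (size-suc M k))))

    -- An edge is charged to both of its ends, and in each direction a point lies on at most two
    -- edges; hence the factor 2.
    energy-bound : ∀ k (f : Vec ℕ k → ℤ) (q : Vec ℕ k → Fin k → ℤ) →
      (∀ x i → 0ℤ ≤ q x i) →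
      (∀ x i → (f (updateAt x i suc) - f x) * (f (updateAt x i suc) - f x) ≤ q x i + q (updateAt x i suc) i) →
      energy k f ≤ pos 2 * ∑ (X k) (λ x → sumFin (q x))
    energy-bound zero    f q q≥0 grad = ℤ.≤-refl
    energy-bound (suc k) f q q≥0 grad =
      ℤ.≤-trans
        (ℤ.+-mono-≤ (∑-mono (range M) (λ u → energy-bound k (λ v → f (u ∷ v)) (λ v i → q (u ∷ v) (suc i))
                       (λ v i → q≥0 (u ∷ v) (suc i)) (λ v i → grad (u ∷ v) (suc i))))
                    (∑-mono (range m) (λ u → ∑-mono (X k) (λ v → grad (u ∷ v) zero))))
        (ℤ.≤-trans (ℤ.≤-reflexive (sym left))
          (ℤ.≤-trans (certify (0≤+ (H≥0 m) (H≥0 0)) (eq H₁ H₂ (H m) (H 0) T)) (ℤ.≤-reflexive right)))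
      where
      H G : ℕ → ℤ
      H u = ∑ (X k) (λ v → q (u ∷ v) zero)
      G u = ∑ (X k) (λ v → sumFin (q (u ∷ v) ∘ suc))
      H₁ = ∑ (range m) H
      H₂ = ∑ (range m) (H ∘ suc)
      T = ∑ (range M) G
      H≥0 : ∀ u → 0ℤ ≤ H u
      H≥0 u = ∑-0≤ (X k) (λ v → q≥0 (u ∷ v) zero)
      eq : ∀ a b c d t → c + d ≡ pos 2 * t + (c + a + (d + b)) - (pos 2 * t + (a + b))
      eq = solve 5 (λ a b c d t → c :+ d := con (pos 2) :* t :+ (c :+ a :+ (d :+ b)) :- (con (pos 2) :* t :+ (a :+ b))) refl
      eq₂ : ∀ h t → pos 2 * t + (h + h) ≡ pos 2 * (h + t)
      eq₂ = solve-∀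
      right : pos 2 * T + (H m + H₁ + (H 0 + H₂)) ≡ pos 2 * ∑ (X (suc k)) (λ x → sumFin (q x))
      right = trans (cong (λ z → pos 2 * T + (H m + H₁ + z)) (∑-range-suc m H))
        (trans (eq₂ (H m + H₁) T)
          (cong (pos 2 *_) (sym (trans (∑-grid M (λ x → sumFin (q x)))
            (trans (∑-cong (range M) (λ u → ∑-+ (X k) (λ v → q (u ∷ v) zero) (λ v → sumFin (q (u ∷ v) ∘ suc))))
                   (∑-+ (range M) H G))))))
      left : pos 2 * T + (H₁ + H₂) ≡
             ∑ (range M) (λ u → pos 2 * G u)
             + ∑ (range m) (λ u → ∑ (X k) (λ v → q (u ∷ v) zero + q (suc u ∷ v) zero))
      left = sym (cong₂ _+_ (∑-* (range M) (pos 2) G)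
        (trans (∑-cong (range m) (λ u → ∑-+ (X k) (λ v → q (u ∷ v) zero) (λ v → q (suc u ∷ v) zero)))
               (∑-+ (range m) H (H ∘ suc))))

    -- To be applied to a squared distance `h`. In each coordinate its squared gradient is at most
    -- linear in the share `r x i` of that coordinate in `h`, so the Poincaré inequality bounds the
    -- variance of `h` by its mean. As `h` vanishes on a set of density at least `1 / a`, the
    -- variance is also at least the squared mean divided by `a`. Together this is a quadratic
    -- inequality for the mean. The resulting bound on the mean is free of the dimension, whereas
    -- the distance between two rotations of a point grows with it.
    mean-bound : ∀ k (h : Vec ℕ k → ℤ) (r : Vec ℕ k → Fin k → ℤ) (Z : Vec ℕ k → ℤ) (a : ℕ) →
      1 ℕ.≤ a → k ℕ.≤ M ℕ.* M →
      (∀ x → 0ℤ ≤ h x) → (∀ x i → 0ℤ ≤ r x i) → (∀ x → sumFin (r x) ≡ h x) →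
      (∀ x i → (h (updateAt x i suc) - h x) * (h (updateAt x i suc) - h x)
               ≤ (pos 32 * r x i + pos 32) + (pos 32 * r (updateAt x i suc) i + pos 32)) →
      (∀ x → (Z x ≡ 0ℤ) ⊎ ((Z x ≡ 1ℤ) × (h x ≡ 0ℤ))) →
      1ℤ ≤ N k → N k ≤ pos a * ∑ (X k) Z →
      ∑ (X k) h ≤ pos 64 * (pos a * (N k * (pos M * pos M)))
    mean-bound k h r Z a 1≤a k≤M² h≥0 r≥0 sum-r grad ind 1≤N dense with
      H ℤ.≤? pos 64 * T
      where
      H = ∑ (X k) h
      T = pos a * (N k * (pos M * pos M))
    ... | yes p = p
    ... | no ¬p = ⊥-elim (absurd (0≤+ (≤⇒0≤ quadratic) (0≤+ (0≤+ (0≤* d≥0 s≥0) (0≤+ (0≤* (0≤⁺ 2016) (0≤² T)) d≥0)) (0≤* (0≤⁺ 96) T≥0))) (eq₅ H T))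
      where
      H S² T n W : ℤ
      n = N k
      H = ∑ (X k) h
      S² = ∑ (X k) (λ x → h x * h x)
      T = pos a * (N k * (pos M * pos M))
      W = ∑ (X k) Z
      n≥0 : 0ℤ ≤ n
      n≥0 = 0≤⁺ (length (X k))
      H≥0 : 0ℤ ≤ H
      H≥0 = ∑-0≤ (X k) h≥0
      M²≥0 : 0ℤ ≤ pos M * pos M
      M²≥0 = 0≤* (0≤⁺ M) (0≤⁺ M)
      T≥0 : 0ℤ ≤ T
      T≥0 = 0≤* (0≤⁺ a) (0≤* n≥0 M²≥0)
      d≥0 : 0ℤ ≤ H - (1ℤ + pos 64 * T)
      d≥0 = ≤⇒0≤ (ℤ.i<j⇒suc[i]≤j (ℤ.≰⇒> ¬p))
      s≥0 : 0ℤ ≤ H + pos 32 * T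
      s≥0 = 0≤+ H≥0 (0≤* (0≤⁺ 32) T≥0)
      -- Chebyshev: a point where `Z` is 1 has `h = 0` and contributes `H * H` to the sum of the
      -- `(n * h x - H)²`.
      vanish : W * (H * H) ≤ n * (n * S² - H * H)
      vanish = subst₂′ (∑-mono (X k) pointwise)
        where
        pointwise : ∀ x → (H * H) * Z x ≤ (n * h x - H) * (n * h x - H)
        pointwise x = go (ind x)
          where
          eq₁ : ∀ n H → H * H * 1ℤ ≡ (n * 0ℤ - H) * (n * 0ℤ - H)
          eq₁ = solve-∀
          go : ∀ {z y} → (z ≡ 0ℤ) ⊎ ((z ≡ 1ℤ) × (y ≡ 0ℤ)) → (H * H) * z ≤ (n * y - H) * (n * y - H)
          go {y = y} (inj₁ refl)    = subst (_≤ (n * y - H) * (n * y - H)) (sym (ℤ.*-zeroʳ (H * H))) (0≤² (n * y - H))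
          go (inj₂ (refl , refl)) = ℤ.≤-reflexive (eq₁ n H)
        eq₂ : ∀ n S H → n * n * S - pos 2 * (H * (n * H)) + n * (H * H) ≡ n * (n * S - H * H)
        eq₂ = solve 3 (λ n S H → n :* n :* S :- con (pos 2) :* (H :* (n :* H)) :+ n :* (H :* H) := n :* (n :* S :- H :* H)) refl
        eq₃ : ∀ n y → n * y * (n * y) ≡ n * n * (y * y)
        eq₃ = solve-∀
        square : ∑ (X k) (λ x → (n * h x - H) * (n * h x - H)) ≡ n * (n * S² - H * H)
        square = trans (∑-shifted² (X k) (λ x → n * h x) H)
          (trans (cong₂ (λ u v → u - pos 2 * (H * v) + n * (H * H))
                   (trans (∑-cong (X k) (λ x → eq₃ n (h x))) (∑-* (X k) (n * n) (λ x → h x * h x)))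
                   (∑-* (X k) n h))
                 (eq₂ n S² H))
        subst₂′ : ∑ (X k) (λ x → (H * H) * Z x) ≤ ∑ (X k) (λ x → (n * h x - H) * (n * h x - H)) →
                  W * (H * H) ≤ n * (n * S² - H * H)
        subst₂′ p = subst (_≤ n * (n * S² - H * H)) (trans (∑-* (X k) (H * H) Z) (ℤ.*-comm (H * H) W))
                          (subst (∑ (X k) (λ x → (H * H) * Z x) ≤_) square p)
      gradient : energy k h ≤ pos 2 * (pos 32 * H + n * (pos k * pos 32))
      gradient = ℤ.≤-trans
        (energy-bound k h (λ x i → pos 32 * r x i + pos 32) (λ x i → 0≤+ (0≤* (0≤⁺ 32) (r≥0 x i)) (0≤⁺ 32)) grad)
        (ℤ.≤-reflexive (cong (pos 2 *_)
          (trans (∑-cong (X k) (λ x → trans (sumFin-affine (pos 32) (pos 32) (r x)) (cong (λ y → pos 32 * y + pos k * pos 32) (sum-r x))))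
          (trans (∑-+ (X k) (λ x → pos 32 * h x) (λ _ → pos k * pos 32))
                 (cong₂ _+_ (∑-* (X k) (pos 32) h) (∑-const (X k) (pos k * pos 32)))))))
      -- 2 W H² ≤ 64 n² M² (H + k n), and W ≥ n / a.
      quadratic : H * H ≤ pos 32 * (T * (H + T))
      quadratic = *-cancelˡ (pos 2 * n) (ℤ.≤-trans 1≤N (certify n≥0 (eq₆ n)))
        (ℤ.≤-trans (*-monoˡ₂ dense)
        (ℤ.≤-trans (*-monoˡ (pos a * pos 2) (0≤* (0≤⁺ a) (0≤⁺ 2)) vanish)
        (ℤ.≤-trans (ℤ.≤-reflexive (eq₇ (pos a) n (n * S² - H * H)))
        (ℤ.≤-trans (*-monoˡ (pos a * n) (0≤* (0≤⁺ a) n≥0) (poincaré k h))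
        (ℤ.≤-trans (*-monoˡ (pos a * n) (0≤* (0≤⁺ a) n≥0)
                     (*-monoˡ (pos M * pos M * n) (0≤* M²≥0 n≥0) gradient))
        (certify (0≤* (0≤* (0≤* (0≤⁺ 64) n≥0) T≥0) (0≤* n≥0 (0≤+ (0≤* (≤⇒0≤ (+≤+ 1≤a)) M²≥0) (≤⇒0≤ k≤))))
                 (eq₈ (pos a) n (pos M) H (pos k))))))))
        where
        k≤ : pos k ≤ pos M * pos M
        k≤ = ℤ.≤-trans (+≤+ k≤M²) (ℤ.≤-reflexive (ℤ.pos-* M M))
        eq₆ : ∀ n → n ≡ pos 2 * n - n
        eq₆ = solve-∀
        eq₇ : ∀ a n v → a * pos 2 * (n * v) ≡ a * n * (pos 2 * v)
        eq₇ = solve-∀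
        *-monoˡ₂ : n ≤ pos a * W → pos 2 * n * (H * H) ≤ pos a * pos 2 * (W * (H * H))
        *-monoˡ₂ p = certify (0≤* (0≤* (0≤⁺ 2) (≤⇒0≤ p)) (0≤² H)) (eq₉ (pos a) n W H)
          where
          eq₉ : ∀ a n W H → pos 2 * (a * W - n) * (H * H) ≡ a * pos 2 * (W * (H * H)) - pos 2 * n * (H * H)
          eq₉ = solve 4 (λ a n W H → con (pos 2) :* (a :* W :- n) :* (H :* H) := a :* con (pos 2) :* (W :* (H :* H)) :- con (pos 2) :* n :* (H :* H)) refl
        eq₈ : ∀ a n M H k →
          pos 64 * n * (a * (n * (M * M))) * (n * ((a - 1ℤ) * (M * M) + (M * M - k)))
          ≡ pos 2 * n * (pos 32 * (a * (n * (M * M)) * (H + a * (n * (M * M)))))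
            - a * n * (M * M * n * (pos 2 * (pos 32 * H + n * (k * pos 32))))
        eq₈ = solve 5 (λ a n M H k → con (pos 64) :* n :* (a :* (n :* (M :* M))) :* (n :* ((a :- con 1ℤ) :* (M :* M) :+ (M :* M :- k))) := con (pos 2) :* n :* (con (pos 32) :* (a :* (n :* (M :* M)) :* (H :+ a :* (n :* (M :* M))))) :- a :* n :* (M :* M :* n :* (con (pos 2) :* (con (pos 32) :* H :+ n :* (k :* con (pos 32)))))) refl
      eq₅ : ∀ H T → (pos 32 * (T * (H + T)) - H * H)
                    + ((H - (1ℤ + pos 64 * T)) * (H + pos 32 * T) + (pos 2016 * (T * T) + (H - (1ℤ + pos 64 * T))) + pos 96 * T)
                    ≡ - 1ℤ
      eq₅ = solve 2 (λ H T → (con (pos 32) :* (T :* (H :+ T)) :- H :* H) :+ ((H :- (con 1ℤ :+ con (pos 64) :* T)) :* (H :+ con (pos 32) :* T) :+ (con (pos 2016) :* (T :* T) :+ (H :- (con 1ℤ :+ con (pos 64) :* T))) :+ con (pos 96) :* T) := :- con 1ℤ) refl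

-- Integer powers of a rational rotation, and an almost exact quarter turn

module Rotation where

  open Prelude
  open Sums

  *-cancelˡ-≡ : ∀ {a b} c → 1ℤ ≤ c → c * a ≡ c * b → a ≡ b
  *-cancelˡ-≡ c p e = ℤ.≤-antisym (*-cancelˡ c p (ℤ.≤-reflexive e)) (*-cancelˡ c p (ℤ.≤-reflexive (sym e)))

  1≤⇒0≤ : ∀ {a} → 1ℤ ≤ a → 0ℤ ≤ a
  1≤⇒0≤ = ℤ.≤-trans (+≤+ ℕ.z≤n)

  ≤⊎> : ∀ a b → (a ≤ b) ⊎ (1ℤ + b ≤ a)
  ≤⊎> a b with a ℤ.≤? b
  ... | yes p = inj₁ p
  ... | no ¬p = inj₂ (ℤ.i<j⇒suc[i]≤j (ℤ.≰⇒> ¬p))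

  ²-cancel-≤ : ∀ {a b} → 0ℤ ≤ b → a * a ≤ b * b → a ≤ b
  ²-cancel-≤ {a} {b} b≥0 p with ≤⊎> a b
  ... | inj₁ q = q
  ... | inj₂ q = ⊥-elim (absurd (0≤+ (0≤+ (≤⇒0≤ p) (0≤* (≤⇒0≤ q) (0≤+ (0≤+ (≤⇒0≤ q) (0≤⁺ 1)) (0≤* (0≤⁺ 2) b≥0)))) (0≤+ (≤⇒0≤ q) (0≤* (0≤⁺ 2) b≥0)))
                   (eq a b))
    where
    eq : ∀ a b → b * b - a * a + (a - (1ℤ + b)) * (a - (1ℤ + b) + 1ℤ + pos 2 * b)
                 + (a - (1ℤ + b) + pos 2 * b) ≡ - 1ℤ
    eq = solve 2 (λ a b → b :* b :- a :* a :+ (a :- (con 1ℤ :+ b)) :* (a :- (con 1ℤ :+ b) :+ con 1ℤ :+ con (pos 2) :* b) :+ (a :- (con 1ℤ :+ b) :+ con (pos 2) :* b) := :- con 1ℤ) refl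

  norm-bound : ∀ a b {s} → 0ℤ ≤ s → a * a + b * b ≡ s * s → a ≤ s
  norm-bound a b {s} s≥0 e = ²-cancel-≤ s≥0 (certify (0≤² b) (trans (eq a b) (cong (_- a * a) e)))
    where
    eq : ∀ a b → b * b ≡ a * a + b * b - a * a
    eq = solve-∀

  -- `re t` and `im t` are the parts of the power `(x + iy)^t`, and `E t` is its modulus. Keeping
  -- the modulus separate replaces cosines and sines by integers.
  module Powers (x y e : ℤ) (norm : x * x + y * y ≡ e * e) where

    re im E : ℕ → ℤ
    re zero    = 1ℤ
    re (suc t) = re t * x - im t * y
    im zero    = 0ℤ
    im (suc t) = im t * x + re t * y
    E zero     = 1ℤ
    E (suc t)  = E t * e

    E-+ : ∀ t u → E (t ℕ.+ u) ≡ E t * E u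
    E-+ t zero    rewrite ℕ.+-identityʳ t = sym (ℤ.*-identityʳ (E t))
    E-+ t (suc u) rewrite ℕ.+-suc t u = trans (cong (_* e) (E-+ t u)) (ℤ.*-assoc (E t) (E u) e)

    re-im-+ : ∀ t u → (re (t ℕ.+ u) ≡ re t * re u - im t * im u) × (im (t ℕ.+ u) ≡ im t * re u + re t * im u)
    re-im-+ t zero    rewrite ℕ.+-identityʳ t = eq₁ (re t) (im t) , eq₂ (re t) (im t)
      where
      eq₁ : ∀ a b → a ≡ a * 1ℤ - b * 0ℤ
      eq₁ = solve-∀
      eq₂ : ∀ a b → b ≡ b * 1ℤ + a * 0ℤ
      eq₂ = solve-∀
    re-im-+ t (suc u) rewrite ℕ.+-suc t u | proj₁ (re-im-+ t u) | proj₂ (re-im-+ t u) =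
      eq₁ (re t) (im t) (re u) (im u) x y , eq₂ (re t) (im t) (re u) (im u) x y
      where
      eq₁ : ∀ a b c d x y → (a * c - b * d) * x - (b * c + a * d) * y ≡ a * (c * x - d * y) - b * (d * x + c * y)
      eq₁ = solve 6 (λ a b c d x y → (a :* c :- b :* d) :* x :- (b :* c :+ a :* d) :* y := a :* (c :* x :- d :* y) :- b :* (d :* x :+ c :* y)) refl
      eq₂ : ∀ a b c d x y → (b * c + a * d) * x + (a * c - b * d) * y ≡ b * (c * x - d * y) + a * (d * x + c * y)
      eq₂ = solve 6 (λ a b c d x y → (b :* c :+ a :* d) :* x :+ (a :* c :- b :* d) :* y := b :* (c :* x :- d :* y) :+ a :* (d :* x :+ c :* y)) refl

    norm-pow : ∀ t → re t * re t + im t * im t ≡ E t * E t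
    norm-pow zero    = refl
    norm-pow (suc t) = trans (eq (re t) (im t) x y)
      (trans (cong₂ _*_ (norm-pow t) norm) (eq′ (E t) e))
      where
      eq : ∀ a b x y → (a * x - b * y) * (a * x - b * y) + (b * x + a * y) * (b * x + a * y)
                       ≡ (a * a + b * b) * (x * x + y * y)
      eq = solve 4 (λ a b x y → (a :* x :- b :* y) :* (a :* x :- b :* y) :+ (b :* x :+ a :* y) :* (b :* x :+ a :* y) := (a :* a :+ b :* b) :* (x :* x :+ y :* y)) refl
      eq′ : ∀ a b → a * a * (b * b) ≡ a * b * (a * b)
      eq′ = solve-∀

    E≥1 : 1ℤ ≤ e → ∀ t → 1ℤ ≤ E t
    E≥1 p zero    = ℤ.≤-refl
    E≥1 p (suc t) = *-mono (0≤⁺ 1) (0≤⁺ 1) (E≥1 p t) p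

  module PowersPowers (x y e : ℤ) (norm : x * x + y * y ≡ e * e) (m : ℕ) where
    open Powers x y e norm
    module Z = Powers (re m) (im m) (E m) (norm-pow m)

    pow-pow : ∀ t → (Z.re t ≡ re (t ℕ.* m)) × (Z.im t ≡ im (t ℕ.* m)) × (Z.E t ≡ E (t ℕ.* m))
    pow-pow zero    = refl , refl , refl
    pow-pow (suc t) with pow-pow t
    ... | p , q , r rewrite ℕ.+-comm m (t ℕ.* m) | p | q | r =
      sym (proj₁ (re-im-+ (t ℕ.* m) m)) , sym (proj₂ (re-im-+ (t ℕ.* m) m)) , sym (E-+ (t ℕ.* m) m)

  module Quadrant (x y : ℤ) (e : ℕ) (norm : x * x + y * y ≡ pos e * pos e)
                  (x≥0 : 0ℤ ≤ x) (y≥1 : 1ℤ ≤ y) (1≤e : 1 ℕ.≤ e) where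
    open Powers x y (pos e) norm

    private
      y≥0 = 1≤⇒0≤ y≥1
      e≥1 : 1ℤ ≤ pos e
      e≥1 = +≤+ 1≤e
      e≥0 = 1≤⇒0≤ e≥1
      x≤e : x ≤ pos e
      x≤e = norm-bound x y e≥0 norm
      E≥0 : ∀ t → 0ℤ ≤ E t
      E≥0 t = 1≤⇒0≤ (E≥1 e≥1 t)

    Inside : ℕ → Set
    Inside T = ∀ t → t ℕ.≤ T → 1ℤ ≤ re t

    -- The last exponent before the powers first leave the open right half plane. Positive real
    -- parts are at least 1, being integers.
    Exit : Set
    Exit = ∃ λ q → (re (suc q) ≤ 0ℤ) × Inside q

    search : ∀ T → Inside T ⊎ Exit
    search zero = inj₁ inside₀
      where
      inside₀ : Inside zero
      inside₀ zero _ = ℤ.≤-refl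
    search (suc T) with search T
    ... | inj₂ ex = inj₂ ex
    ... | inj₁ ins with ≤⊎> (re (suc T)) 0ℤ
    ...   | inj₁ p = inj₂ (T , p , ins)
    ...   | inj₂ p = inj₁ inside₁
      where
      inside₁ : Inside (suc T)
      inside₁ t t≤ with ℕ.m≤n⇒m<n∨m≡n t≤
      ... | inj₁ (ℕ.s≤s q) = ins t q
      ... | inj₂ refl      = p

    im≥0 : ∀ T → Inside T → ∀ t → t ℕ.≤ suc T → 0ℤ ≤ im t
    im≥0 T ins zero    _ = ℤ.≤-refl
    im≥0 T ins (suc t) (ℕ.s≤s p) =
      0≤+ (0≤* (im≥0 T ins t (ℕ.m≤n⇒m≤1+n p)) x≥0) (0≤* (1≤⇒0≤ (ins t p)) y≥0)

    -- Rotating back shows that the imaginary part grows by at least the factor e.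
    im-grows : ∀ T → Inside T → ∀ t → suc t ℕ.≤ T → y * E t ≤ im (suc t)
    im-grows T ins zero    p = ℤ.≤-reflexive (eq x y)
      where
      eq : ∀ x y → y * 1ℤ ≡ 0ℤ * x + 1ℤ * y
      eq = solve-∀
    im-grows T ins (suc t) p = ℤ.≤-trans
      (certify (0≤* (≤⇒0≤ (im-grows T ins t (ℕ.<⇒≤ p))) e≥0) (eq₁ y (E t) (im (suc t)) (pos e)))
      (*-cancelˡ (pos e) e≥1
        (certify (0≤+ (0≤* (1≤⇒0≤ (ins (suc (suc t)) p)) y≥0) (0≤* i₂≥0 (≤⇒0≤ x≤e)))
          (trans (eq₂ (re (suc t)) (im (suc t)) x y (pos e))
            (cong (λ z → pos e * im (suc (suc t)) - im (suc t) * z) norm) ⟨trans⟩ eq₃ (pos e) (im (suc (suc t))) (im (suc t)))))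
      where
      infixl 1 _⟨trans⟩_
      _⟨trans⟩_ : ∀ {a b c : ℤ} → a ≡ b → b ≡ c → a ≡ c
      _⟨trans⟩_ = trans
      i₂≥0 = im≥0 T ins (suc (suc t)) (ℕ.m≤n⇒m≤1+n p)
      eq₁ : ∀ y E i e → (i - y * E) * e ≡ i * e - y * (E * e)
      eq₁ = solve-∀
      eq₂ : ∀ a b x y e → (a * x - b * y) * y + (b * x + a * y) * (e - x)
            ≡ e * (b * x + a * y) - b * (x * x + y * y)
      eq₂ = solve 5 (λ a b x y e → (a :* x :- b :* y) :* y :+ (b :* x :+ a :* y) :* (e :- x) := e :* (b :* x :+ a :* y) :- b :* (x :* x :+ y :* y)) refl
      eq₃ : ∀ e i j → e * i - j * (e * e) ≡ e * i - e * (j * e)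
      eq₃ = solve-∀

    -- By `im-grows` every angle reached after the start has sine at least `y / e`, so each further
    -- step lowers the cosine by at least `(y / e)²`.
    re-drops : ∀ T → Inside T → ∀ t → t ℕ.≤ T →
               pos e * re (suc t) ≤ pos e * E (suc t) - pos t * (y * y * E t)
    re-drops T ins zero    p = certify (0≤* e≥0 (≤⇒0≤ x≤e)) (eq x y (pos e))
      where
      eq : ∀ x y e → e * (e - x) ≡ e * (1ℤ * e) - 0ℤ * (y * y * 1ℤ) - e * (1ℤ * x - 0ℤ * y)
      eq = solve 3 (λ x y e → e :* (e :- x) := e :* (con 1ℤ :* e) :- con 0ℤ :* (y :* y :* con 1ℤ) :- e :* (con 1ℤ :* x :- con 0ℤ :* y)) refl
    re-drops T ins (suc t) p =
      certify (0≤+ (0≤* (≤⇒0≤ (re-drops T ins t (ℕ.<⇒≤ p))) e≥0)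
                (0≤+ (0≤* e≥0 (0≤* (1≤⇒0≤ (ins (suc t) p)) (≤⇒0≤ x≤e)))
                     (0≤* e≥0 (0≤* y≥0 (≤⇒0≤ (im-grows T ins t p))))))
        (eq x y (pos e) (re (suc t)) (im (suc t)) (E t) (pos t))
      where
      eq : ∀ x y e a b E t →
        (e * (E * e) - t * (y * y * E) - e * a) * e + (e * (a * (e - x)) + e * (y * (b - y * E)))
        ≡ e * (E * e * e) - (1ℤ + t) * (y * y * (E * e)) - e * (a * x - b * y)
      eq = solve 7 (λ x y e a b E t → (e :* (E :* e) :- t :* (y :* y :* E) :- e :* a) :* e :+ (e :* (a :* (e :- x)) :+ e :* (y :* (b :- y :* E))) := e :* (E :* e :* e) :- (con 1ℤ :+ t) :* (y :* y :* (E :* e)) :- e :* (a :* x :- b :* y)) refl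

    exit : Exit
    -- A drop of `(y / e)²` per step exhausts the cosine within `e * e` steps, because `y` is at
    -- least 1.
    exit with search (suc (e ℕ.* e))
    ... | inj₂ ex  = ex
    ... | inj₁ ins = ⊥-elim (absurd
        (0≤+ (≤⇒0≤ (subst (λ w → pos e * re (suc T) ≤ pos e * E (suc T) - w * (y * y * E T)) (ℤ.pos-* e e)
                   (re-drops (suc T) ins T (ℕ.n≤1+n T))))
          (0≤+ (0≤* (0≤* (0≤* e≥0 e≥0) (0≤+ (0≤* (≤⇒0≤ y≥1) (≤⇒0≤ y≥1)) (0≤* (0≤⁺ 2) (≤⇒0≤ y≥1)))) (E≥0 T))
            (0≤+ (0≤* e≥0 (≤⇒0≤ (ins (suc (e ℕ.* e)) ℕ.≤-refl))) (≤⇒0≤ e≥1))))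
        (eq y (pos e) (re (suc T)) (E T)))
      where
      T = e ℕ.* e
      eq : ∀ y e a E →
        (e * (E * e) - e * e * (y * y * E) - e * a)
        + (e * e * ((y - 1ℤ) * (y - 1ℤ) + pos 2 * (y - 1ℤ)) * E + (e * (a - 1ℤ) + (e - 1ℤ)))
        ≡ - 1ℤ
      eq = solve 4 (λ y e a E → (e :* (E :* e) :- e :* e :* (y :* y :* E) :- e :* a) :+ (e :* e :* ((y :- con 1ℤ) :* (y :- con 1ℤ) :+ con (pos 2) :* (y :- con 1ℤ)) :* E :+ (e :* (a :- con 1ℤ) :+ (e :- con 1ℤ))) := :- con 1ℤ) refl

    im≤E : ∀ t → im t ≤ E t
    im≤E t = norm-bound (im t) (re t) (E≥0 t) (trans (ℤ.+-comm (im t * im t) (re t * re t)) (norm-pow t))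

    re≤E : ∀ t → re t ≤ E t
    re≤E t = norm-bound (re t) (im t) (E≥0 t) (norm-pow t)

    -- The reverse estimate: one step lowers the cosine by at most `(e - x + y) / e`. It bounds how
    -- far from a right angle the powers are shortly before the exit.
    re-slow : ∀ t r → pos e * re t * E r - pos r * ((pos e - x + y) * E (t ℕ.+ r)) ≤ pos e * re (t ℕ.+ r)
    re-slow t zero rewrite ℕ.+-identityʳ t = ℤ.≤-reflexive (eq (pos e) (re t) ((pos e - x + y) * E t))
      where
      eq : ∀ e a z → e * a * 1ℤ - 0ℤ * z ≡ e * a
      eq = solve-∀
    re-slow t (suc r) rewrite ℕ.+-suc t r =
      certify (0≤+ (0≤* (≤⇒0≤ (re-slow t r)) e≥0)
                (0≤+ (0≤* e≥0 (0≤* (≤⇒0≤ x≤e) (≤⇒0≤ (re≤E (t ℕ.+ r)))))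
                     (0≤* e≥0 (0≤* y≥0 (≤⇒0≤ (im≤E (t ℕ.+ r)))))))
        (eq x y (pos e) (re t) (re (t ℕ.+ r)) (im (t ℕ.+ r)) (E r) (E (t ℕ.+ r)) (pos r))
      where
      eq : ∀ x y e a₀ a b E₀ E r →
        (e * a - (e * a₀ * E₀ - r * ((e - x + y) * E))) * e + (e * ((e - x) * (E - a)) + e * (y * (E - b)))
        ≡ e * (a * x - b * y) - (e * a₀ * (E₀ * e) - (1ℤ + r) * ((e - x + y) * (E * e)))
      eq = solve 9 (λ x y e a₀ a b E₀ E r → (e :* a :- (e :* a₀ :* E₀ :- r :* ((e :- x :+ y) :* E))) :* e :+ (e :* ((e :- x) :* (E :- a)) :+ e :* (y :* (E :- b))) := e :* (a :* x :- b :* y) :- (e :* a₀ :* (E₀ :* e) :- (con 1ℤ :+ r) :* ((e :- x :+ y) :* (E :* e)))) refl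

  -- `c t / s` and `d t / s` are the cosine and sine of `t / P` times an angle that is at most a
  -- right angle. The addition laws are exact, but only within the quarter turn. By `c-P` the cosine
  -- of the whole angle is at most `1 / Λ`, so the angle is nearly right.
  record QuarterTurn (P Λ : ℕ) : Set where
    field
      c d   : ℕ → ℤ
      s     : ℤ
      s≥1   : 1ℤ ≤ s
      c-0   : c 0 ≡ s
      d-0   : d 0 ≡ 0ℤ
      c-+   : ∀ t u → t ℕ.+ u ℕ.≤ P → s * c (t ℕ.+ u) ≡ c t * c u - d t * d u
      d-+   : ∀ t u → t ℕ.+ u ℕ.≤ P → s * d (t ℕ.+ u) ≡ d t * c u + c t * d u
      c²+d² : ∀ t → t ℕ.≤ P → c t * c t + d t * d t ≡ s * s
      c≥0   : ∀ t → t ℕ.≤ P → 0ℤ ≤ c t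
      d≥0   : ∀ t → t ℕ.≤ P → 0ℤ ≤ d t
      c-P   : pos Λ * c P ≤ s

  -- A power of the rational rotation by ((B²-1) + 2Bi) / (B²+1) with B large.
  quarterTurn : ∀ P Λ → 1 ℕ.≤ P → 1 ℕ.≤ Λ → QuarterTurn P Λ
  quarterTurn P@(suc _) Λ 1≤P 1≤Λ = record
    { c = c ; d = d ; s = Z.E P ; s≥1 = Z≥1 P
    ; c-0 = ℤ.*-identityˡ (Z.E P) ; d-0 = ℤ.*-zeroˡ (Z.E P)
    ; c-+ = c-+ ; d-+ = d-+ ; c²+d² = c²+d²
    ; c≥0 = λ t p → 0≤* (1≤⇒0≤ (Z-re≥1 t p)) (1≤⇒0≤ (Z≥1 (P ℕ.∸ t)))
    ; d≥0 = λ t p → 0≤* (Z-im≥0 t p) (1≤⇒0≤ (Z≥1 (P ℕ.∸ t)))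
    ; c-P = c-P }
    where
    A B e : ℕ
    A = Λ ℕ.* P
    B = 4 ℕ.* A
    e = suc (B ℕ.* B)
    a b x y : ℤ
    a = pos A
    b = pos 4 * a
    x = b * b - 1ℤ
    y = pos 2 * b
    a≥1 : 1ℤ ≤ a
    a≥1 = +≤+ (ℕ.*-mono-≤ 1≤Λ 1≤P)
    a≥0 = 1≤⇒0≤ a≥1
    pos-e : pos e ≡ 1ℤ + b * b
    pos-e = cong (1ℤ +_) (trans (ℤ.pos-* B B) (cong₂ _*_ (ℤ.pos-* 4 A) (ℤ.pos-* 4 A)))
    norm : x * x + y * y ≡ pos e * pos e
    norm = trans (eq b) (sym (cong₂ _*_ pos-e pos-e))
      where
      eq : ∀ b → (b * b - 1ℤ) * (b * b - 1ℤ) + pos 2 * b * (pos 2 * b) ≡ (1ℤ + b * b) * (1ℤ + b * b)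
      eq = solve 1 (λ b → (b :* b :- con 1ℤ) :* (b :* b :- con 1ℤ) :+ con (pos 2) :* b :* (con (pos 2) :* b) := (con 1ℤ :+ b :* b) :* (con 1ℤ :+ b :* b)) refl
    x≥0 : 0ℤ ≤ x
    x≥0 = subst (0ℤ ≤_) (eq a) (0≤+ (0≤+ (0≤* (0≤⁺ 16) (0≤² (a - 1ℤ))) (0≤* (0≤⁺ 32) (≤⇒0≤ a≥1))) (0≤⁺ 15))
      where
      eq : ∀ a → pos 16 * ((a - 1ℤ) * (a - 1ℤ)) + pos 32 * (a - 1ℤ) + pos 15 ≡ pos 4 * a * (pos 4 * a) - 1ℤ
      eq = solve 1 (λ a → con (pos 16) :* ((a :- con 1ℤ) :* (a :- con 1ℤ)) :+ con (pos 32) :* (a :- con 1ℤ) :+ con (pos 15) := con (pos 4) :* a :* (con (pos 4) :* a) :- con 1ℤ) refl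
    y≥1 : 1ℤ ≤ y
    y≥1 = certify (0≤+ (0≤* (0≤⁺ 8) (≤⇒0≤ a≥1)) (0≤⁺ 7)) (eq a)
      where
      eq : ∀ a → pos 8 * (a - 1ℤ) + pos 7 ≡ pos 2 * (pos 4 * a) - 1ℤ
      eq = solve 1 (λ a → con (pos 8) :* (a :- con 1ℤ) :+ con (pos 7) := con (pos 2) :* (con (pos 4) :* a) :- con 1ℤ) refl
    open Powers x y (pos e) norm
    open Quadrant x y e norm x≥0 y≥1 (ℕ.s≤s ℕ.z≤n)
    -- Of the `T` small steps made before the exit, `P` blocks of `m` steps are used; the `r < P`
    -- remaining ones are the defect of the quarter turn.
    T m r : ℕ
    T = proj₁ exit
    m = T ℕ./ P
    r = T ℕ.% P
    T≡ : T ≡ r ℕ.+ m ℕ.* P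
    T≡ = ℕ.m≡m%n+[m/n]*n T P
    open PowersPowers x y (pos e) norm m
    inside : ∀ t → t ℕ.≤ P → t ℕ.* m ℕ.≤ T
    inside t p = ℕ.≤-trans (ℕ.*-monoˡ-≤ m p) (ℕ.≤-trans (ℕ.≤-reflexive (ℕ.*-comm P m))
                   (subst (m ℕ.* P ℕ.≤_) (sym T≡) (ℕ.m≤n+m (m ℕ.* P) r)))
    Z-re≥1 : ∀ t → t ℕ.≤ P → 1ℤ ≤ Z.re t
    Z-re≥1 t p = subst (1ℤ ≤_) (sym (proj₁ (pow-pow t))) (proj₂ (proj₂ exit) (t ℕ.* m) (inside t p))
    Z-im≥0 : ∀ t → t ℕ.≤ P → 0ℤ ≤ Z.im t
    Z-im≥0 t p = subst (0ℤ ≤_) (sym (proj₁ (proj₂ (pow-pow t))))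
                   (im≥0 T (proj₂ (proj₂ exit)) (t ℕ.* m) (ℕ.m≤n⇒m≤1+n (inside t p)))
    e≥1 : 1ℤ ≤ pos e
    e≥1 = +≤+ (ℕ.s≤s ℕ.z≤n)
    Z≥1 : ∀ t → 1ℤ ≤ Z.E t
    Z≥1 = Z.E≥1 (E≥1 e≥1 m)
    c d : ℕ → ℤ
    -- Padding with a power of the modulus gives all values the common denominator `Z.E P`.
    c t = Z.re t * Z.E (P ℕ.∸ t)
    d t = Z.im t * Z.E (P ℕ.∸ t)
    complement : ∀ t → t ℕ.≤ P → Z.E P ≡ Z.E t * Z.E (P ℕ.∸ t)
    complement t p = trans (cong Z.E (sym (ℕ.m+[n∸m]≡n p))) (Z.E-+ t (P ℕ.∸ t))
    split : ∀ t u → t ℕ.+ u ℕ.≤ P → Z.E P * Z.E (P ℕ.∸ (t ℕ.+ u)) ≡ Z.E (P ℕ.∸ t) * Z.E (P ℕ.∸ u)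
    split t u p = *-cancelˡ-≡ (Z.E t * Z.E u) (*-mono (0≤⁺ 1) (0≤⁺ 1) (Z≥1 t) (Z≥1 u))
      (trans (eq₁ (Z.E t) (Z.E u) (Z.E P) (Z.E (P ℕ.∸ (t ℕ.+ u))))
        (trans (cong (Z.E P *_) (trans (cong (_* Z.E (P ℕ.∸ (t ℕ.+ u))) (sym (Z.E-+ t u))) (sym (complement (t ℕ.+ u) p))))
          (trans (cong₂ _*_ (complement t (ℕ.≤-trans (ℕ.m≤m+n t u) p)) (complement u (ℕ.≤-trans (ℕ.m≤n+m u t) p)))
            (eq₂ (Z.E t) (Z.E u) (Z.E (P ℕ.∸ t)) (Z.E (P ℕ.∸ u))))))
      where
      eq₁ : ∀ a b c d → a * b * (c * d) ≡ c * (a * b * d)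
      eq₁ = solve-∀
      eq₂ : ∀ a b c d → a * c * (b * d) ≡ a * b * (c * d)
      eq₂ = solve-∀
    c-+ : ∀ t u → t ℕ.+ u ℕ.≤ P → Z.E P * c (t ℕ.+ u) ≡ c t * c u - d t * d u
    c-+ t u p = trans (eq₁ (Z.E P) (Z.re (t ℕ.+ u)) (Z.E (P ℕ.∸ (t ℕ.+ u))))
      (trans (cong₂ _*_ (proj₁ (Z.re-im-+ t u)) (split t u p))
        (eq₂ (Z.re t) (Z.re u) (Z.im t) (Z.im u) (Z.E (P ℕ.∸ t)) (Z.E (P ℕ.∸ u))))
      where
      eq₁ : ∀ a b c → a * (b * c) ≡ b * (a * c)
      eq₁ = solve-∀
      eq₂ : ∀ a b c d e f → (a * b - c * d) * (e * f) ≡ a * e * (b * f) - c * e * (d * f)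
      eq₂ = solve 6 (λ a b c d e f → (a :* b :- c :* d) :* (e :* f) := a :* e :* (b :* f) :- c :* e :* (d :* f)) refl
    d-+ : ∀ t u → t ℕ.+ u ℕ.≤ P → Z.E P * d (t ℕ.+ u) ≡ d t * c u + c t * d u
    d-+ t u p = trans (eq₁ (Z.E P) (Z.im (t ℕ.+ u)) (Z.E (P ℕ.∸ (t ℕ.+ u))))
      (trans (cong₂ _*_ (proj₂ (Z.re-im-+ t u)) (split t u p))
        (eq₂ (Z.re t) (Z.re u) (Z.im t) (Z.im u) (Z.E (P ℕ.∸ t)) (Z.E (P ℕ.∸ u))))
      where
      eq₁ : ∀ a b c → a * (b * c) ≡ b * (a * c)
      eq₁ = solve-∀
      eq₂ : ∀ a b c d e f → (c * b + a * d) * (e * f) ≡ c * e * (b * f) + a * e * (d * f)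
      eq₂ = solve 6 (λ a b c d e f → (c :* b :+ a :* d) :* (e :* f) := c :* e :* (b :* f) :+ a :* e :* (d :* f)) refl
    c²+d² : ∀ t → t ℕ.≤ P → c t * c t + d t * d t ≡ Z.E P * Z.E P
    c²+d² t p = trans (eq₁ (Z.re t) (Z.im t) (Z.E (P ℕ.∸ t)))
      (trans (cong (_* (Z.E (P ℕ.∸ t) * Z.E (P ℕ.∸ t))) (Z.norm-pow t))
        (trans (eq₂ (Z.E t) (Z.E (P ℕ.∸ t))) (sym (cong₂ _*_ (complement t p) (complement t p)))))
      where
      eq₁ : ∀ a b e → a * e * (a * e) + b * e * (b * e) ≡ (a * a + b * b) * (e * e)
      eq₁ = solve 3 (λ a b e → a :* e :* (a :* e) :+ b :* e :* (b :* e) := (a :* a :+ b :* b) :* (e :* e)) refl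
      eq₂ : ∀ a b → a * a * (b * b) ≡ a * b * (a * b)
      eq₂ = solve-∀
    c-P : pos Λ * c P ≤ Z.E P
    c-P = subst₂ (λ u v → pos Λ * u ≤ v) (sym c-P≡) (sym (proj₂ (proj₂ (pow-pow P))))
      (*-cancelˡ (pos P * w) (*-mono (0≤⁺ 1) (0≤⁺ 1) (+≤+ 1≤P) w≥1)
        (ℤ.≤-trans (ℤ.≤-reflexive (trans (eq₁ (pos Λ) (pos P) w ρ) (cong (λ z → z * w * ρ) (sym (ℤ.pos-* Λ P)))))
          (ℤ.≤-trans (certify (0≤* e-large ρ≥0) (eq₂ a w (pos e) ρ)) slow)))
      where
      q = P ℕ.* m
      ρ = re q
      w = pos e - x + y
      c-P≡ : c P ≡ ρ
      c-P≡ = trans (cong (λ z → Z.re P * Z.E z) (ℕ.n∸n≡0 P)) (trans (ℤ.*-identityʳ (Z.re P)) (proj₁ (pow-pow P)))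
      w≡ : w ≡ pos 2 + pos 8 * a
      w≡ = trans (cong (λ z → z - x + y) pos-e) (eq a)
        where
        eq : ∀ a → 1ℤ + pos 4 * a * (pos 4 * a) - (pos 4 * a * (pos 4 * a) - 1ℤ) + pos 2 * (pos 4 * a) ≡ pos 2 + pos 8 * a
        eq = solve 1 (λ a → con 1ℤ :+ con (pos 4) :* a :* (con (pos 4) :* a) :- (con (pos 4) :* a :* (con (pos 4) :* a) :- con 1ℤ) :+ con (pos 2) :* (con (pos 4) :* a) := con (pos 2) :+ con (pos 8) :* a) refl
      w≥1 : 1ℤ ≤ w
      w≥1 = subst (1ℤ ≤_) (sym w≡) (certify (0≤+ (0≤⁺ 1) (0≤* (0≤⁺ 8) a≥0)) (eq a))
        where
        eq : ∀ a → 1ℤ + pos 8 * a ≡ pos 2 + pos 8 * a - 1ℤ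
        eq = solve-∀
      ρ≥0 : 0ℤ ≤ ρ
      ρ≥0 = 1≤⇒0≤ (proj₂ (proj₂ exit) q (inside P ℕ.≤-refl))
      e-large : 0ℤ ≤ pos e - a * w
      e-large = subst₂ (λ u v → 0ℤ ≤ u - a * v) (sym pos-e) (sym w≡)
        (subst (0ℤ ≤_) (eq a) (0≤+ (0≤+ (0≤* (0≤⁺ 8) (0≤* a≥0 (≤⇒0≤ a≥1))) (0≤* (0≤⁺ 6) a≥0)) (0≤⁺ 1)))
        where
        eq : ∀ a → pos 8 * (a * (a - 1ℤ)) + pos 6 * a + 1ℤ ≡ 1ℤ + pos 4 * a * (pos 4 * a) - a * (pos 2 + pos 8 * a)
        eq = solve 1 (λ a → con (pos 8) :* (a :* (a :- con 1ℤ)) :+ con (pos 6) :* a :+ con 1ℤ := con 1ℤ :+ con (pos 4) :* a :* (con (pos 4) :* a) :- a :* (con (pos 2) :+ con (pos 8) :* a)) refl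
      eq₁ : ∀ l p w ρ → p * w * (l * ρ) ≡ l * p * w * ρ
      eq₁ = solve-∀
      eq₂ : ∀ a w e ρ → (e - a * w) * ρ ≡ e * ρ - a * w * ρ
      eq₂ = solve-∀
      -- The exit comes at most `P` small steps after `q`, so the cosine at `q` is at most
      -- `P * w / e`. The choice `B = 4 * (Λ * P)` makes this at most `1 / Λ`.
      slow : pos e * ρ ≤ pos P * w * E q
      slow = *-cancelˡ (E (suc r)) (E≥1 e≥1 (suc r))
        (certify (0≤+ (0≤+ (≤⇒0≤ (re-slow q (suc r))) (0≤* (0≤⁺ e) (≤⇒0≤ re-exit)))
                   (0≤* (0≤* (≤⇒0≤ r<P) (1≤⇒0≤ w≥1)) (1≤⇒0≤ (E≥1 e≥1 (q ℕ.+ suc r)))))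
          (trans (eq₃ (pos e) (re (q ℕ.+ suc r)) ρ (E (suc r)) (pos (suc r)) (pos P) w (E (q ℕ.+ suc r)))
            (cong (λ z → z - E (suc r) * (pos e * ρ)) (trans (cong (pos P * w *_) (E-+ q (suc r))) (eq₄ (pos P * w) (E q) (E (suc r)))))))
        where
        q+r : q ℕ.+ suc r ≡ suc T
        q+r = trans (ℕ.+-suc q r) (cong suc (trans (cong (ℕ._+ r) (ℕ.*-comm P m)) (trans (ℕ.+-comm (m ℕ.* P) r) (sym T≡))))
        re-exit : re (q ℕ.+ suc r) ≤ 0ℤ
        re-exit = subst (λ z → re z ≤ 0ℤ) (sym q+r) (proj₁ (proj₂ exit))
        r<P : pos (suc r) ≤ pos P
        r<P = +≤+ (ℕ.m%n<n T P)
        eq₃ : ∀ e a ρ E r p w F → (e * a - (e * ρ * E - r * (w * F))) + e * (0ℤ - a) + (p - r) * w * F ≡ p * w * F - E * (e * ρ)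
        eq₃ = solve 8 (λ e a ρ E r p w F → (e :* a :- (e :* ρ :* E :- r :* (w :* F))) :+ e :* (con 0ℤ :- a) :+ (p :- r) :* w :* F := p :* w :* F :- E :* (e :* ρ)) refl
        eq₄ : ∀ p E F → p * (E * F) ≡ F * (p * E)
        eq₄ = solve-∀

-- An integer sine wave with an exact antiperiod

module SineWave where

  open Prelude
  open Sums
  open Rotation
  open import Data.Integer using (_⊓_)

  -- An integer-valued approximation to s sin(π t / 2P).
  record Sine (P κ Λ : ℕ) : Set where
    field
      S     : ℕ → ℤ
      s μ   : ℤ
      S-anti : ∀ t → S (t ℕ.+ (P ℕ.+ P)) ≡ - S t
      S-0   : S 0 ≡ 0ℤ
      S≤s   : ∀ t → S t ≤ s
      -s≤S  : ∀ t → - s ≤ S t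
      S-pos : ∀ t → 1 ℕ.≤ t → t ℕ.< P ℕ.+ P → μ ≤ S t
      μ≥1   : 1ℤ ≤ μ
      -- In `sine` this ratio of the largest to the smallest positive value is `4 * P`, so `Λ` can
      -- be chosen after it.
      s≤κμ  : s ≤ pos κ * μ
      -- For an exact sine the bracket vanishes. Later modules know the addition law only through
      -- this relation between three samples.
      three : ∀ a i j → pos Λ * (S j * S a - S (i ℕ.+ j) * S (a ℕ.+ i) + S i * S (a ℕ.+ (i ℕ.+ j))) ≤ s * s
      three⁻ : ∀ a i j → - (s * s) ≤ pos Λ * (S j * S a - S (i ℕ.+ j) * S (a ℕ.+ i) + S i * S (a ℕ.+ (i ℕ.+ j)))

  product-≤ : ∀ x y δ s → x ≤ δ → - δ ≤ x → y ≤ s → - s ≤ y → x * y ≤ δ * s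
  product-≤ x y δ s p p′ q q′ = *-cancelˡ (pos 2) (+≤+ (ℕ.s≤s ℕ.z≤n))
    (certify (0≤+ (0≤* (≤⇒0≤ p) (≤⇒0≤ q′)) (0≤* (≤⇒0≤ p′) (≤⇒0≤ q))) (eq x y δ s))
    where
    eq : ∀ x y δ s → (δ - x) * (y - - s) + (x - - δ) * (s - y) ≡ pos 2 * (δ * s) - pos 2 * (x * y)
    eq = solve 4 (λ x y δ s → (δ :- x) :* (y :- :- s) :+ (x :- :- δ) :* (s :- y) := con (pos 2) :* (δ :* s) :- con (pos 2) :* (x :* y)) refl

  -product-≤ : ∀ x y δ s → x ≤ δ → - δ ≤ x → y ≤ s → - s ≤ y → - (δ * s) ≤ x * y
  -product-≤ x y δ s p p′ q q′ = certify (≤⇒0≤ (product-≤ x (- y) δ s p p′ (ℤ.≤-trans (ℤ.neg-mono-≤ q′) (ℤ.≤-reflexive (ℤ.neg-involutive s))) (ℤ.neg-mono-≤ q)))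
    (eq x y δ s)
    where
    eq : ∀ x y δ s → δ * s - x * - y ≡ x * y - - (δ * s)
    eq = solve-∀

  module QuarterTurn⇒Sine (P Λ L : ℕ) .{{_ : ℕ.NonZero P}} (2≤P : 2 ℕ.≤ P) (1≤Λ : 1 ℕ.≤ Λ)
                          (L≡ : pos L ≡ pos 6 * pos Λ) (Q : QuarterTurn P L) where

    open QuarterTurn Q

    1≤P : 1 ℕ.≤ P
    1≤P = ℕ.<⇒≤ 2≤P
    P′ : ℕ
    P′ = ℕ.pred P
    P≡ : suc P′ ≡ P
    P≡ = ℕ.suc-pred P
    s≥0 = 1≤⇒0≤ s≥1

    -- Beyond the first quadrant the rules `S (t + P) = C t` and `C (t + P) = - S t` are imposed by
    -- definition. Antiperiodicity is then exact, and the defect of the quarter turn shows up only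
    -- in the addition law, where a sum of angles passes from one quadrant to the next.
    cosq sinq : ℕ → ℕ → ℤ
    cosq zero    r = c r
    cosq (suc q) r = - sinq q r
    sinq zero    r = d r
    sinq (suc q) r = cosq q r

    C S : ℕ → ℤ
    C t = cosq (t ℕ./ P) (t ℕ.% P)
    S t = sinq (t ℕ./ P) (t ℕ.% P)

    /-suc : ∀ t → (t ℕ.+ P) ℕ./ P ≡ suc (t ℕ./ P)
    /-suc t = trans (ℕ.m/n≡1+[m∸n]/n (ℕ.m≤n+m P t)) (cong (λ z → suc (z ℕ./ P)) (ℕ.m+n∸n≡m t P))

    S-P : ∀ t → S (t ℕ.+ P) ≡ C t
    S-P t = cong₂ sinq (/-suc t) (ℕ.[m+n]%n≡m%n t P)
    C-P : ∀ t → C (t ℕ.+ P) ≡ - S t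
    C-P t = cong₂ cosq (/-suc t) (ℕ.[m+n]%n≡m%n t P)
    S-small : ∀ {t} → t ℕ.< P → S t ≡ d t
    S-small p = cong₂ sinq (ℕ.m<n⇒m/n≡0 p) (ℕ.m<n⇒m%n≡m p)
    C-small : ∀ {t} → t ℕ.< P → C t ≡ c t
    C-small p = cong₂ cosq (ℕ.m<n⇒m/n≡0 p) (ℕ.m<n⇒m%n≡m p)

    norm : ∀ t → C t * C t + S t * S t ≡ s * s
    norm t = go (t ℕ./ P)
      where
      r = t ℕ.% P
      eq : ∀ a b → - b * - b + a * a ≡ a * a + b * b
      eq = solve-∀
      go : ∀ q → cosq q r * cosq q r + sinq q r * sinq q r ≡ s * s
      go zero    = c²+d² r (ℕ.<⇒≤ (ℕ.m%n<n t P))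
      go (suc q) = trans (eq (cosq q r) (sinq q r)) (go q)

    S≥-s : ∀ t → - s ≤ S t
    S≥-s t = ℤ.≤-trans (ℤ.neg-mono-≤ (norm-bound (- S t) (C t) s≥0 (trans (eq (S t) (C t)) (norm t))))
                       (ℤ.≤-reflexive (ℤ.neg-involutive (S t)))
      where
      eq : ∀ a b → - a * - a + b * b ≡ b * b + a * a
      eq = solve-∀

    d≤s : ∀ t → t ℕ.≤ P → d t ≤ s
    d≤s t p = norm-bound (d t) (c t) s≥0 (trans (ℤ.+-comm (d t * d t) (c t * c t)) (c²+d² t p))
    c≤s : ∀ t → t ℕ.≤ P → c t ≤ s
    c≤s t p = norm-bound (c t) (d t) s≥0 (c²+d² t p)

    cP dP : ℤ
    cP = c P
    dP = d P
    cP≥0 = c≥0 P ℕ.≤-refl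
    s-dP≤cP : s - dP ≤ cP
    s-dP≤cP = *-cancelˡ s s≥1 (certify
      (0≤+ (0≤* (≤⇒0≤ (d≤s P ℕ.≤-refl)) (d≥0 P ℕ.≤-refl)) (0≤* cP≥0 (≤⇒0≤ (c≤s P ℕ.≤-refl))))
      (trans (eq₁ cP dP s (cP * cP + dP * dP) (c²+d² P ℕ.≤-refl)) (eq₂ cP dP s)))
      where
      eq₁ : ∀ a b s n → n ≡ s * s → (s - b) * b + a * (s - a) ≡ (s - b) * b + a * (s - a) + (n - s * s)
      eq₁ a b s n refl = eq (s - b) b (a * (s - a)) (s * s)
        where
        eq : ∀ x b y z → x * b + y ≡ x * b + y + (z - z)
        eq = solve-∀
      eq₂ : ∀ a b s → (s - b) * b + a * (s - a) + (a * a + b * b - s * s) ≡ s * a - s * (s - b)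
      eq₂ = solve 3 (λ a b s → (s :- b) :* b :+ a :* (s :- a) :+ (a :* a :+ b :* b :- s :* s) := s :* a :- s :* (s :- b)) refl

    -- angle subtraction, exact within the first quadrant
    d-difference : ∀ b j → b ℕ.+ j ℕ.≤ P → s * d j ≡ d (b ℕ.+ j) * c b - c (b ℕ.+ j) * d b
    d-difference b j p = *-cancelˡ-≡ s s≥1
      (trans (trans (trans (eq₁ s (d j)) (cong (_* d j) (sym (c²+d² b (ℕ.≤-trans (ℕ.m≤m+n b j) p)))))
                    (eq₂ (c b) (d b) (c j) (d j)))
             (trans (cong₂ (λ u v → u * c b - v * d b) (sym (d-+ b j p)) (sym (c-+ b j p)))
                    (eq₃ s (d (b ℕ.+ j)) (c (b ℕ.+ j)) (c b) (d b))))
      where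
      eq₁ : ∀ s x → s * (s * x) ≡ s * s * x
      eq₁ = solve-∀
      eq₂ : ∀ c d c′ d′ → (c * c + d * d) * d′ ≡ (d * c′ + c * d′) * c - (c * c′ - d * d′) * d
      eq₂ = solve 4 (λ c d c′ d′ → (c :* c :+ d :* d) :* d′ := (d :* c′ :+ c :* d′) :* c :- (c :* c′ :- d :* d′) :* d) refl
      eq₃ : ∀ s x y c d → s * x * c - s * y * d ≡ s * (x * c - y * d)
      eq₃ = solve 5 (λ s x y c d → s :* x :* c :- s :* y :* d := s :* (x :* c :- y :* d)) refl
    c-difference : ∀ b j → b ℕ.+ j ℕ.≤ P → s * c j ≡ c (b ℕ.+ j) * c b + d (b ℕ.+ j) * d b
    c-difference b j p = *-cancelˡ-≡ s s≥1
      (trans (trans (trans (eq₁ s (c j)) (cong (_* c j) (sym (c²+d² b (ℕ.≤-trans (ℕ.m≤m+n b j) p)))))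
                    (eq₂ (c b) (d b) (c j) (d j)))
             (trans (cong₂ (λ u v → v * c b + u * d b) (sym (d-+ b j p)) (sym (c-+ b j p)))
                    (eq₃ s (d (b ℕ.+ j)) (c (b ℕ.+ j)) (c b) (d b))))
      where
      eq₁ : ∀ s x → s * (s * x) ≡ s * s * x
      eq₁ = solve-∀
      eq₂ : ∀ c d c′ d′ → (c * c + d * d) * c′ ≡ (c * c′ - d * d′) * c + (d * c′ + c * d′) * d
      eq₂ = solve 4 (λ c d c′ d′ → (c :* c :+ d :* d) :* c′ := (c :* c′ :- d :* d′) :* c :+ (d :* c′ :+ c :* d′) :* d) refl
      eq₃ : ∀ s x y c d → s * y * c + s * x * d ≡ s * (y * c + x * d)
      eq₃ = solve 5 (λ s x y c d → s :* y :* c :+ s :* x :* d := s :* (y :* c :+ x :* d)) refl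

    -- The allowed failure of the addition law at a passage between quadrants; it is proportional to
    -- the cosine `cP` of the approximate right angle.
    δ : ℤ
    δ = pos 2 * cP * s
    Near : ℤ → ℤ → Set
    Near a b = (a - b ≤ δ) × (- δ ≤ a - b)

    near-≡ : ∀ {a b} → a ≡ b → Near a b
    near-≡ {a} refl = subst (λ z → (z ≤ δ) × (- δ ≤ z)) (sym (ℤ.+-inverseʳ a)) (δ≥0 , ℤ.neg-mono-≤ δ≥0)
      where
      δ≥0 : 0ℤ ≤ δ
      δ≥0 = 0≤* (0≤* (0≤⁺ 2) cP≥0) s≥0

    near-neg : ∀ a b → Near a b → Near (- a) (- b)
    near-neg a b (p , q) =
      ℤ.≤-trans (ℤ.≤-reflexive (eq a b)) (ℤ.≤-trans (ℤ.neg-mono-≤ q) (ℤ.≤-reflexive (ℤ.neg-involutive δ)))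
      , ℤ.≤-trans (ℤ.neg-mono-≤ p) (ℤ.≤-reflexive (sym (eq a b)))
      where
      eq : ∀ a b → - a - - b ≡ - (a - b)
      eq = solve-∀

    -- sin(π/2 - θ) = cos θ up to the defect of the approximate quarter turn
    near-dc : ∀ j v → v ℕ.+ j ≡ P → Near (s * d j) (s * c v)
    near-dc j v e = upper , lower
      where
      e′ : j ℕ.+ v ≡ P
      e′ = trans (ℕ.+-comm j v) e
      j≤P = subst (j ℕ.≤_) e (ℕ.m≤n+m j v)
      exact : s * c v ≡ cP * c j + dP * d j
      exact = trans (c-difference j v (ℕ.≤-reflexive e′)) (cong₂ (λ x y → c x * c j + d y * d j) e′ e′)
      upper : s * d j - s * c v ≤ δ
      upper = certify (0≤+ (0≤+ (0≤* (≤⇒0≤ s-dP≤cP) (d≥0 j j≤P)) (0≤* cP≥0 (≤⇒0≤ (d≤s j j≤P)))) (0≤+ (0≤* cP≥0 (c≥0 j j≤P)) (0≤* cP≥0 s≥0)))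
        (trans (eq s dP cP (d j) (c j)) (cong (λ z → δ - (s * d j - z)) (sym exact)))
        where
        eq : ∀ s b a y x → (a - (s - b)) * y + a * (s - y) + (a * x + a * s) ≡ pos 2 * a * s - (s * y - (a * x + b * y))
        eq = solve 5 (λ s b a y x → (a :- (s :- b)) :* y :+ a :* (s :- y) :+ (a :* x :+ a :* s) := con (pos 2) :* a :* s :- (s :* y :- (a :* x :+ b :* y))) refl
      lower : - δ ≤ s * d j - s * c v
      lower = certify (0≤+ (0≤+ (0≤* (≤⇒0≤ (d≤s P ℕ.≤-refl)) (d≥0 j j≤P)) (0≤* cP≥0 (≤⇒0≤ (c≤s j j≤P)))) (0≤* cP≥0 s≥0))
        (trans (eq s dP cP (d j) (c j)) (cong (λ z → s * d j - z - - δ) (sym exact)))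
        where
        eq : ∀ s b a y x → (s - b) * y + a * (s - x) + a * s ≡ s * y - (a * x + b * y) - - (pos 2 * a * s)
        eq = solve 5 (λ s b a y x → (s :- b) :* y :+ a :* (s :- x) :+ a :* s := s :* y :- (a :* x :+ b :* y) :- :- (con (pos 2) :* a :* s)) refl
    near-cd : ∀ j v → v ℕ.+ j ≡ P → Near (s * c j) (s * d v)
    near-cd j v e = upper , lower
      where
      e′ : j ℕ.+ v ≡ P
      e′ = trans (ℕ.+-comm j v) e
      j≤P = subst (j ℕ.≤_) e (ℕ.m≤n+m j v)
      exact : s * d v ≡ dP * c j - cP * d j
      exact = trans (d-difference j v (ℕ.≤-reflexive e′)) (cong₂ (λ x y → d x * c j - c y * d j) e′ e′)
      upper : s * c j - s * d v ≤ δ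
      upper = certify (0≤+ (0≤+ (0≤* (≤⇒0≤ s-dP≤cP) (c≥0 j j≤P)) (0≤* cP≥0 (≤⇒0≤ (c≤s j j≤P)))) (0≤* cP≥0 (≤⇒0≤ (d≤s j j≤P))))
        (trans (eq s dP cP (d j) (c j)) (cong (λ z → δ - (s * c j - z)) (sym exact)))
        where
        eq : ∀ s b a y x → (a - (s - b)) * x + a * (s - x) + a * (s - y) ≡ pos 2 * a * s - (s * x - (b * x - a * y))
        eq = solve 5 (λ s b a y x → (a :- (s :- b)) :* x :+ a :* (s :- x) :+ a :* (s :- y) := con (pos 2) :* a :* s :- (s :* x :- (b :* x :- a :* y))) refl
      lower : - δ ≤ s * c j - s * d v
      lower = certify (0≤+ (0≤+ (0≤* (≤⇒0≤ (d≤s P ℕ.≤-refl)) (c≥0 j j≤P)) (0≤* cP≥0 (d≥0 j j≤P))) (0≤* (0≤* (0≤⁺ 2) cP≥0) s≥0))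
        (trans (eq s dP cP (d j) (c j)) (cong (λ z → s * c j - z - - δ) (sym exact)))
        where
        eq : ∀ s b a y x → (s - b) * x + a * y + pos 2 * a * s ≡ s * x - (b * x - a * y) - - (pos 2 * a * s)
        eq = solve 5 (λ s b a y x → (s :- b) :* x :+ a :* y :+ con (pos 2) :* a :* s := s :* x :- (b :* x :- a :* y) :- :- (con (pos 2) :* a :* s)) refl

    -- Angle subtraction up to `δ`. Sine and cosine are kept together because adding a quarter turn
    -- to `j` exchanges them.
    Dev : ℕ → ℕ → Set
    Dev b j = Near (s * S j) (S (b ℕ.+ j) * C b - C (b ℕ.+ j) * S b)
            × Near (s * C j) (C (b ℕ.+ j) * C b + S (b ℕ.+ j) * S b)

    dev-base : ∀ b j → b ℕ.< P → j ℕ.< P → Dev b j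
    dev-base b j b<P j<P with ℕ.<-≤-connex (b ℕ.+ j) P
    ... | inj₁ p = near-≡ (trans (cong (s *_) (S-small j<P)) (trans (d-difference b j (ℕ.<⇒≤ p))
                     (sym (cong₂ _-_ (cong₂ _*_ (S-small p) (C-small b<P)) (cong₂ _*_ (C-small p) (S-small b<P))))))
                 , near-≡ (trans (cong (s *_) (C-small j<P)) (trans (c-difference b j (ℕ.<⇒≤ p))
                     (sym (cong₂ _+_ (cong₂ _*_ (C-small p) (C-small b<P)) (cong₂ _*_ (S-small p) (S-small b<P))))))
    -- Now `b + j` lies in the second quadrant. The right-hand sides are exact expressions for the
    -- angle `v = b - r`, where `r = b + j - P`; since `v + j = P`, they differ from the left-hand
    -- sides only by the defect of the quarter turn.
    ... | inj₂ p = subst₂ Near (cong (s *_) (sym (S-small j<P))) sin-rhs (near-dc j v v+j≡P)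
                 , subst₂ Near (cong (s *_) (sym (C-small j<P))) cos-rhs (near-cd j v v+j≡P)
      where
      r v : ℕ
      r = b ℕ.+ j ℕ.∸ P
      v = b ℕ.∸ r
      r+P : r ℕ.+ P ≡ b ℕ.+ j
      r+P = ℕ.m∸n+n≡m p
      r≤b : r ℕ.≤ b
      r≤b = ℕ.+-cancelʳ-≤ P r b (subst (ℕ._≤ b ℕ.+ P) (sym r+P) (ℕ.+-monoʳ-≤ b (ℕ.<⇒≤ j<P)))
      r<P : r ℕ.< P
      r<P = ℕ.≤-<-trans r≤b b<P
      r+v : r ℕ.+ v ≡ b
      r+v = ℕ.m+[n∸m]≡n r≤b
      v+j≡P : v ℕ.+ j ≡ P
      v+j≡P = ℕ.+-cancelˡ-≡ r (v ℕ.+ j) P (trans (sym (ℕ.+-assoc r v j)) (trans (cong (ℕ._+ j) r+v) (sym r+P)))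
      Sb : S (b ℕ.+ j) ≡ c r
      Sb = trans (cong S (sym r+P)) (trans (S-P r) (C-small r<P))
      Cb : C (b ℕ.+ j) ≡ - d r
      Cb = trans (cong C (sym r+P)) (trans (C-P r) (cong -_ (S-small r<P)))
      eq₁ : ∀ c d c′ d′ → c′ * c + d′ * d ≡ c * c′ - (- d) * d′
      eq₁ = solve-∀
      eq₂ : ∀ c d c′ d′ → d′ * c - c′ * d ≡ - d * c′ + c * d′
      eq₂ = solve-∀
      r+v≤P = ℕ.≤-trans (ℕ.≤-reflexive r+v) (ℕ.<⇒≤ b<P)
      sin-rhs : s * c v ≡ S (b ℕ.+ j) * C b - C (b ℕ.+ j) * S b
      sin-rhs = trans (c-difference r v r+v≤P)
        (trans (cong₂ (λ x y → c x * c r + d y * d r) r+v r+v)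
          (trans (eq₁ (c r) (d r) (c b) (d b))
            (sym (cong₂ _-_ (cong₂ _*_ Sb (C-small b<P)) (cong₂ _*_ Cb (S-small b<P))))))
      cos-rhs : s * d v ≡ C (b ℕ.+ j) * C b + S (b ℕ.+ j) * S b
      cos-rhs = trans (d-difference r v r+v≤P)
        (trans (cong₂ (λ x y → d x * c r - c y * d r) r+v r+v)
          (trans (eq₂ (c r) (d r) (c b) (d b))
            (sym (cong₂ _+_ (cong₂ _*_ Cb (C-small b<P)) (cong₂ _*_ Sb (S-small b<P))))))

    +-swap : ∀ b j → b ℕ.+ P ℕ.+ j ≡ b ℕ.+ j ℕ.+ P
    +-swap b j = trans (ℕ.+-assoc b P j) (trans (cong (b ℕ.+_) (ℕ.+-comm P j)) (sym (ℕ.+-assoc b j P)))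

    dev-b : ∀ b j → Dev b j → Dev (b ℕ.+ P) j
    dev-b b j (p , q) = subst (Near (s * S j)) (trans (eq₁ (S (b ℕ.+ j)) (C (b ℕ.+ j)) (S b) (C b))
                          (sym (cong₂ _-_ (cong₂ _*_ Sb (C-P b)) (cong₂ _*_ Cb (S-P b))))) p
                      , subst (Near (s * C j)) (trans (eq₂ (S (b ℕ.+ j)) (C (b ℕ.+ j)) (S b) (C b))
                          (sym (cong₂ _+_ (cong₂ _*_ Cb (C-P b)) (cong₂ _*_ Sb (S-P b))))) q
      where
      Sb : S (b ℕ.+ P ℕ.+ j) ≡ C (b ℕ.+ j)
      Sb = trans (cong S (+-swap b j)) (S-P (b ℕ.+ j))
      Cb : C (b ℕ.+ P ℕ.+ j) ≡ - S (b ℕ.+ j)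
      Cb = trans (cong C (+-swap b j)) (C-P (b ℕ.+ j))
      eq₁ : ∀ S C S′ C′ → S * C′ - C * S′ ≡ C * - S′ - (- S) * C′
      eq₁ = solve-∀
      eq₂ : ∀ S C S′ C′ → C * C′ + S * S′ ≡ (- S) * (- S′) + C * C′
      eq₂ = solve 4 (λ S C S′ C′ → C :* C′ :+ S :* S′ := (:- S) :* (:- S′) :+ C :* C′) refl

    dev-j : ∀ b j → Dev b j → Dev b (j ℕ.+ P)
    dev-j b j (p , q) = subst₂ Near (cong (s *_) (sym (S-P j))) (trans (eq₁ (S (b ℕ.+ j)) (C (b ℕ.+ j)) (S b) (C b))
                          (sym (cong₂ _-_ (cong (_* C b) Sb) (cong (_* S b) Cb)))) q
                      , subst₂ Near (trans (ℤ.neg-distribʳ-* s (S j)) (cong (s *_) (sym (C-P j)))) (trans (eq₂ (S (b ℕ.+ j)) (C (b ℕ.+ j)) (S b) (C b))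
                          (sym (cong₂ _+_ (cong (_* C b) Cb) (cong (_* S b) Sb)))) (near-neg (s * S j) (S (b ℕ.+ j) * C b - C (b ℕ.+ j) * S b) p)
      where
      Sb : S (b ℕ.+ (j ℕ.+ P)) ≡ C (b ℕ.+ j)
      Sb = trans (cong S (sym (ℕ.+-assoc b j P))) (S-P (b ℕ.+ j))
      Cb : C (b ℕ.+ (j ℕ.+ P)) ≡ - S (b ℕ.+ j)
      Cb = trans (cong C (sym (ℕ.+-assoc b j P))) (C-P (b ℕ.+ j))
      eq₁ : ∀ S C S′ C′ → C * C′ + S * S′ ≡ C * C′ - (- S) * S′
      eq₁ = solve-∀
      eq₂ : ∀ S C S′ C′ → - (S * C′ - C * S′) ≡ (- S) * C′ + C * S′
      eq₂ = solve 4 (λ S C S′ C′ → :- (S :* C′ :- C :* S′) := (:- S) :* C′ :+ C :* S′) refl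

    +-* : ∀ r q → r ℕ.+ q ℕ.* P ℕ.+ P ≡ r ℕ.+ suc q ℕ.* P
    +-* r q = trans (ℕ.+-assoc r (q ℕ.* P) P) (cong (r ℕ.+_) (ℕ.+-comm (q ℕ.* P) P))

    dev : ∀ b j → Dev b j
    dev b j = subst₂ Dev (sym (ℕ.m≡m%n+[m/n]*n b P)) (sym (ℕ.m≡m%n+[m/n]*n j P))
                (go-b (b ℕ./ P) (b ℕ.% P) _ (go-j (j ℕ./ P) (b ℕ.% P) (j ℕ.% P) (dev-base _ _ (ℕ.m%n<n b P) (ℕ.m%n<n j P))))
      where
      go-j : ∀ q b r → Dev b r → Dev b (r ℕ.+ q ℕ.* P)
      go-j zero    b r p = subst (Dev b) (sym (ℕ.+-identityʳ r)) p
      go-j (suc q) b r p = subst (Dev b) (+-* r q) (dev-j b _ (go-j q b r p))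
      go-b : ∀ q r j → Dev r j → Dev (r ℕ.+ q ℕ.* P) j
      go-b zero    r j p = subst (λ b → Dev b j) (sym (ℕ.+-identityʳ r)) p
      go-b (suc q) r j p = subst (λ b → Dev b j) (+-* r q) (dev-b _ j (go-b q r j p))

    -- det(v,w) u - det(u,w) v + det(u,v) w = 0 for plane vectors u, v, w.
    three : ∀ a i j → let T = S j * S a - S (i ℕ.+ j) * S (a ℕ.+ i) + S i * S (a ℕ.+ (i ℕ.+ j)) in
            (pos Λ * T ≤ s * s) × (- (s * s) ≤ pos Λ * T)
    three a i j = scale T upper , ℤ.≤-trans (ℤ.neg-mono-≤ (scale (- T) lower))
                                    (ℤ.≤-reflexive (eq₅ (pos Λ) T))
      where
      b c′ : ℕ
      b = a ℕ.+ i
      c′ = a ℕ.+ (i ℕ.+ j)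
      T = S j * S a - S (i ℕ.+ j) * S b + S i * S c′
      ε₁ ε₂ ε₃ : ℤ
      ε₁ = s * S j - (S c′ * C b - C c′ * S b)
      ε₂ = s * S (i ℕ.+ j) - (S c′ * C a - C c′ * S a)
      ε₃ = s * S i - (S b * C a - C b * S a)
      n₁ : Near (s * S j) (S c′ * C b - C c′ * S b)
      n₁ = subst (λ z → Near (s * S j) (S z * C b - C z * S b)) (ℕ.+-assoc a i j) (proj₁ (dev b j))
      n₂ = proj₁ (dev a (i ℕ.+ j))
      n₃ = proj₁ (dev a i)
      S≤ : ∀ t → S t ≤ s
      S≤ t = norm-bound (S t) (C t) s≥0 (trans (ℤ.+-comm (S t * S t) (C t * C t)) (norm t))
      expand : s * T ≡ ε₁ * S a - ε₂ * S b + ε₃ * S c′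
      expand = eq s (S j) (S (i ℕ.+ j)) (S i) (S a) (C a) (S b) (C b) (S c′) (C c′)
        where
        eq : ∀ s x y z sa ca sb cb sc cc → s * (x * sa - y * sb + z * sc) ≡
             (s * x - (sc * cb - cc * sb)) * sa - (s * y - (sc * ca - cc * sa)) * sb + (s * z - (sb * ca - cb * sa)) * sc
        eq = solve 10 (λ s x y z sa ca sb cb sc cc → s :* (x :* sa :- y :* sb :+ z :* sc) := (s :* x :- (sc :* cb :- cc :* sb)) :* sa :- (s :* y :- (sc :* ca :- cc :* sa)) :* sb :+ (s :* z :- (sb :* ca :- cb :* sa)) :* sc) refl
      upper : T ≤ pos 3 * δ
      upper = *-cancelˡ s s≥1 (certify
        (0≤+ (0≤+ (≤⇒0≤ (product-≤ ε₁ (S a) δ s (proj₁ n₁) (proj₂ n₁) (S≤ a) (S≥-s a)))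
                  (≤⇒0≤ (-product-≤ ε₂ (S b) δ s (proj₁ n₂) (proj₂ n₂) (S≤ b) (S≥-s b))))
             (≤⇒0≤ (product-≤ ε₃ (S c′) δ s (proj₁ n₃) (proj₂ n₃) (S≤ c′) (S≥-s c′))))
        (trans (eq (ε₁ * S a) (ε₂ * S b) (ε₃ * S c′) δ s) (cong (λ z → s * (pos 3 * δ) - z) (sym expand))))
        where
        eq : ∀ x y z δ s → δ * s - x + (y - - (δ * s)) + (δ * s - z) ≡ s * (pos 3 * δ) - (x - y + z)
        eq = solve 5 (λ x y z δ s → δ :* s :- x :+ (y :- :- (δ :* s)) :+ (δ :* s :- z) := s :* (con (pos 3) :* δ) :- (x :- y :+ z)) refl
      lower : - T ≤ pos 3 * δ
      lower = *-cancelˡ s s≥1 (certify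
        (0≤+ (0≤+ (≤⇒0≤ (-product-≤ ε₁ (S a) δ s (proj₁ n₁) (proj₂ n₁) (S≤ a) (S≥-s a)))
                  (≤⇒0≤ (product-≤ ε₂ (S b) δ s (proj₁ n₂) (proj₂ n₂) (S≤ b) (S≥-s b))))
             (≤⇒0≤ (-product-≤ ε₃ (S c′) δ s (proj₁ n₃) (proj₂ n₃) (S≤ c′) (S≥-s c′))))
        (trans (eq (ε₁ * S a) (ε₂ * S b) (ε₃ * S c′) δ s)
               (trans (cong (λ z → s * (pos 3 * δ) + z) (sym expand)) (eq₆ s δ T))))
        where
        eq : ∀ x y z δ s → x - - (δ * s) + (δ * s - y) + (z - - (δ * s)) ≡ s * (pos 3 * δ) + (x - y + z)
        eq = solve 5 (λ x y z δ s → x :- :- (δ :* s) :+ (δ :* s :- y) :+ (z :- :- (δ :* s)) := s :* (con (pos 3) :* δ) :+ (x :- y :+ z)) refl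
        eq₆ : ∀ s δ T → s * (pos 3 * δ) + s * T ≡ s * (pos 3 * δ) - s * (- T)
        eq₆ = solve 3 (λ s δ T → s :* (con (pos 3) :* δ) :+ s :* T := s :* (con (pos 3) :* δ) :- s :* (:- T)) refl
      -- `3 * δ` is `6 * cP * s`, and the quarter turn was built with `L = 6 Λ`, so that
      -- `L * cP ≤ s`.
      scale : ∀ X → X ≤ pos 3 * δ → pos Λ * X ≤ s * s
      scale X p = ℤ.≤-trans (*-monoˡ (pos Λ) (0≤⁺ Λ) p)
        (ℤ.≤-trans (ℤ.≤-reflexive (trans (eq (pos Λ) cP s) (cong (λ z → s * (z * cP)) (sym L≡))))
                   (*-monoˡ s s≥0 c-P))
        where
        eq : ∀ l c s → l * (pos 3 * (pos 2 * c * s)) ≡ s * (pos 6 * l * c)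
        eq = solve 3 (λ l c s → l :* (con (pos 3) :* (con (pos 2) :* c :* s)) := s :* (con (pos 6) :* l :* c)) refl
      eq₅ : ∀ l T → - (l * - T) ≡ l * T
      eq₅ = solve-∀

    c-suc≤ : ∀ t → suc t ℕ.≤ P → c (suc t) ≤ c t
    c-suc≤ t p = *-cancelˡ s s≥1 (subst (λ z → s * c z ≤ s * c t) (ℕ.+-comm t 1)
      (certify (0≤+ (0≤* (c≥0 t t≤P) (≤⇒0≤ (c≤s 1 1≤P))) (0≤* (d≥0 t t≤P) (d≥0 1 1≤P)))
        (trans (eq s (c t) (d t) (c 1) (d 1)) (cong (λ z → s * c t - z) (sym (c-+ t 1 (subst (ℕ._≤ P) (ℕ.+-comm 1 t) p)))))))
      where
      t≤P = ℕ.<⇒≤ p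
      eq : ∀ s c d c′ d′ → c * (s - c′) + d * d′ ≡ s * c - (c * c′ - d * d′)
      eq = solve 5 (λ s c d c′ d′ → c :* (s :- c′) :+ d :* d′ := s :* c :- (c :* c′ :- d :* d′)) refl

    c-anti : ∀ t u → t ℕ.+ u ℕ.≤ P → c (t ℕ.+ u) ≤ c t
    c-anti t zero    p rewrite ℕ.+-identityʳ t = ℤ.≤-refl
    c-anti t (suc u) p rewrite ℕ.+-suc t u = ℤ.≤-trans (c-suc≤ (t ℕ.+ u) p) (c-anti t u (ℕ.<⇒≤ p))

    d≥d1 : ∀ t → suc t ℕ.≤ P → d 1 ≤ d (suc t)
    d≥d1 t p = ²-cancel-≤ (d≥0 (suc t) p) (certify
      (0≤+ (0≤* (≤⇒0≤ (c-anti 1 t p)) (c≥0 1 1≤P)) (0≤* (≤⇒0≤ (c-anti 1 t p)) (c≥0 (suc t) p)))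
      (trans (eq (c 1) (d 1) (c (suc t)) (d (suc t)))
        (trans (cong₂ (λ x y → x - y + (d (suc t) * d (suc t) - d 1 * d 1)) (c²+d² 1 1≤P) (c²+d² (suc t) p))
          (eq′ (s * s) (d (suc t) * d (suc t) - d 1 * d 1)))))
      where
      eq : ∀ c d c′ d′ → (c - c′) * c + (c - c′) * c′ ≡ c * c + d * d - (c′ * c′ + d′ * d′) + (d′ * d′ - d * d)
      eq = solve 4 (λ c d c′ d′ → (c :- c′) :* c :+ (c :- c′) :* c′ := c :* c :+ d :* d :- (c′ :* c′ :+ d′ :* d′) :+ (d′ :* d′ :- d :* d)) refl
      eq′ : ∀ x y → x - x + y ≡ y
      eq′ = solve-∀

    d-linear : ∀ t → t ℕ.≤ P → d t ≤ pos t * d 1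
    d-linear zero    p = ℤ.≤-reflexive (trans d-0 (sym (ℤ.*-zeroˡ (d 1))))
    d-linear (suc t) p = ℤ.≤-trans step (ℤ.≤-trans (ℤ.+-monoˡ-≤ (d 1) (d-linear t t≤P)) (ℤ.≤-reflexive (eq (pos t) (d 1))))
      where
      t≤P = ℕ.<⇒≤ p
      eq : ∀ t d → t * d + d ≡ (1ℤ + t) * d
      eq = solve-∀
      eq′ : ∀ s d c d′ c′ → d * (s - c′) + (s - c) * d′ ≡ s * (d + d′) - (d * c′ + c * d′)
      eq′ = solve 5 (λ s d c d′ c′ → d :* (s :- c′) :+ (s :- c) :* d′ := s :* (d :+ d′) :- (d :* c′ :+ c :* d′)) refl
      step : d (suc t) ≤ d t + d 1
      step = *-cancelˡ s s≥1 (subst (λ z → s * d z ≤ s * (d t + d 1)) (ℕ.+-comm t 1)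
        (certify (0≤+ (0≤* (d≥0 t t≤P) (≤⇒0≤ (c≤s 1 1≤P))) (0≤* (≤⇒0≤ (c≤s t t≤P)) (d≥0 1 1≤P)))
          (trans (eq′ s (d t) (c t) (d 1) (c 1)) (cong (λ z → s * (d t + d 1) - z) (sym (d-+ t 1 (subst (ℕ._≤ P) (ℕ.+-comm 1 t) p)))))))

    2cP≤s : pos 2 * cP ≤ s
    2cP≤s = ℤ.≤-trans (certify (0≤* (≤⇒0≤ 2≤) cP≥0) (eq (pos L) cP)) c-P
      where
      eq₂ : ∀ l → pos 6 * (l - 1ℤ) + pos 4 ≡ pos 6 * l - pos 2
      eq₂ = solve-∀
      2≤ : pos 2 ≤ pos L
      2≤ = ℤ.≤-trans (certify (0≤+ (0≤* (0≤⁺ 6) (≤⇒0≤ (+≤+ 1≤Λ))) (0≤⁺ 4)) (eq₂ (pos Λ))) (ℤ.≤-reflexive (sym L≡))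
      eq : ∀ l c → (l - pos 2) * c ≡ l * c - pos 2 * c
      eq = solve-∀

    s≤2dP : s ≤ pos 2 * dP
    s≤2dP = certify (0≤+ (0≤* (0≤⁺ 2) (≤⇒0≤ s-dP≤cP)) (≤⇒0≤ 2cP≤s)) (eq s cP dP)
      where
      eq : ∀ s c d → pos 2 * (c - (s - d)) + (s - pos 2 * c) ≡ pos 2 * d - s
      eq = solve 3 (λ s c d → con (pos 2) :* (c :- (s :- d)) :+ (s :- con (pos 2) :* c) := con (pos 2) :* d :- s) refl

    s≤2Pd1 : s ≤ pos 2 * (pos P * d 1)
    s≤2Pd1 = ℤ.≤-trans s≤2dP (*-monoˡ (pos 2) (0≤⁺ 2) (d-linear P ℕ.≤-refl))

    d1≤2c : d 1 ≤ pos 2 * c P′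
    d1≤2c = *-cancelˡ s s≥1 (certify
      (0≤+ (0≤* (≤⇒0≤ s≤2dP) (d≥0 1 1≤P)) (0≤* (0≤⁺ 2) (0≤* cP≥0 (c≥0 1 1≤P))))
      (trans (eq s cP dP (c 1) (d 1)) (cong (λ z → z - s * d 1) (trans (cong (pos 2 *_) (sym (trans (c-difference 1 P′ (ℕ.≤-reflexive P≡)) (cong₂ (λ u v → c u * c 1 + d v * d 1) P≡ P≡)))) (eq′ s (c P′))))))
      where
      eq : ∀ s a b c d → (pos 2 * b - s) * d + pos 2 * (a * c) ≡ pos 2 * (a * c + b * d) - s * d
      eq = solve 5 (λ s a b c d → (con (pos 2) :* b :- s) :* d :+ con (pos 2) :* (a :* c) := con (pos 2) :* (a :* c :+ b :* d) :- s :* d) refl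
      eq′ : ∀ s c → pos 2 * (s * c) ≡ s * (pos 2 * c)
      eq′ = solve-∀

    -- The wave rises in the first quadrant and falls in the second, so its smallest positive sample
    -- is the first or the last one.
    μ : ℤ
    μ = d 1 ⊓ c P′

    d1≤2μ : d 1 ≤ pos 2 * μ
    d1≤2μ with ℤ.⊓-sel (d 1) (c P′)
    ... | inj₁ e = subst (λ z → d 1 ≤ pos 2 * z) (sym e) (certify (d≥0 1 1≤P) (eq (d 1)))
      where
      eq : ∀ d → d ≡ pos 2 * d - d
      eq = solve-∀
    ... | inj₂ e = subst (λ z → d 1 ≤ pos 2 * z) (sym e) d1≤2c

    -- Subadditivity of the sine gives `dP ≤ P * d 1`, and `dP` is at least `s / 2`; so the first
    -- sample is at least `s / 2P`. The last one, `c P′`, is at least half the first.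
    s≤κμ : s ≤ pos (4 ℕ.* P) * μ
    s≤κμ = ℤ.≤-trans s≤2Pd1 (ℤ.≤-trans (*-monoˡ (pos 2) (0≤⁺ 2) (*-monoˡ (pos P) (0≤⁺ P) d1≤2μ))
      (ℤ.≤-reflexive (trans (eq (pos P) μ) (cong (_* μ) (sym (ℤ.pos-* 4 P))))))
      where
      eq : ∀ p m → pos 2 * (p * (pos 2 * m)) ≡ pos 4 * p * m
      eq = solve-∀

    μ≥1 : 1ℤ ≤ μ
    μ≥1 with ≤⊎> μ 0ℤ
    ... | inj₂ p = p
    ... | inj₁ p = ⊥-elim (absurd (0≤+ (≤⇒0≤ s≥1) (0≤+ (≤⇒0≤ s≤κμ) (0≤* (0≤⁺ (4 ℕ.* P)) (≤⇒0≤ p)))) (eq s (pos (4 ℕ.* P)) μ))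
      where
      eq : ∀ s k m → s - 1ℤ + (k * m - s + k * (0ℤ - m)) ≡ - 1ℤ
      eq = solve-∀

    S-pos : ∀ t → 1 ℕ.≤ t → t ℕ.< P ℕ.+ P → μ ≤ S t
    S-pos (suc t) _ t<2P with ℕ.<-≤-connex (suc t) P
    ... | inj₁ p = ℤ.≤-trans (ℤ.i⊓j≤i (d 1) (c P′)) (ℤ.≤-trans (d≥d1 t (ℕ.<⇒≤ p)) (ℤ.≤-reflexive (sym (S-small p))))
    ... | inj₂ p = ℤ.≤-trans (ℤ.i⊓j≤j (d 1) (c P′))
          (ℤ.≤-trans (subst (λ z → c z ≤ c r) r+v (c-anti r v (ℕ.≤-trans (ℕ.≤-reflexive r+v) (ℕ.pred[n]≤n {P}))))
            (ℤ.≤-reflexive (sym (trans (cong S (sym r+P)) (trans (S-P r) (C-small r<P))))))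
      where
      r v : ℕ
      r = suc t ℕ.∸ P
      r+P : r ℕ.+ P ≡ suc t
      r+P = ℕ.m∸n+n≡m p
      r<P : r ℕ.< P
      r<P = ℕ.+-cancelʳ-< P r P (subst (ℕ._< P ℕ.+ P) (sym r+P) t<2P)
      v = P′ ℕ.∸ r
      r+v : r ℕ.+ v ≡ P′
      r+v = ℕ.m+[n∸m]≡n (ℕ.s≤s⁻¹ (subst (r ℕ.<_) (sym P≡) r<P))

    result : Sine P (4 ℕ.* P) Λ
    result = record
      { S = S ; s = s ; μ = μ
      ; S-anti = λ t → trans (cong S (sym (ℕ.+-assoc t P P))) (trans (S-P (t ℕ.+ P)) (C-P t))
      ; S-0 = trans (S-small 1≤P) d-0
      ; S≤s = λ t → norm-bound (S t) (C t) s≥0 (trans (ℤ.+-comm (S t * S t) (C t * C t)) (norm t))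
      ; -s≤S = S≥-s
      ; S-pos = S-pos ; μ≥1 = μ≥1 ; s≤κμ = s≤κμ
      ; three = λ a i j → proj₁ (three a i j) ; three⁻ = λ a i j → proj₂ (three a i j) }

  sine : ∀ P Λ → 2 ℕ.≤ P → 1 ℕ.≤ Λ → Sine P (4 ℕ.* P) Λ
  sine P Λ 2≤P 1≤Λ = QuarterTurn⇒Sine.result P Λ (6 ℕ.* Λ) {{ℕ.>-nonZero (ℕ.<⇒≤ 2≤P)}} 2≤P 1≤Λ (ℤ.pos-* 6 Λ)
    (quarterTurn P (6 ℕ.* Λ) (ℕ.<⇒≤ 2≤P) (ℕ.*-mono-≤ {1} {6} (ℕ.s≤s ℕ.z≤n) 1≤Λ))

-- Littlewood-Offord anti-concentration for sums over the grid

module AntiConcentration where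

  open Prelude
  open Sums
  open Grid
  open Rotation using (≤⊎>; 1≤⇒0≤)
  open import Data.List using (map)
  open import Data.List.Properties using (length-map)
  open import Data.Vec.Relation.Unary.All using (All; []; _∷_)

  hit : ℤ → ℤ → ℤ → ℤ
  hit w a y with ≤⊎> a y | ≤⊎> (a + w) y
  ... | inj₂ _ | _      = 0ℤ
  ... | inj₁ _ | inj₁ _ = 0ℤ
  ... | inj₁ _ | inj₂ _ = 1ℤ

  data HitView (w a y : ℤ) : ℤ → Set where
    below  : 1ℤ + y ≤ a → HitView w a y 0ℤ
    above  : a + w ≤ y → HitView w a y 0ℤ
    inside : a ≤ y → 1ℤ + y ≤ a + w → HitView w a y 1ℤ

  hit-view : ∀ w a y → HitView w a y (hit w a y)
  hit-view w a y with ≤⊎> a y | ≤⊎> (a + w) y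
  ... | inj₂ p | _      = below p
  ... | inj₁ _ | inj₁ q = above q
  ... | inj₁ p | inj₂ q = inside p q

  <-irrefl : ∀ {a b} → a ≤ b → 1ℤ + b ≤ a → ∀ {A : Set} → A
  <-irrefl {a} {b} p q = ⊥-elim (absurd (0≤+ (≤⇒0≤ p) (≤⇒0≤ q)) (eq a b))
    where
    eq : ∀ a b → b - a + (a - (1ℤ + b)) ≡ - 1ℤ
    eq = solve-∀

  hit-translate : ∀ w a v y → hit w (a - v) y ≡ hit w a (v + y)
  hit-translate w a v y with hit w (a - v) y | hit-view w (a - v) y | hit w a (v + y) | hit-view w a (v + y)
  ... | _ | below p  | _ | below _    = refl
  ... | _ | below p  | _ | above _    = refl
  ... | _ | above _  | _ | below _    = refl
  ... | _ | above _  | _ | above _    = refl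
  ... | _ | inside _ _ | _ | inside _ _ = refl
  ... | _ | below p  | _ | inside q _ = <-irrefl q (certify (≤⇒0≤ p) (eq a v y))
    where
    eq : ∀ a v y → a - v - (1ℤ + y) ≡ a - (1ℤ + (v + y))
    eq = solve-∀
  ... | _ | above p  | _ | inside _ q = <-irrefl {a + w} {v + y} (certify (≤⇒0≤ p) (eq a v w y)) q
    where
    eq : ∀ a v w y → y - (a - v + w) ≡ v + y - (a + w)
    eq = solve-∀
  ... | _ | inside p _ | _ | below q = <-irrefl p (certify (≤⇒0≤ q) (eq a v y))
    where
    eq : ∀ a v y → a - (1ℤ + (v + y)) ≡ a - v - (1ℤ + y)
    eq = solve-∀
  ... | _ | inside _ p | _ | above q = <-irrefl {a - v + w} {y} (certify (≤⇒0≤ q) (eq a v w y)) p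
    where
    eq : ∀ a v w y → v + y - (a + w) ≡ y - (a - v + w)
    eq = solve-∀

  pow : ℤ → ℕ → ℤ
  pow b zero    = 1ℤ
  pow b (suc k) = b * pow b k

  pow≥0 : ∀ {b} → 0ℤ ≤ b → ∀ k → 0ℤ ≤ pow b k
  pow≥0 p zero    = 0≤⁺ 1
  pow≥0 p (suc k) = 0≤* p (pow≥0 p k)

  pow≥1 : ∀ {b} → 1ℤ ≤ b → ∀ k → 1ℤ ≤ pow b k
  pow≥1 p zero    = ℤ.≤-refl
  pow≥1 p (suc k) = *-mono (0≤⁺ 1) (0≤⁺ 1) p (pow≥1 p k)

  bernoulli : ∀ (m : ℤ) → 0ℤ ≤ m → ∀ k → (m + pos k) * pow m k ≤ m * pow (1ℤ + m) k
  bernoulli m m≥0 zero    = ℤ.≤-reflexive (eq m)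
    where
    eq : ∀ m → (m + 0ℤ) * 1ℤ ≡ m * 1ℤ
    eq = solve-∀
  bernoulli m m≥0 (suc k) = certify
    (0≤+ (0≤* (0≤+ (0≤⁺ 1) m≥0) (≤⇒0≤ (bernoulli m m≥0 k))) (0≤* (0≤⁺ k) (pow≥0 m≥0 k)))
    (eq m (pos k) (pow m k) (pow (1ℤ + m) k))
    where
    eq : ∀ m k p q → (1ℤ + m) * (m * q - (m + k) * p) + k * p ≡ m * ((1ℤ + m) * q) - (m + (1ℤ + k)) * (m * p)
    eq = solve 4 (λ m k p q → (con 1ℤ :+ m) :* (m :* q :- (m :+ k) :* p) :+ k :* p := m :* ((con 1ℤ :+ m) :* q) :- (m :+ (con 1ℤ :+ k)) :* (m :* p)) refl

  module LittlewoodOfford (M : ℕ) (w : ℤ) (w≥1 : 1ℤ ≤ w) where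

    private
      w≥0 = 1≤⇒0≤ w≥1

    -- Left ends of disjoint windows of length `w`, in decreasing order, so that `recombine` can
    -- move the topmost window from one family to another.
    data Separated : List ℤ → Set where
      []   : Separated []
      [-]  : ∀ {a} → Separated (a ∷ [])
      _∷_  : ∀ {a b U} → b + w ≤ a → Separated (b ∷ U) → Separated (a ∷ b ∷ U)

    tail : ∀ {a U} → Separated (a ∷ U) → Separated U
    tail [-]     = []
    tail (_ ∷ s) = s

    translate : ℤ → List ℤ → List ℤ
    translate v = map (_- v)

    separated-translate : ∀ v {U} → Separated U → Separated (translate v U)
    separated-translate v []      = []
    separated-translate v [-]     = [-]
    separated-translate v (_∷_ {a} {b} p s) = certify (≤⇒0≤ p) (eq a b v w) ∷ separated-translate v s
      where
      eq : ∀ a b v w → a - (b + w) ≡ a - v - (b - v + w)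
      eq = solve-∀

    separated-cons : ∀ {c a U} → a + w ≤ c → Separated (a ∷ U) → Separated (c ∷ a ∷ U)
    separated-cons = _∷_

    hits-below : ∀ {a U} y → Separated (a ∷ U) → a ≤ y → ∑ U (λ b → hit w b y) ≡ 0ℤ
    hits-below y [-] p = refl
    hits-below {a} y (_∷_ {b = b} {U} q s) p with hit w b y | hit-view w b y
    ... | _ | below r    = <-irrefl (ℤ.≤-trans (certify w≥0 (eq b w)) (ℤ.≤-trans q p)) r
      where
      eq : ∀ b w → w ≡ b + w - b
      eq = solve-∀
    ... | _ | inside _ r = <-irrefl (ℤ.≤-trans q p) r
    ... | _ | above r    = trans (ℤ.+-identityˡ _) (hits-below y s (ℤ.≤-trans (certify w≥0 (eq b w)) r))
      where
      eq : ∀ b w → w ≡ b + w - b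
      eq = solve-∀

    hits≤1 : ∀ {U} y → Separated U → ∑ U (λ b → hit w b y) ≤ 1ℤ
    hits≤1 {[]}    y s = 0≤⁺ 1
    hits≤1 {a ∷ U} y s with hit w a y | hit-view w a y
    ... | _ | below _    = ℤ.≤-trans (ℤ.≤-reflexive (ℤ.+-identityˡ _)) (hits≤1 y (tail s))
    ... | _ | above _    = ℤ.≤-trans (ℤ.≤-reflexive (ℤ.+-identityˡ _)) (hits≤1 y (tail s))
    ... | _ | inside p _ = ℤ.≤-reflexive (trans (cong (1ℤ +_) (hits-below y s p)) (ℤ.+-identityʳ 1ℤ))

    -- How many grid points have their sum in the window at `a` (see `count-grid`). In this
    -- recursive form, fixing the first coordinate is a translation of the window.
    count : ∀ {k} → Vec (ℕ → ℤ) k → ℤ → ℤ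
    count []       a = hit w a 0ℤ
    count (γ ∷ gs) a = ∑ (range M) (λ u → count gs (a - γ u))

    eval : ∀ {k} → Vec (ℕ → ℤ) k → Vec ℕ k → ℤ
    eval []       []      = 0ℤ
    eval (γ ∷ gs) (u ∷ x) = γ u + eval gs x

    count-grid : ∀ {k} (gs : Vec (ℕ → ℤ) k) a → count gs a ≡ ∑ (grid M k) (λ x → hit w a (eval gs x))
    count-grid []       a = sym (ℤ.+-identityʳ _)
    count-grid {suc k} (γ ∷ gs) a = trans
      (∑-cong (range M) (λ u → trans (count-grid gs (a - γ u)) (∑-cong (grid M k) (λ x → hit-translate w a (γ u) (eval gs x)))))
      (sym (∑-grid M (λ x → hit w a (eval (γ ∷ gs) x))))

    count-step : ∀ {k} γ (gs : Vec (ℕ → ℤ) k) U →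
      ∑ U (count (γ ∷ gs)) ≡ ∑ (range M) (λ u → ∑ (translate (γ u) U) (count gs))
    count-step γ gs U = trans (∑-swap U (range M) (λ a u → count gs (a - γ u)))
      (∑-cong (range M) (λ u → sym (∑-map (_- γ u) U (count gs))))

    count-trivial : ∀ {k} (gs : Vec (ℕ → ℤ) k) {U} → Separated U → ∑ U (count gs) ≤ size M k
    count-trivial []       s = hits≤1 0ℤ s
    count-trivial {suc k} (γ ∷ gs) {U} s = ℤ.≤-trans (ℤ.≤-reflexive (count-step γ gs U))
      (ℤ.≤-trans (∑-mono (range M) (λ u → count-trivial gs (separated-translate (γ u) s)))
        (ℤ.≤-reflexive (trans (∑-range-const M (size M k)) (sym (size-suc M k)))))

    -- What is asked of one summand: its values are symmetric, and for at least half of all `u`,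
    -- those marked by `χ`, the values `γ u` and `- γ u` are at least `w` apart.
    record Spread (γ : ℕ → ℤ) : Set where
      field
        symmetric : ∀ (f : ℤ → ℤ) → ∑ (range M) (λ u → f (γ u)) ≡ ∑ (range M) (λ u → f (- γ u))
        χ         : ℕ → ℤ
        χ-big     : ∀ u → (χ u ≡ 0ℤ) ⊎ ((χ u ≡ 1ℤ) × ((w ≤ γ u + γ u) ⊎ (w ≤ - γ u + - γ u)))
        χ-half    : pos M ≤ pos 2 * ∑ (range M) χ

    module _ (L : ℕ) where

      Θ : ℤ
      Θ = pos 2 * (pos L * pos L)

      θ : ℤ
      θ = Θ - 1ℤ

      -- Concave with second difference -2, zero at 0, and maximal at `L`, where its value is `L²`.
      ψ : ℤ → ℤ
      ψ r = r * (pos 2 * pos L - r)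

      -- A supersolution of the lazy walk recursion, small at r ≪ L once k ≫ L².
      Γ : ℕ → ℤ → ℤ
      Γ k r = r * pow Θ k + pos L * pow θ k * ψ r

      module _ (1≤L : 1 ℕ.≤ L) where

        L≥1 : 1ℤ ≤ pos L
        L≥1 = +≤+ 1≤L
        Θ≥0 : 0ℤ ≤ Θ
        Θ≥0 = 0≤* (0≤⁺ 2) (0≤* (0≤⁺ L) (0≤⁺ L))
        λ≥0 : 0ℤ ≤ θ
        λ≥0 = subst (0ℤ ≤_) (eq (pos L)) (0≤+ (0≤+ (0≤* (0≤⁺ 2) (0≤² (pos L - 1ℤ))) (0≤* (0≤⁺ 4) (≤⇒0≤ L≥1))) (0≤⁺ 1))
          where
          eq : ∀ L → pos 2 * ((L - 1ℤ) * (L - 1ℤ)) + pos 4 * (L - 1ℤ) + 1ℤ ≡ pos 2 * (L * L) - 1ℤ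
          eq = solve 1 (λ L → con (pos 2) :* ((L :- con 1ℤ) :* (L :- con 1ℤ)) :+ con (pos 4) :* (L :- con 1ℤ) :+ con 1ℤ := con (pos 2) :* (L :* L) :- con 1ℤ) refl

        Bound : ∀ {k} → Vec (ℕ → ℤ) k → Set
        Bound {k} gs = ∀ U → Separated U → length U ℕ.≤ L →
          pos L * pow Θ k * ∑ U (count gs) ≤ size M k * Γ k (pos (length U))

        -- For `L` windows disjointness is enough: they hold at most the whole grid, and `Γ` at `L`
        -- is at least `L * Θ^k`.
        bound-full : ∀ {k} (gs : Vec (ℕ → ℤ) k) U → Separated U → length U ≡ L →
          pos L * pow Θ k * ∑ U (count gs) ≤ size M k * Γ k (pos (length U))
        bound-full {k} gs U s refl = ℤ.≤-trans
          (*-monoˡ (pos L * pow Θ k) (0≤* (0≤⁺ L) (pow≥0 Θ≥0 k)) (count-trivial gs s))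
          (certify (0≤* (0≤⁺ (length (grid M k))) (0≤* (0≤* (0≤⁺ L) (pow≥0 λ≥0 k)) (0≤* (0≤⁺ L) (0≤⁺ L))))
            (eq (pos L) (pow Θ k) (pow θ k) (size M k)))
          where
          eq : ∀ L p q n → n * (L * q * (L * L)) ≡ n * (L * p + L * q * (L * (pos 2 * L - L))) - L * p * n
          eq = solve 4 (λ L p q n → n :* (L :* q :* (L :* L)) := n :* (L :* p :+ L :* q :* (L :* (con (pos 2) :* L :- L))) :- L :* p :* n) refl

        -- The two translates of a family by ±v (2v ≥ w) recombine into a family with one
        -- member more and a family with one member less.
        recombine : ∀ {k} (gs : Vec (ℕ → ℤ) k) → Bound gs → ∀ a U → Separated (a ∷ U) → suc (length U) ℕ.< L →
          ∀ v → w ≤ v + v →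
          pos L * pow Θ k * (∑ (translate v (a ∷ U)) (count gs) + ∑ (translate (- v) (a ∷ U)) (count gs))
          ≤ size M k * (pos 2 * Γ k (pos (suc (length U))) - pos 2 * (pos L * pow θ k))
        recombine {k} gs bound a U s r<L v w≤2v = certify
          (0≤+ (≤⇒0≤ more) (≤⇒0≤ less))
          (eq (pos L) (pow Θ k) (pow θ k) (size M k) (pos (length U))
              (count gs (a - v)) (∑ (translate v U) (count gs)) (count gs (a - - v)) (∑ (translate (- v) U) (count gs)))
          where
          len : ∀ v → length (translate v U) ≡ length U
          len v = length-map (_- v) U
          more : pos L * pow Θ k * (count gs (a - - v) + (count gs (a - v) + ∑ (translate v U) (count gs)))
                 ≤ size M k * Γ k (pos (suc (suc (length U))))
          more = subst (λ l → pos L * pow Θ k * (count gs (a - - v) + (count gs (a - v) + ∑ (translate v U) (count gs)))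
                               ≤ size M k * Γ k (pos (suc (suc l)))) (len v)
            (bound ((a - - v) ∷ translate v (a ∷ U))
              (separated-cons (certify (≤⇒0≤ w≤2v) (eq₁ a v w)) (separated-translate v s))
              (subst (λ l → suc (suc l) ℕ.≤ L) (sym (len v)) r<L))
            where
            eq₁ : ∀ a v w → v + v - w ≡ a - - v - (a - v + w)
            eq₁ = solve-∀
          less : pos L * pow Θ k * ∑ (translate (- v) U) (count gs) ≤ size M k * Γ k (pos (length U))
          less = subst (λ l → pos L * pow Θ k * ∑ (translate (- v) U) (count gs) ≤ size M k * Γ k (pos l)) (len (- v))
            (bound (translate (- v) U) (separated-translate (- v) (tail s))
              (subst (ℕ._≤ L) (sym (len (- v))) (ℕ.<⇒≤ (ℕ.<⇒≤ r<L))))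
          eq : ∀ L p q n l A B C D →
            n * ((pos 2 + l) * p + L * q * ((pos 2 + l) * (pos 2 * L - (pos 2 + l)))) - L * p * (C + (A + B))
            + (n * (l * p + L * q * (l * (pos 2 * L - l))) - L * p * D)
            ≡ n * (pos 2 * ((1ℤ + l) * p + L * q * ((1ℤ + l) * (pos 2 * L - (1ℤ + l)))) - pos 2 * (L * q))
              - L * p * (A + B + (C + D))
          eq = solve 9 (λ L p q n l A B C D → n :* ((con (pos 2) :+ l) :* p :+ L :* q :* ((con (pos 2) :+ l) :* (con (pos 2) :* L :- (con (pos 2) :+ l)))) :- L :* p :* (C :+ (A :+ B)) :+ (n :* (l :* p :+ L :* q :* (l :* (con (pos 2) :* L :- l))) :- L :* p :* D) := n :* (con (pos 2) :* ((con 1ℤ :+ l) :* p :+ L :* q :* ((con 1ℤ :+ l) :* (con (pos 2) :* L :- (con 1ℤ :+ l)))) :- con (pos 2) :* (L :* q)) :- L :* p :* (A :+ B :+ (C :+ D))) refl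

        -- For a marked `u`, recombination bounds the two translates by `Γ(r+1) + Γ(r-1)` instead of
        -- `2 Γ(r)`, a gain of `2 L θ^k` from the concavity of `ψ`. At least half of all `u` are
        -- marked, so on average `ψ(r)` drops by 1/2. As `ψ ≤ L²`, this is at least the fraction
        -- `1 / Θ` of it, which is the passage from `θ^k` to `θ^(k+1)`.
        bound-step : ∀ {k} γ (gs : Vec (ℕ → ℤ) k) → Spread γ → Bound gs → Bound (γ ∷ gs)
        bound-step {k} γ gs sp bound U s r≤L with ℕ.m≤n⇒m<n∨m≡n r≤L
        ... | inj₂ e   = bound-full (γ ∷ gs) U s e
        ... | inj₁ r<L = go U s r<L
          where
          open Spread sp
          n q p : ℤ
          n = size M k
          q = pow θ k
          p = pow Θ k
          go : ∀ U → Separated U → length U ℕ.< L →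
               pos L * pow Θ (suc k) * ∑ U (count (γ ∷ gs)) ≤ size M (suc k) * Γ (suc k) (pos (length U))
          go []      s r<L = ℤ.≤-reflexive (eq (pos L) (pow Θ (suc k)) (pow θ (suc k)) (size M (suc k)))
            where
            eq : ∀ L p q n → L * p * 0ℤ ≡ n * (0ℤ * p + L * q * (0ℤ * (pos 2 * L - 0ℤ)))
            eq = solve 4 (λ L p q n → L :* p :* con 0ℤ := n :* (con 0ℤ :* p :+ L :* q :* (con 0ℤ :* (con (pos 2) :* L :- con 0ℤ)))) refl
          go (a ∷ U) s r<L = *-cancelˡ (pos 2) (+≤+ (ℕ.s≤s ℕ.z≤n)) (certify
              (0≤+ (0≤+ (0≤* Θ≥0 (≤⇒0≤ total)) (0≤* (0≤* Θ≥0 (0≤* (0≤⁺ (length (grid M k))) (0≤* (0≤⁺ L) (pow≥0 λ≥0 k)))) (≤⇒0≤ χ-half)))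
                   (0≤* (0≤* (0≤* (0≤⁺ M) (0≤⁺ (length (grid M k)))) (0≤* (0≤⁺ L) (pow≥0 λ≥0 k))) (0≤* (0≤⁺ 2) (0≤² (pos L - r)))))
              (trans (eq (pos L) p q n (pos M) r (∑ V (count (γ ∷ gs))) X)
                     (cong (λ z → pos 2 * (z * Γ (suc k) r) - pos 2 * (pos L * (Θ * p) * ∑ V (count (γ ∷ gs)))) (sym (size-suc M k)))))
            where
            V = a ∷ U
            r X : ℤ
            r = pos (length V)
            X = ∑ (range M) χ
            f₋ f₊ : ℕ → ℤ
            f₋ u = ∑ (translate (γ u) V) (count gs)
            f₊ u = ∑ (translate (- γ u) V) (count gs)
            rhs : ℕ → ℤ
            rhs u = n * (pos 2 * Γ k r) - n * (pos 2 * (pos L * q)) * χ u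
            pair : ∀ u → pos L * p * (f₋ u + f₊ u) ≤ rhs u
            pair u with χ-big u
            ... | inj₁ e rewrite e = certify (0≤+ (≤⇒0≤ (shifted (γ u))) (≤⇒0≤ (shifted (- γ u))))
                    (eq′ (pos L) p n (Γ k r) (n * (pos 2 * (pos L * q))) (f₋ u) (f₊ u))
              where
              shifted : ∀ v → pos L * p * ∑ (translate v V) (count gs) ≤ n * Γ k r
              shifted v = subst (λ l → pos L * p * ∑ (translate v V) (count gs) ≤ n * Γ k (pos l)) (length-map (_- v) V)
                (bound (translate v V) (separated-translate v s) (subst (ℕ._≤ L) (sym (length-map (_- v) V)) (ℕ.<⇒≤ r<L)))
              eq′ : ∀ L p n g c x y → n * g - L * p * x + (n * g - L * p * y) ≡ n * (pos 2 * g) - c * 0ℤ - L * p * (x + y)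
              eq′ = solve 7 (λ L p n g c x y → n :* g :- L :* p :* x :+ (n :* g :- L :* p :* y) := n :* (con (pos 2) :* g) :- c :* con 0ℤ :- L :* p :* (x :+ y)) refl
            ... | inj₂ (e , inj₁ big) rewrite e = ℤ.≤-trans (recombine gs bound a U s r<L (γ u) big)
                    (ℤ.≤-reflexive (eq′ n (pos 2 * Γ k r) (pos 2 * (pos L * q))))
              where
              eq′ : ∀ n g c → n * (g - c) ≡ n * g - n * c * 1ℤ
              eq′ = solve-∀
            ... | inj₂ (e , inj₂ big) rewrite e = ℤ.≤-trans
                    (subst (λ z → pos L * p * z ≤ n * (pos 2 * Γ k r - pos 2 * (pos L * q)))
                       (trans (cong (λ v → f₊ u + ∑ (translate v V) (count gs)) (ℤ.neg-involutive (γ u))) (ℤ.+-comm (f₊ u) (f₋ u)))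
                       (recombine gs bound a U s r<L (- γ u) big))
                    (ℤ.≤-reflexive (eq′ n (pos 2 * Γ k r) (pos 2 * (pos L * q))))
              where
              eq′ : ∀ n g c → n * (g - c) ≡ n * g - n * c * 1ℤ
              eq′ = solve-∀
            doubled : pos 2 * ∑ V (count (γ ∷ gs)) ≡ ∑ (range M) (λ u → f₋ u + f₊ u)
            doubled = trans (eq′ (∑ V (count (γ ∷ gs)))) (trans
              (cong₂ _+_ (count-step γ gs V) (trans (count-step γ gs V) (symmetric (λ v → ∑ (translate v V) (count gs)))))
              (sym (∑-+ (range M) f₋ f₊)))
              where
              eq′ : ∀ x → pos 2 * x ≡ x + x
              eq′ = solve-∀
            total : pos L * p * (pos 2 * ∑ V (count (γ ∷ gs)))
                    ≤ pos M * (n * (pos 2 * Γ k r)) - n * (pos 2 * (pos L * q)) * X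
            total = ℤ.≤-trans (ℤ.≤-reflexive (trans (cong (pos L * p *_) doubled) (sym (∑-* (range M) (pos L * p) (λ u → f₋ u + f₊ u)))))
              (ℤ.≤-trans (∑-mono (range M) pair)
                (ℤ.≤-reflexive (trans (∑-- (range M) (λ _ → n * (pos 2 * Γ k r)) (λ u → n * (pos 2 * (pos L * q)) * χ u))
                  (cong₂ _-_ (∑-range-const M (n * (pos 2 * Γ k r))) (∑-* (range M) (n * (pos 2 * (pos L * q))) χ)))))
            eq : ∀ L p q n M r S X →
              let Θ = pos 2 * (L * L)
                  g = r * p + L * q * (r * (pos 2 * L - r)) in
              Θ * (M * (n * (pos 2 * g)) - n * (pos 2 * (L * q)) * X - L * p * (pos 2 * S))
              + Θ * (n * (L * q)) * (pos 2 * X - M)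
              + M * n * (L * q) * (pos 2 * ((L - r) * (L - r)))
              ≡ pos 2 * (M * n * (r * (Θ * p) + L * ((Θ - 1ℤ) * q) * (r * (pos 2 * L - r)))) - pos 2 * (L * (Θ * p) * S)
            eq = solve 8 (λ L p q n M r S X →
              let Θ = con (pos 2) :* (L :* L)
                  g = r :* p :+ L :* q :* (r :* (con (pos 2) :* L :- r)) in
              Θ :* (M :* (n :* (con (pos 2) :* g)) :- n :* (con (pos 2) :* (L :* q)) :* X :- L :* p :* (con (pos 2) :* S))
              :+ Θ :* (n :* (L :* q)) :* (con (pos 2) :* X :- M)
              :+ M :* n :* (L :* q) :* (con (pos 2) :* ((L :- r) :* (L :- r)))
              := con (pos 2) :* (M :* n :* (r :* (Θ :* p) :+ L :* ((Θ :- con 1ℤ) :* q) :* (r :* (con (pos 2) :* L :- r)))) :- con (pos 2) :* (L :* (Θ :* p) :* S)) refl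

        bound-all : ∀ {k} (gs : Vec (ℕ → ℤ) k) → All Spread gs → Bound gs
        bound-all []       []        U s r≤L with U
        ... | []    = ℤ.≤-reflexive (eq (pos L))
          where
          eq : ∀ L → L * 1ℤ * 0ℤ ≡ 1ℤ * (0ℤ * 1ℤ + L * 1ℤ * (0ℤ * (pos 2 * L - 0ℤ)))
          eq = solve 1 (λ L → L :* con 1ℤ :* con 0ℤ := con 1ℤ :* (con 0ℤ :* con 1ℤ :+ L :* con 1ℤ :* (con 0ℤ :* (con (pos 2) :* L :- con 0ℤ)))) refl
        ... | a ∷ V = ℤ.≤-trans (*-monoˡ (pos L * 1ℤ) (0≤* (0≤⁺ L) (0≤⁺ 1)) (hits≤1 0ℤ s))
              (certify (0≤+ (0≤+ (0≤* (0≤⁺ L) (0≤* (0≤⁺ (length (a ∷ V))) (≤⇒0≤ r≤)))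
                           (0≤* (0≤⁺ L) (0≤+ (0≤* (≤⇒0≤ L≥1) (0≤⁺ (length (a ∷ V)))) (0≤⁺ (length V)))))
                         (0≤⁺ (length (a ∷ V))))
                 (eq (pos L) (pos (length V))))
          where
          r≤ : pos (length (a ∷ V)) ≤ pos L
          r≤ = +≤+ r≤L
          eq : ∀ L l → L * ((1ℤ + l) * (L - (1ℤ + l))) + L * ((L - 1ℤ) * (1ℤ + l) + l) + (1ℤ + l)
               ≡ 1ℤ * ((1ℤ + l) * 1ℤ + L * 1ℤ * ((1ℤ + l) * (pos 2 * L - (1ℤ + l)))) - L * 1ℤ * 1ℤ
          eq = solve 2 (λ L l → L :* ((con 1ℤ :+ l) :* (L :- (con 1ℤ :+ l))) :+ L :* ((L :- con 1ℤ) :* (con 1ℤ :+ l) :+ l) :+ (con 1ℤ :+ l) := con 1ℤ :* ((con 1ℤ :+ l) :* con 1ℤ :+ L :* con 1ℤ :* ((con 1ℤ :+ l) :* (con (pos 2) :* L :- (con 1ℤ :+ l)))) :- L :* con 1ℤ :* con 1ℤ) refl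
        bound-all (γ ∷ gs) (sp ∷ sps) = bound-step γ gs sp (bound-all gs sps)

    windows : ℤ → ℕ → List ℤ
    windows a zero    = []
    windows a (suc i) = (a + pos i * w) ∷ windows a i

    windows-separated : ∀ a i → Separated (windows a i)
    windows-separated a zero          = []
    windows-separated a (suc zero)    = [-]
    windows-separated a (suc (suc i)) = ℤ.≤-reflexive (eq a (pos i) w) ∷ windows-separated a (suc i)
      where
      eq : ∀ a i w → a + i * w + w ≡ a + (1ℤ + i) * w
      eq = solve-∀

    length-windows : ∀ a i → length (windows a i) ≡ i
    length-windows a zero    = refl
    length-windows a (suc i) = cong suc (length-windows a i)

    hit≥0 : ∀ a y → 0ℤ ≤ hit w a y
    hit≥0 a y with hit w a y | hit-view w a y
    ... | _ | below _    = 0≤⁺ 0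
    ... | _ | above _    = 0≤⁺ 0
    ... | _ | inside _ _ = 0≤⁺ 1

    windows-cover : ∀ a i y → a ≤ y → 1ℤ + y ≤ a + pos i * w → 1ℤ ≤ ∑ (windows a i) (λ b → hit w b y)
    windows-cover a zero    y p q = <-irrefl p (ℤ.≤-trans q (ℤ.≤-reflexive (eq a w)))
      where
      eq : ∀ a w → a + 0ℤ * w ≡ a
      eq = solve-∀
    windows-cover a (suc i) y p q with hit w (a + pos i * w) y | hit-view w (a + pos i * w) y
    ... | _ | inside _ _ = certify (∑-0≤ (windows a i) (λ b → hit≥0 b y)) (eq (∑ (windows a i) (λ b → hit w b y)))
      where
      eq : ∀ s → s ≡ 1ℤ + s - 1ℤ
      eq = solve-∀
    ... | _ | below r = ℤ.≤-trans (windows-cover a i y p r) (ℤ.≤-reflexive (sym (ℤ.+-identityˡ _)))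
    ... | _ | above r = <-irrefl r (ℤ.≤-trans q (ℤ.≤-reflexive (eq a (pos i) w)))
      where
      eq : ∀ a i w → a + (1ℤ + i) * w ≡ a + i * w + w
      eq = solve-∀

    -- In `Γ` at `r = W` the first term amounts to a fraction `W / L = 1 / 2d` of the grid. By
    -- Bernoulli's inequality `k ≥ Θ²` gives `Θ θ^k ≤ Θ^k`, so the second term amounts to at most
    -- `2 L W / Θ`, which is `1 / 2d` again.
    anti-concentration : ∀ W d → 1 ℕ.≤ W → 1 ℕ.≤ d →
      let L = 2 ℕ.* (W ℕ.* d) in
      ∀ k → (2 ℕ.* (L ℕ.* L)) ℕ.* (2 ℕ.* (L ℕ.* L)) ℕ.≤ k →
      (gs : Vec (ℕ → ℤ) k) → All Spread gs → ∀ a →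
      pos d * ∑ (windows a W) (count gs) ≤ size M k
    anti-concentration W d 1≤W 1≤d k large gs spread a =
      *-cancelˡ (pos 2 * pos L * p) (*-mono (0≤⁺ 1) (0≤⁺ 1) (*-mono (0≤⁺ 1) (0≤⁺ 1) 1≤2 (L≥1 L 1≤L)) p≥1) (certify
        (0≤+ (0≤+ (0≤* (0≤* (0≤⁺ 2) (0≤⁺ d)) (≤⇒0≤ bound)) (0≤* (0≤* N≥0 L≥0) (≤⇒0≤ small)))
             (0≤* (0≤* (0≤* (0≤* (0≤⁺ 2) (0≤⁺ d)) N≥0) (0≤* L≥0 q≥0)) (0≤² (pos W))))
        (eq (pos W) (pos d) (pos L) p q N X L≡))
      where
      L : ℕ
      L = 2 ℕ.* (W ℕ.* d)
      1≤2 : 1ℤ ≤ pos 2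
      1≤2 = +≤+ (ℕ.s≤s ℕ.z≤n)
      W≤L : W ℕ.≤ L
      W≤L = ℕ.≤-trans (ℕ.m≤m*n W d {{ℕ.>-nonZero 1≤d}}) (ℕ.m≤n*m (W ℕ.* d) 2)
      1≤L : 1 ℕ.≤ L
      1≤L = ℕ.≤-trans 1≤W W≤L
      L≥0 = 0≤⁺ L
      N p q X m : ℤ
      N = size M k
      p = pow (Θ L) k
      q = pow (θ L) k
      m = θ L
      X = ∑ (windows a W) (count gs)
      N≥0 : 0ℤ ≤ N
      N≥0 = 0≤⁺ (length (grid M k))
      L≡ : pos L ≡ pos 2 * (pos W * pos d)
      L≡ = trans (ℤ.pos-* 2 (W ℕ.* d)) (cong (pos 2 *_) (ℤ.pos-* W d))
      q≥0 : 0ℤ ≤ q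
      q≥0 = pow≥0 (λ≥0 L 1≤L) k
      m≥1 : 1ℤ ≤ m
      m≥1 = certify (0≤+ (0≤* (0≤⁺ 2) (0≤² (pos L - 1ℤ))) (0≤* (0≤⁺ 4) (≤⇒0≤ (L≥1 L 1≤L)))) (eq₁ (pos L))
        where
        eq₁ : ∀ L → pos 2 * ((L - 1ℤ) * (L - 1ℤ)) + pos 4 * (L - 1ℤ) ≡ pos 2 * (L * L) - 1ℤ - 1ℤ
        eq₁ = solve 1 (λ L → con (pos 2) :* ((L :- con 1ℤ) :* (L :- con 1ℤ)) :+ con (pos 4) :* (L :- con 1ℤ) := con (pos 2) :* (L :* L) :- con 1ℤ :- con 1ℤ) refl
      Θ≡ : 1ℤ + m ≡ Θ L
      Θ≡ = eq₁ (Θ L)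
        where
        eq₁ : ∀ x → 1ℤ + (x - 1ℤ) ≡ x
        eq₁ = solve-∀
      p≥1 : 1ℤ ≤ p
      p≥1 = pow≥1 (subst (1ℤ ≤_) Θ≡ (ℤ.+-mono-≤ (ℤ.≤-refl {1ℤ}) (1≤⇒0≤ m≥1))) k
      ΘΘ≤k : Θ L * Θ L ≤ pos k
      ΘΘ≤k = ℤ.≤-trans (ℤ.≤-reflexive (sym (trans (ℤ.pos-* (2 ℕ.* (L ℕ.* L)) (2 ℕ.* (L ℕ.* L))) (cong₂ _*_ e e)))) (+≤+ large)
        where
        e : pos (2 ℕ.* (L ℕ.* L)) ≡ Θ L
        e = trans (ℤ.pos-* 2 (L ℕ.* L)) (cong (pos 2 *_) (ℤ.pos-* L L))
      small : Θ L * q ≤ p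
      small = *-cancelˡ m m≥1 (ℤ.≤-trans
        (certify (0≤+ (0≤* (≤⇒0≤ ΘΘ≤k) q≥0) (0≤* (0≤+ (Θ≥0 L 1≤L) (1≤⇒0≤ m≥1)) q≥0)) (eq₁ (Θ L) (pos k) q))
        (subst (λ z → (m + pos k) * q ≤ m * pow z k) Θ≡ (bernoulli m (1≤⇒0≤ m≥1) k)))
        where
        eq₁ : ∀ x k q → (k - x * x) * q + (x + (x - 1ℤ)) * q ≡ (x - 1ℤ + k) * q - (x - 1ℤ) * (x * q)
        eq₁ = solve 3 (λ x k q → (k :- x :* x) :* q :+ (x :+ (x :- con 1ℤ)) :* q := (x :- con 1ℤ :+ k) :* q :- (x :- con 1ℤ) :* (x :* q)) refl
      bound : pos L * p * X ≤ N * Γ L k (pos W)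
      bound = subst (λ l → pos L * p * X ≤ N * Γ L k (pos l)) (length-windows a W)
        (bound-all L 1≤L gs spread (windows a W) (windows-separated a W) (subst (ℕ._≤ L) (sym (length-windows a W)) W≤L))
      eq′ : ∀ W d p q N X → let L = pos 2 * (W * d) in
        pos 2 * d * (N * (W * p + L * q * (W * (pos 2 * L - W))) - L * p * X)
        + N * L * (p - pos 2 * (L * L) * q) + pos 2 * d * N * (L * q) * (W * W)
        ≡ pos 2 * L * p * N - pos 2 * L * p * (d * X)
      eq′ = solve 6 (λ W d p q N X → let L = con (pos 2) :* (W :* d) in
        con (pos 2) :* d :* (N :* (W :* p :+ L :* q :* (W :* (con (pos 2) :* L :- W))) :- L :* p :* X)
        :+ N :* L :* (p :- con (pos 2) :* (L :* L) :* q) :+ con (pos 2) :* d :* N :* (L :* q) :* (W :* W)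
        := con (pos 2) :* L :* p :* N :- con (pos 2) :* L :* p :* (d :* X)) refl
      eq : ∀ W d L p q N X → L ≡ pos 2 * (W * d) →
        pos 2 * d * (N * (W * p + L * q * (W * (pos 2 * L - W))) - L * p * X)
        + N * L * (p - pos 2 * (L * L) * q) + pos 2 * d * N * (L * q) * (W * W)
        ≡ pos 2 * L * p * N - pos 2 * L * p * (d * X)
      eq W d _ p q N X refl = eq′ W d p q N X

-- The closed polygon and its l1 metric

module Curve where

  open Prelude
  open Sums
  open Grid
  open import Data.Integer using (∣_∣; -≤+)
  open import Data.Nat.Divisibility using (divides)

  abs : ℤ → ℤ
  abs a = pos ∣ a ∣

  abs≥0 : ∀ a → 0ℤ ≤ abs a
  abs≥0 a = 0≤⁺ ∣ a ∣

  ≤abs : ∀ a → a ≤ abs a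
  ≤abs (pos n)     = ℤ.≤-refl
  ≤abs -[1+ n ]    = -≤+

  -≤abs : ∀ a → - a ≤ abs a
  -≤abs a = subst (- a ≤_) (cong pos (ℤ.∣-i∣≡∣i∣ a)) (≤abs (- a))

  abs-* : ∀ a b → abs (a * b) ≡ abs a * abs b
  abs-* a b = trans (cong pos (ℤ.abs-* a b)) (ℤ.pos-* ∣ a ∣ ∣ b ∣)

  abs-flip : ∀ a b → abs (a - b) ≡ abs (b - a)
  abs-flip a b = cong pos (ℤ.∣i-j∣≡∣j-i∣ a b)

  abs-triangle : ∀ a b c → abs (a - c) ≤ abs (a - b) + abs (b - c)
  abs-triangle a b c = ∣∣≤
    (ℤ.≤-trans (ℤ.≤-reflexive (eq a b c)) (ℤ.+-mono-≤ (≤abs (a - b)) (≤abs (b - c))))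
    (ℤ.≤-trans (ℤ.≤-reflexive (eq′ a b c)) (ℤ.+-mono-≤ (-≤abs (a - b)) (-≤abs (b - c))))
    where
    eq : ∀ a b c → a - c ≡ a - b + (b - c)
    eq = solve-∀
    eq′ : ∀ a b c → - (a - c) ≡ - (a - b) + - (b - c)
    eq′ = solve-∀

  %-shift≢ : ∀ Q .{{_ : ℕ.NonZero Q}} x d → 1 ℕ.≤ d → d ℕ.< Q → (x ℕ.+ d) ℕ.% Q ≢ x ℕ.% Q
  %-shift≢ Q x d 1≤d d<Q e = ℕ.<-irrefl refl (ℕ.<-≤-trans between (ℕ.*-monoˡ-≤ Q above))
    where
    a b : ℕ
    a = x ℕ./ Q
    b = (x ℕ.+ d) ℕ./ Q
    multiples : b ℕ.* Q ≡ a ℕ.* Q ℕ.+ d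
    multiples = ℕ.+-cancelˡ-≡ (x ℕ.% Q) _ _ (trans (cong (ℕ._+ b ℕ.* Q) (sym e))
      (trans (sym (ℕ.m≡m%n+[m/n]*n (x ℕ.+ d) Q))
        (trans (cong (ℕ._+ d) (ℕ.m≡m%n+[m/n]*n x Q)) (ℕ.+-assoc (x ℕ.% Q) (a ℕ.* Q) d))))
    above : suc a ℕ.≤ b
    above = ℕ.*-cancelʳ-< Q a b (subst (a ℕ.* Q ℕ.<_) (sym multiples) (ℕ.m<m+n (a ℕ.* Q) 1≤d))
    between : b ℕ.* Q ℕ.< suc a ℕ.* Q
    between = subst₂ ℕ._<_ (sym multiples) (ℕ.+-comm (a ℕ.* Q) Q) (ℕ.+-monoʳ-< (a ℕ.* Q) d<Q)

  ∑∑-mono : ∀ {A B : Set} (xs : List A) (ys : List B) {f g : A → B → ℤ} → (∀ x y → f x y ≤ g x y) →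
            ∑ xs (λ x → ∑ ys (f x)) ≤ ∑ xs (λ x → ∑ ys (g x))
  ∑∑-mono xs ys p = ∑-mono xs (λ x → ∑-mono ys (p x))

  ∑∑-product : ∀ {A B : Set} (xs : List A) (ys : List B) (f : A → ℤ) (g : B → ℤ) →
               ∑ xs (λ x → ∑ ys (λ y → f x * g y)) ≡ ∑ xs f * ∑ ys g
  ∑∑-product xs ys f g = trans (∑-cong xs (λ x → trans (∑-* ys (f x) g) (ℤ.*-comm (f x) (∑ ys g))))
    (trans (∑-* xs (∑ ys g) f) (ℤ.*-comm (∑ ys g) (∑ xs f)))

  -- A closed curve in ℤ^Q visiting n times the unit vectors in turn along straight segments:
  -- its point at time u is Σ_{i<n} of the unit vector number ⌊(u+i)/n⌋ mod Q.
  module Polygon (Q n : ℕ) .{{_ : ℕ.NonZero Q}} .{{_ : ℕ.NonZero n}} where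

    M : ℕ
    M = Q ℕ.* n

    -- A point is represented by the linear functional it induces on functions of the vertex number;
    -- `coord` recovers its coordinates.
    point : ℕ → (ℕ → ℤ) → ℤ
    point u f = ∑ (range n) (λ i → f ((u ℕ.+ i) ℕ./ n))

    ι : ℕ → ℕ → ℤ
    ι b t with t ℕ.% Q ℕ.≟ b
    ... | yes _ = 1ℤ
    ... | no  _ = 0ℤ

    ι-yes : ∀ {b t} → t ℕ.% Q ≡ b → ι b t ≡ 1ℤ
    ι-yes {b} {t} e with t ℕ.% Q ℕ.≟ b
    ... | yes _ = refl
    ... | no ¬e = ⊥-elim (¬e e)

    ι-no : ∀ {b t} → t ℕ.% Q ≢ b → ι b t ≡ 0ℤ
    ι-no {b} {t} ¬e with t ℕ.% Q ℕ.≟ b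
    ... | yes e = ⊥-elim (¬e e)
    ... | no  _ = refl

    coord : ℕ → ℕ → ℤ
    coord b u = point u (ι b)

    /-shift : ∀ u t i → (u ℕ.+ t ℕ.* n ℕ.+ i) ℕ./ n ≡ (u ℕ.+ i) ℕ./ n ℕ.+ t
    /-shift u t i = trans (cong (ℕ._/ n) (trans (ℕ.+-assoc u (t ℕ.* n) i)
        (trans (cong (u ℕ.+_) (ℕ.+-comm (t ℕ.* n) i)) (sym (ℕ.+-assoc u i (t ℕ.* n))))))
      (trans (ℕ.+-distrib-/-∣ʳ (u ℕ.+ i) (divides t refl))
        (cong ((u ℕ.+ i) ℕ./ n ℕ.+_) (ℕ.m*n/n≡m t n)))

    point-shift : ∀ u t f → point (u ℕ.+ t ℕ.* n) f ≡ point u (λ a → f (a ℕ.+ t))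
    point-shift u t f = ∑-cong (range n) (λ i → cong f (/-shift u t i))

    point-cong : ∀ u {f g : ℕ → ℤ} → (∀ a → f a ≡ g a) → point u f ≡ point u g
    point-cong u p = ∑-cong (range n) (λ i → p ((u ℕ.+ i) ℕ./ n))

    point-period : ∀ u {f} → Periodic Q f → point (u ℕ.+ M) f ≡ point u f
    point-period u {f} per = trans (point-shift u Q f) (point-cong u per)

    point-suc : ∀ u f → point (suc u) f + f (u ℕ./ n) ≡ point u f + f (suc (u ℕ./ n))
    point-suc u f = trans (ℤ.+-comm (point (suc u) f) (f (u ℕ./ n)))
      (trans (cong₂ _+_ (cong (λ z → f (z ℕ./ n)) (sym (ℕ.+-identityʳ u)))
                        (∑-cong (range n) (λ i → cong (λ z → f (z ℕ./ n)) (sym (ℕ.+-suc u i)))))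
        (trans (∑-range-suc n (λ i → f ((u ℕ.+ i) ℕ./ n)))
          (trans (ℤ.+-comm (f ((u ℕ.+ n) ℕ./ n)) (point u f)) (cong (λ z → point u f + f z) last))))
      where
      last : (u ℕ.+ n) ℕ./ n ≡ suc (u ℕ./ n)
      last = trans (ℕ.m/n≡1+[m∸n]/n (ℕ.m≤n+m n u)) (cong (λ z → suc (z ℕ./ n)) (ℕ.m+n∸n≡m u n))

    %-periodic : ∀ {f : ℕ → ℤ} → Periodic Q f → ∀ t → f (t ℕ.% Q) ≡ f t
    %-periodic {f} per t = trans (sym (go (t ℕ./ Q) (t ℕ.% Q))) (cong f (sym (ℕ.m≡m%n+[m/n]*n t Q)))
      where
      go : ∀ m r → f (r ℕ.+ m ℕ.* Q) ≡ f r
      go zero    r = cong f (ℕ.+-identityʳ r)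
      go (suc m) r = trans (cong f (trans (cong (r ℕ.+_) (ℕ.+-comm Q (m ℕ.* Q))) (sym (ℕ.+-assoc r (m ℕ.* Q) Q)))) (trans (per _) (go m r))

    ∑-ι : ∀ (f : ℕ → ℤ) m t → t ℕ.% Q ℕ.< m → ∑ (range m) (λ b → f b * ι b t) ≡ f (t ℕ.% Q)
    ∑-ι f (suc m) t p with t ℕ.% Q ℕ.≟ m
    ... | yes e = trans (cong₂ _+_ (trans (ℤ.*-identityʳ (f m)) (cong f (sym e)))
                    (trans (∑-cong∈ (range m) (λ b b∈ → trans (cong (f b *_) (ι-no (λ e′ → ℕ.<-irrefl (trans (sym e′) e) (∈-range⁻ b∈)))) (ℤ.*-zeroʳ (f b))))
                      (∑-0 (range m)))) (ℤ.+-identityʳ _)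
    ... | no ¬e = trans (cong₂ _+_ (ℤ.*-zeroʳ (f m)) (∑-ι f m t (ℕ.≤∧≢⇒< (ℕ.s≤s⁻¹ p) ¬e))) (ℤ.+-identityˡ _)

    point-coords : ∀ u {f} → Periodic Q f → point u f ≡ ∑ (range Q) (λ b → f b * coord b u)
    point-coords u {f} per = trans
      (∑-cong (range n) (λ i → sym (trans (∑-ι f Q (t i) (ℕ.m%n<n (t i) Q)) (%-periodic per (t i)))))
      (trans (∑-swap (range n) (range Q) (λ i b → f b * ι b (t i)))
        (∑-cong (range Q) (λ b → ∑-* (range n) (f b) (λ i → ι b (t i)))))
      where
      t : ℕ → ℕ
      t i = (u ℕ.+ i) ℕ./ n

    ι-periodic : ∀ b → Periodic Q (ι b)
    ι-periodic b t with t ℕ.% Q ℕ.≟ b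
    ... | yes e = ι-yes (trans (ℕ.[m+n]%n≡m%n t Q) e)
    ... | no ¬e = ι-no (λ e → ¬e (trans (sym (ℕ.[m+n]%n≡m%n t Q)) e))

    ρ : ℕ → ℕ → ℤ
    ρ u v = ∑ (range Q) (λ b → abs (coord b u - coord b v))

    ρ≥0 : ∀ u v → 0ℤ ≤ ρ u v
    ρ≥0 u v = ∑-0≤ (range Q) (λ b → abs≥0 (coord b u - coord b v))

    ρ-refl : ∀ u → ρ u u ≡ 0ℤ
    ρ-refl u = trans (∑-cong (range Q) (λ b → cong abs (ℤ.+-inverseʳ (coord b u)))) (∑-0 (range Q))

    ρ-sym : ∀ u v → ρ u v ≡ ρ v u
    ρ-sym u v = ∑-cong (range Q) (λ b → abs-flip (coord b u) (coord b v))

    ρ-triangle : ∀ u v w → ρ u w ≤ ρ u v + ρ v w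
    ρ-triangle u v w = ℤ.≤-trans (∑-mono (range Q) (λ b → abs-triangle (coord b u) (coord b v) (coord b w)))
      (ℤ.≤-reflexive (∑-+ (range Q) (λ b → abs (coord b u - coord b v)) (λ b → abs (coord b v - coord b w))))

    ρ-period : ∀ u v → ρ (u ℕ.+ M) v ≡ ρ u v
    ρ-period u v = ∑-cong (range Q) (λ b → cong (λ z → abs (z - coord b v)) (point-period u (ι-periodic b)))

    ι-suc : ∀ b t → ι ((b ℕ.+ 1) ℕ.% Q) (t ℕ.+ 1) ≡ ι (b ℕ.% Q) t
    ι-suc b t with t ℕ.% Q ℕ.≟ b ℕ.% Q
    ... | yes e = ι-yes (trans (ℕ.%-distribˡ-+ t 1 Q) (trans (cong (λ z → (z ℕ.+ 1 ℕ.% Q) ℕ.% Q) e) (sym (ℕ.%-distribˡ-+ b 1 Q))))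
    ... | no ¬e = ι-no (λ e → ¬e (trans (back t) (trans (cong (λ z → (z ℕ.+ ℕ.pred Q) ℕ.% Q) e) (sym (back b)))))
      where
      back : ∀ t → t ℕ.% Q ≡ ((t ℕ.+ 1) ℕ.% Q ℕ.+ ℕ.pred Q) ℕ.% Q
      back t = trans (sym (ℕ.[m+n]%n≡m%n t Q)) (trans (cong (ℕ._% Q) (trans (cong (t ℕ.+_) (sym (ℕ.suc-pred Q))) (sym (ℕ.+-assoc t 1 (ℕ.pred Q)))))
        (trans (ℕ.%-distribˡ-+ (t ℕ.+ 1) (ℕ.pred Q) Q) (trans (cong (λ z → (z ℕ.+ ℕ.pred Q ℕ.% Q) ℕ.% Q) (sym (ℕ.m%n%n≡m%n (t ℕ.+ 1) Q)))
          (sym (ℕ.%-distribˡ-+ ((t ℕ.+ 1) ℕ.% Q) (ℕ.pred Q) Q)))))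

    -- Advancing the time by `n` renumbers the unit vectors cyclically, so the sum over the
    -- coordinates is only reordered.
    ρ-shift₁ : ∀ u v → ρ (u ℕ.+ 1 ℕ.* n) (v ℕ.+ 1 ℕ.* n) ≡ ρ u v
    ρ-shift₁ u v = trans (∑-cong∈ (range Q) (λ b b∈ → cong (term (u ℕ.+ 1 ℕ.* n) (v ℕ.+ 1 ℕ.* n)) (sym (ℕ.m<n⇒m%n≡m (∈-range⁻ b∈)))))
      (trans (sym (∑-periodic Q {F} per 1))
        (trans (∑-cong (range Q) (λ b → cong₂ (λ x y → abs (x - y)) (move b u) (move b v)))
          (∑-cong∈ (range Q) (λ b b∈ → cong (term u v) (ℕ.m<n⇒m%n≡m (∈-range⁻ b∈))))))
      where
      term : ℕ → ℕ → ℕ → ℤ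
      term u v b = abs (coord b u - coord b v)
      F : ℕ → ℤ
      F b = term (u ℕ.+ 1 ℕ.* n) (v ℕ.+ 1 ℕ.* n) (b ℕ.% Q)
      per : Periodic Q F
      per b = cong (term (u ℕ.+ 1 ℕ.* n) (v ℕ.+ 1 ℕ.* n)) (ℕ.[m+n]%n≡m%n b Q)
      move : ∀ b w → coord ((b ℕ.+ 1) ℕ.% Q) (w ℕ.+ 1 ℕ.* n) ≡ coord (b ℕ.% Q) w
      move b w = trans (point-shift w 1 (ι ((b ℕ.+ 1) ℕ.% Q))) (point-cong w (ι-suc b))

    ρ-shift : ∀ t u v → ρ (u ℕ.+ t ℕ.* n) (v ℕ.+ t ℕ.* n) ≡ ρ u v
    ρ-shift zero    u v = cong₂ ρ (ℕ.+-identityʳ u) (ℕ.+-identityʳ v)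
    ρ-shift (suc t) u v = trans (cong₂ ρ (split u) (split v)) (trans (ρ-shift₁ (u ℕ.+ t ℕ.* n) (v ℕ.+ t ℕ.* n)) (ρ-shift t u v))
      where
      split : ∀ u → u ℕ.+ suc t ℕ.* n ≡ u ℕ.+ t ℕ.* n ℕ.+ 1 ℕ.* n
      split u = trans (cong (u ℕ.+_) (trans (ℕ.+-comm n (t ℕ.* n)) (cong (t ℕ.* n ℕ.+_) (sym (ℕ.*-identityˡ n))))) (sym (ℕ.+-assoc u (t ℕ.* n) (1 ℕ.* n)))

    ρ-step : ∀ u → ρ (suc u) u ≤ pos 2
    ρ-step u = ℤ.≤-trans (∑-mono (range Q) near)
      (ℤ.≤-trans (ℤ.≤-reflexive (∑-+ (range Q) (λ b → 1ℤ * ι b (suc a)) (λ b → 1ℤ * ι b a)))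
        (ℤ.≤-reflexive (cong₂ _+_ (∑-ι (λ _ → 1ℤ) Q (suc a) (ℕ.m%n<n (suc a) Q)) (∑-ι (λ _ → 1ℤ) Q a (ℕ.m%n<n a Q)))))
      where
      a = u ℕ./ n
      ι≥0 : ∀ b t → 0ℤ ≤ ι b t
      ι≥0 b t with t ℕ.% Q ℕ.≟ b
      ... | yes _ = 0≤⁺ 1
      ... | no  _ = 0≤⁺ 0
      difference : ∀ b → coord b (suc u) - coord b u ≡ ι b (suc a) - ι b a
      difference b = trans (eq (coord b (suc u)) (coord b u) (ι b a))
        (trans (cong (λ z → z - coord b u - ι b a) (point-suc u (ι b))) (eq′ (coord b u) (ι b (suc a)) (ι b a)))
        where
        eq : ∀ x y z → x - y ≡ x + z - y - z
        eq = solve-∀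
        eq′ : ∀ x y z → x + y - x - z ≡ y - z
        eq′ = solve-∀
      near : ∀ b → abs (coord b (suc u) - coord b u) ≤ 1ℤ * ι b (suc a) + 1ℤ * ι b a
      near b = ∣∣≤
        (ℤ.≤-trans (ℤ.≤-reflexive (difference b)) (certify (0≤* (0≤⁺ 2) (ι≥0 b a)) (eq (ι b (suc a)) (ι b a))))
        (ℤ.≤-trans (ℤ.≤-reflexive (cong -_ (difference b))) (certify (0≤* (0≤⁺ 2) (ι≥0 b (suc a))) (eq′ (ι b (suc a)) (ι b a))))
        where
        eq : ∀ x y → pos 2 * y ≡ 1ℤ * x + 1ℤ * y - (x - y)
        eq = solve-∀
        eq′ : ∀ x y → pos 2 * x ≡ 1ℤ * x + 1ℤ * y - - (x - y)
        eq′ = solve-∀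

    point-lipschitz : ∀ u v {f} → Periodic Q f → (∀ b → abs (f b) ≤ 1ℤ) → point u f - point v f ≤ ρ u v
    point-lipschitz u v {f} per f≤1 = ℤ.≤-trans (ℤ.≤-reflexive (trans (cong₂ _-_ (point-coords u per) (point-coords v per))
        (sym (∑-- (range Q) (λ b → f b * coord b u) (λ b → f b * coord b v)))))
      (∑-mono (range Q) (λ b → ℤ.≤-trans (ℤ.≤-reflexive (eq (f b) (coord b u) (coord b v)))
        (ℤ.≤-trans (≤abs (f b * (coord b u - coord b v)))
          (ℤ.≤-trans (ℤ.≤-reflexive (abs-* (f b) (coord b u - coord b v)))
            (ℤ.≤-trans (*-mono (abs≥0 (f b)) (abs≥0 (coord b u - coord b v)) (f≤1 b) ℤ.≤-refl)
              (ℤ.≤-reflexive (ℤ.*-identityˡ (abs (coord b u - coord b v)))))))))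
      where
      eq : ∀ f x y → f * x - f * y ≡ f * (x - y)
      eq = solve-∀

    /-range : ∀ u i → i ℕ.< n → ((u ℕ.+ i) ℕ./ n ≡ u ℕ./ n) ⊎ ((u ℕ.+ i) ℕ./ n ≡ suc (u ℕ./ n))
    /-range u i i<n with ℕ.m≤n⇒m<n∨m≡n (ℕ./-monoˡ-≤ n (ℕ.m≤m+n u i))
    ... | inj₂ e = inj₁ (sym e)
    ... | inj₁ p = inj₂ (ℕ.≤-antisym (ℕ.≤-trans (ℕ./-monoˡ-≤ n (ℕ.+-monoʳ-≤ u (ℕ.<⇒≤ i<n)))
                     (ℕ.≤-reflexive (trans (ℕ.m/n≡1+[m∸n]/n (ℕ.m≤n+m n u)) (cong (λ z → suc (z ℕ./ n)) (ℕ.m+n∸n≡m u n))))) p)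

    -- The two points lie on edges without a common vertex. The functional that is 1 at both ends
    -- `a`, `suc a` of the first edge and 0 at all other vertices has the value `n` at one point and
    -- 0 at the other.
    ρ-far : ∀ u j → 2 ℕ.≤ j → j ℕ.+ 2 ℕ.≤ Q → pos n ≤ ρ u (u ℕ.+ j ℕ.* n)
    ρ-far u j 2≤j j+2≤Q = subst (_≤ ρ u (u ℕ.+ j ℕ.* n)) (trans (cong₂ _-_ at-u at-v) (ℤ.+-identityʳ (pos n)))
        (point-lipschitz u (u ℕ.+ j ℕ.* n) per bounded)
      where
      a = u ℕ./ n
      φ : ℕ → ℤ
      φ r with r ℕ.≟ a ℕ.% Q | r ℕ.≟ suc a ℕ.% Q
      ... | yes _ | _     = 1ℤ
      ... | no _  | yes _ = 1ℤ
      ... | no _  | no _  = 0ℤ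
      f : ℕ → ℤ
      f t = φ (t ℕ.% Q)
      per : Periodic Q f
      per t = cong φ (ℕ.[m+n]%n≡m%n t Q)
      bounded : ∀ t → abs (f t) ≤ 1ℤ
      bounded t with t ℕ.% Q ℕ.≟ a ℕ.% Q | t ℕ.% Q ℕ.≟ suc a ℕ.% Q
      ... | yes _ | _     = ℤ.≤-refl
      ... | no _  | yes _ = ℤ.≤-refl
      ... | no _  | no _  = 0≤⁺ 1
      φ-1 : ∀ r → (r ≡ a ℕ.% Q) ⊎ (r ≡ suc a ℕ.% Q) → φ r ≡ 1ℤ
      φ-1 r p with r ℕ.≟ a ℕ.% Q | r ℕ.≟ suc a ℕ.% Q
      ... | yes _ | _     = refl
      ... | no _  | yes _ = refl
      φ-1 r (inj₁ e) | no ¬e | no _ = ⊥-elim (¬e e)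
      φ-1 r (inj₂ e) | no _ | no ¬e = ⊥-elim (¬e e)
      f-a : f a ≡ 1ℤ
      f-a = φ-1 (a ℕ.% Q) (inj₁ refl)
      f-a+1 : f (suc a) ≡ 1ℤ
      f-a+1 = φ-1 (suc a ℕ.% Q) (inj₂ refl)
      φ-0 : ∀ r → r ≢ a ℕ.% Q → r ≢ suc a ℕ.% Q → φ r ≡ 0ℤ
      φ-0 r p q with r ℕ.≟ a ℕ.% Q | r ℕ.≟ suc a ℕ.% Q
      ... | yes e | _     = ⊥-elim (p e)
      ... | no _  | yes e = ⊥-elim (q e)
      ... | no _  | no _  = refl
      f-0 : ∀ t → t ℕ.% Q ≢ a ℕ.% Q → t ℕ.% Q ≢ suc a ℕ.% Q → f t ≡ 0ℤ
      f-0 t = φ-0 (t ℕ.% Q)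
      at-u : point u f ≡ pos n
      at-u = trans (∑-cong∈ (range n) one) (trans (∑-range-const n 1ℤ) (ℤ.*-identityʳ (pos n)))
        where
        one : ∀ i → i ∈ range n → f ((u ℕ.+ i) ℕ./ n) ≡ 1ℤ
        one i i∈ with /-range u i (∈-range⁻ i∈)
        ... | inj₁ e = trans (cong f e) f-a
        ... | inj₂ e = trans (cong f e) f-a+1
      j<Q : suc j ℕ.< Q
      j<Q = subst (ℕ._≤ Q) (ℕ.+-comm j 2) j+2≤Q
      j′ = ℕ.pred j
      j≡ : suc j′ ≡ j
      j≡ = ℕ.suc-pred j {{ℕ.>-nonZero (ℕ.<⇒≤ 2≤j)}}
      f-far₀ : f (a ℕ.+ j) ≡ 0ℤ
      f-far₀ = f-0 (a ℕ.+ j) (%-shift≢ Q a j (ℕ.<⇒≤ 2≤j) (ℕ.<⇒≤ j<Q))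
        (subst (λ z → z ℕ.% Q ≢ suc a ℕ.% Q) (trans (sym (ℕ.+-suc a j′)) (cong (a ℕ.+_) j≡))
          (%-shift≢ Q (suc a) j′ (ℕ.s≤s⁻¹ (subst (2 ℕ.≤_) (sym j≡) 2≤j)) (ℕ.<⇒≤ (ℕ.<-trans (subst (suc j′ ℕ.<_) (cong suc j≡) (ℕ.n<1+n (suc j′))) j<Q))))
      f-far₁ : f (suc a ℕ.+ j) ≡ 0ℤ
      f-far₁ = f-0 (suc a ℕ.+ j)
        (subst (λ z → z ℕ.% Q ≢ a ℕ.% Q) (ℕ.+-suc a j) (%-shift≢ Q a (suc j) (ℕ.s≤s ℕ.z≤n) j<Q))
        (%-shift≢ Q (suc a) j (ℕ.<⇒≤ 2≤j) (ℕ.<⇒≤ j<Q))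
      at-v : point (u ℕ.+ j ℕ.* n) f ≡ 0ℤ
      at-v = trans (point-shift u j f) (trans (∑-cong∈ (range n) none) (∑-0 (range n)))
        where
        none : ∀ i → i ∈ range n → f ((u ℕ.+ i) ℕ./ n ℕ.+ j) ≡ 0ℤ
        none i i∈ with /-range u i (∈-range⁻ i∈)
        ... | inj₁ e = trans (cong (λ z → f (z ℕ.+ j)) e) f-far₀
        ... | inj₂ e = trans (cong (λ z → f (z ℕ.+ j)) e) f-far₁

-- The bilinear form of a single coordinate

module Form where

  open Prelude
  open Sums
  open Grid
  open Rotation using (≤⊎>)
  open SineWave
  open AntiConcentration
  open Curve

  module Bilinear (P κ Λ n : ℕ) .{{_ : ℕ.NonZero n}} (4≤P : 4 ℕ.≤ P) (wave : Sine P κ Λ) where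

    open Sine wave

    Q : ℕ
    Q = (P ℕ.+ P) ℕ.+ (P ℕ.+ P)

    instance
      Q≢0 : ℕ.NonZero Q
      Q≢0 = ℕ.>-nonZero (ℕ.≤-trans (ℕ.≤-trans (ℕ.s≤s ℕ.z≤n) 4≤P) (ℕ.≤-trans (ℕ.m≤m+n P P) (ℕ.m≤m+n (P ℕ.+ P) (P ℕ.+ P))))

    open Polygon Q n public

    s≥0 : 0ℤ ≤ s
    s≥0 = *-cancelˡ (pos 2) (+≤+ (ℕ.s≤s ℕ.z≤n)) (certify (0≤+ (≤⇒0≤ (S≤s 0)) (≤⇒0≤ (-s≤S 0))) (eq s (S 0)))
      where
      eq : ∀ s x → s - x + (x - - s) ≡ pos 2 * s - pos 2 * 0ℤ
      eq = solve-∀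

    S-period : ∀ t → S (t ℕ.+ Q) ≡ S t
    S-period t = trans (cong S (sym (ℕ.+-assoc t (P ℕ.+ P) (P ℕ.+ P))))
      (trans (S-anti (t ℕ.+ (P ℕ.+ P))) (trans (cong -_ (S-anti t)) (ℤ.neg-involutive (S t))))

    S-periods : ∀ m t → S (t ℕ.+ m ℕ.* Q) ≡ S t
    S-periods zero    t = cong S (ℕ.+-identityʳ t)
    S-periods (suc m) t = trans (cong S (trans (cong (t ℕ.+_) (ℕ.+-comm Q (m ℕ.* Q))) (sym (ℕ.+-assoc t (m ℕ.* Q) Q))))
      (trans (S-period (t ℕ.+ m ℕ.* Q)) (S-periods m t))

    q : ℕ
    q = ℕ.pred Q

    -- K a b = S (a - b), since q ≡ -1 modulo the period Q.
    K : ℕ → ℕ → ℤ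
    K a b = S (a ℕ.+ q ℕ.* b)

    K-inv : ∀ t a b → K (a ℕ.+ t) (b ℕ.+ t) ≡ K a b
    K-inv t a b = trans (cong S (trans (eq a b t q) (cong (λ z → a ℕ.+ q ℕ.* b ℕ.+ t ℕ.* z) (ℕ.suc-pred Q)))) (S-periods t (a ℕ.+ q ℕ.* b))
      where
      eq : ∀ a b t q → a ℕ.+ t ℕ.+ q ℕ.* (b ℕ.+ t) ≡ a ℕ.+ q ℕ.* b ℕ.+ t ℕ.* (suc q)
      eq = ℕSolver.solve-∀

    +-swap : ∀ a t b → a ℕ.+ t ℕ.+ b ≡ a ℕ.+ b ℕ.+ t
    +-swap = ℕSolver.solve-∀

    K-anti₁ : ∀ a b → K (a ℕ.+ (P ℕ.+ P)) b ≡ - K a b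
    K-anti₁ a b = trans (cong S (+-swap a (P ℕ.+ P) (q ℕ.* b))) (S-anti (a ℕ.+ q ℕ.* b))

    K-anti₂ : ∀ a b → K a (b ℕ.+ (P ℕ.+ P)) ≡ - K a b
    K-anti₂ a b = trans (sym (ℤ.neg-involutive _)) (cong -_ (trans (sym (K-anti₁ a (b ℕ.+ (P ℕ.+ P)))) (K-inv (P ℕ.+ P) a b)))

    K-period₁ : ∀ b → Periodic Q (λ a → K a b)
    K-period₁ b a = trans (cong S (+-swap a Q (q ℕ.* b))) (S-period (a ℕ.+ q ℕ.* b))

    K-period₂ : ∀ a → Periodic Q (K a)
    K-period₂ a b = trans (sym (K-period₁ (b ℕ.+ Q) a)) (K-inv Q a b)

    -- The bilinear extension of `K` from the vertices of the polygon to all its points.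
    g₁ : ℕ → ℕ → ℤ
    g₁ u v = point u (λ a → point v (K a))

    g₁-inv : ∀ t u v → g₁ (u ℕ.+ t ℕ.* n) (v ℕ.+ t ℕ.* n) ≡ g₁ u v
    g₁-inv t u v = trans (point-shift u t (λ a → point (v ℕ.+ t ℕ.* n) (K a)))
      (point-cong u (λ a → trans (point-shift v t (K (a ℕ.+ t))) (point-cong v (λ b → K-inv t a b))))

    point-neg : ∀ u f → point u (λ a → - f a) ≡ - point u f
    point-neg u f = ∑-neg (range n) (λ i → f ((u ℕ.+ i) ℕ./ n))

    g₁-anti₂ : ∀ u v → g₁ u (v ℕ.+ (P ℕ.+ P) ℕ.* n) ≡ - g₁ u v
    g₁-anti₂ u v = trans (point-cong u (λ a → trans (point-shift v (P ℕ.+ P) (K a))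
        (trans (point-cong v (K-anti₂ a)) (point-neg v (K a))))) (point-neg u (λ a → point v (K a)))

    g₁-anti₁ : ∀ u v → g₁ (u ℕ.+ (P ℕ.+ P) ℕ.* n) v ≡ - g₁ u v
    g₁-anti₁ u v = trans (point-shift u (P ℕ.+ P) (λ a → point v (K a)))
      (trans (point-cong u (λ a → trans (point-cong v (K-anti₁ a)) (point-neg v (K a)))) (point-neg u (λ a → point v (K a))))

    g₁-period₁ : ∀ u v → g₁ (u ℕ.+ M) v ≡ g₁ u v
    g₁-period₁ u v = point-period u (λ a → point-cong v (λ b → K-period₁ b a))

    g₁-period₂ : ∀ u v → g₁ u (v ℕ.+ M) ≡ g₁ u v
    g₁-period₂ u v = point-cong u (λ a → point-period v (K-period₂ a))

    trio : ℕ → ℕ → ℤ → ℤ → ℤ → ℤ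
    trio i j x y z = S j * x - S (i ℕ.+ j) * y + S i * z

    Small : ℤ → ℤ → Set
    Small E T = (pos Λ * T ≤ E) × (- E ≤ pos Λ * T)

    small-∑ : ∀ m E (T : ℕ → ℤ) → (∀ i → Small E (T i)) → Small (pos m * E) (∑ (range m) T)
    small-∑ m E T p =
        subst₂ _≤_ (∑-* (range m) (pos Λ) T) (∑-range-const m E) (∑-mono (range m) (λ i → proj₁ (p i)))
      , subst₂ _≤_ (trans (∑-neg (range m) (λ _ → E)) (cong -_ (∑-range-const m E))) (∑-* (range m) (pos Λ) T) (∑-mono (range m) (λ i → proj₂ (p i)))

    -- `τ` behaves like a sine wave with the period of `S`, up to an error. The condition is linear
    -- in `τ`, so it passes from `K` to `g₁`, to `g`, and to weighted sums of values of `g`.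
    ThreeTerm : ℤ → (ℕ → ℤ) → Set
    ThreeTerm E τ = ∀ i j t → Small E (trio i j (τ t) (τ (t ℕ.+ i)) (τ (t ℕ.+ (i ℕ.+ j))))

    three-cong : ∀ {E τ τ′} → (∀ t → τ t ≡ τ′ t) → ThreeTerm E τ → ThreeTerm E τ′
    three-cong {E} e p i j t = subst (Small E)
      (cong₃ (trio i j) (e t) (e (t ℕ.+ i)) (e (t ℕ.+ (i ℕ.+ j)))) (p i j t)

    three-∑ : ∀ m {E} (τ : ℕ → ℕ → ℤ) → (∀ l → ThreeTerm E (τ l)) → ThreeTerm (pos m * E) (λ t → ∑ (range m) (λ l → τ l t))
    three-∑ m {E} τ p i j t = subst (Small (pos m * E)) linear
        (small-∑ m E (λ l → trio i j (τ l t) (τ l (t ℕ.+ i)) (τ l (t ℕ.+ (i ℕ.+ j)))) (λ l → p l i j t))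
      where
      linear : ∑ (range m) (λ l → trio i j (τ l t) (τ l (t ℕ.+ i)) (τ l (t ℕ.+ (i ℕ.+ j)))) ≡
               trio i j (∑ (range m) (λ l → τ l t)) (∑ (range m) (λ l → τ l (t ℕ.+ i))) (∑ (range m) (λ l → τ l (t ℕ.+ (i ℕ.+ j))))
      linear = trans (∑-+ (range m) (λ l → S j * τ l t - S (i ℕ.+ j) * τ l (t ℕ.+ i)) (λ l → S i * τ l (t ℕ.+ (i ℕ.+ j))))
        (cong₂ _+_ (trans (∑-- (range m) (λ l → S j * τ l t) (λ l → S (i ℕ.+ j) * τ l (t ℕ.+ i)))
                          (cong₂ _-_ (∑-* (range m) (S j) (λ l → τ l t)) (∑-* (range m) (S (i ℕ.+ j)) (λ l → τ l (t ℕ.+ i)))))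
                   (∑-* (range m) (S i) (λ l → τ l (t ℕ.+ (i ℕ.+ j)))))

    three-K₁ : ∀ a b → ThreeTerm (s * s) (λ t → K (a ℕ.+ t) b)
    three-K₁ a b = three-cong (λ t → cong S (+-swap a (q ℕ.* b) t))
      (λ i j t → subst (Small (s * s)) (cong₂ (trio i j (S (c ℕ.+ t))) (cong S (ℕ.+-assoc c t i)) (cong S (ℕ.+-assoc c t (i ℕ.+ j))))
         (three (c ℕ.+ t) i j , three⁻ (c ℕ.+ t) i j))
      where
      c = a ℕ.+ q ℕ.* b

    -- `K` depends only on the difference of its arguments, so moving the second one forwards is
    -- moving the first one backwards, and the relation for `i`, `j` is the one for `j`, `i`.
    three-K₂ : ∀ a b → ThreeTerm (s * s) (λ t → K a (b ℕ.+ t))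
    three-K₂ a b i j t = subst (Small (s * s))
        (trans (cong₃ (trio j i) (cong (λ z → K z b′) (ℕ.+-identityʳ a)) second third) reverse)
        (three-K₁ a b′ j i 0)
      where
      b′ = b ℕ.+ (t ℕ.+ (i ℕ.+ j))
      second : K (a ℕ.+ j) b′ ≡ K a (b ℕ.+ (t ℕ.+ i))
      second = trans (cong (K (a ℕ.+ j)) (eq b t i j)) (K-inv j a (b ℕ.+ (t ℕ.+ i)))
        where
        eq : ∀ b t i j → b ℕ.+ (t ℕ.+ (i ℕ.+ j)) ≡ b ℕ.+ (t ℕ.+ i) ℕ.+ j
        eq = ℕSolver.solve-∀
      third : K (a ℕ.+ (j ℕ.+ i)) b′ ≡ K a (b ℕ.+ t)
      third = trans (cong (K (a ℕ.+ (j ℕ.+ i))) (eq b t i j)) (K-inv (j ℕ.+ i) a (b ℕ.+ t))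
        where
        eq : ∀ b t i j → b ℕ.+ (t ℕ.+ (i ℕ.+ j)) ≡ b ℕ.+ t ℕ.+ (j ℕ.+ i)
        eq = ℕSolver.solve-∀
      reverse : trio j i (K a b′) (K a (b ℕ.+ (t ℕ.+ i))) (K a (b ℕ.+ t)) ≡ trio i j (K a (b ℕ.+ t)) (K a (b ℕ.+ (t ℕ.+ i))) (K a b′)
      reverse = trans (eq (S i) (S (j ℕ.+ i)) (S j) (K a b′) (K a (b ℕ.+ (t ℕ.+ i))) (K a (b ℕ.+ t)))
        (cong (λ z → S j * K a (b ℕ.+ t) - S z * K a (b ℕ.+ (t ℕ.+ i)) + S i * K a b′) (ℕ.+-comm j i))
        where
        eq : ∀ u v w x y z → u * x - v * y + w * z ≡ w * z - v * y + u * x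
        eq = solve 6 (λ u v w x y z → u :* x :- v :* y :+ w :* z := w :* z :- v :* y :+ u :* x) refl

    E₁ : ℤ
    E₁ = pos n * (pos n * (s * s))

    three-g₁-left : ∀ u v → ThreeTerm E₁ (λ t → g₁ (u ℕ.+ t ℕ.* n) v)
    three-g₁-left u v = three-cong (λ t → sym (point-shift u t (λ a → point v (K a))))
      (three-∑ n (λ i t → point v (K ((u ℕ.+ i) ℕ./ n ℕ.+ t)))
        (λ i → three-∑ n (λ j t → K ((u ℕ.+ i) ℕ./ n ℕ.+ t) ((v ℕ.+ j) ℕ./ n)) (λ j → three-K₁ ((u ℕ.+ i) ℕ./ n) ((v ℕ.+ j) ℕ./ n))))

    three-g₁-right : ∀ u v → ThreeTerm E₁ (λ t → g₁ u (v ℕ.+ t ℕ.* n))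
    three-g₁-right u v = three-cong (λ t → point-cong u (λ a → sym (point-shift v t (K a))))
      (three-∑ n (λ i t → point v (λ b → K ((u ℕ.+ i) ℕ./ n) (b ℕ.+ t)))
        (λ i → three-∑ n (λ j t → K ((u ℕ.+ i) ℕ./ n) ((v ℕ.+ j) ℕ./ n ℕ.+ t)) (λ j → three-K₂ ((u ℕ.+ i) ℕ./ n) ((v ℕ.+ j) ℕ./ n))))

    abs-K : ∀ a b → abs (K a b) ≤ s
    abs-K a b = ∣∣≤ (S≤s (a ℕ.+ q ℕ.* b)) (ℤ.≤-trans (ℤ.neg-mono-≤ (-s≤S (a ℕ.+ q ℕ.* b))) (ℤ.≤-reflexive (ℤ.neg-involutive s)))

    g₁-coords : ∀ u v → g₁ u v ≡ ∑ (range Q) (λ b → ∑ (range Q) (λ c → K b c * coord c v * coord b u))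
    g₁-coords u v = trans (point-coords u (λ a → point-cong v (λ b → K-period₁ b a)))
      (∑-cong (range Q) (λ b → trans (cong (_* coord b u) (point-coords v (K-period₂ b)))
        (trans (ℤ.*-comm _ (coord b u)) (trans (sym (∑-* (range Q) (coord b u) (λ c → K b c * coord c v)))
          (∑-cong (range Q) (λ c → ℤ.*-comm (coord b u) (K b c * coord c v)))))))

    -- The mixed second difference is a bilinear form in the two increments.
    mixed₁ : ∀ u u′ v v′ → g₁ u v - g₁ u′ v - g₁ u v′ + g₁ u′ v′ ≤ s * (ρ u u′ * ρ v v′)
    mixed₁ u u′ v v′ = ℤ.≤-trans (ℤ.≤-reflexive expand) (ℤ.≤-trans
        (∑∑-mono (range Q) (range Q) bounded)
        (ℤ.≤-reflexive (trans (∑-cong (range Q) (λ b → ∑-* (range Q) s (λ c → X b * Y c)))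
          (trans (∑-* (range Q) s (λ b → ∑ (range Q) (λ c → X b * Y c))) (cong (s *_) (∑∑-product (range Q) (range Q) X Y))))))
      where
      x y X Y : ℕ → ℤ
      x b = coord b u - coord b u′
      y c = coord c v - coord c v′
      X b = abs (x b)
      Y c = abs (y c)
      bounded : ∀ b c → K b c * (x b * y c) ≤ s * (X b * Y c)
      bounded b c = ℤ.≤-trans (≤abs (K b c * (x b * y c)))
        (ℤ.≤-trans (ℤ.≤-reflexive (trans (abs-* (K b c) (x b * y c)) (cong (abs (K b c) *_) (abs-* (x b) (y c)))))
          (*-mono (abs≥0 (K b c)) (0≤* (abs≥0 (x b)) (abs≥0 (y c))) (abs-K b c) ℤ.≤-refl))
      term : ℕ → ℕ → ℕ → ℕ → ℤ
      term u v b c = K b c * coord c v * coord b u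
      Sum : (ℕ → ℕ → ℤ) → ℤ
      Sum f = ∑ (range Q) (λ b → ∑ (range Q) (f b))
      Sum-- : ∀ f h → Sum (λ b c → f b c - h b c) ≡ Sum f - Sum h
      Sum-- f h = trans (∑-cong (range Q) (λ b → ∑-- (range Q) (f b) (h b))) (∑-- (range Q) (λ b → ∑ (range Q) (f b)) (λ b → ∑ (range Q) (h b)))
      Sum-+ : ∀ f h → Sum (λ b c → f b c + h b c) ≡ Sum f + Sum h
      Sum-+ f h = trans (∑-cong (range Q) (λ b → ∑-+ (range Q) (f b) (h b))) (∑-+ (range Q) (λ b → ∑ (range Q) (f b)) (λ b → ∑ (range Q) (h b)))
      expand : g₁ u v - g₁ u′ v - g₁ u v′ + g₁ u′ v′ ≡ Sum (λ b c → K b c * (x b * y c))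
      expand = trans (cong₂ _+_ (cong₂ _-_ (cong₂ _-_ (g₁-coords u v) (g₁-coords u′ v)) (g₁-coords u v′)) (g₁-coords u′ v′))
        (trans (cong (_+ Sum (term u′ v′)) (trans (cong (_- Sum (term u v′)) (sym (Sum-- (term u v) (term u′ v)))) (sym (Sum-- (λ b c → term u v b c - term u′ v b c) (term u v′)))))
          (trans (sym (Sum-+ (λ b c → term u v b c - term u′ v b c - term u v′ b c) (term u′ v′)))
            (∑-cong (range Q) (λ b → ∑-cong (range Q) (λ c → eq (K b c) (coord b u) (coord b u′) (coord c v) (coord c v′))))))
        where
        eq : ∀ K a a′ b b′ → K * b * a - K * b * a′ - K * b′ * a + K * b′ * a′ ≡ K * ((a - a′) * (b - b′))
        eq = solve 5 (λ K a a′ b b′ → K :* b :* a :- K :* b :* a′ :- K :* b′ :* a :+ K :* b′ :* a′ := K :* ((a :- a′) :* (b :- b′))) refl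

    -- The arithmetic-geometric mean inequality, giving a form that adds up over the coordinates to
    -- the squared distance.
    mixed₂ : ∀ u u′ v v′ → pos 2 * (g₁ u v - g₁ u′ v - g₁ u v′ + g₁ u′ v′) ≤ s * (ρ u u′ * ρ u u′ + ρ v v′ * ρ v v′)
    mixed₂ u u′ v v′ = ℤ.≤-trans (*-monoˡ (pos 2) (0≤⁺ 2) (mixed₁ u u′ v v′))
      (certify (0≤* s≥0 (0≤² (ρ u u′ - ρ v v′))) (eq s (ρ u u′) (ρ v v′)))
      where
      eq : ∀ s x y → s * ((x - y) * (x - y)) ≡ s * (x * x + y * y) - pos 2 * (s * (x * y))
      eq = solve 3 (λ s x y → s :* ((x :- y) :* (x :- y)) := s :* (x :* x :+ y :* y) :- con (pos 2) :* (s :* (x :* y))) refl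

    data Steady (t : ℕ) : Set where
      positive : (∀ x → x ℕ.≤ 2 → μ ≤ S (t ℕ.+ x)) → Steady t
      negative : (∀ x → x ℕ.≤ 2 → μ ≤ - S (t ℕ.+ x)) → Steady t

    steady-anti : ∀ t → Steady t → Steady (t ℕ.+ (P ℕ.+ P))
    steady-anti t (positive p) = negative (λ x x≤2 → ℤ.≤-trans (p x x≤2)
      (ℤ.≤-reflexive (trans (sym (ℤ.neg-involutive (S (t ℕ.+ x)))) (cong -_ (trans (sym (S-anti (t ℕ.+ x))) (cong S (+-swap t x (P ℕ.+ P))))))))
    steady-anti t (negative p) = positive (λ x x≤2 → ℤ.≤-trans (p x x≤2)
      (ℤ.≤-reflexive (trans (sym (S-anti (t ℕ.+ x))) (cong S (+-swap t x (P ℕ.+ P))))))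

    -- Zeros of the wave recur every `2P`. If three consecutive samples meet one, then a quarter
    -- turn later they lie strictly between two zeros, as `P` is at least 4.
    steady-quadrant : ∀ t → Steady t ⊎ Steady (t ℕ.+ P)
    steady-quadrant t = subst (λ z → Steady z ⊎ Steady (z ℕ.+ P)) (sym (ℕ.m≡m%n+[m/n]*n t H)) (go (t ℕ./ H) (base (t ℕ.% H) (ℕ.m%n<n t H)))
      where
      H = P ℕ.+ P
      instance
        H≢0 : ℕ.NonZero H
        H≢0 = ℕ.>-nonZero (ℕ.≤-trans (ℕ.≤-trans (ℕ.s≤s ℕ.z≤n) 4≤P) (ℕ.m≤m+n P P))
      go : ∀ {r} m → Steady r ⊎ Steady (r ℕ.+ P) → Steady (r ℕ.+ m ℕ.* H) ⊎ Steady (r ℕ.+ m ℕ.* H ℕ.+ P)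
      go {r} zero    p = subst (λ z → Steady z ⊎ Steady (z ℕ.+ P)) (sym (ℕ.+-identityʳ r)) p
      go {r} (suc m) p with go m p
      ... | inj₁ a = inj₁ (subst Steady (eq r m H) (steady-anti _ a))
        where
        eq : ∀ r m H → r ℕ.+ m ℕ.* H ℕ.+ H ≡ r ℕ.+ (H ℕ.+ m ℕ.* H)
        eq = ℕSolver.solve-∀
      ... | inj₂ a = inj₂ (subst Steady (eq r m H P) (steady-anti _ a))
        where
        eq : ∀ r m H P → r ℕ.+ m ℕ.* H ℕ.+ P ℕ.+ H ≡ r ℕ.+ (H ℕ.+ m ℕ.* H) ℕ.+ P
        eq = ℕSolver.solve-∀
      small : ∀ r → 1 ℕ.≤ r → r ℕ.+ 2 ℕ.< H → Steady r
      small r p p′ = positive (λ x x≤2 → S-pos (r ℕ.+ x) (ℕ.≤-trans p (ℕ.m≤m+n r x)) (ℕ.≤-<-trans (ℕ.+-monoʳ-≤ r x≤2) p′))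
      P+2<H : P ℕ.+ 2 ℕ.< H
      P+2<H = ℕ.+-monoʳ-< P (ℕ.≤-trans (ℕ.s≤s (ℕ.s≤s (ℕ.s≤s ℕ.z≤n))) 4≤P)
      base : ∀ r → r ℕ.< H → Steady r ⊎ Steady (r ℕ.+ P)
      base zero    r<H = inj₂ (small P (ℕ.≤-trans (ℕ.s≤s ℕ.z≤n) 4≤P) P+2<H)
      base (suc r) r<H with ℕ.<-≤-connex (suc r ℕ.+ 2) H
      ... | inj₁ p = inj₁ (small (suc r) (ℕ.s≤s ℕ.z≤n) p)
      ... | inj₂ p = inj₂ (subst Steady r′+H (steady-anti r′ (small r′ 1≤r′ r′+2<H)))
        where
        H≤ : H ℕ.≤ suc r ℕ.+ P
        H≤ = ℕ.≤-trans p (ℕ.+-monoʳ-≤ (suc r) (ℕ.≤-trans (ℕ.s≤s (ℕ.s≤s ℕ.z≤n)) 4≤P))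
        r′ = suc r ℕ.+ P ℕ.∸ H
        r′+H : r′ ℕ.+ H ≡ suc r ℕ.+ P
        r′+H = ℕ.m∸n+n≡m H≤
        1≤r′ : 1 ℕ.≤ r′
        1≤r′ = ℕ.m<n⇒0<n∸m (ℕ.≤-<-trans p (ℕ.+-monoʳ-< (suc r) (ℕ.≤-trans (ℕ.s≤s (ℕ.s≤s (ℕ.s≤s ℕ.z≤n))) 4≤P)))
        r′<P : r′ ℕ.< P
        r′<P = ℕ.+-cancelʳ-< H r′ P (subst₂ ℕ._<_ (sym r′+H) (ℕ.+-comm H P) (ℕ.+-monoˡ-< P r<H))
        r′+2<H : r′ ℕ.+ 2 ℕ.< H
        r′+2<H = ℕ.<-trans (ℕ.+-monoˡ-< 2 r′<P) P+2<H

    w : ℤ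
    w = pos 2 * (pos n * (pos n * μ))

    w≥1 : 1ℤ ≤ w
    w≥1 = *-mono (0≤⁺ 1) (0≤⁺ 1) 1≤2 (*-mono (0≤⁺ 1) (0≤⁺ 1) 1≤n (*-mono (0≤⁺ 1) (0≤⁺ 1) 1≤n μ≥1))
      where
      1≤2 : 1ℤ ≤ pos 2
      1≤2 = +≤+ (ℕ.s≤s ℕ.z≤n)
      1≤n : 1ℤ ≤ pos n
      1≤n = +≤+ (ℕ.>-nonZero⁻¹ n)

    Big : ℤ → Set
    Big x = (w ≤ x + x) ⊎ (w ≤ - x + - x)

    point-≥ : ∀ u f c → (∀ i → i ℕ.< n → c ≤ f ((u ℕ.+ i) ℕ./ n)) → pos n * c ≤ point u f
    point-≥ u f c p = ℤ.≤-trans (ℤ.≤-reflexive (sym (∑-range-const n c))) (∑-mono∈ (range n) (λ i i∈ → p i (∈-range⁻ i∈)))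

    -- The values of K occurring in g₁ are three consecutive values of S.
    big-steady : ∀ u v → Steady (u ℕ./ n ℕ.+ q ℕ.* suc (v ℕ./ n)) → Big (g₁ u v)
    big-steady u v st = result st
      where
      a b t : ℕ
      a = u ℕ./ n
      b = v ℕ./ n
      t = a ℕ.+ q ℕ.* suc b
      K₀ : K a b ≡ S (t ℕ.+ 1)
      K₀ = trans (sym (S-period (a ℕ.+ q ℕ.* b))) (cong S (trans (cong (a ℕ.+ q ℕ.* b ℕ.+_) (sym (ℕ.suc-pred Q))) (eq a b q)))
        where
        eq : ∀ a b q → a ℕ.+ q ℕ.* b ℕ.+ suc q ≡ a ℕ.+ q ℕ.* suc b ℕ.+ 1
        eq = ℕSolver.solve-∀
      K₁₀ : K (suc a) b ≡ S (t ℕ.+ 2)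
      K₁₀ = trans (sym (S-period (suc a ℕ.+ q ℕ.* b))) (cong S (trans (cong (suc a ℕ.+ q ℕ.* b ℕ.+_) (sym (ℕ.suc-pred Q))) (eq a b q)))
        where
        eq : ∀ a b q → suc a ℕ.+ q ℕ.* b ℕ.+ suc q ≡ a ℕ.+ q ℕ.* suc b ℕ.+ 2
        eq = ℕSolver.solve-∀
      K₁₁ : K (suc a) (suc b) ≡ S (t ℕ.+ 1)
      K₁₁ = cong S (ℕ.+-comm 1 t)
      values : ∀ (F : ℤ → Set) → (∀ x → x ℕ.≤ 2 → F (S (t ℕ.+ x))) →
               ∀ i j → i ℕ.< n → j ℕ.< n → F (K ((u ℕ.+ i) ℕ./ n) ((v ℕ.+ j) ℕ./ n))
      values F p i j i<n j<n with /-range u i i<n | /-range v j j<n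
      ... | inj₁ e | inj₁ e′ = subst F (sym (trans (cong₂ K e e′) K₀)) (p 1 (ℕ.s≤s ℕ.z≤n))
      ... | inj₁ e | inj₂ e′ = subst F (sym (trans (cong₂ K e e′) (cong S (sym (ℕ.+-identityʳ t))))) (p 0 ℕ.z≤n)
      ... | inj₂ e | inj₁ e′ = subst F (sym (trans (cong₂ K e e′) K₁₀)) (p 2 ℕ.≤-refl)
      ... | inj₂ e | inj₂ e′ = subst F (sym (trans (cong₂ K e e′) K₁₁)) (p 1 (ℕ.s≤s ℕ.z≤n))
      eq : ∀ x → x + x ≡ pos 2 * x
      eq = solve-∀
      result : Steady t → Big (g₁ u v)
      result (positive p) = inj₁ (ℤ.≤-trans (*-monoˡ (pos 2) (0≤⁺ 2)
        (point-≥ u (λ a → point v (K a)) (pos n * μ) (λ i i<n → point-≥ v (K ((u ℕ.+ i) ℕ./ n)) μ (λ j j<n → values (μ ≤_) p i j i<n j<n))))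
        (ℤ.≤-reflexive (sym (eq (g₁ u v)))))
      result (negative p) = inj₂ (ℤ.≤-trans (*-monoˡ (pos 2) (0≤⁺ 2)
        (point-≥ u (λ a → point v (λ b → - K a b)) (pos n * μ) (λ i i<n → point-≥ v (λ b → - K ((u ℕ.+ i) ℕ./ n) b) μ (λ j j<n → values (λ z → μ ≤ - z) p i j i<n j<n))))
        (ℤ.≤-reflexive (trans (cong (pos 2 *_) (trans (point-cong u (λ a → point-neg v (K a))) (point-neg u (λ a → point v (K a))))) (sym (eq (- g₁ u v))))))

    big-quadrant : ∀ u v → Big (g₁ u v) ⊎ Big (g₁ (u ℕ.+ P ℕ.* n) v)
    big-quadrant u v with steady-quadrant (u ℕ./ n ℕ.+ q ℕ.* suc (v ℕ./ n))
    ... | inj₁ st = inj₁ (big-steady u v st)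
    ... | inj₂ st = inj₂ (big-steady (u ℕ.+ P ℕ.* n) v (subst Steady
          (trans (+-swap (u ℕ./ n) (q ℕ.* suc (v ℕ./ n)) P) (cong (ℕ._+ q ℕ.* suc (v ℕ./ n)) (sym shifted))) st))
      where
      shifted : (u ℕ.+ P ℕ.* n) ℕ./ n ≡ u ℕ./ n ℕ.+ P
      shifted = trans (cong (ℕ._/ n) (sym (ℕ.+-identityʳ (u ℕ.+ P ℕ.* n)))) (trans (/-shift u P 0) (cong (λ z → z ℕ./ n ℕ.+ P) (ℕ.+-identityʳ u)))

    open LittlewoodOfford M w w≥1 public hiding (tail)

    big? : ℤ → ℤ
    big? x with ≤⊎> w (x + x) | ≤⊎> w (- x + - x)
    ... | inj₁ _ | _      = 1ℤ
    ... | inj₂ _ | inj₁ _ = 1ℤ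
    ... | inj₂ _ | inj₂ _ = 0ℤ

    big?-sound : ∀ x → (big? x ≡ 0ℤ) ⊎ ((big? x ≡ 1ℤ) × Big x)
    big?-sound x with ≤⊎> w (x + x) | ≤⊎> w (- x + - x)
    ... | inj₁ p | _      = inj₂ (refl , inj₁ p)
    ... | inj₂ _ | inj₁ p = inj₂ (refl , inj₂ p)
    ... | inj₂ _ | inj₂ _ = inj₁ refl

    big?≥0 : ∀ x → 0ℤ ≤ big? x
    big?≥0 x with ≤⊎> w (x + x) | ≤⊎> w (- x + - x)
    ... | inj₁ p | _      = 0≤⁺ 1
    ... | inj₂ _ | inj₁ p = 0≤⁺ 1
    ... | inj₂ _ | inj₂ _ = 0≤⁺ 0

    big?-complete : ∀ x → Big x → 1ℤ ≤ big? x
    big?-complete x b with ≤⊎> w (x + x) | ≤⊎> w (- x + - x)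
    ... | inj₁ p | _      = ℤ.≤-refl
    ... | inj₂ _ | inj₁ p = ℤ.≤-refl
    big?-complete x (inj₁ b) | inj₂ p | inj₂ _ = <-irrefl b p
    big?-complete x (inj₂ b) | inj₂ _ | inj₂ p = <-irrefl b p

    -- Half a turn negates `g₁`, which gives the symmetry. Of `u` and `u` a quarter turn later at
    -- least one has a big value, which gives the half.
    spread : ∀ v → Spread (λ u → g₁ u v)
    spread v = record
      { symmetric = λ f → trans (sym (∑-periodic M {λ u → f (g₁ u v)} (λ u → cong f (g₁-period₁ u v)) ((P ℕ.+ P) ℕ.* n)))
                                (∑-cong (range M) (λ u → cong f (g₁-anti₁ u v)))
      ; χ = λ u → big? (g₁ u v)
      ; χ-big = λ u → big?-sound (g₁ u v)
      ; χ-half = ℤ.≤-trans (ℤ.≤-reflexive (sym (trans (∑-range-const M 1ℤ) (ℤ.*-identityʳ (pos M)))))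
          (ℤ.≤-trans (∑-mono (range M) either)
            (ℤ.≤-reflexive (trans (∑-+ (range M) χ (λ u → χ (u ℕ.+ P ℕ.* n)))
              (trans (cong (∑ (range M) χ +_) (∑-periodic M {χ} (λ u → cong big? (g₁-period₁ u v)) (P ℕ.* n))) (eq (∑ (range M) χ)))))) }
      where
      χ : ℕ → ℤ
      χ u = big? (g₁ u v)
      eq : ∀ x → x + x ≡ pos 2 * x
      eq = solve-∀
      either : ∀ u → 1ℤ ≤ χ u + χ (u ℕ.+ P ℕ.* n)
      either u with big-quadrant u v
      ... | inj₁ b = ℤ.≤-trans (big?-complete (g₁ u v) b) (certify (big?≥0 (g₁ (u ℕ.+ P ℕ.* n) v)) (eq′ (χ u) (χ (u ℕ.+ P ℕ.* n))))
        where
        eq′ : ∀ a b → b ≡ a + b - a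
        eq′ = solve-∀
      ... | inj₂ b = ℤ.≤-trans (big?-complete (g₁ (u ℕ.+ P ℕ.* n) v) b) (certify (big?≥0 (g₁ u v)) (eq′ (χ u) (χ (u ℕ.+ P ℕ.* n))))
        where
        eq′ : ∀ a b → a ≡ a + b - b
        eq′ = solve-∀

-- Squared distance and form in high dimension

module Space where

  open Prelude
  open Sums
  open Grid
  open Rotation using (≤⊎>)
  open SineWave
  open AntiConcentration
  open Curve
  open Form
  open import Data.Vec.Relation.Unary.All using (All; []; _∷_)

  lift : ∀ {k} → (ℕ → ℕ → ℤ) → Vec ℕ k → Vec ℕ k → ℤ
  lift φ []      []      = 0ℤ
  lift φ (u ∷ x) (v ∷ y) = φ u v + lift φ x y

  lift-cong : ∀ {k} {φ ψ : ℕ → ℕ → ℤ} (h h′ : ℕ → ℕ) → (∀ u v → φ (h u) (h′ v) ≡ ψ u v) →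
              ∀ (x y : Vec ℕ k) → lift φ (Vec.map h x) (Vec.map h′ y) ≡ lift ψ x y
  lift-cong h h′ p []      []      = refl
  lift-cong h h′ p (u ∷ x) (v ∷ y) = cong₂ _+_ (p u v) (lift-cong h h′ p x y)

  lift-cong₁ : ∀ {k} {φ ψ : ℕ → ℕ → ℤ} (h : ℕ → ℕ) → (∀ u v → φ (h u) v ≡ ψ u v) →
               ∀ (x y : Vec ℕ k) → lift φ (Vec.map h x) y ≡ lift ψ x y
  lift-cong₁ h p []      []      = refl
  lift-cong₁ h p (u ∷ x) (v ∷ y) = cong₂ _+_ (p u v) (lift-cong₁ h p x y)

  lift-flip : ∀ {k} {φ ψ : ℕ → ℕ → ℤ} → (∀ u v → φ u v ≡ ψ v u) → ∀ (x y : Vec ℕ k) → lift φ x y ≡ lift ψ y x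
  lift-flip p []      []      = refl
  lift-flip p (u ∷ x) (v ∷ y) = cong₂ _+_ (p u v) (lift-flip p x y)

  lift-neg : ∀ {k} (φ : ℕ → ℕ → ℤ) (x y : Vec ℕ k) → lift (λ u v → - φ u v) x y ≡ - lift φ x y
  lift-neg φ []      []      = refl
  lift-neg φ (u ∷ x) (v ∷ y) = trans (cong (- φ u v +_) (lift-neg φ x y)) (sym (ℤ.neg-distrib-+ (φ u v) (lift φ x y)))

  lift-periodic₁ : ∀ {k} {φ : ℕ → ℕ → ℤ} m → (∀ u v → φ (u ℕ.+ m) v ≡ φ u v) →
                   ∀ (y : Vec ℕ k) → PeriodicV m (λ x → lift φ x y)
  lift-periodic₁ {φ = φ} m p (v ∷ y) (u ∷ x) zero    = cong (_+ lift φ x y) (p u v)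
  lift-periodic₁ {φ = φ} m p (v ∷ y) (u ∷ x) (suc i) = cong (φ u v +_) (lift-periodic₁ m p y x i)

  lift-periodic₂ : ∀ {k} {φ : ℕ → ℕ → ℤ} m → (∀ u v → φ u (v ℕ.+ m) ≡ φ u v) →
                   ∀ (x : Vec ℕ k) → PeriodicV m (λ y → lift φ x y)
  lift-periodic₂ {φ = φ} m p (u ∷ x) (v ∷ y) zero    = cong (_+ lift φ x y) (p u v)
  lift-periodic₂ {φ = φ} m p (u ∷ x) (v ∷ y) (suc i) = cong (φ u v +_) (lift-periodic₂ m p x y i)

  module HighDim (P κ Λ n : ℕ) .{{_ : ℕ.NonZero n}} (4≤P : 4 ℕ.≤ P) (wave : Sine P κ Λ) where

    open Sine wave public
    open Bilinear P κ Λ n 4≤P wave public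

    sh : ∀ {k} → ℕ → Vec ℕ k → Vec ℕ k
    sh t = shift (t ℕ.* n)

    sh-0 : ∀ {k} (x : Vec ℕ k) → sh 0 x ≡ x
    sh-0 []      = refl
    sh-0 (u ∷ x) = cong₂ _∷_ (ℕ.+-identityʳ u) (sh-0 x)

    sh-+ : ∀ {k} t t′ (x : Vec ℕ k) → sh t (sh t′ x) ≡ sh (t′ ℕ.+ t) x
    sh-+ t t′ []      = refl
    sh-+ t t′ (u ∷ x) = cong₂ _∷_ (eq u t t′ n) (sh-+ t t′ x)
      where
      eq : ∀ u t t′ n → u ℕ.+ t′ ℕ.* n ℕ.+ t ℕ.* n ≡ u ℕ.+ (t′ ℕ.+ t) ℕ.* n
      eq = ℕSolver.solve-∀

    ρ² : ℕ → ℕ → ℤ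
    ρ² u v = ρ u v * ρ u v

    D g : ∀ {k} → Vec ℕ k → Vec ℕ k → ℤ
    D = lift ρ²
    g = lift g₁

    D≥0 : ∀ {k} (x y : Vec ℕ k) → 0ℤ ≤ D x y
    D≥0 []      []      = ℤ.≤-refl
    D≥0 (u ∷ x) (v ∷ y) = 0≤+ (0≤² (ρ u v)) (D≥0 x y)

    D-refl : ∀ {k} (x : Vec ℕ k) → D x x ≡ 0ℤ
    D-refl []      = refl
    D-refl (u ∷ x) = cong₂ _+_ (cong₂ _*_ (ρ-refl u) (ρ-refl u)) (D-refl x)

    D-sym : ∀ {k} (x y : Vec ℕ k) → D x y ≡ D y x
    D-sym = lift-flip (λ u v → cong₂ _*_ (ρ-sym u v) (ρ-sym u v))

    D-triangle : ∀ {k} (x y z : Vec ℕ k) → D x z ≤ pos 2 * (D x y + D y z)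
    D-triangle []      []      []      = ℤ.≤-refl
    D-triangle (u ∷ x) (v ∷ y) (w ∷ z) = certify
      (0≤+ (0≤+ (≤⇒0≤ (D-triangle x y z)) (0≤² (ρ u v - ρ v w)))
           (0≤* (≤⇒0≤ (ρ-triangle u v w)) (0≤+ (0≤+ (ρ≥0 u v) (ρ≥0 v w)) (ρ≥0 u w))))
      (eq (ρ u v) (ρ v w) (ρ u w) (D x y) (D y z) (D x z))
      where
      eq : ∀ a b c d e f → pos 2 * (d + e) - f + (a - b) * (a - b) + (a + b - c) * (a + b + c)
           ≡ pos 2 * (a * a + d + (b * b + e)) - (c * c + f)
      eq = solve 6 (λ a b c d e f → con (pos 2) :* (d :+ e) :- f :+ (a :- b) :* (a :- b) :+ (a :+ b :- c) :* (a :+ b :+ c) := con (pos 2) :* (a :* a :+ d :+ (b :* b :+ e)) :- (c :* c :+ f)) refl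

    D-sh : ∀ {k} t (x y : Vec ℕ k) → D (sh t x) (sh t y) ≡ D x y
    D-sh t = lift-cong (ℕ._+ t ℕ.* n) (ℕ._+ t ℕ.* n) (λ u v → cong₂ _*_ (ρ-shift t u v) (ρ-shift t u v))

    ρ²-period : ∀ u v → ρ² (u ℕ.+ M) v ≡ ρ² u v
    ρ²-period u v = cong₂ _*_ (ρ-period u v) (ρ-period u v)

    D-period : ∀ {k} (x y : Vec ℕ k) → D (sh Q x) y ≡ D x y
    D-period = lift-cong₁ (ℕ._+ M) ρ²-period

    D-far : ∀ {k} j → 2 ℕ.≤ j → j ℕ.+ 2 ℕ.≤ Q → ∀ (x : Vec ℕ k) → pos k * (pos n * pos n) ≤ D x (sh j x)
    D-far j p p′ []      = ℤ.≤-reflexive (ℤ.*-zeroˡ (pos n * pos n))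
    D-far {suc k} j p p′ (u ∷ x) = ℤ.≤-trans (ℤ.≤-reflexive (eq (pos k) (pos n)))
        (ℤ.+-mono-≤ (*-mono (0≤⁺ n) (0≤⁺ n) far far) (D-far j p p′ x))
      where
      far = ρ-far u j p p′
      eq : ∀ k n → (1ℤ + k) * (n * n) ≡ n * n + k * (n * n)
      eq = solve-∀

    -- A unit step changes one `ρ` by at most 2, and so its square by at most `4 ρ + 4`.
    D-step : ∀ {k} (x y : Vec ℕ k) i → D (updateAt x i suc) y ≤ D x y + (pos 4 * ρ (lookup x i) (lookup y i) + pos 4)
    D-step (u ∷ x) (v ∷ y) zero = certify
      (0≤* (≤⇒0≤ near) (0≤+ (0≤+ (ρ≥0 u v) (0≤⁺ 2)) (ρ≥0 (suc u) v)))
      (eq (ρ u v) (ρ (suc u) v) (D x y))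
      where
      near : ρ (suc u) v ≤ pos 2 + ρ u v
      near = ℤ.≤-trans (ρ-triangle (suc u) u v) (ℤ.+-monoˡ-≤ (ρ u v) (ρ-step u))
      eq : ∀ a b d → (pos 2 + a - b) * (a + pos 2 + b) ≡ a * a + d + (pos 4 * a + pos 4) - (b * b + d)
      eq = solve 3 (λ a b d → (con (pos 2) :+ a :- b) :* (a :+ con (pos 2) :+ b) := a :* a :+ d :+ (con (pos 4) :* a :+ con (pos 4)) :- (b :* b :+ d)) refl
    D-step (u ∷ x) (v ∷ y) (suc i) = ℤ.≤-trans (ℤ.+-monoʳ-≤ (ρ² u v) (D-step x y i)) (ℤ.≤-reflexive (sym (ℤ.+-assoc (ρ² u v) (D x y) _)))

    D-step⁻ : ∀ {k} (x y : Vec ℕ k) i → D x y ≤ D (updateAt x i suc) y + (pos 4 * ρ (suc (lookup x i)) (lookup y i) + pos 4)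
    D-step⁻ (u ∷ x) (v ∷ y) zero = certify
      (0≤* (≤⇒0≤ near) (0≤+ (0≤+ (ρ≥0 (suc u) v) (0≤⁺ 2)) (ρ≥0 u v)))
      (eq (ρ u v) (ρ (suc u) v) (D x y))
      where
      near : ρ u v ≤ pos 2 + ρ (suc u) v
      near = ℤ.≤-trans (ρ-triangle u (suc u) v) (ℤ.+-monoˡ-≤ (ρ (suc u) v) (ℤ.≤-trans (ℤ.≤-reflexive (ρ-sym u (suc u))) (ρ-step u)))
      eq : ∀ a b d → (pos 2 + b - a) * (b + pos 2 + a) ≡ b * b + d + (pos 4 * b + pos 4) - (a * a + d)
      eq = solve 3 (λ a b d → (con (pos 2) :+ b :- a) :* (b :+ con (pos 2) :+ a) := b :* b :+ d :+ (con (pos 4) :* b :+ con (pos 4)) :- (a :* a :+ d)) refl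
    D-step⁻ (u ∷ x) (v ∷ y) (suc i) = ℤ.≤-trans (ℤ.+-monoʳ-≤ (ρ² u v) (D-step⁻ x y i)) (ℤ.≤-reflexive (sym (ℤ.+-assoc (ρ² u v) (D (updateAt x i suc) y) _)))

    sumFin-ρ² : ∀ {k} (x y : Vec ℕ k) → sumFin (λ i → ρ² (lookup x i) (lookup y i)) ≡ D x y
    sumFin-ρ² []      []      = refl
    sumFin-ρ² (u ∷ x) (v ∷ y) = cong (ρ² u v +_) (sumFin-ρ² x y)

    g-inv : ∀ {k} t (x z : Vec ℕ k) → g (sh t x) (sh t z) ≡ g x z
    g-inv t = lift-cong (ℕ._+ t ℕ.* n) (ℕ._+ t ℕ.* n) (g₁-inv t)

    g-anti₂ : ∀ {k} (x z : Vec ℕ k) → g x (sh (P ℕ.+ P) z) ≡ - g x z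
    g-anti₂ x z = trans (lift-flip (λ _ _ → refl) x (sh (P ℕ.+ P) z))
      (trans (lift-cong₁ {ψ = λ v u → - g₁ u v} (ℕ._+ (P ℕ.+ P) ℕ.* n) (λ v u → g₁-anti₂ u v) z x)
        (trans (lift-flip (λ _ _ → refl) z x) (lift-neg g₁ x z)))

    g-anti₁ : ∀ {k} (x z : Vec ℕ k) → g (sh (P ℕ.+ P) x) z ≡ - g x z
    g-anti₁ x z = trans (lift-cong₁ {ψ = λ u v → - g₁ u v} (ℕ._+ (P ℕ.+ P) ℕ.* n) g₁-anti₁ x z) (lift-neg g₁ x z)

    mixed : ∀ {k} (x x′ z z′ : Vec ℕ k) → pos 2 * (g x z - g x′ z - g x z′ + g x′ z′) ≤ s * (D x x′ + D z z′)
    mixed []      []        []      []        = ℤ.≤-reflexive (sym (ℤ.*-zeroʳ s))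
    mixed (u ∷ x) (u′ ∷ x′) (v ∷ z) (v′ ∷ z′) = certify
      (0≤+ (≤⇒0≤ (mixed₂ u u′ v v′)) (≤⇒0≤ (mixed x x′ z z′)))
      (eq s (ρ² u u′) (ρ² v v′) (g₁ u v) (g₁ u′ v) (g₁ u v′) (g₁ u′ v′) (D x x′) (D z z′) (g x z) (g x′ z) (g x z′) (g x′ z′))
      where
      eq : ∀ s r r′ a b c d D D′ a′ b′ c′ d′ →
        s * (r + r′) - pos 2 * (a - b - c + d) + (s * (D + D′) - pos 2 * (a′ - b′ - c′ + d′))
        ≡ s * (r + D + (r′ + D′)) - pos 2 * (a + a′ - (b + b′) - (c + c′) + (d + d′))
      eq = solve 13 (λ s r r′ a b c d D D′ a′ b′ c′ d′ → s :* (r :+ r′) :- con (pos 2) :* (a :- b :- c :+ d) :+ (s :* (D :+ D′) :- con (pos 2) :* (a′ :- b′ :- c′ :+ d′)) := s :* (r :+ D :+ (r′ :+ D′)) :- con (pos 2) :* (a :+ a′ :- (b :+ b′) :- (c :+ c′) :+ (d :+ d′))) refl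

    three-+ : ∀ {E F τ τ′} → ThreeTerm E τ → ThreeTerm F τ′ → ThreeTerm (E + F) (λ t → τ t + τ′ t)
    three-+ {E} {F} {τ} {τ′} p p′ i j t = subst (Small (E + F))
      (eq (S j) (S (i ℕ.+ j)) (S i) (τ t) (τ (t ℕ.+ i)) (τ (t ℕ.+ (i ℕ.+ j))) (τ′ t) (τ′ (t ℕ.+ i)) (τ′ (t ℕ.+ (i ℕ.+ j))))
      ( ℤ.≤-trans (ℤ.≤-reflexive (ℤ.*-distribˡ-+ (pos Λ) T T′)) (ℤ.+-mono-≤ (proj₁ (p i j t)) (proj₁ (p′ i j t)))
      , ℤ.≤-trans (ℤ.≤-trans (ℤ.≤-reflexive (ℤ.neg-distrib-+ E F)) (ℤ.+-mono-≤ (proj₂ (p i j t)) (proj₂ (p′ i j t))))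
                  (ℤ.≤-reflexive (sym (ℤ.*-distribˡ-+ (pos Λ) T T′))))
      where
      T T′ : ℤ
      T = trio i j (τ t) (τ (t ℕ.+ i)) (τ (t ℕ.+ (i ℕ.+ j)))
      T′ = trio i j (τ′ t) (τ′ (t ℕ.+ i)) (τ′ (t ℕ.+ (i ℕ.+ j)))
      eq : ∀ x y z a b c a′ b′ c′ → x * a - y * b + z * c + (x * a′ - y * b′ + z * c′)
           ≡ x * (a + a′) - y * (b + b′) + z * (c + c′)
      eq = solve 9 (λ x y z a b c a′ b′ c′ → x :* a :- y :* b :+ z :* c :+ (x :* a′ :- y :* b′ :+ z :* c′) := x :* (a :+ a′) :- y :* (b :+ b′) :+ z :* (c :+ c′)) refl

    Err : ℕ → ℤ
    Err zero    = 0ℤ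
    Err (suc k) = E₁ + Err k

    Err≡ : ∀ k → Err k ≡ pos k * E₁
    Err≡ zero    = sym (ℤ.*-zeroˡ E₁)
    Err≡ (suc k) = trans (cong (E₁ +_) (Err≡ k)) (eq (pos k) E₁)
      where
      eq : ∀ k e → e + k * e ≡ (1ℤ + k) * e
      eq = solve-∀

    three-0 : ThreeTerm 0ℤ (λ _ → 0ℤ)
    three-0 i j t = subst (Small 0ℤ) (eq (S j) (S (i ℕ.+ j)) (S i)) (ℤ.≤-reflexive (ℤ.*-zeroʳ (pos Λ)) , ℤ.≤-reflexive (sym (ℤ.*-zeroʳ (pos Λ))))
      where
      eq : ∀ x y z → 0ℤ ≡ x * 0ℤ - y * 0ℤ + z * 0ℤ
      eq = solve-∀

    three-left : ∀ {k} (x z : Vec ℕ k) → ThreeTerm (Err k) (λ t → g (sh t x) z)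
    three-left []      []      = three-0
    three-left (u ∷ x) (v ∷ z) = three-+ {τ = λ t → g₁ (u ℕ.+ t ℕ.* n) v} {τ′ = λ t → g (sh t x) z} (three-g₁-left u v) (three-left x z)

    three-right : ∀ {k} (x z : Vec ℕ k) → ThreeTerm (Err k) (λ t → g x (sh t z))
    three-right []      []      = three-0
    three-right (u ∷ x) (v ∷ z) = three-+ {τ = λ t → g₁ u (v ℕ.+ t ℕ.* n)} {τ′ = λ t → g x (sh t z)} (three-g₁-right u v) (three-right x z)

    eval-g : ∀ {k} (x z : Vec ℕ k) → eval (Vec.map (λ v u → g₁ u v) z) x ≡ g x z
    eval-g []      []      = refl
    eval-g (u ∷ x) (v ∷ z) = cong (g₁ u v +_) (eval-g x z)

    spreads : ∀ {k} (z : Vec ℕ k) → All Spread (Vec.map (λ v u → g₁ u v) z)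
    spreads []      = []
    spreads (v ∷ z) = spread v ∷ spreads z

    Near : ℤ → ℤ → Set
    Near R y = (- R ≤ y) × (y ≤ R)

    near? : ℤ → ℤ → ℤ
    near? R y with ≤⊎> (- R) y | ≤⊎> y R
    ... | inj₁ _ | inj₁ _ = 1ℤ
    ... | inj₁ _ | inj₂ _ = 0ℤ
    ... | inj₂ _ | _      = 0ℤ

    near?≥0 : ∀ R y → 0ℤ ≤ near? R y
    near?≥0 R y with ≤⊎> (- R) y | ≤⊎> y R
    ... | inj₁ _ | inj₁ _ = 0≤⁺ 1
    ... | inj₁ _ | inj₂ _ = 0≤⁺ 0
    ... | inj₂ _ | _      = 0≤⁺ 0

    data Sign (R y : ℤ) : ℤ → Set where
      plus  : 1ℤ + R ≤ y → Sign R y 0ℤ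
      minus : 1ℤ + R ≤ - y → Sign R y 0ℤ
      close : Near R y → Sign R y 1ℤ

    sign : ∀ R y → Sign R y (near? R y)
    sign R y with ≤⊎> (- R) y | ≤⊎> y R
    ... | inj₁ p | inj₁ q = close (p , q)
    ... | inj₁ _ | inj₂ q = plus q
    ... | inj₂ p | _      = minus (certify (≤⇒0≤ p) (eq R y))
      where
      eq : ∀ R y → - R - (1ℤ + y) ≡ - y - (1ℤ + R)
      eq = solve-∀

    -- For fixed `z` and uniformly random `x`, the value `g x z` is a sum of independent symmetric
    -- terms, one per coordinate; `W` windows of length `w` cover the interval from `- R` to `R`.
    near-rare : ∀ {k} R W d → 1 ℕ.≤ W → 1 ℕ.≤ d → 1ℤ + (R + R) ≤ pos W * w →
      let L = 2 ℕ.* (W ℕ.* d) in (2 ℕ.* (L ℕ.* L)) ℕ.* (2 ℕ.* (L ℕ.* L)) ℕ.≤ k →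
      ∀ (z : Vec ℕ k) → pos d * ∑ (grid M k) (λ x → near? R (g x z)) ≤ size M k
    near-rare {k} R W d 1≤W 1≤d R≤ large z = ℤ.≤-trans (*-monoˡ (pos d) (0≤⁺ d)
        (ℤ.≤-trans (∑-mono (grid M k) covered)
          (ℤ.≤-reflexive (trans (∑-swap (grid M k) (windows (- R) W) (λ x a → hit w a (g x z)))
            (∑-cong (windows (- R) W) (λ a → trans (∑-cong (grid M k) (λ x → cong (hit w a) (sym (eval-g x z)))) (sym (count-grid gs a))))))))
        (anti-concentration W d 1≤W 1≤d k large gs (spreads z) (- R))
      where
      gs = Vec.map (λ v u → g₁ u v) z
      covered : ∀ x → near? R (g x z) ≤ ∑ (windows (- R) W) (λ a → hit w a (g x z))
      covered x = cover (g x z) (sign R (g x z))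
        where
        cover : ∀ y {b} → Sign R y b → b ≤ ∑ (windows (- R) W) (λ a → hit w a y)
        cover y (plus _)        = ∑-0≤ (windows (- R) W) (λ a → hit≥0 a y)
        cover y (minus _)       = ∑-0≤ (windows (- R) W) (λ a → hit≥0 a y)
        cover y (close (p , q)) = windows-cover (- R) W y p (certify (0≤+ (≤⇒0≤ R≤) (≤⇒0≤ q)) (eq R y (pos W * w)))
          where
          eq : ∀ R y v → v - (1ℤ + (R + R)) + (R - y) ≡ - R + v - (1ℤ + y)
          eq = solve 3 (λ R y v → v :- (con 1ℤ :+ (R :+ R)) :+ (R :- y) := :- R :+ v :- (con 1ℤ :+ y)) refl

  search : ∀ {A : Set} (f : A → ℤ) C (xs : List A) → (∃ λ x → (x ∈ xs) × (f x ≤ C)) ⊎ (∀ x → x ∈ xs → 1ℤ + C ≤ f x)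
  search f C []       = inj₂ (λ _ ())
  search f C (x ∷ xs) with ≤⊎> (f x) C | search f C xs
  ... | inj₁ p | _                  = inj₁ (x , here refl , p)
  ... | inj₂ _ | inj₁ (y , y∈ , q)  = inj₁ (y , there y∈ , q)
  ... | inj₂ p | inj₂ all           = inj₂ (λ { y (here refl) → p ; y (there y∈) → all y y∈ })

-- Cliques have at most p + ℓ vertices

module Cliques where

  open Prelude
  open Sums
  open Grid
  open Rotation using (1≤⇒0≤)
  open SineWave
  open AntiConcentration using (<-irrefl)
  open Curve
  open Form
  open Space
  open import Data.Fin using (fromℕ<)

  module CliqueFree (p ℓ κ Λ n k : ℕ) .{{_ : ℕ.NonZero n}} (4≤P : 4 ℕ.≤ p ℕ.+ p) (1≤ℓ : 1 ℕ.≤ ℓ) (2ℓ≤p : ℓ ℕ.+ ℓ ℕ.≤ p)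
                    (wave : Sine (p ℕ.+ p) κ Λ) (C : ℤ) where

    open HighDim (p ℕ.+ p) κ Λ n 4≤P wave

    -- The quarter turn is `2p` vertices of the polygon, so half a turn is `H₂ = 4p`, a full turn is
    -- `Q = 8p`, and `1 / p` of a turn is `sh 8`.
    P H₂ : ℕ
    P = p ℕ.+ p
    H₂ = P ℕ.+ P

    V : Set
    V = Vec ℕ k

    -- `R` is twice the bound `s * C` of a mixed second difference with both displacements at most
    -- `C`; one half is spent in `margin` on comparing points.
    E R : ℤ
    E = Err k
    R = pos 2 * (s * C)

    Q≡8p : Q ≡ 8 ℕ.* p
    Q≡8p = eq p
      where
      eq : ∀ p → (p ℕ.+ p ℕ.+ (p ℕ.+ p)) ℕ.+ (p ℕ.+ p ℕ.+ (p ℕ.+ p)) ≡ 8 ℕ.* p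
      eq = ℕSolver.solve-∀

    H₂≡ : H₂ ≡ 4 ℕ.* p
    H₂≡ = eq p
      where
      eq : ∀ p → p ℕ.+ p ℕ.+ (p ℕ.+ p) ≡ 4 ℕ.* p
      eq = ℕSolver.solve-∀

    -- The properties of `g` used below, isolated so that the argument also applies to `swap g`,
    -- where the classes have changed places.
    record BForm (G : V → V → ℤ) : Set where
      field
        inv   : ∀ t x z → G (sh t x) (sh t z) ≡ G x z
        anti₁ : ∀ x z → G (sh H₂ x) z ≡ - G x z
        anti₂ : ∀ x z → G x (sh H₂ z) ≡ - G x z
        left  : ∀ x z → ThreeTerm E (λ t → G (sh t x) z)
        right : ∀ x z → ThreeTerm E (λ t → G x (sh t z))
        mix   : ∀ x x′ z z′ → pos 2 * (G x z - G x′ z - G x z′ + G x′ z′) ≤ s * (D x x′ + D z z′)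

    g-form : BForm g
    g-form = record { inv = g-inv ; anti₁ = g-anti₁ ; anti₂ = g-anti₂ ; left = three-left ; right = three-right ; mix = mixed }

    three-neg : ∀ {F τ} → ThreeTerm F τ → ThreeTerm F (λ t → - τ t)
    three-neg {F} {τ} h i j t =
        ℤ.≤-trans (ℤ.≤-reflexive flipped) (ℤ.≤-trans (ℤ.neg-mono-≤ (proj₂ (h i j t))) (ℤ.≤-reflexive (ℤ.neg-involutive F)))
      , ℤ.≤-trans (ℤ.neg-mono-≤ (proj₁ (h i j t))) (ℤ.≤-reflexive (sym flipped))
      where
      eq : ∀ l x y z a b c → l * (x * - a - y * - b + z * - c) ≡ - (l * (x * a - y * b + z * c))
      eq = solve 7 (λ l x y z a b c → l :* (x :* :- a :- y :* :- b :+ z :* :- c) := :- (l :* (x :* a :- y :* b :+ z :* c))) refl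
      flipped = eq (pos Λ) (S j) (S (i ℕ.+ j)) (S i) (τ t) (τ (t ℕ.+ i)) (τ (t ℕ.+ (i ℕ.+ j)))

    -- Exchanging the two sides turns the cross adjacency into one of the same shape.
    swap : (V → V → ℤ) → V → V → ℤ
    swap G z x = - G x (sh (8 ℕ.* ℓ) z)

    sh-comm : ∀ t t′ (x : V) → sh t (sh t′ x) ≡ sh t′ (sh t x)
    sh-comm t t′ x = trans (sh-+ t t′ x) (trans (cong (λ r → sh r x) (ℕ.+-comm t′ t)) (sym (sh-+ t′ t x)))

    swap-form : ∀ {G} → BForm G → BForm (swap G)
    swap-form {G} f = record
      { inv = λ t z x → cong -_ (trans (cong (G (sh t x)) (sh-comm m t z)) (inv t x (sh m z)))
      ; anti₁ = λ z x → cong -_ (trans (cong (G x) (sh-comm m H₂ z)) (anti₂ x (sh m z)))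
      ; anti₂ = λ z x → cong -_ (anti₁ x (sh m z))
      ; left = λ z x → three-neg {τ = λ t → G x (sh m (sh t z))}
          (three-cong {τ = λ t → G x (sh t (sh m z))} (λ t → cong (G x) (sh-comm t m z)) (right x (sh m z)))
      ; right = λ z x → three-neg {τ = λ t → G (sh t x) (sh m z)} (left x (sh m z))
      ; mix = λ z z′ x x′ → ℤ.≤-trans
          (ℤ.≤-reflexive (eq (G x (sh m z)) (G x (sh m z′)) (G x′ (sh m z)) (G x′ (sh m z′))))
          (ℤ.≤-trans (mix x′ x (sh m z) (sh m z′))
            (ℤ.≤-reflexive (cong (s *_) (trans (ℤ.+-comm (D x′ x) (D (sh m z) (sh m z′))) (cong₂ _+_ (D-sh m z z′) (D-sym x′ x)))))) }
      where
      open BForm f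
      m = 8 ℕ.* ℓ
      eq : ∀ a b c d → pos 2 * (- a - - b - - c + - d) ≡ pos 2 * (c - a - d + b)
      eq = solve 4 (λ a b c d → con (pos 2) :* (:- a :- :- b :- :- c :+ :- d) := con (pos 2) :* (c :- a :- d :+ b)) refl

    Cross : (V → V → ℤ) → V → V → Set
    Cross G x z = (1ℤ + R ≤ G x z) × (1ℤ + R ≤ - G x (sh (8 ℕ.* ℓ) z))

    swap-cross : ∀ {G} → BForm G → ∀ x z → Cross G x z → Cross (swap G) z x
    swap-cross {G} f x z (a , b) = b , ℤ.≤-trans a (ℤ.≤-reflexive
      (trans (sym (BForm.inv f (8 ℕ.* ℓ) x z)) (sym (ℤ.neg-involutive (G (sh (8 ℕ.* ℓ) x) (sh (8 ℕ.* ℓ) z))))))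

    Linked : V → V → Set
    Linked x y = ∃ λ t → (1 ℕ.≤ t) × (t ℕ.< p) × (D (sh (8 ℕ.* t) x) y ≤ C)

    linked-sym : ∀ {x y} → Linked x y → Linked y x
    linked-sym {x} {y} (t , 1≤t , t<p , d) = p ℕ.∸ t , ℕ.m<n⇒0<n∸m t<p , ℕ.∸-monoʳ-< 1≤t (ℕ.<⇒≤ t<p)
      , ℤ.≤-trans (ℤ.≤-reflexive (trans (D-sym (sh r y) x) (trans (sym (D-period x (sh r y)))
          (trans (cong (λ z → D z (sh r y)) (sym whole)) (D-sh r (sh (8 ℕ.* t) x) y))))) d
      where
      r = 8 ℕ.* (p ℕ.∸ t)
      whole : sh r (sh (8 ℕ.* t) x) ≡ sh Q x
      whole = trans (sh-+ r (8 ℕ.* t) x) (cong (λ z → sh z x) (trans (sym (ℕ.*-distribˡ-+ 8 t (p ℕ.∸ t)))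
        (trans (cong (8 ℕ.*_) (ℕ.m+[n∸m]≡n (ℕ.<⇒≤ t<p))) (sym Q≡8p))))

    module _ (1≤Λ : 1 ℕ.≤ Λ) (2≤C : pos 2 ≤ C) (separated : 1ℤ + pos 10 * C ≤ pos k * (pos n * pos n))
             (fine : 1ℤ + pos 3 * E ≤ pos Λ * (μ * μ)) where

      C≥0 = ℤ.≤-trans (0≤⁺ 2) 2≤C
      μ≥0 = 1≤⇒0≤ μ≥1
      Λ≥1 : 1ℤ ≤ pos Λ
      Λ≥1 = +≤+ 1≤Λ
      E≥0 : 0ℤ ≤ E
      E≥0 = ℤ.≤-trans (0≤* (0≤⁺ k) (0≤* (0≤⁺ n) (0≤* (0≤⁺ n) (0≤² s)))) (ℤ.≤-reflexive (sym (Err≡ k)))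
      R≥0 : 0ℤ ≤ R
      R≥0 = 0≤* (0≤⁺ 2) (0≤* s≥0 C≥0)

      1<H₂ : 1 ℕ.< H₂
      1<H₂ = ℕ.≤-trans (ℕ.≤-trans (ℕ.s≤s (ℕ.s≤s ℕ.z≤n)) 4≤P) (ℕ.m≤m+n P P)

      μ≤s : μ ≤ s
      μ≤s = ℤ.≤-trans (S-pos 1 ℕ.≤-refl 1<H₂) (S≤s 1)

      S-H₂ : S H₂ ≡ 0ℤ
      S-H₂ = trans (S-anti 0) (cong -_ S-0)

      S≥0 : ∀ t → t ℕ.≤ H₂ → 0ℤ ≤ S t
      S≥0 zero    _ = ℤ.≤-reflexive (sym S-0)
      S≥0 (suc t) t≤ with ℕ.m≤n⇒m<n∨m≡n t≤
      ... | inj₁ t< = ℤ.≤-trans μ≥0 (S-pos (suc t) (ℕ.s≤s ℕ.z≤n) t<)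
      ... | inj₂ e  = ℤ.≤-reflexive (sym (trans (cong S e) S-H₂))

      -- When `i + j` is at most half a turn, the samples `S j`, `S (i + j)`, `S i` are nonnegative.
      -- Signs +, -, + of `τ` would then make all three terms of the relation nonnegative, with a
      -- sum beyond its error `F`.
      no-zigzag : ∀ {F r} (τ : ℕ → ℤ) → ThreeTerm F τ → 0ℤ ≤ r → 1ℤ + F ≤ pos Λ * (r * μ) →
        ∀ t i j → 1 ℕ.≤ i → 1 ℕ.≤ j → i ℕ.+ j ℕ.≤ H₂ →
        r ≤ τ t → r ≤ - τ (t ℕ.+ i) → r ≤ τ (t ℕ.+ (i ℕ.+ j)) → ⊥
      no-zigzag {F} {r} τ h r≥0 big t i j 1≤i 1≤j i+j≤ a b c = absurd
        (0≤+ (0≤+ (≤⇒0≤ big) (≤⇒0≤ (proj₁ (h i j t)))) (0≤* (0≤⁺ Λ)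
          (0≤+ (0≤+ (0≤+ (0≤* Sj≥0 (≤⇒0≤ a)) (0≤* (S≥0 (i ℕ.+ j) i+j≤) (ℤ.≤-trans r≥0 b))) (0≤* Si≥0 (ℤ.≤-trans r≥0 c)))
               (0≤* r≥0 (≤⇒0≤ Sj)))))
        (eq (pos Λ) F r μ (S j) (S (i ℕ.+ j)) (S i) (τ t) (τ (t ℕ.+ i)) (τ (t ℕ.+ (i ℕ.+ j))))
        where
        Sj : μ ≤ S j
        Sj = S-pos j 1≤j (ℕ.<-≤-trans (ℕ.m<n+m j 1≤i) i+j≤)
        Sj≥0 = ℤ.≤-trans μ≥0 Sj
        Si≥0 = ℤ.≤-trans μ≥0 (S-pos i 1≤i (ℕ.<-≤-trans (ℕ.m<m+n i 1≤j) i+j≤))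
        eq : ∀ l F r μ x y z a b c →
          l * (r * μ) - (1ℤ + F) + (F - l * (x * a - y * b + z * c)) + l * (x * (a - r) + y * (- b) + z * c + r * (x - μ)) ≡ - 1ℤ
        eq = solve 10 (λ l F r μ x y z a b c → l :* (r :* μ) :- (con 1ℤ :+ F) :+ (F :- l :* (x :* a :- y :* b :+ z :* c)) :+ l :* (x :* (a :- r) :+ y :* (:- b) :+ z :* c :+ r :* (x :- μ)) := :- con 1ℤ) refl

      -- The origin lies in the triangle spanned by the directions 0, 8b and 8c.
      record Dependency (b c : ℕ) : Set where
        field
          λ₀ λ₁ λ₂ : ℤ
          λ₀≥0 : 0ℤ ≤ λ₀
          λ₁≥0 : 0ℤ ≤ λ₁
          λ₂≥0 : 0ℤ ≤ λ₂
          sum≥μ : μ ≤ λ₀ + λ₁ + λ₂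
          sum≤3s : λ₀ + λ₁ + λ₂ ≤ pos 3 * s
          relation : ∀ (τ : ℕ → ℤ) → ThreeTerm E τ → (∀ t → τ (t ℕ.+ H₂) ≡ - τ t) →
                     Small E (λ₀ * τ 0 + λ₁ * τ (8 ℕ.* b) + λ₂ * τ (8 ℕ.* c))

      8*≤H₂ : ∀ b → b ℕ.+ b ℕ.≤ p → 8 ℕ.* b ℕ.≤ H₂
      8*≤H₂ b q = ℕ.≤-trans (ℕ.≤-reflexive (eq b)) (ℕ.≤-trans (ℕ.*-monoʳ-≤ 4 q) (ℕ.≤-reflexive (sym H₂≡)))
        where
        eq : ∀ b → 8 ℕ.* b ≡ 4 ℕ.* (b ℕ.+ b)
        eq = ℕSolver.solve-∀

      H₂≤8* : ∀ c → p ℕ.≤ c ℕ.+ c → H₂ ℕ.≤ 8 ℕ.* c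
      H₂≤8* c q = ℕ.≤-trans (ℕ.≤-reflexive H₂≡) (ℕ.≤-trans (ℕ.*-monoʳ-≤ 4 q) (ℕ.≤-reflexive (eq c)))
        where
        eq : ∀ c → 4 ℕ.* (c ℕ.+ c) ≡ 8 ℕ.* c
        eq = ℕSolver.solve-∀

      -- The degenerate case: the directions 0 and half a turn balance by themselves, and the third
      -- weight is 0.
      antipodal : ∀ b → b ℕ.+ b ≡ p → Dependency b b
      antipodal b e = record
        { λ₀ = μ ; λ₁ = μ ; λ₂ = 0ℤ ; λ₀≥0 = μ≥0 ; λ₁≥0 = μ≥0 ; λ₂≥0 = ℤ.≤-refl
        ; sum≥μ = certify μ≥0 (eq₁ μ) ; sum≤3s = certify (0≤+ (0≤* (0≤⁺ 2) (≤⇒0≤ μ≤s)) s≥0) (eq₂ μ s)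
        ; relation = λ τ _ anti → subst (Small E) (sym (vanish τ anti)) small-0 }
        where
        eq₁ : ∀ m → m ≡ m + m + 0ℤ - m
        eq₁ = solve-∀
        eq₂ : ∀ m s → pos 2 * (s - m) + s ≡ pos 3 * s - (m + m + 0ℤ)
        eq₂ = solve 2 (λ m s → con (pos 2) :* (s :- m) :+ s := con (pos 3) :* s :- (m :+ m :+ con 0ℤ)) refl
        eq₃ : ∀ m x y → m * x + m * - x + 0ℤ * y ≡ 0ℤ
        eq₃ = solve-∀
        8b : 8 ℕ.* b ≡ H₂
        8b = ℕ.≤-antisym (8*≤H₂ b (ℕ.≤-reflexive e)) (H₂≤8* b (ℕ.≤-reflexive (sym e)))
        small-0 : Small E 0ℤ
        small-0 = ℤ.≤-trans (ℤ.≤-reflexive (ℤ.*-zeroʳ (pos Λ))) E≥0 , ℤ.≤-trans (ℤ.neg-mono-≤ E≥0) (ℤ.≤-reflexive (sym (ℤ.*-zeroʳ (pos Λ))))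
        vanish : ∀ τ → (∀ t → τ (t ℕ.+ H₂) ≡ - τ t) → μ * τ 0 + μ * τ (8 ℕ.* b) + 0ℤ * τ (8 ℕ.* b) ≡ 0ℤ
        vanish τ anti = trans (cong (λ z → μ * τ 0 + μ * z + 0ℤ * τ (8 ℕ.* b)) (trans (cong τ 8b) (anti 0))) (eq₃ μ (τ 0) (τ (8 ℕ.* b)))

      -- The weights are the coefficients of the three-term relation at 0, `8b` and `8(b + e)`. The
      -- middle one carries a minus sign; it is nonnegative because `b + e` parts make at least half
      -- a turn, where the wave is not positive.
      triangle : ∀ b e → 1 ℕ.≤ b → 1 ℕ.≤ e → b ℕ.+ b ℕ.≤ p → e ℕ.+ e ℕ.≤ p → p ℕ.≤ (b ℕ.+ e) ℕ.+ (b ℕ.+ e) → b ℕ.+ e ℕ.< p →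
                 Dependency b (b ℕ.+ e)
      triangle b e 1≤b 1≤e 2b≤p 2e≤p p≤2c c<p = record
        { λ₀ = S j ; λ₁ = - S (i ℕ.+ j) ; λ₂ = S i
        ; λ₀≥0 = Sj≥0 ; λ₁≥0 = λ₁≥0 ; λ₂≥0 = Si≥0
        ; sum≥μ = sum≥μ
        ; sum≤3s = certify (0≤+ (0≤+ (≤⇒0≤ (S≤s j)) (≤⇒0≤ (-s≤S (i ℕ.+ j)))) (≤⇒0≤ (S≤s i))) (eq₁ s (S j) (S (i ℕ.+ j)) (S i))
        ; relation = λ τ h _ → subst (Small E) (trans (eq₂ (S j) (S (i ℕ.+ j)) (S i) (τ 0) (τ i) (τ (i ℕ.+ j)))
                                  (cong (λ z → S j * τ 0 + - S (i ℕ.+ j) * τ i + S i * τ z) (sym (ℕ.*-distribˡ-+ 8 b e)))) (h i j 0) }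
        where
        i j : ℕ
        i = 8 ℕ.* b
        j = 8 ℕ.* e
        eq₁ : ∀ s x y z → s - x + (y - - s) + (s - z) ≡ pos 3 * s - (x + - y + z)
        eq₁ = solve 4 (λ s x y z → s :- x :+ (y :- :- s) :+ (s :- z) := con (pos 3) :* s :- (x :+ :- y :+ z)) refl
        eq₂ : ∀ x y z a b c → x * a - y * b + z * c ≡ x * a + - y * b + z * c
        eq₂ = solve 6 (λ x y z a b c → x :* a :- y :* b :+ z :* c := x :* a :+ :- y :* b :+ z :* c) refl
        Si≥0 = S≥0 i (8*≤H₂ b 2b≤p)
        Sj≥0 = S≥0 j (8*≤H₂ e 2e≤p)
        1≤i : 1 ℕ.≤ i
        1≤i = ℕ.≤-trans 1≤b (ℕ.m≤n*m b 8)
        1≤j : 1 ℕ.≤ j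
        1≤j = ℕ.≤-trans 1≤e (ℕ.m≤n*m e 8)
        i+j : i ℕ.+ j ≡ 8 ℕ.* (b ℕ.+ e)
        i+j = sym (ℕ.*-distribˡ-+ 8 b e)
        r = i ℕ.+ j ℕ.∸ H₂
        r+H₂ : r ℕ.+ H₂ ≡ i ℕ.+ j
        r+H₂ = ℕ.m∸n+n≡m (subst (H₂ ℕ.≤_) (sym i+j) (H₂≤8* (b ℕ.+ e) p≤2c))
        i+j<Q : i ℕ.+ j ℕ.< H₂ ℕ.+ H₂
        i+j<Q = subst₂ ℕ._<_ (sym i+j) (sym Q≡8p) (ℕ.*-monoʳ-< 8 c<p)
        λ₁≥0 : 0ℤ ≤ - S (i ℕ.+ j)
        λ₁≥0 = ℤ.≤-trans (S≥0 r (ℕ.<⇒≤ (ℕ.+-cancelʳ-< H₂ r H₂ (subst (ℕ._< H₂ ℕ.+ H₂) (sym r+H₂) i+j<Q))))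
          (ℤ.≤-reflexive (trans (sym (ℤ.neg-involutive (S r))) (cong -_ (trans (sym (S-anti r)) (cong S r+H₂)))))
        eq₃ : ∀ x y z m → (z - m) + x + - y ≡ x + - y + z - m
        eq₃ = solve-∀
        eq₄ : ∀ x y z m → (x - m) + z + - y ≡ x + - y + z - m
        eq₄ = solve-∀
        sum≥μ : μ ≤ S j + - S (i ℕ.+ j) + S i
        sum≥μ =
          [ (λ i< → certify (0≤+ (0≤+ (≤⇒0≤ (S-pos i 1≤i i<)) Sj≥0) λ₁≥0) (eq₃ (S j) (S (i ℕ.+ j)) (S i) μ))
          , (λ i≡ → [ (λ j< → certify (0≤+ (0≤+ (≤⇒0≤ (S-pos j 1≤j j<)) Si≥0) λ₁≥0) (eq₄ (S j) (S (i ℕ.+ j)) (S i) μ))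
                    , (λ j≡ → ⊥-elim (ℕ.<-irrefl (cong₂ ℕ._+_ i≡ j≡) i+j<Q)) ]′ (ℕ.m≤n⇒m<n∨m≡n (8*≤H₂ e 2e≤p)))
          ]′ (ℕ.m≤n⇒m<n∨m≡n (8*≤H₂ b 2b≤p))

      module Signs {F r : ℤ} (τ : ℕ → ℤ) (three-τ : ThreeTerm F τ) (r≥1 : 1ℤ ≤ r) (F-small : 1ℤ + F ≤ pos Λ * (r * μ))
                   (τ-period : ∀ i → τ (8 ℕ.* (i ℕ.+ p)) ≡ τ (8 ℕ.* i)) where

        Plus Minus : ℕ → Set
        Plus i = r ≤ τ (8 ℕ.* i)
        Minus i = r ≤ - τ (8 ℕ.* i)

        clash : ∀ {i} → Plus i → Minus i → ⊥
        clash {i} a b = absurd (0≤+ (0≤+ (≤⇒0≤ a) (≤⇒0≤ b)) (0≤+ (0≤* (0≤⁺ 2) (≤⇒0≤ r≥1)) (0≤⁺ 1))) (eq (τ (8 ℕ.* i)) r)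
          where
          eq : ∀ x r → x - r + (- x - r) + (pos 2 * (r - 1ℤ) + 1ℤ) ≡ - 1ℤ
          eq = solve 2 (λ x r → x :- r :+ (:- x :- r) :+ (con (pos 2) :* (r :- con 1ℤ) :+ con 1ℤ) := :- con 1ℤ) refl

        zigzag : ∀ i j l → 1 ℕ.≤ j → 1 ℕ.≤ l → (j ℕ.+ l) ℕ.+ (j ℕ.+ l) ℕ.≤ p →
                 Plus i → Minus (i ℕ.+ j) → Plus (i ℕ.+ (j ℕ.+ l)) → ⊥
        zigzag i j l 1≤j 1≤l short a b c = no-zigzag τ three-τ (1≤⇒0≤ r≥1) F-small (8 ℕ.* i) (8 ℕ.* j) (8 ℕ.* l)
          (ℕ.≤-trans 1≤j (ℕ.m≤n*m j 8)) (ℕ.≤-trans 1≤l (ℕ.m≤n*m l 8))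
          (subst (ℕ._≤ H₂) (ℕ.*-distribˡ-+ 8 j l) (8*≤H₂ (j ℕ.+ l) short)) a
          (subst (λ t → r ≤ - τ t) (ℕ.*-distribˡ-+ 8 i j) b)
          (subst (λ t → r ≤ τ t) (trans (ℕ.*-distribˡ-+ 8 i (j ℕ.+ l)) (cong (8 ℕ.* i ℕ.+_) (ℕ.*-distribˡ-+ 8 j l))) c)

        -- The signs of τ at 0, ℓ, i, i+ℓ would be +, -, +, - around the circle.
        outside : ∀ {i} → Plus 0 → Minus ℓ → Plus i → Minus (i ℕ.+ ℓ) → ℓ ℕ.≤ i → i ℕ.+ ℓ ℕ.≤ p → ⊥
        outside {i} at-0 at-ℓ at-i at-i+ℓ ℓ≤i i+ℓ≤p =
          go (ℕ.m≤n⇒m<n∨m≡n ℓ≤i) (ℕ.m≤n⇒m<n∨m≡n i+ℓ≤p) (ℕ.≤-total (i ℕ.+ i) p)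
          where
          l = p ℕ.∸ (i ℕ.+ ℓ)
          i+ℓ+l : i ℕ.+ (ℓ ℕ.+ l) ≡ p
          i+ℓ+l = trans (sym (ℕ.+-assoc i ℓ l)) (ℕ.m+[n∸m]≡n i+ℓ≤p)
          sizes : i ℕ.+ i ℕ.+ (ℓ ℕ.+ l ℕ.+ (ℓ ℕ.+ l)) ≡ p ℕ.+ p
          sizes = trans (eq i (ℓ ℕ.+ l)) (cong₂ ℕ._+_ i+ℓ+l i+ℓ+l)
            where
            eq : ∀ i m → i ℕ.+ i ℕ.+ (m ℕ.+ m) ≡ i ℕ.+ m ℕ.+ (i ℕ.+ m)
            eq = ℕSolver.solve-∀
          at-p : Plus p
          at-p = subst (r ≤_) (sym (τ-period 0)) at-0
          go : (ℓ ℕ.< i) ⊎ (ℓ ≡ i) → (i ℕ.+ ℓ ℕ.< p) ⊎ (i ℕ.+ ℓ ≡ p) → (i ℕ.+ i ℕ.≤ p) ⊎ (p ℕ.≤ i ℕ.+ i) → ⊥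
          go (inj₂ e) _ _ = clash {ℓ} (subst Plus (sym e) at-i) at-ℓ
          go (inj₁ _) (inj₂ e) _ = clash {p} at-p (subst Minus e at-i+ℓ)
          go (inj₁ ℓ<i) (inj₁ _) (inj₁ 2i≤p) = zigzag 0 ℓ (i ℕ.∸ ℓ) 1≤ℓ (ℕ.m<n⇒0<n∸m ℓ<i)
            (subst (λ t → t ℕ.+ t ℕ.≤ p) (sym (ℕ.m+[n∸m]≡n ℓ≤i)) 2i≤p) at-0 at-ℓ
            (subst Plus (sym (ℕ.m+[n∸m]≡n ℓ≤i)) at-i)
          go (inj₁ _) (inj₁ i+ℓ<p) (inj₂ p≤2i) = zigzag i ℓ l 1≤ℓ (ℕ.m<n⇒0<n∸m i+ℓ<p)
            (ℕ.+-cancelˡ-≤ (i ℕ.+ i) _ _ (ℕ.≤-trans (ℕ.≤-reflexive sizes) (ℕ.+-monoˡ-≤ p p≤2i)))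
            at-i at-i+ℓ (subst Plus (sym i+ℓ+l) at-p)

        opposite : ∀ {i i′} → Plus i → Minus (i′ ℕ.+ ℓ) → i′ ℕ.+ ℓ ≡ i ℕ.+ p → ⊥
        opposite {i} {i′} a b e = clash {i ℕ.+ p} (subst (r ≤_) (sym (τ-period i)) a) (subst Minus e b)

      -- Three clique members of one class lie near the rotations of `x₀` by 0, `b` and `c` parts;
      -- `τ` is the weighted sum of their forms along the orbit of a vertex `z₀` of the other class.
      module Sector {G : V → V → ℤ} (form : BForm G) {b c : ℕ} (dep : Dependency b c)
                    (x₀ x₁ x₂ : V) (d₁ : D (sh (8 ℕ.* b) x₀) x₁ ≤ C) (d₂ : D (sh (8 ℕ.* c) x₀) x₂ ≤ C) (z₀ : V) where
        open BForm form
        open Dependency dep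

        Member : ℕ → V → Set
        Member i z = (D (sh (8 ℕ.* i) z₀) z ≤ C) × Cross G x₀ z × Cross G x₁ z × Cross G x₂ z

        τ : ℕ → ℤ
        τ t = λ₀ * G x₀ (sh t z₀) + λ₁ * G x₁ (sh t z₀) + λ₂ * G x₂ (sh t z₀)

        L : ℤ
        L = λ₀ + λ₁ + λ₂

        sums : V → ℤ
        sums z = λ₀ * G x₀ z + λ₁ * G x₁ z + λ₂ * G x₂ z

        defect : ∀ x y z z′ → D x y ≤ C → D z z′ ≤ C →
                 (G x z - G y z - G x z′ + G y z′ ≤ s * C) × (- (s * C) ≤ G x z - G y z - G x z′ + G y z′)
        defect x y z z′ p q = *-cancelˡ (pos 2) (+≤+ (ℕ.s≤s ℕ.z≤n))
              (ℤ.≤-trans (mix x y z z′) (certify (0≤* s≥0 (0≤+ (≤⇒0≤ p) (≤⇒0≤ q))) (eq₁ s C (D x y) (D z z′))))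
          , *-cancelˡ (pos 2) (+≤+ (ℕ.s≤s ℕ.z≤n)) (certify
              (0≤+ (≤⇒0≤ (mix y x z z′)) (0≤* s≥0 (0≤+ (≤⇒0≤ (subst (_≤ C) (D-sym x y) p)) (≤⇒0≤ q))))
              (eq₂ s C (D y x) (D z z′) (G x z) (G y z) (G x z′) (G y z′)))
          where
          eq₁ : ∀ s C d e → s * (C - d + (C - e)) ≡ pos 2 * (s * C) - s * (d + e)
          eq₁ = solve 4 (λ s C d e → s :* (C :- d :+ (C :- e)) := con (pos 2) :* (s :* C) :- s :* (d :+ e)) refl
          eq₂ : ∀ s C d e a b a′ b′ → s * (d + e) - pos 2 * (b - a - b′ + a′) + s * (C - d + (C - e))
                ≡ pos 2 * (a - b - a′ + b′) - pos 2 * (- (s * C))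
          eq₂ = solve 8 (λ s C d e a b a′ b′ → s :* (d :+ e) :- con (pos 2) :* (b :- a :- b′ :+ a′) :+ s :* (C :- d :+ (C :- e)) := con (pos 2) :* (a :- b :- a′ :+ b′) :- con (pos 2) :* (:- (s :* C))) refl

        rotated : V → ℤ
        rotated z = λ₀ * G x₀ z + λ₁ * G (sh (8 ℕ.* b) x₀) z + λ₂ * G (sh (8 ℕ.* c) x₀) z

        -- With exact rotations of `x₀` in the first argument the weighted sum vanishes up to the
        -- error of the sine, whatever `z` is.
        rotated-small : ∀ z → Small E (rotated z)
        rotated-small z = subst (λ x → Small E (λ₀ * G x z + λ₁ * G (sh (8 ℕ.* b) x₀) z + λ₂ * G (sh (8 ℕ.* c) x₀) z)) (sh-0 x₀)
          (relation (λ t → G (sh t x₀) z) (left x₀ z) (λ t → trans (cong (λ x → G x z) (sym (sh-+ H₂ t x₀))) (anti₁ (sh t x₀) z)))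

        module _ (z z′ : V) (dz : D z z′ ≤ C) where
          private
            q₀ = defect x₀ x₀ z′ z (ℤ.≤-trans (ℤ.≤-reflexive (D-refl x₀)) C≥0) (ℤ.≤-trans (ℤ.≤-reflexive (D-sym z′ z)) dz)
            q₁ = defect x₁ (sh (8 ℕ.* b) x₀) z′ z (ℤ.≤-trans (ℤ.≤-reflexive (D-sym x₁ _)) d₁) (ℤ.≤-trans (ℤ.≤-reflexive (D-sym z′ z)) dz)
            q₂ = defect x₂ (sh (8 ℕ.* c) x₀) z′ z (ℤ.≤-trans (ℤ.≤-reflexive (D-sym x₂ _)) d₂) (ℤ.≤-trans (ℤ.≤-reflexive (D-sym z′ z)) dz)

            X₀ X₁ X₂ Z : ℤ
            X₀ = G x₀ z′ - G x₀ z′ - G x₀ z + G x₀ z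
            X₁ = G x₁ z′ - G (sh (8 ℕ.* b) x₀) z′ - G x₁ z + G (sh (8 ℕ.* b) x₀) z
            X₂ = G x₂ z′ - G (sh (8 ℕ.* c) x₀) z′ - G x₂ z + G (sh (8 ℕ.* c) x₀) z
            Z = λ₀ * X₀ + λ₁ * X₁ + λ₂ * X₂

            Z≡ : Z ≡ sums z′ - rotated z′ - sums z + rotated z
            Z≡ = trans (cong₂ _+_ (trans (cong₂ _+_ (distrib λ₀ (G x₀ z′) (G x₀ z′) (G x₀ z) (G x₀ z))
                                                    (distrib λ₁ (G x₁ z′) (G (sh (8 ℕ.* b) x₀) z′) (G x₁ z) (G (sh (8 ℕ.* b) x₀) z)))
                                         (add4 (λ₀ * G x₀ z′) (λ₀ * G x₀ z′) (λ₀ * G x₀ z) (λ₀ * G x₀ z)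
                                               (λ₁ * G x₁ z′) (λ₁ * G (sh (8 ℕ.* b) x₀) z′) (λ₁ * G x₁ z) (λ₁ * G (sh (8 ℕ.* b) x₀) z)))
                                  (distrib λ₂ (G x₂ z′) (G (sh (8 ℕ.* c) x₀) z′) (G x₂ z) (G (sh (8 ℕ.* c) x₀) z)))
                       (add4 (λ₀ * G x₀ z′ + λ₁ * G x₁ z′) (λ₀ * G x₀ z′ + λ₁ * G (sh (8 ℕ.* b) x₀) z′)
                             (λ₀ * G x₀ z + λ₁ * G x₁ z) (λ₀ * G x₀ z + λ₁ * G (sh (8 ℕ.* b) x₀) z)
                             (λ₂ * G x₂ z′) (λ₂ * G (sh (8 ℕ.* c) x₀) z′) (λ₂ * G x₂ z) (λ₂ * G (sh (8 ℕ.* c) x₀) z))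
              where
              distrib : ∀ l a b c d → l * (a - b - c + d) ≡ l * a - l * b - l * c + l * d
              distrib = solve 5 (λ l a b c d → l :* (a :- b :- c :+ d) := l :* a :- l :* b :- l :* c :+ l :* d) refl
              add4 : ∀ a b c d a′ b′ c′ d′ → a - b - c + d + (a′ - b′ - c′ + d′) ≡ a + a′ - (b + b′) - (c + c′) + (d + d′)
              add4 = solve 8 (λ a b c d a′ b′ c′ d′ → a :- b :- c :+ d :+ (a′ :- b′ :- c′ :+ d′) := a :+ a′ :- (b :+ b′) :- (c :+ c′) :+ (d :+ d′)) refl

            Z≤ : Z ≤ L * (s * C)
            Z≤ = certify (0≤+ (0≤+ (0≤* λ₀≥0 (≤⇒0≤ (proj₁ q₀))) (0≤* λ₁≥0 (≤⇒0≤ (proj₁ q₁)))) (0≤* λ₂≥0 (≤⇒0≤ (proj₁ q₂))))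
                   (eq λ₀ λ₁ λ₂ X₀ X₁ X₂ (s * C))
              where
              eq : ∀ u v w x y z k → u * (k - x) + v * (k - y) + w * (k - z) ≡ (u + v + w) * k - (u * x + v * y + w * z)
              eq = solve 7 (λ u v w x y z k → u :* (k :- x) :+ v :* (k :- y) :+ w :* (k :- z) := (u :+ v :+ w) :* k :- (u :* x :+ v :* y :+ w :* z)) refl

            Z≥ : - (L * (s * C)) ≤ Z
            Z≥ = certify (0≤+ (0≤+ (0≤* λ₀≥0 (≤⇒0≤ (proj₂ q₀))) (0≤* λ₁≥0 (≤⇒0≤ (proj₂ q₁)))) (0≤* λ₂≥0 (≤⇒0≤ (proj₂ q₂))))
                   (eq λ₀ λ₁ λ₂ X₀ X₁ X₂ (s * C))
              where
              eq : ∀ u v w x y z k → u * (x - - k) + v * (y - - k) + w * (z - - k) ≡ u * x + v * y + w * z - - ((u + v + w) * k)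
              eq = solve 7 (λ u v w x y z k → u :* (x :- :- k) :+ v :* (y :- :- k) :+ w :* (z :- :- k) := u :* x :+ v :* y :+ w :* z :- :- ((u :+ v :+ w) :* k)) refl

          -- Passing to exact rotations in the first argument and from `z` to `z′` in the second
          -- costs only mixed differences, and the rotated sums are small at both `z` and `z′`.
          -- Hence the weighted sum hardly changes from `z` to `z′`, although its three terms
          -- separately may.
          compare-upper : pos Λ * sums z′ ≤ pos Λ * sums z + pos Λ * (L * (s * C)) + pos 2 * E
          compare-upper = certify
            (0≤+ (0≤* (0≤⁺ Λ) (≤⇒0≤ (subst (_≤ L * (s * C)) Z≡ Z≤)))
                 (0≤+ (≤⇒0≤ (proj₁ (rotated-small z′))) (≤⇒0≤ (proj₂ (rotated-small z)))))
            (eq (pos Λ) E (L * (s * C)) (sums z′) (rotated z′) (sums z) (rotated z))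
            where
            eq : ∀ l E k a y b y′ → l * (k - (a - y - b + y′)) + (E - l * y + (l * y′ - - E)) ≡ l * b + l * k + pos 2 * E - l * a
            eq = solve 7 (λ l E k a y b y′ → l :* (k :- (a :- y :- b :+ y′)) :+ (E :- l :* y :+ (l :* y′ :- :- E)) := l :* b :+ l :* k :+ con (pos 2) :* E :- l :* a) refl

          compare-lower : pos Λ * sums z ≤ pos Λ * sums z′ + pos Λ * (L * (s * C)) + pos 2 * E
          compare-lower = certify
            (0≤+ (0≤* (0≤⁺ Λ) (≤⇒0≤ (subst (- (L * (s * C)) ≤_) Z≡ Z≥)))
                 (0≤+ (≤⇒0≤ (proj₂ (rotated-small z′))) (≤⇒0≤ (proj₁ (rotated-small z)))))
            (eq (pos Λ) E (L * (s * C)) (sums z′) (rotated z′) (sums z) (rotated z))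
            where
            eq : ∀ l E k a y b y′ → l * (a - y - b + y′ - - k) + (l * y - - E + (E - l * y′)) ≡ l * a + l * k + pos 2 * E - l * b
            eq = solve 7 (λ l E k a y b y′ → l :* (a :- y :- b :+ y′ :- :- k) :+ (l :* y :- :- E :+ (E :- l :* y′)) := l :* a :+ l :* k :+ con (pos 2) :* E :- l :* b) refl

        r : ℤ
        r = μ * s

        sum-large : ∀ z → 1ℤ + R ≤ G x₀ z → 1ℤ + R ≤ G x₁ z → 1ℤ + R ≤ G x₂ z → L * (1ℤ + R) ≤ sums z
        sum-large z a b c = certify (0≤+ (0≤+ (0≤* λ₀≥0 (≤⇒0≤ a)) (0≤* λ₁≥0 (≤⇒0≤ b))) (0≤* λ₂≥0 (≤⇒0≤ c)))
          (eq λ₀ λ₁ λ₂ (G x₀ z) (G x₁ z) (G x₂ z) (1ℤ + R))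
          where
          eq : ∀ u v w a b c r → u * (a - r) + v * (b - r) + w * (c - r) ≡ u * a + v * b + w * c - (u + v + w) * r
          eq = solve 7 (λ u v w a b c r → u :* (a :- r) :+ v :* (b :- r) :+ w :* (c :- r) := u :* a :+ v :* b :+ w :* c :- (u :+ v :+ w) :* r) refl

        sum-large⁻ : ∀ z → 1ℤ + R ≤ - G x₀ z → 1ℤ + R ≤ - G x₁ z → 1ℤ + R ≤ - G x₂ z → L * (1ℤ + R) ≤ - sums z
        sum-large⁻ z a b c = certify (0≤+ (0≤+ (0≤* λ₀≥0 (≤⇒0≤ a)) (0≤* λ₁≥0 (≤⇒0≤ b))) (0≤* λ₂≥0 (≤⇒0≤ c)))
          (eq λ₀ λ₁ λ₂ (G x₀ z) (G x₁ z) (G x₂ z) (1ℤ + R))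
          where
          eq : ∀ u v w a b c r → u * (- a - r) + v * (- b - r) + w * (- c - r) ≡ - (u * a + v * b + w * c) - (u + v + w) * r
          eq = solve 7 (λ u v w a b c r → u :* (:- a :- r) :+ v :* (:- b :- r) :+ w :* (:- c :- r) := :- (u :* a :+ v :* b :+ w :* c) :- (u :+ v :+ w) :* r) refl

        -- The clique conditions make the weighted sum at least `L * (1 + R)`. The comparison loses
        -- `L * (s * C)` and two errors of the sine; `r = μ * s` must survive.
        margin : pos Λ * r + pos Λ * (L * (s * C)) + pos 2 * E ≤ pos Λ * (L * (1ℤ + R))
        margin = certify
          (0≤+ (0≤+ (0≤* (0≤⁺ Λ) (0≤* (0≤+ (0≤⁺ 1) (0≤* s≥0 C≥0)) (≤⇒0≤ sum≥μ)))
                    (0≤+ (≤⇒0≤ fine) (0≤+ (0≤⁺ 1) E≥0)))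
               (0≤* (0≤* (0≤⁺ Λ) μ≥0) (0≤+ (0≤+ (≤⇒0≤ μ≤s) (0≤⁺ 1)) (0≤* s≥0 (≤⇒0≤ 2≤C)))))
          (eq (pos Λ) μ s C L E)
          where
          eq : ∀ l m s C L E →
            l * ((1ℤ + s * C) * (L - m)) + (l * (m * m) - (1ℤ + pos 3 * E) + (1ℤ + E)) + l * m * (s - m + 1ℤ + s * (C - pos 2))
            ≡ l * (L * (1ℤ + pos 2 * (s * C))) - (l * (m * s) + l * (L * (s * C)) + pos 2 * E)
          eq = solve 6 (λ l m s C L E → l :* ((con 1ℤ :+ s :* C) :* (L :- m)) :+ (l :* (m :* m) :- (con 1ℤ :+ con (pos 3) :* E) :+ (con 1ℤ :+ E)) :+ l :* m :* (s :- m :+ con 1ℤ :+ s :* (C :- con (pos 2))) := l :* (L :* (con 1ℤ :+ con (pos 2) :* (s :* C))) :- (l :* (m :* s) :+ l :* (L :* (s :* C)) :+ con (pos 2) :* E)) refl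

        τ-positive : ∀ {i z} → Member i z → r ≤ τ (8 ℕ.* i)
        τ-positive {i} {z} (d , (a , _) , (b , _) , (c , _)) = *-cancelˡ (pos Λ) Λ≥1 (certify
          (0≤+ (0≤+ (≤⇒0≤ margin) (≤⇒0≤ (compare-upper (sh (8 ℕ.* i) z₀) z d))) (0≤* (0≤⁺ Λ) (≤⇒0≤ (sum-large z a b c))))
          (eq (pos Λ) r (L * (s * C)) E (L * (1ℤ + R)) (sums z) (τ (8 ℕ.* i))))
          where
          eq : ∀ l r k E m x y → l * m - (l * r + l * k + pos 2 * E) + (l * y + l * k + pos 2 * E - l * x) + l * (x - m) ≡ l * y - l * r
          eq = solve 7 (λ l r k E m x y → l :* m :- (l :* r :+ l :* k :+ con (pos 2) :* E) :+ (l :* y :+ l :* k :+ con (pos 2) :* E :- l :* x) :+ l :* (x :- m) := l :* y :- l :* r) refl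

        τ-negative : ∀ {i z} → Member i z → r ≤ - τ (8 ℕ.* (i ℕ.+ ℓ))
        τ-negative {i} {z} (d , (_ , a) , (_ , b) , (_ , c)) = *-cancelˡ (pos Λ) Λ≥1 (certify
          (0≤+ (0≤+ (≤⇒0≤ margin) (≤⇒0≤ lower)) (0≤* (0≤⁺ Λ) (≤⇒0≤ (sum-large⁻ (sh m z) a b c))))
          (eq (pos Λ) r (L * (s * C)) E (L * (1ℤ + R)) (sums (sh m z)) (τ (8 ℕ.* (i ℕ.+ ℓ)))))
          where
          m = 8 ℕ.* ℓ
          dist : D (sh (8 ℕ.* (i ℕ.+ ℓ)) z₀) (sh m z) ≤ C
          dist = ℤ.≤-trans (ℤ.≤-reflexive (trans (cong (λ y → D y (sh m z))
            (trans (cong (λ t → sh t z₀) (ℕ.*-distribˡ-+ 8 i ℓ)) (sym (sh-+ m (8 ℕ.* i) z₀)))) (D-sh m (sh (8 ℕ.* i) z₀) z))) d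
          lower = compare-lower (sh (8 ℕ.* (i ℕ.+ ℓ)) z₀) (sh m z) dist
          eq : ∀ l r k E m x y → l * m - (l * r + l * k + pos 2 * E) + (l * x + l * k + pos 2 * E - l * y) + l * (- x - m) ≡ l * (- y) - l * r
          eq = solve 7 (λ l r k E m x y → l :* m :- (l :* r :+ l :* k :+ con (pos 2) :* E) :+ (l :* x :+ l :* k :+ con (pos 2) :* E :- l :* y) :+ l :* (:- x :- m) := l :* (:- y) :- l :* r) refl

        F : ℤ
        F = λ₀ * E + λ₁ * E + λ₂ * E

        three-scale : ∀ {c E} {τ : ℕ → ℤ} → 0ℤ ≤ c → ThreeTerm E τ → ThreeTerm (c * E) (λ t → c * τ t)
        three-scale {c} {E} {τ} c≥0 h i j t =
            ℤ.≤-trans (ℤ.≤-reflexive scaled) (*-monoˡ c c≥0 (proj₁ (h i j t)))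
          , ℤ.≤-trans (ℤ.≤-trans (ℤ.≤-reflexive (ℤ.neg-distribʳ-* c E)) (*-monoˡ c c≥0 (proj₂ (h i j t)))) (ℤ.≤-reflexive (sym scaled))
          where
          eq : ∀ l c x y z a b d → l * (x * (c * a) - y * (c * b) + z * (c * d)) ≡ c * (l * (x * a - y * b + z * d))
          eq = solve 8 (λ l c x y z a b d → l :* (x :* (c :* a) :- y :* (c :* b) :+ z :* (c :* d)) := c :* (l :* (x :* a :- y :* b :+ z :* d))) refl
          scaled = eq (pos Λ) c (S j) (S (i ℕ.+ j)) (S i) (τ t) (τ (t ℕ.+ i)) (τ (t ℕ.+ (i ℕ.+ j)))

        three-τ : ThreeTerm F τ
        three-τ = three-+ {τ = λ t → λ₀ * G x₀ (sh t z₀) + λ₁ * G x₁ (sh t z₀)} {τ′ = λ t → λ₂ * G x₂ (sh t z₀)}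
          (three-+ {τ = λ t → λ₀ * G x₀ (sh t z₀)} {τ′ = λ t → λ₁ * G x₁ (sh t z₀)}
            (three-scale {τ = λ t → G x₀ (sh t z₀)} λ₀≥0 (right x₀ z₀)) (three-scale {τ = λ t → G x₁ (sh t z₀)} λ₁≥0 (right x₁ z₀)))
          (three-scale {τ = λ t → G x₂ (sh t z₀)} λ₂≥0 (right x₂ z₀))

        r≥0 : 0ℤ ≤ r
        r≥0 = 0≤* μ≥0 s≥0

        r≥1 : 1ℤ ≤ r
        r≥1 = *-mono (0≤⁺ 1) (0≤⁺ 1) μ≥1 (ℤ.≤-trans μ≥1 μ≤s)

        F-small : 1ℤ + F ≤ pos Λ * (r * μ)
        F-small = certify
          (0≤+ (0≤+ (0≤* (≤⇒0≤ sum≤3s) E≥0) (0≤* s≥0 (≤⇒0≤ fine))) (≤⇒0≤ (ℤ.≤-trans μ≥1 μ≤s)))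
          (eq (pos Λ) μ s λ₀ λ₁ λ₂ E)
          where
          eq : ∀ l m s u v w E → (pos 3 * s - (u + v + w)) * E + s * (l * (m * m) - (1ℤ + pos 3 * E)) + (s - 1ℤ)
               ≡ l * (m * s * m) - (1ℤ + (u * E + v * E + w * E))
          eq = solve 7 (λ l m s u v w E → (con (pos 3) :* s :- (u :+ v :+ w)) :* E :+ s :* (l :* (m :* m) :- (con 1ℤ :+ con (pos 3) :* E)) :+ (s :- con 1ℤ) := l :* (m :* s :* m) :- (con 1ℤ :+ (u :* E :+ v :* E :+ w :* E))) refl

        τ-period : ∀ i → τ (8 ℕ.* (i ℕ.+ p)) ≡ τ (8 ℕ.* i)
        τ-period i = cong₂ _+_ (cong₂ _+_ (cong (λ₀ *_) (period x₀)) (cong (λ₁ *_) (period x₁))) (cong (λ₂ *_) (period x₂))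
          where
          turn : sh (8 ℕ.* (i ℕ.+ p)) z₀ ≡ sh H₂ (sh H₂ (sh (8 ℕ.* i) z₀))
          turn = sym (trans (cong (sh H₂) (sh-+ H₂ (8 ℕ.* i) z₀)) (trans (sh-+ H₂ (8 ℕ.* i ℕ.+ H₂) z₀)
            (cong (λ t → sh t z₀) (trans (ℕ.+-assoc (8 ℕ.* i) H₂ H₂) (trans (cong (8 ℕ.* i ℕ.+_) Q≡8p) (sym (ℕ.*-distribˡ-+ 8 i p)))))))
          period : ∀ x → G x (sh (8 ℕ.* (i ℕ.+ p)) z₀) ≡ G x (sh (8 ℕ.* i) z₀)
          period x = trans (cong (G x) turn) (trans (anti₂ x (sh H₂ (sh (8 ℕ.* i) z₀))) (trans (cong -_ (anti₂ x (sh (8 ℕ.* i) z₀))) (ℤ.neg-involutive _)))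

        module ττ = Signs τ three-τ r≥1 F-small τ-period

      -- A nonempty clique in one class. Vertex 0 serves as origin: `label a` tells near which
      -- rotation of it the vertex `a` lies.
      record System (A : ℕ) : Set where
        field
          x    : Fin (suc A) → V
          link : ∀ a b → a ≢ b → Linked (x a) (x b)

        label : Fin (suc A) → ℕ
        label zero    = 0
        label (suc a) = proj₁ (link zero (suc a) (λ ()))

        label-near : ∀ a → D (sh (8 ℕ.* label a) (x zero)) (x a) ≤ C
        label-near zero    = ℤ.≤-trans (ℤ.≤-reflexive (trans (cong (λ y → D y (x zero)) (sh-0 (x zero))) (D-refl (x zero)))) C≥0
        label-near (suc a) = proj₂ (proj₂ (proj₂ (link zero (suc a) (λ ()))))

        label<p : ∀ a → label a ℕ.< p
        label<p zero    = ℕ.≤-trans 1≤ℓ (ℕ.≤-trans (ℕ.m≤m+n ℓ ℓ) 2ℓ≤p)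
        label<p (suc a) = proj₁ (proj₂ (proj₂ (link zero (suc a) (λ ()))))

        -- Members with equal labels are within `4 C` of each other. A link between them would then
        -- place a vertex within `2 (4 C + C) = 10 C` of a proper rotation of itself, against
        -- `separated`.
        label-injective : ∀ a b → a ≢ b → label a ≢ label b
        label-injective a b a≢b e = separate (link a b a≢b)
          where
          y = sh (8 ℕ.* label a) (x zero)
          nearby : D (x a) (x b) ≤ pos 4 * C
          nearby = ℤ.≤-trans (D-triangle (x a) y (x b)) (certify
            (0≤* (0≤⁺ 2) (0≤+ (≤⇒0≤ (ℤ.≤-trans (ℤ.≤-reflexive (D-sym (x a) y)) (label-near a)))
              (≤⇒0≤ (subst (λ l → D (sh (8 ℕ.* l) (x zero)) (x b) ≤ C) (sym e) (label-near b)))))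
            (eq C (D (x a) y) (D y (x b))))
            where
            eq : ∀ C d e → pos 2 * (C - d + (C - e)) ≡ pos 4 * C - pos 2 * (d + e)
            eq = solve 3 (λ C d e → con (pos 2) :* (C :- d :+ (C :- e)) := con (pos 4) :* C :- con (pos 2) :* (d :+ e)) refl
          separate : Linked (x a) (x b) → ⊥
          separate (t , 1≤t , t<p , d) = absurd
            (0≤+ (0≤+ (≤⇒0≤ separated) (≤⇒0≤ far))
                 (0≤+ (≤⇒0≤ (D-triangle (x a) (x b) u)) (0≤* (0≤⁺ 2) (0≤+ (≤⇒0≤ nearby) (≤⇒0≤ (ℤ.≤-trans (ℤ.≤-reflexive (D-sym (x b) u)) d))))))
            (eq C (pos k * (pos n * pos n)) (D (x a) u) (D (x a) (x b)) (D (x b) u))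
            where
            u = sh (8 ℕ.* t) (x a)
            far : pos k * (pos n * pos n) ≤ D (x a) u
            far = D-far (8 ℕ.* t) (ℕ.≤-trans {2} {8} (ℕ.s≤s (ℕ.s≤s ℕ.z≤n)) (ℕ.*-monoʳ-≤ 8 1≤t))
              (ℕ.≤-trans (ℕ.+-monoʳ-≤ (8 ℕ.* t) {2} {8} (ℕ.s≤s (ℕ.s≤s ℕ.z≤n)))
                (ℕ.≤-trans (ℕ.≤-reflexive (trans (ℕ.+-comm (8 ℕ.* t) 8) (sym (ℕ.*-suc 8 t)))) (ℕ.≤-trans (ℕ.*-monoʳ-≤ 8 t<p) (ℕ.≤-reflexive (sym Q≡8p))))) (x a)
            eq : ∀ C m d e f → m - (1ℤ + pos 10 * C) + (d - m) + (pos 2 * (e + f) - d + pos 2 * (pos 4 * C - e + (C - f))) ≡ - 1ℤ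
            eq = solve 5 (λ C m d e f → m :- (con 1ℤ :+ con (pos 10) :* C) :+ (d :- m) :+ (con (pos 2) :* (e :+ f) :- d :+ con (pos 2) :* (con (pos 4) :* C :- e :+ (C :- f))) := :- con 1ℤ) refl

        ≤p : suc A ℕ.≤ p
        ≤p = ℕ.≮⇒≥ (λ p<A → collide (Fin.pigeonhole p<A (λ a → fromℕ< (label<p a))))
          where
          collide : (∃ λ a → ∃ λ b → (a Fin.< b) × (fromℕ< (label<p a) ≡ fromℕ< (label<p b))) → ⊥
          collide (a , b , a<b , e) = label-injective a b (λ { refl → ℕ.<-irrefl refl a<b })
            (trans (sym (Fin.toℕ-fromℕ< (label<p a))) (trans (cong toℕ e) (Fin.toℕ-fromℕ< (label<p b))))

      h : ℕ
      h = ℕ.⌊ p /2⌋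

      h+h≤p : h ℕ.+ h ℕ.≤ p
      h+h≤p = ℕ.≤-trans (ℕ.+-monoʳ-≤ h (ℕ.⌊n/2⌋≤⌈n/2⌉ p)) (ℕ.≤-reflexive (ℕ.⌊n/2⌋+⌈n/2⌉≡n p))

      H : ℕ
      H = ℕ.⌈ p /2⌉

      h+H≡p : h ℕ.+ H ≡ p
      h+H≡p = ℕ.⌊n/2⌋+⌈n/2⌉≡n p

      H≤1+h : H ℕ.≤ suc h
      H≤1+h = go p
        where
        go : ∀ m → ℕ.⌈ m /2⌉ ℕ.≤ suc ℕ.⌊ m /2⌋
        go zero          = ℕ.z≤n
        go (suc zero)    = ℕ.≤-refl
        go (suc (suc m)) = ℕ.s≤s (go m)

      -- Labels in the lower and upper half circle, folded together: a collision is a pair of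
      -- labels b, b + ⌊p/2⌋, and together with the label 0 it surrounds the centre.
      data Half (j : ℕ) : ℕ → Set where
        lower : j ℕ.+ j ℕ.< p → Half j j
        upper : ∀ {i} → p ℕ.≤ j ℕ.+ j → i ℕ.+ h ≡ j → Half j i

      halve : ∀ j → j ℕ.< p → ∃ λ i → (i ℕ.< H) × Half j i
      halve j j<p with ℕ.<-≤-connex (j ℕ.+ j) p
      ... | inj₁ q = j , j<H , lower q
        where
        j<H : j ℕ.< H
        j<H = ℕ.≰⇒> (λ H≤j → ℕ.<-irrefl refl (ℕ.<-≤-trans q (ℕ.≤-trans (ℕ.≤-reflexive (sym h+H≡p))
                (ℕ.+-mono-≤ (ℕ.≤-trans (ℕ.⌊n/2⌋≤⌈n/2⌉ p) H≤j) H≤j))))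
      ... | inj₂ q = j ℕ.∸ h , ℕ.+-cancelʳ-< h (j ℕ.∸ h) H (subst₂ ℕ._<_ (sym (ℕ.m∸n+n≡m h≤j)) (sym (trans (ℕ.+-comm H h) h+H≡p)) j<p)
                   , upper q (ℕ.m∸n+n≡m h≤j)
        where
        h≤j : h ℕ.≤ j
        h≤j = ℕ.≮⇒≥ (λ j<h → ℕ.<-irrefl refl (ℕ.<-≤-trans (ℕ.+-mono-< j<h j<h) (ℕ.≤-trans h+h≤p q)))

      1≤h : 1 ℕ.≤ h
      1≤h = ℕ.⌊n/2⌋-mono (ℕ.≤-trans (ℕ.+-mono-≤ 1≤ℓ 1≤ℓ) 2ℓ≤p)

      -- The colliding labels are completed by the label 0. If `b` is itself 0, the hypotheses force
      -- `p = 2h`, and the pair is antipodal.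
      dependency : ∀ b → b ℕ.+ b ℕ.< p → p ℕ.≤ (b ℕ.+ h) ℕ.+ (b ℕ.+ h) → b ℕ.+ h ℕ.< p →
                   (b ≡ 0 × Dependency h h) ⊎ Dependency b (b ℕ.+ h)
      dependency zero    q q′ c<p = inj₁ (refl , antipodal h (ℕ.≤-antisym h+h≤p q′))
      dependency (suc b) q q′ c<p = inj₂ (triangle (suc b) h (ℕ.s≤s ℕ.z≤n) 1≤h (ℕ.<⇒≤ q) h+h≤p q′ c<p)

      module Pair {G : V → V → ℤ} (form : BForm G) {A B : ℕ} (X : System A) (Z : System B)
                  (cross : ∀ a b → Cross G (System.x X a) (System.x Z b)) where
        private
          module X = System X
          module Z = System Z

        -- By `outside` every label of the other class is below `ℓ` or above `p - ℓ`. Adding `ℓ - p`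
        -- to the latter folds all of them into the `ℓ` places below `ℓ`. A label folded onto a
        -- small one would need `τ` to have both signs there, so the folding is injective.
        too-many : ∀ {b c} → Dependency b c → ∀ a₁ a₂ → D (sh (8 ℕ.* b) (X.x zero)) (X.x a₁) ≤ C →
                   D (sh (8 ℕ.* c) (X.x zero)) (X.x a₂) ≤ C → ℓ ℕ.< suc B → ⊥
        too-many {b} {c} dep a₁ a₂ d₁ d₂ ℓ<B = collide (Fin.pigeonhole ℓ<B (λ m → fromℕ< (proj₁ (proj₂ (fold m)))))
          where
          module Sec = Sector form dep (X.x zero) (X.x a₁) (X.x a₂) d₁ d₂ (Z.x zero)
          open Sec.ττ using (Plus; Minus; outside; opposite)
          member : ∀ m → Sec.Member (Z.label m) (Z.x m)
          member m = Z.label-near m , cross zero m , cross a₁ m , cross a₂ m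
          at⁺ : ∀ m → Plus (Z.label m)
          at⁺ m = Sec.τ-positive {Z.label m} {Z.x m} (member m)
          at⁻ : ∀ m → Minus (Z.label m ℕ.+ ℓ)
          at⁻ m = Sec.τ-negative {Z.label m} {Z.x m} (member m)
          data Side (j : ℕ) : ℕ → Set where
            same : Side j j
            far  : ∀ {i} → j ℕ.+ ℓ ≡ i ℕ.+ p → Side j i
          fold : ∀ m → ∃ λ i → (i ℕ.< ℓ) × Side (Z.label m) i
          fold m = go (ℕ.<-≤-connex (Z.label m) ℓ) (ℕ.≤-<-connex (Z.label m ℕ.+ ℓ) p)
            where
            j = Z.label m
            go : (j ℕ.< ℓ) ⊎ (ℓ ℕ.≤ j) → (j ℕ.+ ℓ ℕ.≤ p) ⊎ (p ℕ.< j ℕ.+ ℓ) → ∃ λ i → (i ℕ.< ℓ) × Side j i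
            go (inj₁ q) _        = j , q , same
            go (inj₂ q) (inj₁ r) = ⊥-elim (outside {j} (at⁺ zero) (at⁻ zero) (at⁺ m) (at⁻ m) q r)
            go (inj₂ q) (inj₂ r) = j ℕ.+ ℓ ℕ.∸ p , ℕ.+-cancelʳ-< p (j ℕ.+ ℓ ℕ.∸ p) ℓ
                (subst₂ ℕ._<_ (sym e) (ℕ.+-comm p ℓ) (ℕ.+-monoˡ-< ℓ (Z.label<p m))) , far (sym e)
              where
              e : j ℕ.+ ℓ ℕ.∸ p ℕ.+ p ≡ j ℕ.+ ℓ
              e = ℕ.m∸n+n≡m (ℕ.<⇒≤ r)
          clash : ∀ m m′ {i} → m ≢ m′ → Side (Z.label m) i → Side (Z.label m′) i → ⊥
          clash m m′ ne s₁ s₂ = go refl refl s₁ s₂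
            where
            go : ∀ {j j′ i} → Z.label m ≡ j → Z.label m′ ≡ j′ → Side j i → Side j′ i → ⊥
            go e e′ same same = Z.label-injective m m′ ne (trans e (sym e′))
            go e e′ (far f) (far f′) = Z.label-injective m m′ ne (trans e (trans (ℕ.+-cancelʳ-≡ ℓ _ _ (trans f (sym f′))) (sym e′)))
            go {j} {j′} e e′ same (far f′) = opposite {Z.label m} {Z.label m′} (at⁺ m) (at⁻ m′)
              (trans (cong (ℕ._+ ℓ) e′) (trans f′ (cong (ℕ._+ p) (sym e))))
            go {j} {j′} e e′ (far f) same = opposite {Z.label m′} {Z.label m} (at⁺ m′) (at⁻ m)
              (trans (cong (ℕ._+ ℓ) e) (trans f (cong (ℕ._+ p) (sym e′))))
          collide : (∃ λ m → ∃ λ m′ → (m Fin.< m′) × (fromℕ< (proj₁ (proj₂ (fold m))) ≡ fromℕ< (proj₁ (proj₂ (fold m′))))) → ⊥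
          collide (m , m′ , m<m′ , e) = clash m m′ (λ { refl → ℕ.<-irrefl refl m<m′ }) (proj₂ (proj₂ (fold m)))
            (subst (Side (Z.label m′)) (sym i≡) (proj₂ (proj₂ (fold m′))))
            where
            i≡ : proj₁ (fold m) ≡ proj₁ (fold m′)
            i≡ = trans (sym (Fin.toℕ-fromℕ< (proj₁ (proj₂ (fold m))))) (trans (cong toℕ e) (Fin.toℕ-fromℕ< (proj₁ (proj₂ (fold m′)))))

        -- More than `H` labels collide when folded into a half circle, and a collision yields the
        -- `Dependency` that `too-many` asks for.
        pair-bound : H ℕ.< suc A → ℓ ℕ.< suc B → ⊥
        pair-bound H<A ℓ<B = collide (Fin.pigeonhole H<A (λ a → fromℕ< (proj₁ (proj₂ (fold a)))))
          where
          fold : ∀ a → ∃ λ i → (i ℕ.< H) × Half (X.label a) i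
          fold a = halve (X.label a) (X.label<p a)
          surround : ∀ a a′ b → X.label a ≡ b → X.label a′ ≡ b ℕ.+ h → b ℕ.+ b ℕ.< p → p ℕ.≤ (b ℕ.+ h) ℕ.+ (b ℕ.+ h) → ⊥
          surround a a′ b e e′ q q′ = go (dependency b q q′ (subst (ℕ._< p) e′ (X.label<p a′)))
            where
            go : (b ≡ 0 × Dependency h h) ⊎ Dependency b (b ℕ.+ h) → ⊥
            go (inj₁ (b≡0 , dep)) = too-many dep a′ a′ at-h at-h ℓ<B
              where
              at-h = subst (λ l → D (sh (8 ℕ.* l) (X.x zero)) (X.x a′) ≤ C) (trans e′ (cong (ℕ._+ h) b≡0)) (X.label-near a′)
            go (inj₂ dep) = too-many dep a a′ (subst (λ l → D (sh (8 ℕ.* l) (X.x zero)) (X.x a) ≤ C) e (X.label-near a))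
              (subst (λ l → D (sh (8 ℕ.* l) (X.x zero)) (X.x a′) ≤ C) e′ (X.label-near a′)) ℓ<B
          clash : ∀ a a′ → a ≢ a′ → ∀ {j j′ i} → X.label a ≡ j → X.label a′ ≡ j′ → Half j i → Half j′ i → ⊥
          clash a a′ ne e e′ (lower _) (lower _) = X.label-injective a a′ ne (trans e (sym e′))
          clash a a′ ne e e′ (upper _ f) (upper _ f′) = X.label-injective a a′ ne (trans e (trans (trans (sym f) f′) (sym e′)))
          clash a a′ ne {j} e e′ (lower q) (upper q′ f′) = surround a a′ j e (trans e′ (sym f′)) q (subst (λ c → p ℕ.≤ c ℕ.+ c) (sym f′) q′)
          clash a a′ ne {j} {j′} e e′ (upper q f) (lower q′) = surround a′ a j′ e′ (trans e (sym f)) q′ (subst (λ c → p ℕ.≤ c ℕ.+ c) (sym f) q)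
          collide : (∃ λ a → ∃ λ a′ → (a Fin.< a′) × (fromℕ< (proj₁ (proj₂ (fold a))) ≡ fromℕ< (proj₁ (proj₂ (fold a′))))) → ⊥
          collide (a , a′ , a<a′ , e) = clash a a′ (λ { refl → ℕ.<-irrefl refl a<a′ }) refl refl (proj₂ (proj₂ (fold a)))
            (subst (Half (X.label a′)) (sym i≡) (proj₂ (proj₂ (fold a′))))
            where
            i≡ : proj₁ (fold a) ≡ proj₁ (fold a′)
            i≡ = trans (sym (Fin.toℕ-fromℕ< (proj₁ (proj₂ (fold a))))) (trans (cong toℕ e) (Fin.toℕ-fromℕ< (proj₁ (proj₂ (fold a′)))))

      system : ∀ {A} (x : Fin (suc A) → V) → (∀ a b → a ≢ b → Linked (x a) (x b)) → System A
      system x link = record { x = x ; link = link }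

      -- If both sides had at most `H` members, there would be at most `p + 1` vertices in all,
      -- fewer than `p + ℓ + 1`. So one side exceeds `H`. It has at most `p` members, which leaves
      -- more than `ℓ` for the other, against `pair-bound`.
      no-clique : ∀ A B (x : Fin A → V) (z : Fin B → V) → A ℕ.+ B ≡ p ℕ.+ ℓ ℕ.+ 1 →
        (∀ a b → a ≢ b → Linked (x a) (x b)) → (∀ a b → a ≢ b → Linked (z a) (z b)) →
        (∀ a b → Cross g (x a) (z b)) → ⊥
      no-clique zero B x z e lx lz cr = ℕ.<-irrefl refl (ℕ.≤-<-trans (small B z lz) (subst (p ℕ.<_) (sym e) p<))
        where
        p< : p ℕ.< p ℕ.+ ℓ ℕ.+ 1
        p< = subst (p ℕ.<_) (ℕ.+-comm 1 (p ℕ.+ ℓ)) (ℕ.s≤s (ℕ.m≤m+n p ℓ))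
        small : ∀ B (z : Fin B → V) → (∀ a b → a ≢ b → Linked (z a) (z b)) → B ℕ.≤ p
        small zero    z lz = ℕ.z≤n
        small (suc B) z lz = System.≤p (system z lz)
      no-clique (suc A) zero x z e lx lz cr = ℕ.<-irrefl refl (ℕ.≤-<-trans (System.≤p (system x lx))
          (subst (p ℕ.<_) (trans (sym e) (ℕ.+-identityʳ (suc A))) p<))
        where
        p< : p ℕ.< p ℕ.+ ℓ ℕ.+ 1
        p< = subst (p ℕ.<_) (ℕ.+-comm 1 (p ℕ.+ ℓ)) (ℕ.s≤s (ℕ.m≤m+n p ℓ))
      no-clique (suc A) (suc B) x z e lx lz cr = go (ℕ.<-≤-connex H (suc A)) (ℕ.<-≤-connex H (suc B))
        where
        X = system x lx
        Z = system z lz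
        other : ∀ {a b} → a ℕ.≤ p → a ℕ.+ b ≡ p ℕ.+ ℓ ℕ.+ 1 → ℓ ℕ.< b
        other {a} {b} a≤p e = ℕ.+-cancelˡ-< p ℓ b (ℕ.<-≤-trans (ℕ.≤-reflexive (trans (ℕ.+-comm 1 (p ℕ.+ ℓ)) (sym e))) (ℕ.+-monoˡ-≤ b a≤p))
        go : (H ℕ.< suc A) ⊎ (suc A ℕ.≤ H) → (H ℕ.< suc B) ⊎ (suc B ℕ.≤ H) → ⊥
        go (inj₁ q) _ = Pair.pair-bound g-form X Z cr q (other (System.≤p X) e)
        go (inj₂ _) (inj₁ q) = Pair.pair-bound (swap-form g-form) Z X (λ b a → swap-cross g-form (x a) (z b) (cr a b)) q
          (other (System.≤p Z) (trans (ℕ.+-comm (suc B) (suc A)) e))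
        go (inj₂ q) (inj₂ q′) = ℕ.<-irrefl refl (ℕ.≤-<-trans (ℕ.≤-trans (ℕ.+-mono-≤ q q′)
            (ℕ.≤-trans (ℕ.+-monoˡ-≤ H H≤1+h) (ℕ.≤-reflexive (cong suc h+H≡p))))
          (subst (suc p ℕ.<_) (trans (ℕ.+-comm 1 (p ℕ.+ ℓ)) (sym e)) (ℕ.s≤s (subst (ℕ._≤ p ℕ.+ ℓ) (ℕ.+-comm p 1) (ℕ.+-monoʳ-≤ p 1≤ℓ)))))

-- All rotations of some point are close to a dense set

module Concentrate where

  open Prelude
  open Sums
  open Grid
  open SineWave
  open Curve
  open Form
  open Space
  open import Data.List.Extrema ℤ.≤-totalOrder using (argmin; f[argmin]≤f[xs]; f[argmin]≤f[⊤]; argmin-sel)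

  indicator : ∀ {A : Set} → Dec A → ℤ
  indicator (yes _) = 1ℤ
  indicator (no _)  = 0ℤ

  indicator≥0 : ∀ {A : Set} (d : Dec A) → 0ℤ ≤ indicator d
  indicator≥0 (yes _) = 0≤⁺ 1
  indicator≥0 (no _)  = 0≤⁺ 0

  indicator-yes : ∀ {A : Set} (d : Dec A) → A → indicator d ≡ 1ℤ
  indicator-yes (yes _) _ = refl
  indicator-yes (no ¬a) a = ⊥-elim (¬a a)

  indicator-sound : ∀ {A : Set} (d : Dec A) → (indicator d ≡ 0ℤ) ⊎ ((indicator d ≡ 1ℤ) × A)
  indicator-sound (yes a) = inj₂ (refl , a)
  indicator-sound (no _)  = inj₁ refl

  1≤size : ∀ M → 1 ℕ.≤ M → ∀ k → 1ℤ ≤ size M k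
  1≤size M p zero    = ℤ.≤-refl
  1≤size M p (suc k) = ℤ.≤-trans (*-mono (0≤⁺ 1) (0≤⁺ 1) (+≤+ p) (1≤size M p k)) (ℤ.≤-reflexive (sym (size-suc M k)))

  mean-bound′ : ∀ M .{{_ : ℕ.NonZero M}} k (h : Vec ℕ k → ℤ) (r : Vec ℕ k → Fin k → ℤ) (Z : Vec ℕ k → ℤ) (a : ℕ) →
    1 ℕ.≤ a → k ℕ.≤ M ℕ.* M →
    (∀ x → 0ℤ ≤ h x) → (∀ x i → 0ℤ ≤ r x i) → (∀ x → sumFin (r x) ≡ h x) →
    (∀ x i → (h (updateAt x i suc) - h x) * (h (updateAt x i suc) - h x)
             ≤ (pos 32 * r x i + pos 32) + (pos 32 * r (updateAt x i suc) i + pos 32)) →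
    (∀ x → (Z x ≡ 0ℤ) ⊎ ((Z x ≡ 1ℤ) × (h x ≡ 0ℤ))) →
    size M k ≤ pos a * ∑ (grid M k) Z →
    ∑ (grid M k) h ≤ pos 64 * (pos a * (size M k * (pos M * pos M)))
  mean-bound′ (suc m) k h r Z a 1≤a k≤ h≥0 r≥0 sum-r grad ind dense =
    Poincaré.mean-bound m k h r Z a 1≤a k≤ h≥0 r≥0 sum-r grad ind (1≤size (suc m) (ℕ.s≤s ℕ.z≤n) k) dense

  square-bound : ∀ y a b → y ≤ pos 4 * a + pos 4 → - y ≤ pos 4 * b + pos 4 →
                 y * y ≤ (pos 32 * (a * a) + pos 32) + (pos 32 * (b * b) + pos 32)
  square-bound y a b p q with ℤ.≤-total 0ℤ y
  ... | inj₁ y≥0 = ℤ.≤-trans (*-mono y≥0 y≥0 p p) (certify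
        (0≤+ (0≤* (0≤⁺ 16) (0≤² (a - 1ℤ))) (0≤+ (0≤* (0≤⁺ 32) (0≤² b)) (0≤⁺ 32))) (eq a b))
    where
    eq : ∀ a b → pos 16 * ((a - 1ℤ) * (a - 1ℤ)) + (pos 32 * (b * b) + pos 32)
         ≡ pos 32 * (a * a) + pos 32 + (pos 32 * (b * b) + pos 32) - (pos 4 * a + pos 4) * (pos 4 * a + pos 4)
    eq = solve 2 (λ a b → con (pos 16) :* ((a :- con 1ℤ) :* (a :- con 1ℤ)) :+ (con (pos 32) :* (b :* b) :+ con (pos 32)) := con (pos 32) :* (a :* a) :+ con (pos 32) :+ (con (pos 32) :* (b :* b) :+ con (pos 32)) :- (con (pos 4) :* a :+ con (pos 4)) :* (con (pos 4) :* a :+ con (pos 4))) refl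
  ... | inj₂ y≤0 = ℤ.≤-trans (ℤ.≤-reflexive (eq₀ y)) (ℤ.≤-trans (*-mono (ℤ.neg-mono-≤ y≤0) (ℤ.neg-mono-≤ y≤0) q q) (certify
        (0≤+ (0≤* (0≤⁺ 16) (0≤² (b - 1ℤ))) (0≤+ (0≤* (0≤⁺ 32) (0≤² a)) (0≤⁺ 32))) (eq a b)))
    where
    eq₀ : ∀ y → y * y ≡ - y * - y
    eq₀ = solve-∀
    eq : ∀ a b → pos 16 * ((b - 1ℤ) * (b - 1ℤ)) + (pos 32 * (a * a) + pos 32)
         ≡ pos 32 * (a * a) + pos 32 + (pos 32 * (b * b) + pos 32) - (pos 4 * b + pos 4) * (pos 4 * b + pos 4)
    eq = solve 2 (λ a b → con (pos 16) :* ((b :- con 1ℤ) :* (b :- con 1ℤ)) :+ (con (pos 32) :* (a :* a) :+ con (pos 32)) := con (pos 32) :* (a :* a) :+ con (pos 32) :+ (con (pos 32) :* (b :* b) :+ con (pos 32)) :- (con (pos 4) :* b :+ con (pos 4)) :* (con (pos 4) :* b :+ con (pos 4))) refl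

  gradient-bound : ∀ {h h⁺} a b → h⁺ ≤ h + (pos 4 * a + pos 4) → h ≤ h⁺ + (pos 4 * b + pos 4) →
                   (h⁺ - h) * (h⁺ - h) ≤ (pos 32 * (a * a) + pos 32) + (pos 32 * (b * b) + pos 32)
  gradient-bound {h} {h⁺} a b p q = square-bound (h⁺ - h) a b
    (certify (≤⇒0≤ p) (eq h h⁺ (pos 4 * a + pos 4))) (certify (≤⇒0≤ q) (eq′ h h⁺ (pos 4 * b + pos 4)))
    where
    eq : ∀ a b c → a + c - b ≡ c - (b - a)
    eq = solve-∀
    eq′ : ∀ a b c → b + c - a ≡ c - - (b - a)
    eq′ = solve-∀

  -- Averaging over all shifts of a random point.
  good-point : ∀ M .{{_ : ℕ.NonZero M}} {k} (h : Vec ℕ k → ℤ) (r : Vec ℕ k → Fin k → ℤ) (Z : Vec ℕ k → ℤ) (a p : ℕ) (c : ℕ → ℕ) →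
    1 ℕ.≤ a → k ℕ.≤ M ℕ.* M →
    (∀ x → 0ℤ ≤ h x) → PeriodicV M h → (∀ x i → 0ℤ ≤ r x i) → (∀ x → sumFin (r x) ≡ h x) →
    (∀ x i → (h (updateAt x i suc) - h x) * (h (updateAt x i suc) - h x)
             ≤ (pos 32 * r x i + pos 32) + (pos 32 * r (updateAt x i suc) i + pos 32)) →
    (∀ x → (Z x ≡ 0ℤ) ⊎ ((Z x ≡ 1ℤ) × (h x ≡ 0ℤ))) →
    size M k ≤ pos a * ∑ (grid M k) Z →
    ∃ λ x → ∀ j → j ℕ.< p → h (shift (c j) x) ≤ pos p * (pos 64 * (pos a * (pos M * pos M)))
  good-point M {k} h r Z a p c 1≤a k≤ h≥0 per r≥0 sum-r grad ind dense = result (search total bound (grid M k))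
    where
    bound : ℤ
    bound = pos p * (pos 64 * (pos a * (pos M * pos M)))
    total : Vec ℕ k → ℤ
    total x = ∑ (range p) (λ j → h (shift (c j) x))
    N H : ℤ
    N = size M k
    H = ∑ (grid M k) h
    mean : H ≤ pos 64 * (pos a * (N * (pos M * pos M)))
    mean = mean-bound′ M k h r Z a 1≤a k≤ h≥0 r≥0 sum-r grad ind dense
    average : (∀ x → x ∈ grid M k → 1ℤ + bound ≤ total x) → N * (1ℤ + bound) ≤ pos p * H
    average large = ℤ.≤-trans (ℤ.≤-reflexive (sym (∑-const (grid M k) (1ℤ + bound))))
      (ℤ.≤-trans (∑-mono∈ (grid M k) large)
        (ℤ.≤-reflexive (trans (∑-swap (grid M k) (range p) (λ x j → h (shift (c j) x)))
          (trans (∑-cong (range p) (λ j → ∑-grid-shift M (c j) per)) (∑-range-const p H)))))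
    eq : ∀ p a M N H → p * H - N * (1ℤ + p * (pos 64 * (a * (M * M)))) + p * (pos 64 * (a * (N * (M * M))) - H) + (N - 1ℤ)
         ≡ - 1ℤ
    eq = solve 5 (λ p a M N H → p :* H :- N :* (con 1ℤ :+ p :* (con (pos 64) :* (a :* (M :* M)))) :+ p :* (con (pos 64) :* (a :* (N :* (M :* M))) :- H) :+ (N :- con 1ℤ) := :- con 1ℤ) refl
    result : (∃ λ x → (x ∈ grid M k) × (total x ≤ bound)) ⊎ (∀ x → x ∈ grid M k → 1ℤ + bound ≤ total x) →
             ∃ λ x → ∀ j → j ℕ.< p → h (shift (c j) x) ≤ bound
    result (inj₁ (x , _ , small)) = x , λ j j<p → ℤ.≤-trans
      (∑-member (λ j → h (shift (c j) x)) (λ j → h≥0 (shift (c j) x)) (∈-range⁺ j<p)) small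
    result (inj₂ large) = ⊥-elim (absurd
      (0≤+ (0≤+ (≤⇒0≤ (average large)) (0≤* (0≤⁺ p) (≤⇒0≤ mean))) (≤⇒0≤ (1≤size M (ℕ.>-nonZero⁻¹ M) k)))
      (eq (pos p) (pos a) (pos M) N H))

  module Nearest {V : Set} (D : V → V → ℤ) (D≥0 : ∀ x y → 0ℤ ≤ D x y) (D-refl : ∀ x → D x x ≡ 0ℤ)
                 (a₀ : V) (as : List V) where

    nearest : V → V
    nearest x = argmin (D x) a₀ as

    nearest∈ : ∀ x → nearest x ∈ a₀ ∷ as
    nearest∈ x = [ here , there ]′ (argmin-sel (D x) a₀ as)

    h : V → ℤ
    h x = D x (nearest x)

    h≤ : ∀ x {y} → y ∈ a₀ ∷ as → h x ≤ D x y
    h≤ x (here refl) = f[argmin]≤f[⊤] {f = D x} a₀ as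
    h≤ x (there m)   = ListAll.lookup (f[argmin]≤f[xs] {f = D x} a₀ as) m

    h≥0 : ∀ x → 0ℤ ≤ h x
    h≥0 x = D≥0 x (nearest x)

    h-member : ∀ {x} → x ∈ a₀ ∷ as → h x ≡ 0ℤ
    h-member {x} m = ℤ.≤-antisym (ℤ.≤-trans (h≤ x m) (ℤ.≤-reflexive (D-refl x))) (h≥0 x)

    h-invariant : ∀ x x′ → (∀ y → D x′ y ≡ D x y) → h x′ ≡ h x
    h-invariant x x′ e = ℤ.≤-antisym
      (ℤ.≤-trans (h≤ x′ (nearest∈ x)) (ℤ.≤-reflexive (e (nearest x))))
      (ℤ.≤-trans (h≤ x (nearest∈ x′)) (ℤ.≤-reflexive (sym (e (nearest x′)))))

  module Concentration (P κ Λ n : ℕ) .{{_ : ℕ.NonZero n}} (4≤P : 4 ℕ.≤ P) (wave : Sine P κ Λ) where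

    open HighDim P κ Λ n 4≤P wave

    M≥1 : 1 ℕ.≤ M
    M≥1 = ℕ.*-mono-≤ (ℕ.>-nonZero⁻¹ Q) (ℕ.>-nonZero⁻¹ n)

    instance
      M≢0 : ℕ.NonZero M
      M≢0 = ℕ.>-nonZero M≥1

    module Distance {k : ℕ} (a₀ : Vec ℕ k) (as : List (Vec ℕ k)) where

      open Nearest D D≥0 D-refl a₀ as public

      h-periodic : PeriodicV M h
      h-periodic x i = h-invariant x (updateAt x i (ℕ._+ M)) (λ y → lift-periodic₁ M ρ²-period y x i)

      r : Vec ℕ k → Fin k → ℤ
      r x i = ρ² (lookup x i) (lookup (nearest x) i)

      lookup-suc : ∀ {k} (x : Vec ℕ k) i → lookup (updateAt x i suc) i ≡ suc (lookup x i)
      lookup-suc (u ∷ x) zero    = refl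
      lookup-suc (u ∷ x) (suc i) = lookup-suc x i

      -- The nearest point of either neighbour is a candidate for the other, so both one-sided
      -- changes of `h` are bounded by a step of `D` towards a fixed point.
      gradient : ∀ x i → (h (updateAt x i suc) - h x) * (h (updateAt x i suc) - h x)
                 ≤ (pos 32 * r x i + pos 32) + (pos 32 * r (updateAt x i suc) i + pos 32)
      gradient x i = gradient-bound {h x} {h x⁺} (ρ (lookup x i) (lookup (nearest x) i)) (ρ (lookup x⁺ i) (lookup (nearest x⁺) i))
        (ℤ.≤-trans (h≤ x⁺ (nearest∈ x)) (D-step x (nearest x) i))
        (ℤ.≤-trans (h≤ x (nearest∈ x⁺)) (subst (λ u → D x (nearest x⁺) ≤ h x⁺ + (pos 4 * ρ u (lookup (nearest x⁺) i) + pos 4)) (sym (lookup-suc x i)) (D-step⁻ x (nearest x⁺) i)))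
        where
        x⁺ = updateAt x i suc

      -- The zero set of the distance instead of membership in the list. It contains the list, and
      -- `h` vanishes where it is 1, as `mean-bound` demands.
      Z : Vec ℕ k → ℤ
      Z x = indicator (h x ℤ.≟ 0ℤ)

      Z-sound : ∀ x → (Z x ≡ 0ℤ) ⊎ ((Z x ≡ 1ℤ) × (h x ≡ 0ℤ))
      Z-sound x = indicator-sound (h x ℤ.≟ 0ℤ)

      rotations : ∀ a p e → 1 ℕ.≤ a → k ℕ.≤ M ℕ.* M → size M k ≤ pos a * ∑ (grid M k) Z →
        ∃ λ x → ∀ j → j ℕ.< p → h (sh (e ℕ.* j) x) ≤ pos p * (pos 64 * (pos a * (pos M * pos M)))
      rotations a p e 1≤a k≤ dense = good-point M h r Z a p (λ j → e ℕ.* j ℕ.* n) 1≤a k≤ h≥0 h-periodic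
        (λ x i → 0≤² (ρ (lookup x i) (lookup (nearest x) i))) (λ x → sumFin-ρ² x (nearest x)) gradient Z-sound dense

-- Counting edges within and between the classes

module Counting where

  open Prelude
  open Sums
  open Grid
  open Rotation using (≤⊎>; 1≤⇒0≤; *-cancelˡ-≡)
  open SineWave
  open AntiConcentration using (<-irrefl; pow; pow≥0; pow≥1; bernoulli)
  open Curve
  open Form
  open Space
  open Cliques
  open Concentrate using (indicator; indicator≥0; indicator-sound; indicator-yes)

  indicator-no : ∀ {A : Set} (d : Dec A) → ¬ A → indicator d ≡ 0ℤ
  indicator-no (yes a) ¬a = ⊥-elim (¬a a)
  indicator-no (no _)  _  = refl

  indicator-≤ : ∀ {A B : Set} (d : Dec A) (e : Dec B) → (A → B) → indicator d ≤ indicator e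
  indicator-≤ (yes a) e f = ℤ.≤-reflexive (sym (indicator-yes e (f a)))
  indicator-≤ (no _)  e f = indicator≥0 e

  indicator-either : ∀ {A B : Set} (d : Dec A) (e : Dec B) → (¬ A → ¬ B → ⊥) → 1ℤ ≤ indicator d + indicator e
  indicator-either (yes _) (yes _) _ = 0≤⇒≤ (0≤⁺ 1)
  indicator-either (yes _) (no _)  _ = ℤ.≤-refl
  indicator-either (no _)  (yes _) _ = ℤ.≤-refl
  indicator-either (no a)  (no b)  f = ⊥-elim (f a b)

  indicator≤1 : ∀ {A : Set} (d : Dec A) → indicator d ≤ 1ℤ
  indicator≤1 (yes _) = ℤ.≤-refl
  indicator≤1 (no _)  = 0≤⁺ 1

  atMost : ℤ → ℤ → ℤ
  atMost b y = indicator (y ℤ.≤? b)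

  module SmallBalls (M : ℕ) (φ : ℕ → ℕ → ℤ) (φ≥0 : ∀ u v → 0ℤ ≤ φ u v) (θ : ℤ) (far : ℕ → ℕ → ℤ)
    (far-sound : ∀ u v → (far u v ≡ 0ℤ) ⊎ ((far u v ≡ 1ℤ) × (θ ≤ φ u v)))
    (far-half : ∀ u → pos M ≤ pos 2 * ∑ (range M) (far u)) where

    lift≥0 : ∀ {k} (x y : Vec ℕ k) → 0ℤ ≤ lift φ x y
    lift≥0 []      []      = ℤ.≤-refl
    lift≥0 (u ∷ x) (v ∷ y) = 0≤+ (φ≥0 u v) (lift≥0 x y)

    ball : ∀ {k} → Vec ℕ k → ℤ → ℤ
    ball {k} x b = ∑ (grid M k) (λ y → atMost b (lift φ x y))

    ball-step : ∀ {k} u (x : Vec ℕ k) b → ball (u ∷ x) b ≤ ∑ (range M) (λ v → ball x (b - φ u v))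
    ball-step {k} u x b = ℤ.≤-trans (ℤ.≤-reflexive (∑-grid M (λ y → atMost b (lift φ (u ∷ x) y))))
      (∑-mono (range M) (λ v → ∑-mono (grid M k) (λ y →
        indicator-≤ (φ u v + lift φ x y ℤ.≤? b) (lift φ x y ℤ.≤? b - φ u v) (λ p → certify (≤⇒0≤ p) (eq (φ u v) (lift φ x y) b)))))
      where
      eq : ∀ a d b → b - (a + d) ≡ b - a - d
      eq = solve-∀

    ball-empty : ∀ {k} (x : Vec ℕ k) b → 1ℤ + b ≤ 0ℤ → ball x b ≡ 0ℤ
    ball-empty {k} x b b<0 = trans (∑-cong (grid M k) (λ y → indicator-no (lift φ x y ℤ.≤? b)
      (λ p → <-irrefl {0ℤ} {b} (ℤ.≤-trans (lift≥0 x y) p) b<0))) (∑-0 (grid M k))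

    -- A coordinate of `y` far from that of `x` uses up `θ` of the radius, that is one unit of `r`,
    -- and halves the bound. At least half of the values of each coordinate are far, so every
    -- dimension brings an average factor of at most 3/4.
    ball-bound : ∀ {k} (x : Vec ℕ k) r b → 1ℤ + b ≤ pos r * θ → pow (pos 4) k * ball x b ≤ pow (pos 2) r * pow (pos 3) k * size M k
    ball-bound []      r b p = ℤ.≤-trans (*-monoˡ 1ℤ (0≤⁺ 1) (ℤ.+-monoˡ-≤ 0ℤ (indicator≤1 (0ℤ ℤ.≤? b))))
      (certify (≤⇒0≤ (pow≥1 (+≤+ (ℕ.s≤s ℕ.z≤n)) r)) (eq (pow (pos 2) r)))
      where
      eq : ∀ a → a - 1ℤ ≡ a * 1ℤ * 1ℤ - 1ℤ * (1ℤ + 0ℤ)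
      eq = solve-∀
    ball-bound {suc k} (u ∷ x) zero b p = ℤ.≤-trans
      (ℤ.≤-reflexive (trans (cong (pow (pos 4) (suc k) *_) (ball-empty (u ∷ x) b (ℤ.≤-trans p (ℤ.≤-reflexive (ℤ.*-zeroˡ θ))))) (ℤ.*-zeroʳ (pow (pos 4) (suc k)))))
      (0≤* (0≤* (0≤⁺ 1) (pow≥0 (0≤⁺ 3) (suc k))) (0≤⁺ (length (grid M (suc k)))))
    ball-bound {suc k} (u ∷ x) (suc r) b p = ℤ.≤-trans
      (*-monoˡ (pow (pos 4) (suc k)) (pow≥0 (0≤⁺ 4) (suc k)) (ball-step u x b))
      (ℤ.≤-trans (ℤ.≤-reflexive (trans (eq₁ p₄ Σball) (cong (pos 2 *_) (trans (cong (pos 2 *_) (sym (∑-* (range M) p₄ (λ v → ball x (b - φ u v))))) (sym (∑-* (range M) (pos 2) (λ v → p₄ * ball x (b - φ u v))))))))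
        (ℤ.≤-trans (*-monoˡ (pos 2) (0≤⁺ 2) (∑-mono (range M) pointwise))
          (ℤ.≤-trans (ℤ.≤-reflexive (cong (pos 2 *_) sum-eq))
            (certify (0≤* c≥0 (≤⇒0≤ (far-half u))) (trans (eq₂ p₂ p₃ N (pos M) F) (cong (λ z → pos 2 * p₂ * (pos 3 * p₃) * z - pos 2 * (pos M * (pos 4 * c) - pos 2 * c * F)) (sym (size-suc M k))))))))
      where
      p₂ p₃ p₄ N c F Σball : ℤ
      p₂ = pow (pos 2) r
      p₃ = pow (pos 3) k
      p₄ = pow (pos 4) k
      N = size M k
      c = p₂ * p₃ * N
      F = ∑ (range M) (far u)
      Σball = ∑ (range M) (λ v → ball x (b - φ u v))
      c≥0 : 0ℤ ≤ pos 2 * c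
      c≥0 = 0≤* (0≤⁺ 2) (0≤* (0≤* (pow≥0 (0≤⁺ 2) r) (pow≥0 (0≤⁺ 3) k)) (0≤⁺ (length (grid M k))))
      eq₁ : ∀ p s → pos 4 * p * s ≡ pos 2 * (pos 2 * (p * s))
      eq₁ = solve-∀
      eq₂ : ∀ a b n M F → pos 2 * (a * b * n) * (pos 2 * F - M) ≡ pos 2 * a * (pos 3 * b) * (M * n) - pos 2 * (M * (pos 4 * (a * b * n)) - pos 2 * (a * b * n) * F)
      eq₂ = solve 5 (λ a b n M F → con (pos 2) :* (a :* b :* n) :* (con (pos 2) :* F :- M) := con (pos 2) :* a :* (con (pos 3) :* b) :* (M :* n) :- con (pos 2) :* (M :* (con (pos 4) :* (a :* b :* n)) :- con (pos 2) :* (a :* b :* n) :* F)) refl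
      sum-eq : ∑ (range M) (λ v → pos 4 * c - pos 2 * c * far u v) ≡ pos M * (pos 4 * c) - pos 2 * c * F
      sum-eq = trans (∑-- (range M) (λ _ → pos 4 * c) (λ v → pos 2 * c * far u v)) (cong₂ _-_ (∑-range-const M (pos 4 * c)) (∑-* (range M) (pos 2 * c) (far u)))
      pointwise : ∀ v → pos 2 * (p₄ * ball x (b - φ u v)) ≤ pos 4 * c - pos 2 * c * far u v
      pointwise v = [ (λ e → ℤ.≤-trans (*-monoˡ (pos 2) (0≤⁺ 2) (ball-bound x (suc r) (b - φ u v) (certify (0≤+ (≤⇒0≤ p) (φ≥0 u v)) (eq₃ b (φ u v) (pos r) θ))))
                            (ℤ.≤-reflexive (trans (eq₄ p₂ p₃ N) (cong (λ z → pos 4 * c - pos 2 * c * z) (sym e)))))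
                    , (λ { (e , q) → ℤ.≤-trans (*-monoˡ (pos 2) (0≤⁺ 2) (ball-bound x r (b - φ u v) (certify (0≤+ (≤⇒0≤ p) (≤⇒0≤ q)) (eq₅ b (φ u v) (pos r) θ))))
                            (ℤ.≤-reflexive (trans (eq₆ p₂ p₃ N) (cong (λ z → pos 4 * c - pos 2 * c * z) (sym e)))) }) ]′ (far-sound u v)
        where
        eq₃ : ∀ b f r t → (1ℤ + r) * t - (1ℤ + b) + f ≡ (1ℤ + r) * t - (1ℤ + (b - f))
        eq₃ = solve 4 (λ b f r t → (con 1ℤ :+ r) :* t :- (con 1ℤ :+ b) :+ f := (con 1ℤ :+ r) :* t :- (con 1ℤ :+ (b :- f))) refl
        eq₄ : ∀ a b n → pos 2 * (pos 2 * a * b * n) ≡ pos 4 * (a * b * n) - pos 2 * (a * b * n) * 0ℤ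
        eq₄ = solve 3 (λ a b n → con (pos 2) :* (con (pos 2) :* a :* b :* n) := con (pos 4) :* (a :* b :* n) :- con (pos 2) :* (a :* b :* n) :* con 0ℤ) refl
        eq₅ : ∀ b f r t → (1ℤ + r) * t - (1ℤ + b) + (f - t) ≡ r * t - (1ℤ + (b - f))
        eq₅ = solve 4 (λ b f r t → (con 1ℤ :+ r) :* t :- (con 1ℤ :+ b) :+ (f :- t) := r :* t :- (con 1ℤ :+ (b :- f))) refl
        eq₆ : ∀ a b n → pos 2 * (a * b * n) ≡ pos 4 * (a * b * n) - pos 2 * (a * b * n) * 1ℤ
        eq₆ = solve 3 (λ a b n → con (pos 2) :* (a :* b :* n) := con (pos 4) :* (a :* b :* n) :- con (pos 2) :* (a :* b :* n) :* con 1ℤ) refl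

    -- Bernoulli's inequality makes `(4/3)^k` at least `1 + k / 3`, which beats `d * 2^r` once `k`
    -- is large.
    ball-small : ∀ {k} (x : Vec ℕ k) r b d → 1ℤ + b ≤ pos r * θ → pos 3 * (pos d * pow (pos 2) r) ≤ pos k → pos d * ball x b ≤ size M k
    ball-small {k} x r b d p large = *-cancelˡ (pow (pos 4) k) (pow≥1 (+≤+ (ℕ.s≤s ℕ.z≤n)) k)
      (ℤ.≤-trans (ℤ.≤-reflexive (eq₁ (pow (pos 4) k) (pos d) (ball x b)))
        (ℤ.≤-trans (*-monoˡ (pos d) (0≤⁺ d) (ball-bound x r b p))
          (*-cancelˡ (pos 3) (+≤+ (ℕ.s≤s ℕ.z≤n)) (certify
            (0≤* (0≤⁺ (length (grid M k))) (0≤+ (0≤+ (≤⇒0≤ (bernoulli (pos 3) (0≤⁺ 3) k)) (0≤* (≤⇒0≤ large) p₃≥0)) (0≤* (0≤⁺ 3) p₃≥0)))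
            (eq₂ (pow (pos 4) k) (pow (pos 3) k) (pow (pos 2) r) (pos d) (pos k) (size M k))))))
      where
      p₃≥0 = pow≥0 {pos 3} (0≤⁺ 3) k
      eq₁ : ∀ p d x → p * (d * x) ≡ d * (p * x)
      eq₁ = solve-∀
      eq₂ : ∀ q t s d k n → n * (pos 3 * q - (pos 3 + k) * t + (k - pos 3 * (d * s)) * t + pos 3 * t) ≡ pos 3 * (q * n) - pos 3 * (d * (s * t * n))
      eq₂ = solve 6 (λ q t s d k n → n :* (con (pos 3) :* q :- (con (pos 3) :+ k) :* t :+ (k :- con (pos 3) :* (d :* s)) :* t :+ con (pos 3) :* t) := con (pos 3) :* (q :* n) :- con (pos 3) :* (d :* (s :* t :* n))) refl

  exceeds : ℤ → ℤ → ℤ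
  exceeds R y = indicator (1ℤ + R ℤ.≤? y)

  data Exceeds (R y : ℤ) : ℤ → Set where
    over  : 1ℤ + R ≤ y → Exceeds R y 1ℤ
    under : y ≤ R → Exceeds R y 0ℤ

  exceeds-view : ∀ R y → Exceeds R y (exceeds R y)
  exceeds-view R y with 1ℤ + R ℤ.≤? y
  ... | yes p = over p
  ... | no ¬p = under (ℤ.≮⇒≥ (λ q → ¬p (ℤ.i<j⇒suc[i]≤j q)))

  -- A sequence changing sign once per half turn leaves the positive side exactly once.
  module Turning (H m : ℕ) (1≤H : 1 ℕ.≤ H) (m≤H : m ℕ.≤ H) (B : ℕ → ℤ)
    (B-bit : ∀ t → (B t ≡ 0ℤ) ⊎ (B t ≡ 1ℤ)) (B-anti : ∀ t → B (t ℕ.+ H) ≡ 1ℤ - B t)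
    (no-turn : ∀ t i j → 1 ℕ.≤ i → 1 ℕ.≤ j → i ℕ.+ j ℕ.≤ H → (B (t ℕ.+ i) - B t) * (B (t ℕ.+ (i ℕ.+ j)) - B (t ℕ.+ i)) ≡ 0ℤ) where

    Q : ℕ
    Q = H ℕ.+ H

    B-periodic : Periodic Q B
    B-periodic t = trans (cong B (sym (ℕ.+-assoc t H H))) (trans (B-anti (t ℕ.+ H)) (trans (cong (λ z → 1ℤ - z) (B-anti t)) (eq (B t))))
      where
      eq : ∀ a → 1ℤ - (1ℤ - a) ≡ a
      eq = solve-∀

    drops : ℕ → ℤ
    drops i = ∑ (range Q) (λ t → B t * (1ℤ - B (t ℕ.+ i)))

    B² : ∀ t → B t * B t ≡ B t
    B² t = [ (λ e → trans (cong₂ _*_ e e) (sym e)) , (λ e → trans (cong₂ _*_ e e) (sym e)) ]′ (B-bit t)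

    drops-0 : drops 0 ≡ 0ℤ
    drops-0 = trans (∑-cong (range Q) (λ t → trans (cong (λ z → B t * (1ℤ - B z)) (ℕ.+-identityʳ t)) (trans (eq (B t)) (trans (cong (λ z → B t - z) (B² t)) (ℤ.+-inverseʳ (B t)))))) (∑-0 (range Q))
      where
      eq : ∀ a → a * (1ℤ - a) ≡ a - a * a
      eq = solve-∀

    -- Within half a turn the sign changes at most once, so a fall during `suc i` steps happens
    -- either in the first `i` steps or in the last one. By periodicity the falls in the last step
    -- number `drops 1`.
    drops-suc : ∀ i → suc i ℕ.≤ H → drops (suc i) ≡ drops i + drops 1
    drops-suc zero    _ = sym (trans (cong (_+ drops 1) drops-0) (ℤ.+-identityˡ (drops 1)))
    drops-suc (suc i) p = trans (∑-cong (range Q) pointwise)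
      (trans (∑-+ (range Q) (λ t → B t * (1ℤ - B (t ℕ.+ suc i))) (λ t → B (t ℕ.+ suc i) * (1ℤ - B (t ℕ.+ suc i ℕ.+ 1))))
        (cong (drops (suc i) +_) (∑-periodic Q {λ t → B t * (1ℤ - B (t ℕ.+ 1))} per (suc i))))
      where
      per : Periodic Q (λ t → B t * (1ℤ - B (t ℕ.+ 1)))
      per t = cong₂ (λ a b → a * (1ℤ - b)) (B-periodic t) (trans (cong B (eq t Q)) (B-periodic (t ℕ.+ 1)))
        where
        eq : ∀ t Q → t ℕ.+ Q ℕ.+ 1 ≡ t ℕ.+ 1 ℕ.+ Q
        eq = ℕSolver.solve-∀
      pointwise : ∀ t → B t * (1ℤ - B (t ℕ.+ suc (suc i))) ≡ B t * (1ℤ - B (t ℕ.+ suc i)) + B (t ℕ.+ suc i) * (1ℤ - B (t ℕ.+ suc i ℕ.+ 1))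
      pointwise t = trans (cong (λ z → B t * (1ℤ - B z)) (sym e))
        (trans (trans (sym (ℤ.+-identityʳ _)) (cong (B t * (1ℤ - B (t ℕ.+ suc i ℕ.+ 1)) +_) (sym turn)))
          (trans (eq (B t) (B (t ℕ.+ suc i)) (B (t ℕ.+ suc i ℕ.+ 1)))
            (trans (cong (λ z → B t * (1ℤ - B (t ℕ.+ suc i)) + B (t ℕ.+ suc i) * (1ℤ - B (t ℕ.+ suc i ℕ.+ 1)) + (z - B (t ℕ.+ suc i))) (B² (t ℕ.+ suc i)))
              (eq′ (B t * (1ℤ - B (t ℕ.+ suc i)) + B (t ℕ.+ suc i) * (1ℤ - B (t ℕ.+ suc i ℕ.+ 1))) (B (t ℕ.+ suc i))))))
        where
        e : t ℕ.+ suc i ℕ.+ 1 ≡ t ℕ.+ suc (suc i)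
        e = eq₀ t i
          where
          eq₀ : ∀ t i → t ℕ.+ suc i ℕ.+ 1 ≡ t ℕ.+ suc (suc i)
          eq₀ = ℕSolver.solve-∀
        turn : - ((B (t ℕ.+ suc i) - B t) * (B (t ℕ.+ suc i ℕ.+ 1) - B (t ℕ.+ suc i))) ≡ 0ℤ
        turn = cong -_ (trans (cong (λ z → (B (t ℕ.+ suc i) - B t) * (B z - B (t ℕ.+ suc i))) (ℕ.+-assoc t (suc i) 1))
          (no-turn t (suc i) 1 (ℕ.s≤s ℕ.z≤n) ℕ.≤-refl (subst (ℕ._≤ H) (ℕ.+-comm 1 (suc i)) p)))
        eq : ∀ a b c → a * (1ℤ - c) + - ((b - a) * (c - b)) ≡ a * (1ℤ - b) + b * (1ℤ - c) + (b * b - b)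
        eq = solve 3 (λ a b c → a :* (con 1ℤ :- c) :+ :- ((b :- a) :* (c :- b)) := a :* (con 1ℤ :- b) :+ b :* (con 1ℤ :- c) :+ (b :* b :- b)) refl
        eq′ : ∀ x y → x + (y - y) ≡ x
        eq′ = solve-∀

    drops-linear : ∀ i → i ℕ.≤ H → drops i ≡ pos i * drops 1
    drops-linear zero    _ = trans drops-0 (sym (ℤ.*-zeroˡ (drops 1)))
    drops-linear (suc i) p = trans (drops-suc i p) (trans (cong (_+ drops 1) (drops-linear i (ℕ.<⇒≤ p))) (eq (pos i) (drops 1)))
      where
      eq : ∀ i d → i * d + d ≡ (1ℤ + i) * d
      eq = solve-∀

    drops-H : drops H ≡ pos H
    drops-H = trans (∑-cong (range Q) (λ t → trans (cong (λ z → B t * (1ℤ - z)) (B-anti t)) (trans (eq (B t)) (B² t))))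
      (trans (∑-range-+ H H B) (trans (sym (∑-+ (range H) B (λ t → B (H ℕ.+ t))))
        (trans (∑-cong (range H) (λ t → trans (cong (λ z → B t + B z) (ℕ.+-comm H t)) (trans (cong (B t +_) (B-anti t)) (eq′ (B t)))))
          (trans (∑-range-const H 1ℤ) (ℤ.*-identityʳ (pos H))))))
      where
      eq : ∀ a → a * (1ℤ - (1ℤ - a)) ≡ a * a
      eq = solve-∀
      eq′ : ∀ a → a + (1ℤ - a) ≡ 1ℤ
      eq′ = solve-∀

    -- `drops` is linear up to `H`. Its value there is `H`: half a turn turns every positive time
    -- negative, and half of the `2H` times are positive.
    drops-1 : drops 1 ≡ 1ℤ
    drops-1 = *-cancelˡ-≡ (pos H) (+≤+ 1≤H) (trans (sym (drops-linear H ℕ.≤-refl)) (trans drops-H (sym (ℤ.*-identityʳ (pos H)))))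

    drops-m : drops m ≡ pos m
    drops-m = trans (drops-linear m m≤H) (trans (cong (pos m *_) drops-1) (ℤ.*-identityʳ (pos m)))

  module Density (p ℓ κ Λ n k : ℕ) .{{_ : ℕ.NonZero n}} (4≤P : 4 ℕ.≤ p ℕ.+ p) (1≤ℓ : 1 ℕ.≤ ℓ) (2ℓ≤p : ℓ ℕ.+ ℓ ℕ.≤ p)
                 (wave : Sine (p ℕ.+ p) κ Λ) (C : ℤ) (1≤Λ : 1 ℕ.≤ Λ) (2≤C : pos 2 ≤ C) where

    open CliqueFree p ℓ κ Λ n k 4≤P 1≤ℓ 2ℓ≤p wave C
    open HighDim (p ℕ.+ p) κ Λ n 4≤P wave

    module _ (separated : 1ℤ + pos 10 * C ≤ pos k * (pos n * pos n)) (fine : 1ℤ + pos 3 * E ≤ pos Λ * (μ * μ)) where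

      m : ℕ
      m = 8 ℕ.* ℓ

      cross? : V → V → ℤ
      cross? x z = exceeds R (g x z) * exceeds R (- g x (sh m z))

      private
        R≥μ : μ ≤ R
        R≥μ = certify (0≤+ (0≤+ (≤⇒0≤ (μ≤s 1≤Λ 2≤C separated fine)) (0≤* (0≤* (0≤⁺ 2) s≥0) (≤⇒0≤ 2≤C))) (0≤* (0≤⁺ 3) s≥0)) (eq μ s C)
          where
          eq : ∀ m s C → s - m + pos 2 * s * (C - pos 2) + pos 3 * s ≡ pos 2 * (s * C) - m
          eq = solve 3 (λ m s C → s :- m :+ con (pos 2) :* s :* (C :- con (pos 2)) :+ con (pos 3) :* s := con (pos 2) :* (s :* C) :- m) refl

      -- An orbit without values near zero. There a value that is not clearly positive is clearly
      -- negative, so the signs are exactly antiperiodic and `no-zigzag` excludes two changes within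
      -- half a turn.
      module Generic (U : ℕ → ℤ) (three-U : ThreeTerm E U) (U-anti : ∀ t → U (t ℕ.+ H₂) ≡ - U t)
                     (generic : ∀ t → ¬ Near R (U t)) where

        exceeds-neg : ∀ t → exceeds R (- U t) ≡ 1ℤ - exceeds R (U t)
        exceeds-neg t = go (exceeds-view R (U t)) (exceeds-view R (- U t))
          where
          eq : ∀ R y → - y - (1ℤ + R) + (y - (1ℤ + R)) + (pos 2 * R + 1ℤ) ≡ - 1ℤ
          eq = solve 2 (λ R y → :- y :- (con 1ℤ :+ R) :+ (y :- (con 1ℤ :+ R)) :+ (con (pos 2) :* R :+ con 1ℤ) := :- con 1ℤ) refl
          go : ∀ {a b} → Exceeds R (U t) a → Exceeds R (- U t) b → b ≡ 1ℤ - a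
          go (over p)  (over q)  = ⊥-elim (absurd (0≤+ (0≤+ (≤⇒0≤ q) (≤⇒0≤ p)) (0≤+ (0≤* (0≤⁺ 2) (R≥0 1≤Λ 2≤C separated fine)) (0≤⁺ 1))) (eq R (U t)))
          go (over _)  (under _) = refl
          go (under _) (over _)  = refl
          go (under p) (under q) = ⊥-elim (generic t (ℤ.≤-trans (ℤ.neg-mono-≤ q) (ℤ.≤-reflexive (ℤ.neg-involutive (U t))) , p))

        zigzag : ∀ {τ : ℕ → ℤ} → ThreeTerm E τ → ∀ t i j → 1 ℕ.≤ i → 1 ℕ.≤ j → i ℕ.+ j ℕ.≤ H₂ → R ≤ τ t → R ≤ - τ (t ℕ.+ i) → R ≤ τ (t ℕ.+ (i ℕ.+ j)) → ⊥
        zigzag {τ} h = no-zigzag 1≤Λ 2≤C separated fine {E} {R} τ h (R≥0 1≤Λ 2≤C separated fine)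
          (ℤ.≤-trans (certify (0≤* (0≤⁺ 2) (E≥0 1≤Λ 2≤C separated fine)) (eq E)) (ℤ.≤-trans fine (*-monoˡ (pos Λ) (0≤⁺ Λ) (*-mono (1≤⇒0≤ μ≥1) (1≤⇒0≤ μ≥1) R≥μ (ℤ.≤-refl {μ})))))
          where
          eq : ∀ E → pos 2 * E ≡ 1ℤ + pos 3 * E - (1ℤ + E)
          eq = solve-∀

        weaken : ∀ {y} → 1ℤ + R ≤ y → R ≤ y
        weaken {y} = ℤ.≤-trans (certify (0≤⁺ 1) (eq R))
          where
          eq : ∀ R → 1ℤ ≡ 1ℤ + R - R
          eq = solve-∀

        negative-side : ∀ t → U t ≤ R → R ≤ - U t
        negative-side t p = [ (λ q → ⊥-elim (generic t (q , p))) , (λ q → certify (0≤+ (≤⇒0≤ q) (0≤⁺ 1)) (eq R (U t))) ]′ (≤⊎> (- R) (U t))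
          where
          eq : ∀ R y → - R - (1ℤ + y) + 1ℤ ≡ - y - R
          eq = solve-∀

        no-turn : ∀ t i j → 1 ℕ.≤ i → 1 ℕ.≤ j → i ℕ.+ j ℕ.≤ H₂ →
          (exceeds R (U (t ℕ.+ i)) - exceeds R (U t)) * (exceeds R (U (t ℕ.+ (i ℕ.+ j))) - exceeds R (U (t ℕ.+ i))) ≡ 0ℤ
        no-turn t i j 1≤i 1≤j i+j≤ = go (exceeds-view R (U t)) (exceeds-view R (U (t ℕ.+ i))) (exceeds-view R (U (t ℕ.+ (i ℕ.+ j))))
          where
          go : ∀ {a b c} → Exceeds R (U t) a → Exceeds R (U (t ℕ.+ i)) b → Exceeds R (U (t ℕ.+ (i ℕ.+ j))) c → (b - a) * (c - b) ≡ 0ℤ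
          go (over p)  (under q) (over r)  = ⊥-elim (zigzag three-U t i j 1≤i 1≤j i+j≤ (weaken p) (negative-side (t ℕ.+ i) q) (weaken r))
          go (under p) (over q)  (under r) = ⊥-elim (zigzag (three-neg {τ = U} three-U) t i j 1≤i 1≤j i+j≤ (negative-side t p)
            (ℤ.≤-trans (weaken q) (ℤ.≤-reflexive (sym (ℤ.neg-involutive (U (t ℕ.+ i)))))) (negative-side (t ℕ.+ (i ℕ.+ j)) r))
          go (over _)  (over _)  (over _)  = refl
          go (over _)  (over _)  (under _) = refl
          go (over _)  (under _) (under _) = refl
          go (under _) (over _)  (over _)  = refl
          go (under _) (under _) (over _)  = refl
          go (under _) (under _) (under _) = refl

        bit : ∀ t → (exceeds R (U t) ≡ 0ℤ) ⊎ (exceeds R (U t) ≡ 1ℤ)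
        bit t = go (exceeds-view R (U t))
          where
          go : ∀ {a} → Exceeds R (U t) a → (a ≡ 0ℤ) ⊎ (a ≡ 1ℤ)
          go (over _)  = inj₂ refl
          go (under _) = inj₁ refl

        1≤H₂ : 1 ℕ.≤ H₂
        1≤H₂ = ℕ.≤-trans (ℕ.s≤s ℕ.z≤n) (ℕ.≤-trans 4≤P (ℕ.m≤m+n P P))

        m≤H₂ : m ℕ.≤ H₂
        m≤H₂ = ℕ.≤-trans (ℕ.≤-reflexive (eq ℓ)) (ℕ.≤-trans (ℕ.*-monoʳ-≤ 4 2ℓ≤p) (ℕ.≤-reflexive (sym H₂≡)))
          where
          eq : ∀ b → 8 ℕ.* b ≡ 4 ℕ.* (b ℕ.+ b)
          eq = ℕSolver.solve-∀

        module T = Turning H₂ m 1≤H₂ m≤H₂ (λ t → exceeds R (U t)) bit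
          (λ t → trans (cong (exceeds R) (U-anti t)) (exceeds-neg t)) no-turn

        crossings : ∑ (range Q) (λ t → exceeds R (U t) * exceeds R (- U (t ℕ.+ m))) ≡ pos m
        crossings = trans (∑-cong (range Q) (λ t → cong (exceeds R (U t) *_) (exceeds-neg (t ℕ.+ m)))) T.drops-m

      shift-updateAt : ∀ {k} c M (z : Vec ℕ k) i → shift c (updateAt z i (ℕ._+ M)) ≡ updateAt (shift c z) i (ℕ._+ M)
      shift-updateAt c M (u ∷ z) zero    = cong (_∷ shift c z) (eq u M c)
        where
        eq : ∀ u M c → u ℕ.+ M ℕ.+ c ≡ u ℕ.+ c ℕ.+ M
        eq = ℕSolver.solve-∀
      shift-updateAt c M (u ∷ z) (suc i) = cong (u ℕ.+ c ∷_) (shift-updateAt c M z i)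

      g-periodic : ∀ (x : V) → PeriodicV {k} M (λ z → g x z)
      g-periodic x = lift-periodic₂ M g₁-period₂ x

      cross?-periodic : ∀ (x : V) → PeriodicV {k} M (cross? x)
      cross?-periodic x z i = cong₂ (λ a b → exceeds R a * exceeds R (- b)) (g-periodic x z i)
        (trans (cong (g x) (shift-updateAt (m ℕ.* n) M z i)) (g-periodic x (sh m z) i))

      exceeds≥0 : ∀ y → 0ℤ ≤ exceeds R y
      exceeds≥0 y = indicator≥0 (1ℤ + R ℤ.≤? y)

      cross?≥0 : ∀ x z → 0ℤ ≤ cross? x z
      cross?≥0 x z = 0≤* (exceeds≥0 (g x z)) (exceeds≥0 (- g x (sh m z)))

      cross?≤1 : ∀ x z → cross? x z ≤ 1ℤ
      cross?≤1 x z = *-mono (exceeds≥0 (g x z)) (exceeds≥0 (- g x (sh m z)))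
        (indicator≤1 (1ℤ + R ℤ.≤? g x z)) (indicator≤1 (1ℤ + R ℤ.≤? - g x (sh m z)))

      module Orbit (x z : V) where
        U : ℕ → ℤ
        U t = g x (sh t z)

        total near-count : ℤ
        total = ∑ (range Q) (λ t → cross? x (sh t z))
        near-count = ∑ (range Q) (λ t → near? R (U t))

        U-anti : ∀ t → U (t ℕ.+ H₂) ≡ - U t
        U-anti t = trans (cong (g x) (sym (sh-+ H₂ t z))) (g-anti₂ x (sh t z))

        U-periodic : Periodic Q U
        U-periodic t = trans (cong U (sym (ℕ.+-assoc t H₂ H₂))) (trans (U-anti (t ℕ.+ H₂)) (trans (cong -_ (U-anti t)) (ℤ.neg-involutive (U t))))

        count≡ : (∀ t → ¬ Near R (U t)) → total ≡ pos m
        count≡ generic = trans (∑-cong (range Q) (λ t → cong (λ y → exceeds R (U t) * exceeds R (- g x y)) (sh-+ m t z)))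
          (Generic.crossings U (three-right x z) U-anti generic)

        near?-1 : ∀ y → Near R y → near? R y ≡ 1ℤ
        near?-1 y (p , q) = go (sign R y)
          where
          go : ∀ {a} → Sign R y a → a ≡ 1ℤ
          go (plus r)  = <-irrefl q r
          go (minus r) = <-irrefl (ℤ.≤-trans (ℤ.neg-mono-≤ p) (ℤ.≤-reflexive (ℤ.neg-involutive R))) r
          go (close _) = refl

        none : near-count ≤ 0ℤ → ∀ t → ¬ Near R (U t)
        none p t nr = <-irrefl {1ℤ} {0ℤ} (ℤ.≤-trans (ℤ.≤-trans (ℤ.≤-reflexive (sym (near?-1 (U r) (subst (Near R) (sym (%-periodic U-periodic t)) nr))))
            (∑-member (λ t → near? R (U t)) (λ t → near?≥0 R (U t)) (∈-range⁺ (ℕ.m%n<n t Q)))) p) ℤ.≤-refl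
          where
          r = t ℕ.% Q

        m≤Q : pos m ≤ pos Q
        m≤Q = +≤+ (ℕ.≤-trans (ℕ.*-monoʳ-≤ 8 (ℕ.≤-trans (ℕ.m≤m+n ℓ ℓ) 2ℓ≤p)) (ℕ.≤-reflexive (sym Q≡8p)))

        -- An orbit free of values near zero contributes exactly `m`. Any other contributes between
        -- 0 and `Q`, and this is charged to its values near zero.
        count-≤ : total ≤ pos m + pos Q * near-count
        count-≤ = [ (λ p → ℤ.≤-trans (ℤ.≤-reflexive (count≡ (none p))) (certify (0≤* (0≤⁺ Q) (∑-0≤ (range Q) (λ t → near?≥0 R (U t)))) (eq (pos m) (pos Q * near-count))))
                  , (λ q → ℤ.≤-trans (∑-mono (range Q) (λ t → cross?≤1 x (sh t z))) (ℤ.≤-trans (ℤ.≤-reflexive (∑-range-const Q 1ℤ))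
                      (certify (0≤+ (0≤* (0≤⁺ Q) (≤⇒0≤ q)) (0≤⁺ m)) (eq′ (pos m) (pos Q) near-count)))) ]′ (≤⊎> near-count 0ℤ)
          where
          eq : ∀ a b → b ≡ a + b - a
          eq = solve-∀
          eq′ : ∀ m Q c → Q * (c - (1ℤ + 0ℤ)) + m ≡ m + Q * c - Q * 1ℤ
          eq′ = solve 3 (λ m Q c → Q :* (c :- (con 1ℤ :+ con 0ℤ)) :+ m := m :+ Q :* c :- Q :* con 1ℤ) refl

        count-≥ : pos m ≤ total + pos Q * near-count
        count-≥ = [ (λ p → ℤ.≤-trans (ℤ.≤-reflexive (sym (count≡ (none p)))) (certify (0≤* (0≤⁺ Q) (∑-0≤ (range Q) (λ t → near?≥0 R (U t)))) (eq total (pos Q * near-count))))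
                  , (λ q → ℤ.≤-trans m≤Q (certify (0≤+ (0≤* (0≤⁺ Q) (≤⇒0≤ q)) (∑-0≤ (range Q) (λ t → cross?≥0 x (sh t z)))) (eq′ total (pos Q) near-count))) ]′ (≤⊎> near-count 0ℤ)
          where
          eq : ∀ a b → b ≡ a + b - a
          eq = solve-∀
          eq′ : ∀ c Q b → Q * (b - (1ℤ + 0ℤ)) + c ≡ c + Q * b - Q
          eq′ = solve-∀

      N edges : ℤ
      N = size M k
      edges = ∑ (grid M k) (λ x → ∑ (grid M k) (cross? x))

      -- Every rotation permutes the torus, so summing over orbits counts each pair `Q` times.
      orbit-sum : ∀ (f : V → V → ℤ) → (∀ x → PeriodicV {k} M (f x)) →
        ∑ (grid M k) (λ x → ∑ (grid M k) (λ z → ∑ (range Q) (λ t → f x (sh t z)))) ≡ pos Q * ∑ (grid M k) (λ x → ∑ (grid M k) (f x))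
      orbit-sum f per = trans (∑-cong (grid M k) (λ x → trans (∑-swap (grid M k) (range Q) (λ z t → f x (sh t z)))
          (trans (∑-cong (range Q) (λ t → ∑-grid-shift M (t ℕ.* n) (per x))) (∑-range-const Q (∑ (grid M k) (f x))))))
        (∑-* (grid M k) (pos Q) (λ x → ∑ (grid M k) (f x)))

      nears : ℤ
      nears = ∑ (grid M k) (λ x → ∑ (grid M k) (λ z → near? R (g x z)))

      count-sum : ∑ (grid M k) (λ x → ∑ (grid M k) (λ z → Orbit.total x z)) ≡ pos Q * edges
      count-sum = orbit-sum cross? cross?-periodic

      near-sum : ∑ (grid M k) (λ x → ∑ (grid M k) (λ z → Orbit.near-count x z)) ≡ pos Q * nears
      near-sum = orbit-sum (λ x z → near? R (g x z)) (λ x z i → cong (near? R) (g-periodic x z i))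

      ∑∑-affine : ∀ a c (f : V → V → ℤ) → ∑ (grid M k) (λ x → ∑ (grid M k) (λ z → a + c * f x z)) ≡ N * (N * a) + c * ∑ (grid M k) (λ x → ∑ (grid M k) (f x))
      ∑∑-affine a c f = trans (∑-cong (grid M k) (λ x → trans (∑-+ (grid M k) (λ _ → a) (λ z → c * f x z)) (cong₂ _+_ (∑-const (grid M k) a) (∑-* (grid M k) c (f x)))))
        (trans (∑-+ (grid M k) (λ _ → N * a) (λ x → c * ∑ (grid M k) (f x))) (cong₂ _+_ (∑-const (grid M k) (N * a)) (∑-* (grid M k) c (λ x → ∑ (grid M k) (f x)))))

      edges-≤ : pos Q * edges ≤ N * (N * pos m) + pos Q * (pos Q * nears)
      edges-≤ = subst₂ _≤_ count-sum (trans (∑∑-affine (pos m) (pos Q) (λ x z → Orbit.near-count x z)) (cong (λ y → N * (N * pos m) + pos Q * y) near-sum))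
        (∑∑-mono (grid M k) (grid M k) (λ x z → Orbit.count-≤ x z))

      edges-≥ : N * (N * pos m) ≤ pos Q * edges + pos Q * (pos Q * nears)
      edges-≥ = subst₂ _≤_ (trans (∑-cong (grid M k) (λ _ → ∑-const (grid M k) (pos m))) (∑-const (grid M k) (N * pos m)))
        (trans (∑-cong (grid M k) (λ x → trans (∑-+ (grid M k) (λ z → Orbit.total x z) (λ z → pos Q * Orbit.near-count x z)) (cong (∑ (grid M k) (λ z → Orbit.total x z) +_) (∑-* (grid M k) (pos Q) (λ z → Orbit.near-count x z)))))
          (trans (∑-+ (grid M k) (λ x → ∑ (grid M k) (λ z → Orbit.total x z)) (λ x → pos Q * ∑ (grid M k) (λ z → Orbit.near-count x z)))
            (cong₂ _+_ count-sum (trans (∑-* (grid M k) (pos Q) (λ x → ∑ (grid M k) (λ z → Orbit.near-count x z))) (cong (pos Q *_) near-sum)))))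
        (∑∑-mono (grid M k) (grid M k) (λ x z → Orbit.count-≥ x z))

      nears-small : ∀ d → (∀ z → pos d * ∑ (grid M k) (λ x → near? R (g x z)) ≤ N) → pos d * nears ≤ N * N
      nears-small d p = ℤ.≤-trans (ℤ.≤-reflexive (trans (cong (pos d *_) (∑-swap (grid M k) (grid M k) (λ x z → near? R (g x z))))
          (sym (∑-* (grid M k) (pos d) (λ z → ∑ (grid M k) (λ x → near? R (g x z)))))))
        (ℤ.≤-trans (∑-mono (grid M k) p) (ℤ.≤-reflexive (∑-const (grid M k) N)))

  module Sparse (P κ Λ n : ℕ) .{{_ : ℕ.NonZero n}} (4≤P : 4 ℕ.≤ P) (wave : Sine P κ Λ) where

    open HighDim P κ Λ n 4≤P wave

    -- Distances are doubled so that the threshold `n / 2` can be expressed in integers.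
    φ : ℕ → ℕ → ℤ
    φ u v = pos 2 * ρ u v * (pos 2 * ρ u v)

    far : ℕ → ℕ → ℤ
    far u v = indicator (pos n ℤ.≤? pos 2 * ρ u v)

    far-sound : ∀ u v → (far u v ≡ 0ℤ) ⊎ ((far u v ≡ 1ℤ) × (pos n * pos n ≤ φ u v))
    far-sound u v = [ inj₁ , (λ q → inj₂ (proj₁ q , *-mono (0≤⁺ n) (0≤⁺ n) (proj₂ q) (proj₂ q))) ]′ (indicator-sound (pos n ℤ.≤? pos 2 * ρ u v))

    4≤Q : 4 ℕ.≤ Q
    4≤Q = ℕ.≤-trans 4≤P (ℕ.≤-trans (ℕ.m≤m+n P P) (ℕ.m≤m+n (P ℕ.+ P) (P ℕ.+ P)))

    -- `v` and `v + 2n` are at least `n` apart, so one of the two is at least `n / 2` away from `u`.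
    far-half : ∀ u → pos M ≤ pos 2 * ∑ (range M) (far u)
    far-half u = ℤ.≤-trans (ℤ.≤-reflexive (sym (trans (∑-range-const M 1ℤ) (ℤ.*-identityʳ (pos M)))))
      (ℤ.≤-trans (∑-mono (range M) either) (ℤ.≤-reflexive (trans (∑-+ (range M) (far u) (λ v → far u (v ℕ.+ 2 ℕ.* n)))
        (trans (cong (∑ (range M) (far u) +_) (∑-periodic M {far u} per (2 ℕ.* n))) (eq (∑ (range M) (far u)))))))
      where
      eq : ∀ x → x + x ≡ pos 2 * x
      eq = solve-∀
      per : Periodic M (far u)
      per v = cong (λ z → indicator (pos n ℤ.≤? pos 2 * z)) (trans (ρ-sym u (v ℕ.+ M)) (trans (ρ-period v u) (ρ-sym v u)))
      either : ∀ v → 1ℤ ≤ far u v + far u (v ℕ.+ 2 ℕ.* n)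
      either v = indicator-either (pos n ℤ.≤? pos 2 * ρ u v) (pos n ℤ.≤? pos 2 * ρ u (v ℕ.+ 2 ℕ.* n)) (λ a b → absurd (0≤+ (0≤+ (≤⇒0≤ (ℤ.i<j⇒suc[i]≤j (ℤ.≰⇒> a))) (≤⇒0≤ (ℤ.i<j⇒suc[i]≤j (ℤ.≰⇒> b))))
                (0≤+ (0≤* (0≤⁺ 2) (≤⇒0≤ (ℤ.≤-trans (ρ-far v 2 ℕ.≤-refl 4≤Q) (ρ-triangle v u (v ℕ.+ 2 ℕ.* n))))) (0≤+ (0≤* (0≤⁺ 2) (≤⇒0≤ (ℤ.≤-reflexive (ρ-sym v u)))) (0≤⁺ 1))))
              (eq′ (pos n) (ρ u v) (ρ u (v ℕ.+ 2 ℕ.* n)) (ρ v u)))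
        where
        eq′ : ∀ n a b c → n - (1ℤ + pos 2 * a) + (n - (1ℤ + pos 2 * b)) + (pos 2 * (c + b - n) + (pos 2 * (a - c) + 1ℤ)) ≡ - 1ℤ
        eq′ = solve 4 (λ n a b c → n :- (con 1ℤ :+ con (pos 2) :* a) :+ (n :- (con 1ℤ :+ con (pos 2) :* b)) :+ (con (pos 2) :* (c :+ b :- n) :+ (con (pos 2) :* (a :- c) :+ con 1ℤ)) := :- con 1ℤ) refl

    open SmallBalls M φ (λ u v → 0≤² (pos 2 * ρ u v)) (pos n * pos n) far far-sound far-half

    lift-φ : ∀ {k} (x y : Vec ℕ k) → lift φ x y ≡ pos 4 * D x y
    lift-φ []      []      = refl
    lift-φ (u ∷ x) (v ∷ y) = trans (cong (φ u v +_) (lift-φ x y)) (eq (ρ u v) (D x y))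
      where
      eq : ∀ a d → pos 2 * a * (pos 2 * a) + pos 4 * d ≡ pos 4 * (a * a + d)
      eq = solve 2 (λ a d → con (pos 2) :* a :* (con (pos 2) :* a) :+ con (pos 4) :* d := con (pos 4) :* (a :* a :+ d)) refl

    close-rare : ∀ {k} C r d → 1ℤ + pos 4 * C ≤ pos r * (pos n * pos n) → pos 3 * (pos d * pow (pos 2) r) ≤ pos k →
      ∀ (x : Vec ℕ k) → pos d * ∑ (grid M k) (λ y → atMost C (D x y)) ≤ size M k
    close-rare {k} C r d p large x = ℤ.≤-trans (*-monoˡ (pos d) (0≤⁺ d) (∑-mono (grid M k) (λ y →
        indicator-≤ (D x y ℤ.≤? C) (lift φ x y ℤ.≤? pos 4 * C) (λ q → ℤ.≤-trans (ℤ.≤-reflexive (lift-φ x y)) (*-monoˡ (pos 4) (0≤⁺ 4) q)))))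
      (ball-small x r (pos 4 * C) d p large)

-- Templates, and the choice of the constants

module Templates where

  open Prelude
  open Sums
  open Grid
  open Rotation using (1≤⇒0≤)
  open SineWave
  open AntiConcentration using (pow)
  open Curve
  open Form
  open Space
  open Cliques
  open Concentrate
  open Counting
  open import Data.Integer using (∣_∣)
  open import Data.Bool using (_∧_; _∨_)
  open import Data.List.Relation.Unary.Any using (Any; any?)
  open import Relation.Binary using (Tri; tri<; tri≈; tri>)

  bit : Bool → ℤ
  bit true  = 1ℤ
  bit false = 0ℤ

  does⇒ : ∀ {A : Set} (a? : Dec A) → does a? ≡ true → A
  does⇒ (yes a) _ = a

  ⇒does : ∀ {A : Set} (a? : Dec A) → A → does a? ≡ true
  ⇒does (yes _) _ = refl
  ⇒does (no ¬a) a = ⊥-elim (¬a a)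

  bit-does : ∀ {A : Set} (a? : Dec A) → bit (does a?) ≡ indicator a?
  bit-does (yes _) = refl
  bit-does (no _)  = refl

  bit-∧ : ∀ a b → bit (a ∧ b) ≡ bit a * bit b
  bit-∧ true  b = sym (ℤ.*-identityˡ (bit b))
  bit-∧ false b = sym (ℤ.*-zeroˡ (bit b))

  bit≥0 : ∀ b → 0ℤ ≤ bit b
  bit≥0 true  = 0≤⁺ 1
  bit≥0 false = 0≤⁺ 0

  bit-∨ : ∀ a b → bit (a ∨ b) ≤ bit a + bit b
  bit-∨ true  b = certify (bit≥0 b) (eq (bit b))
    where
    eq : ∀ b → b ≡ 1ℤ + b - 1ℤ
    eq = solve-∀
  bit-∨ false b = ℤ.≤-reflexive (sym (ℤ.+-identityˡ (bit b)))

  ∧-true : ∀ {a b} → a ∧ b ≡ true → (a ≡ true) × (b ≡ true)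
  ∧-true {true} {true} _ = refl , refl

  bit-any : ∀ {A : Set} {Q : A → Set} (Q? : ∀ x → Dec (Q x)) xs → bit (does (any? Q? xs)) ≤ ∑ xs (λ x → indicator (Q? x))
  bit-any Q? []       = ℤ.≤-refl
  bit-any Q? (x ∷ xs) = ℤ.≤-trans (bit-∨ (does (Q? x)) (does (any? Q? xs)))
    (ℤ.+-mono-≤ (ℤ.≤-reflexive (bit-does (Q? x))) (bit-any Q? xs))

  -- The numerals are variables here because conversion checking would unfold products of literals.
  rescale : ∀ a b e p d n c {M : ℤ} → c ≡ p ℕ.* (b ℕ.* (d ℕ.* ((e ℕ.* p) ℕ.* (e ℕ.* p)))) → M ≡ pos e * pos p * pos n →
            pos a * (pos p * (pos b * (pos d * (M * M)))) ≡ pos (a ℕ.* c) * (pos n * pos n)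
  rescale a b e p d n _ refl refl = trans (eq (pos a) (pos b) (pos e) (pos p) (pos d) (pos n))
    (cong (_* (pos n * pos n)) (sym (trans (ℤ.pos-* a _) (cong (pos a *_) (trans (ℤ.pos-* p _) (cong (pos p *_)
      (trans (ℤ.pos-* b _) (cong (pos b *_) (trans (ℤ.pos-* d _) (cong (pos d *_)
        (trans (ℤ.pos-* (e ℕ.* p) (e ℕ.* p)) (cong₂ _*_ (ℤ.pos-* e p) (ℤ.pos-* e p)))))))))))))
    where
    eq : ∀ a b e p d n → a * (p * (b * (d * (e * p * n * (e * p * n))))) ≡ a * (p * (b * (d * (e * p * (e * p))))) * (n * n)
    eq = solve 6 (λ a b e p d n → a :* (p :* (b :* (d :* (e :* p :* n :* (e :* p :* n))))) := a :* (p :* (b :* (d :* (e :* p :* (e :* p))))) :* (n :* n)) refl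

  -- The weighted reduced structure on one finite grid, of which the graphs are blow-ups.
  record Template (p ℓ d : ℕ) : Set where
    field
      M k : ℕ
      1≤M : 1 ℕ.≤ M
    V : Set
    V = Vec ℕ k
    N : ℤ
    N = size M k
    field
      link        : V → V → Bool
      link-sym    : ∀ x y → link x y ≡ link y x
      link-irrefl : ∀ x → link x x ≡ false
      cross       : V → V → Bool
      Z           : V → List V → V → ℤ
      Z≥0         : ∀ a as x → 0ℤ ≤ Z a as x
      Z-member    : ∀ a as {x} → x ∈ a ∷ as → Z a as x ≡ 1ℤ
      find-clique : ∀ a as → N ≤ pos d * ∑ (grid M k) (Z a as) →
                    ∃ λ (c : Fin p → V) → (∀ j → c j ∈ a ∷ as) × (∀ i j → i ≢ j → link (c i) (c j) ≡ true)
      sparse      : pos d * ∑ (grid M k) (λ x → ∑ (grid M k) (λ y → bit (link x y))) ≤ N * N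
      dense≤      : pos d * (pos p * ∑ (grid M k) (λ x → ∑ (grid M k) (λ z → bit (cross x z)))) ≤ pos d * (pos ℓ * (N * N)) + N * N
      dense≥      : pos d * (pos ℓ * (N * N)) ≤ pos d * (pos p * ∑ (grid M k) (λ x → ∑ (grid M k) (λ z → bit (cross x z)))) + N * N
      clique-free : ∀ A B (x : Fin A → V) (z : Fin B → V) → A ℕ.+ B ≡ p ℕ.+ ℓ ℕ.+ 1 →
        (∀ a b → a ≢ b → link (x a) (x b) ≡ true) → (∀ a b → a ≢ b → link (z a) (z b) ≡ true) →
        (∀ a b → cross (x a) (z b) ≡ true) → ⊥

  -- `c₀ * n²` is the bound of `rotations` for the period `M = 8 p n`, and `C` is four times as
  -- large because points near rotations of a common centre are compared by way of it. `many` puts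
  -- rotations of a point more than `10 C` apart. `W` windows cover the values between `- R` and
  -- `R`; `d₂` absorbs the factors lost on orbits with a value near zero; `r` measures the ball of
  -- radius `4 C` in units of `n²`.
  module Build (p ℓ d k Λ : ℕ) .{{_ : ℕ.NonZero k}} (4≤P : 4 ℕ.≤ p ℕ.+ p) (1≤ℓ : 1 ℕ.≤ ℓ) (2ℓ≤p : ℓ ℕ.+ ℓ ℕ.≤ p) (1≤d : 1 ℕ.≤ d)
               (κ : ℕ) (wave : Sine (p ℕ.+ p) κ Λ) (1≤Λ : 1 ℕ.≤ Λ)
               (c₀ : ℕ) (c₀≡ : c₀ ≡ p ℕ.* (64 ℕ.* (d ℕ.* ((8 ℕ.* p) ℕ.* (8 ℕ.* p)))))
               (many : 1 ℕ.+ 10 ℕ.* (4 ℕ.* c₀) ℕ.≤ k)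
               (W : ℕ) (W≡ : W ≡ 1 ℕ.+ 2 ℕ.* (κ ℕ.* (4 ℕ.* c₀)))
               (d₂ : ℕ) (d₂≡ : d₂ ≡ 8 ℕ.* (p ℕ.* p) ℕ.* d)
               (large : (2 ℕ.* (2 ℕ.* (W ℕ.* d₂) ℕ.* (2 ℕ.* (W ℕ.* d₂)))) ℕ.* (2 ℕ.* (2 ℕ.* (W ℕ.* d₂) ℕ.* (2 ℕ.* (W ℕ.* d₂)))) ℕ.≤ k)
               (r : ℕ) (r≡ : r ≡ 1 ℕ.+ 4 ℕ.* (4 ℕ.* c₀))
               (rare : pos 3 * (pos (2 ℕ.* p ℕ.* d) * pow (pos 2) r) ≤ pos k)
               (Λ-large : 1 ℕ.+ 3 ℕ.* (k ℕ.* (k ℕ.* (k ℕ.* (κ ℕ.* κ)))) ℕ.≤ Λ) where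

    -- Subdividing each edge into as many pieces as there are coordinates secures `k ≤ M * M` for
    -- the Poincaré argument.
    n : ℕ
    n = k

    c₁ : ℕ
    c₁ = 4 ℕ.* c₀

    C : ℤ
    C = pos c₁ * (pos n * pos n)

    open CliqueFree p ℓ κ Λ n k 4≤P 1≤ℓ 2ℓ≤p wave C
    open HighDim (p ℕ.+ p) κ Λ n 4≤P wave
    module Conc = Concentration (p ℕ.+ p) κ Λ n 4≤P wave

    1≤p : 1 ℕ.≤ p
    1≤p = ℕ.≤-trans 1≤ℓ (ℕ.≤-trans (ℕ.m≤m+n ℓ ℓ) 2ℓ≤p)

    1≤k : 1 ℕ.≤ k
    1≤k = ℕ.>-nonZero⁻¹ k

    1≤c₀ : 1 ℕ.≤ c₀
    1≤c₀ = subst (1 ℕ.≤_) (sym c₀≡) (ℕ.*-mono-≤ 1≤p (ℕ.*-mono-≤ {1} {64} (ℕ.s≤s ℕ.z≤n) (ℕ.*-mono-≤ 1≤d (ℕ.*-mono-≤ 1≤8p 1≤8p))))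
      where
      1≤8p : 1 ℕ.≤ 8 ℕ.* p
      1≤8p = ℕ.*-mono-≤ {1} {8} (ℕ.s≤s ℕ.z≤n) 1≤p

    n≥1 : 1ℤ ≤ pos n
    n≥1 = +≤+ 1≤k

    n²≥1 : 1ℤ ≤ pos n * pos n
    n²≥1 = *-mono (0≤⁺ 1) (0≤⁺ 1) n≥1 n≥1

    2≤C : pos 2 ≤ C
    2≤C = ℤ.≤-trans {pos 2} {pos c₁ * 1ℤ} (ℤ.≤-trans (+≤+ (ℕ.≤-trans (ℕ.s≤s (ℕ.s≤s ℕ.z≤n)) (ℕ.*-monoʳ-≤ 4 1≤c₀))) (ℤ.≤-reflexive (sym (ℤ.*-identityʳ (pos c₁)))))
      (*-monoˡ (pos c₁) (0≤⁺ c₁) n²≥1)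

    separated : 1ℤ + pos 10 * C ≤ pos k * (pos n * pos n)
    separated = ℤ.≤-trans (certify (≤⇒0≤ n²≥1) (eq (pos c₁) (pos n)))
      (ℤ.≤-trans (ℤ.≤-reflexive (cong (_* (pos n * pos n)) (cong (1ℤ +_) (sym (ℤ.pos-* 10 c₁)))))
        (*-mono (0≤⁺ (suc (10 ℕ.* c₁))) (0≤* (0≤⁺ n) (0≤⁺ n)) (+≤+ many) ℤ.≤-refl))
      where
      eq : ∀ c n → n * n - 1ℤ ≡ (1ℤ + pos 10 * c) * (n * n) - (1ℤ + pos 10 * (c * (n * n)))
      eq = solve 2 (λ c n → n :* n :- con 1ℤ := (con 1ℤ :+ con (pos 10) :* c) :* (n :* n) :- (con 1ℤ :+ con (pos 10) :* (c :* (n :* n)))) refl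

    -- The accumulated error `E` is `k * n² * s²`; with `s ≤ κ μ` it is at most a multiple of `μ²`
    -- that `Λ-large` anticipates.
    fine : 1ℤ + pos 3 * E ≤ pos Λ * (μ * μ)
    fine = ℤ.≤-trans (ℤ.≤-reflexive (cong (λ z → 1ℤ + pos 3 * z) (Err≡ k)))
      (ℤ.≤-trans (certify (0≤+ (≤⇒0≤ μ²≥1) (0≤* (0≤⁺ 3) (0≤* (0≤⁺ k) (0≤* (0≤* (0≤⁺ n) (0≤⁺ n)) (0≤+ (0≤* (≤⇒0≤ s≤κμ) (0≤* (0≤⁺ κ) (1≤⇒0≤ μ≥1))) (0≤* s≥0 (≤⇒0≤ s≤κμ)))))))
                  (eq (pos k) (pos n) s μ (pos κ)))
        (*-mono (0≤+ (0≤⁺ 1) (0≤* (0≤⁺ 3) (0≤* (0≤⁺ k) (0≤* (0≤⁺ n) (0≤* (0≤⁺ n) (0≤* (0≤⁺ κ) (0≤⁺ κ)))))))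
                (0≤² μ) Λ≥ ℤ.≤-refl))
      where
      μ²≥1 : 1ℤ ≤ μ * μ
      μ²≥1 = *-mono (0≤⁺ 1) (0≤⁺ 1) μ≥1 μ≥1
      Λ≥ : 1ℤ + pos 3 * (pos k * (pos n * (pos n * (pos κ * pos κ)))) ≤ pos Λ
      Λ≥ = ℤ.≤-trans (ℤ.≤-reflexive (cong (1ℤ +_) (sym
        (trans (ℤ.pos-* 3 (k ℕ.* (k ℕ.* (k ℕ.* (κ ℕ.* κ))))) (cong (pos 3 *_)
          (trans (ℤ.pos-* k (k ℕ.* (k ℕ.* (κ ℕ.* κ)))) (cong (pos k *_)
            (trans (ℤ.pos-* k (k ℕ.* (κ ℕ.* κ))) (cong (pos k *_) (trans (ℤ.pos-* k (κ ℕ.* κ)) (cong (pos k *_) (ℤ.pos-* κ κ)))))))))))) (+≤+ Λ-large)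
      eq : ∀ k n s m κ → (m * m - 1ℤ) + pos 3 * (k * (n * n * ((κ * m - s) * (κ * m) + s * (κ * m - s))))
           ≡ (1ℤ + pos 3 * (k * (n * (n * (κ * κ))))) * (m * m) - (1ℤ + pos 3 * (k * (n * (n * (s * s)))))
      eq = solve 5 (λ k n s m κ → (m :* m :- con 1ℤ) :+ con (pos 3) :* (k :* (n :* n :* ((κ :* m :- s) :* (κ :* m) :+ s :* (κ :* m :- s)))) := (con 1ℤ :+ con (pos 3) :* (k :* (n :* (n :* (κ :* κ))))) :* (m :* m) :- (con 1ℤ :+ con (pos 3) :* (k :* (n :* (n :* (s :* s)))))) refl

    1≤W : 1 ℕ.≤ W
    1≤W = subst (1 ℕ.≤_) (sym W≡) (ℕ.s≤s ℕ.z≤n)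

    1≤d₂ : 1 ℕ.≤ d₂
    1≤d₂ = subst (1 ℕ.≤_) (sym d₂≡) (ℕ.*-mono-≤ (ℕ.*-mono-≤ {1} {8} (ℕ.s≤s ℕ.z≤n) (ℕ.*-mono-≤ 1≤p 1≤p)) 1≤d)

    R≤W : 1ℤ + (R + R) ≤ pos W * w
    R≤W = ℤ.≤-trans (certify (0≤+ (≤⇒0≤ w≥1) (0≤* (0≤* (0≤* (0≤⁺ 4) (0≤⁺ c₁)) (0≤* (0≤⁺ n) (0≤⁺ n))) (≤⇒0≤ s≤κμ))) (eq (pos c₁) (pos n) s μ (pos κ)))
      (ℤ.≤-reflexive (cong (_* w) (sym (trans (cong pos W≡) (cong (1ℤ +_) (trans (ℤ.pos-* 2 (κ ℕ.* c₁)) (cong (pos 2 *_) (ℤ.pos-* κ c₁))))))))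
      where
      eq : ∀ c n s m κ → (pos 2 * (n * (n * m)) - 1ℤ) + pos 4 * c * (n * n) * (κ * m - s)
           ≡ (1ℤ + pos 2 * (κ * c)) * (pos 2 * (n * (n * m))) - (1ℤ + (pos 2 * (s * (c * (n * n))) + pos 2 * (s * (c * (n * n)))))
      eq = solve 5 (λ c n s m κ → (con (pos 2) :* (n :* (n :* m)) :- con 1ℤ) :+ con (pos 4) :* c :* (n :* n) :* (κ :* m :- s) := (con 1ℤ :+ con (pos 2) :* (κ :* c)) :* (con (pos 2) :* (n :* (n :* m))) :- (con 1ℤ :+ (con (pos 2) :* (s :* (c :* (n :* n))) :+ con (pos 2) :* (s :* (c :* (n :* n)))))) refl

    close? : ∀ (x y : V) → Dec (Any (λ t → D (sh (8 ℕ.* suc t) x) y ≤ C) (range (ℕ.pred p)))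
    close? x y = any? (λ t → D (sh (8 ℕ.* suc t) x) y ℤ.≤? C) (range (ℕ.pred p))

    -- Both orders are tested so that symmetry holds as an equality of Booleans.
    link : V → V → Bool
    link x y = does (close? x y) ∨ does (close? y x)

    link-sym : ∀ (x y : V) → link x y ≡ link y x
    link-sym x y = Bool.∨-comm (does (close? x y)) (does (close? y x))

    close⇒linked : ∀ (x y : V) {m} → m ℕ.≤ ℕ.pred p → Any (λ t → D (sh (8 ℕ.* suc t) x) y ≤ C) (range m) → Linked x y
    close⇒linked x y {suc m} m≤ (here d)  = suc m , ℕ.s≤s ℕ.z≤n , subst (suc (suc m) ℕ.≤_) (ℕ.suc-pred p {{ℕ.>-nonZero 1≤p}}) (ℕ.s≤s m≤) , d
    close⇒linked x y {suc m} m≤ (there a) = close⇒linked x y (ℕ.<⇒≤ m≤) a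

    linked⇒close : ∀ (x y : V) t → 1 ℕ.≤ t → t ℕ.< p → D (sh (8 ℕ.* t) x) y ≤ C → Any (λ t → D (sh (8 ℕ.* suc t) x) y ≤ C) (range (ℕ.pred p))
    linked⇒close x y (suc t) _ t<p d = go (∈-range⁺ (ℕ.≤-pred (subst (suc (suc t) ℕ.≤_) (sym (ℕ.suc-pred p {{ℕ.>-nonZero 1≤p}})) t<p)))
      where
      go : ∀ {ts} → t ∈ ts → Any (λ t → D (sh (8 ℕ.* suc t) x) y ≤ C) ts
      go (here refl) = here d
      go (there m)   = there (go m)

    ∨-case : ∀ a b → a ∨ b ≡ true → (a ≡ true) ⊎ (b ≡ true)
    ∨-case true  b _ = inj₁ refl
    ∨-case false b e = inj₂ e

    link⇒linked : ∀ (x y : V) → link x y ≡ true → Linked x y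
    link⇒linked x y e = [ (λ e′ → close⇒linked x y ℕ.≤-refl (does⇒ (close? x y) e′))
                        , (λ e′ → linked-sym {y} {x} (close⇒linked y x ℕ.≤-refl (does⇒ (close? y x) e′))) ]′ (∨-case (does (close? x y)) (does (close? y x)) e)

    close⇒link : ∀ (x y : V) t → 1 ℕ.≤ t → t ℕ.< p → D (sh (8 ℕ.* t) x) y ≤ C → link x y ≡ true
    close⇒link x y t 1≤t t<p d = cong (_∨ does (close? y x)) (⇒does (close? x y) (linked⇒close x y t 1≤t t<p d))

    -- A vertex linked to itself would be within `C` of a proper rotation of itself, which
    -- `separated` excludes.
    sysLink : ∀ (x : V) → (b : Bool) → link x x ≡ b → b ≡ false
    sysLink x false e = refl
    sysLink x true  e = ⊥-elim (refute (link⇒linked x x e))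
      where
      refute : Linked x x → ⊥
      refute (t , 1≤t , t<p , dd) = absurd
        (0≤+ (0≤+ (≤⇒0≤ separated) (≤⇒0≤ far)) (0≤+ (≤⇒0≤ dd) (0≤* (0≤⁺ 9) (ℤ.≤-trans (0≤⁺ 2) 2≤C))))
        (eq C (pos k * (pos n * pos n)) (D x u) (D u x) (D-sym x u))
        where
        u = sh (8 ℕ.* t) x
        far : pos k * (pos n * pos n) ≤ D x u
        far = D-far (8 ℕ.* t) (ℕ.≤-trans {2} {8} (ℕ.s≤s (ℕ.s≤s ℕ.z≤n)) (ℕ.*-monoʳ-≤ 8 1≤t))
          (ℕ.≤-trans (ℕ.+-monoʳ-≤ (8 ℕ.* t) {2} {8} (ℕ.s≤s (ℕ.s≤s ℕ.z≤n)))
            (ℕ.≤-trans (ℕ.≤-reflexive (trans (ℕ.+-comm (8 ℕ.* t) 8) (sym (ℕ.*-suc 8 t)))) (ℕ.≤-trans (ℕ.*-monoʳ-≤ 8 t<p) (ℕ.≤-reflexive (sym Q≡8p))))) x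
        eq′ : ∀ C m a → m - (1ℤ + pos 10 * C) + (a - m) + (C - a + pos 9 * C) ≡ - 1ℤ
        eq′ = solve 3 (λ C m a → m :- (con 1ℤ :+ con (pos 10) :* C) :+ (a :- m) :+ (C :- a :+ con (pos 9) :* C) := :- con 1ℤ) refl
        eq : ∀ C m a b → a ≡ b → m - (1ℤ + pos 10 * C) + (a - m) + (C - b + pos 9 * C) ≡ - 1ℤ
        eq C m a _ refl = eq′ C m a

    link-irrefl : ∀ x → link x x ≡ false
    link-irrefl x = sysLink x (link x x) refl

    open Density p ℓ κ Λ n k 4≤P 1≤ℓ 2ℓ≤p wave C 1≤Λ 2≤C hiding (m; N)

    m : ℕ
    m = 8 ℕ.* ℓ

    crossᵇ : V → V → Bool
    crossᵇ x z = does (1ℤ + R ℤ.≤? g x z) ∧ does (1ℤ + R ℤ.≤? - g x (sh m z))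

    bit-cross : ∀ (x z : V) → bit (crossᵇ x z) ≡ cross? separated fine x z
    bit-cross x z = trans (bit-∧ (does (1ℤ + R ℤ.≤? g x z)) (does (1ℤ + R ℤ.≤? - g x (sh m z))))
      (cong₂ _*_ (bit-does (1ℤ + R ℤ.≤? g x z)) (bit-does (1ℤ + R ℤ.≤? - g x (sh m z))))

    cross-true : ∀ (x z : V) → crossᵇ x z ≡ true → Cross g x z
    cross-true x z e = does⇒ (1ℤ + R ℤ.≤? g x z) (proj₁ (∧-true e)) , does⇒ (1ℤ + R ℤ.≤? - g x (sh m z)) (proj₂ (∧-true e))

    N : ℤ
    N = size M k

    e : ℤ
    e = ∑ (grid M k) (λ x → ∑ (grid M k) (λ z → bit (crossᵇ x z)))

    e≡ : e ≡ edges separated fine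
    e≡ = ∑-cong (grid M k) (λ x → ∑-cong (grid M k) (bit-cross x))

    few : pos d₂ * nears separated fine ≤ N * N
    few = nears-small separated fine d₂ (near-rare R W d₂ 1≤W 1≤d₂ R≤W large)

    pos-Q : pos Q ≡ pos 8 * pos p
    pos-Q = trans (cong pos Q≡8p) (ℤ.pos-* 8 p)

    pos-d₂ : pos d₂ ≡ pos 8 * (pos p * pos p) * pos d
    pos-d₂ = trans (cong pos d₂≡) (trans (ℤ.pos-* (8 ℕ.* (p ℕ.* p)) d) (cong (_* pos d) (trans (ℤ.pos-* 8 (p ℕ.* p)) (cong (pos 8 *_) (ℤ.pos-* p p)))))

    dense≤ : pos d * (pos p * e) ≤ pos d * (pos ℓ * (N * N)) + N * N
    dense≤ = *-cancelˡ (pos 8) (+≤+ (ℕ.s≤s ℕ.z≤n)) (certify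
      (0≤+ (0≤* (0≤⁺ d) (≤⇒0≤ main)) (0≤* (0≤⁺ 8) (≤⇒0≤ few′))) (eq (pos d) (pos p) (pos ℓ) N e nr))
      where
      nr = nears separated fine
      few′ : pos 8 * (pos p * pos p) * pos d * nr ≤ N * N
      few′ = subst (λ z → z * nr ≤ N * N) pos-d₂ few
      main : pos 8 * pos p * e ≤ N * (N * (pos 8 * pos ℓ)) + pos 8 * pos p * (pos 8 * pos p * nr)
      main = subst (λ z → pos 8 * pos p * z ≤ N * (N * (pos 8 * pos ℓ)) + pos 8 * pos p * (pos 8 * pos p * nr)) (sym e≡)
        (subst₂ (λ q y → q * edges separated fine ≤ N * (N * y) + q * (q * nr)) pos-Q (ℤ.pos-* 8 ℓ) (edges-≤ separated fine))
      eq : ∀ d p l N e r → d * (N * (N * (pos 8 * l)) + pos 8 * p * (pos 8 * p * r) - pos 8 * p * e) + pos 8 * (N * N - pos 8 * (p * p) * d * r)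
           ≡ pos 8 * (d * (l * (N * N)) + N * N) - pos 8 * (d * (p * e))
      eq = solve 6 (λ d p l N e r → d :* (N :* (N :* (con (pos 8) :* l)) :+ con (pos 8) :* p :* (con (pos 8) :* p :* r) :- con (pos 8) :* p :* e) :+ con (pos 8) :* (N :* N :- con (pos 8) :* (p :* p) :* d :* r) := con (pos 8) :* (d :* (l :* (N :* N)) :+ N :* N) :- con (pos 8) :* (d :* (p :* e))) refl

    dense≥ : pos d * (pos ℓ * (N * N)) ≤ pos d * (pos p * e) + N * N
    dense≥ = *-cancelˡ (pos 8) (+≤+ (ℕ.s≤s ℕ.z≤n)) (certify
      (0≤+ (0≤* (0≤⁺ d) (≤⇒0≤ main)) (0≤* (0≤⁺ 8) (≤⇒0≤ few′))) (eq (pos d) (pos p) (pos ℓ) N e nr))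
      where
      nr = nears separated fine
      few′ : pos 8 * (pos p * pos p) * pos d * nr ≤ N * N
      few′ = subst (λ z → z * nr ≤ N * N) pos-d₂ few
      main : N * (N * (pos 8 * pos ℓ)) ≤ pos 8 * pos p * e + pos 8 * pos p * (pos 8 * pos p * nr)
      main = subst (λ z → N * (N * (pos 8 * pos ℓ)) ≤ pos 8 * pos p * z + pos 8 * pos p * (pos 8 * pos p * nr)) (sym e≡)
        (subst₂ (λ q y → N * (N * y) ≤ q * edges separated fine + q * (q * nr)) pos-Q (ℤ.pos-* 8 ℓ) (edges-≥ separated fine))
      eq : ∀ d p l N e r → d * (pos 8 * p * e + pos 8 * p * (pos 8 * p * r) - N * (N * (pos 8 * l))) + pos 8 * (N * N - pos 8 * (p * p) * d * r)
           ≡ pos 8 * (d * (p * e) + N * N) - pos 8 * (d * (l * (N * N)))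
      eq = solve 6 (λ d p l N e r → d :* (con (pos 8) :* p :* e :+ con (pos 8) :* p :* (con (pos 8) :* p :* r) :- N :* (N :* (con (pos 8) :* l))) :+ con (pos 8) :* (N :* N :- con (pos 8) :* (p :* p) :* d :* r) := con (pos 8) :* (d :* (p :* e) :+ N :* N) :- con (pos 8) :* (d :* (l :* (N :* N)))) refl

    d₃ : ℕ
    d₃ = 2 ℕ.* p ℕ.* d

    module Sp = Sparse (p ℕ.+ p) κ Λ n 4≤P wave

    rare-pairs : ∀ (x : V) → pos d₃ * ∑ (grid M k) (λ y → atMost C (D x y)) ≤ N
    rare-pairs = Sp.close-rare C r d₃ r-large rare
      where
      r-large : 1ℤ + pos 4 * C ≤ pos r * (pos n * pos n)
      r-large = ℤ.≤-trans (certify (≤⇒0≤ n²≥1) (eq (pos c₁) (pos n)))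
        (ℤ.≤-reflexive (cong (_* (pos n * pos n)) (sym (trans (cong pos r≡) (cong (1ℤ +_) (ℤ.pos-* 4 c₁))))))
        where
        eq : ∀ c n → n * n - 1ℤ ≡ (1ℤ + pos 4 * c) * (n * n) - (1ℤ + pos 4 * (c * (n * n)))
        eq = solve 2 (λ c n → n :* n :- con 1ℤ := (con 1ℤ :+ con (pos 4) :* c) :* (n :* n) :- (con 1ℤ :+ con (pos 4) :* (c :* (n :* n)))) refl

    closeness : ℤ
    closeness = ∑ (grid M k) (λ x → ∑ (grid M k) (λ y → bit (does (close? x y))))

    closeness-rare : pos d₃ * closeness ≤ pos p * (N * N)
    closeness-rare = ℤ.≤-trans (*-monoˡ (pos d₃) (0≤⁺ d₃) (∑∑-mono (grid M k) (grid M k) (λ x y → bit-any (λ t → D (sh (8 ℕ.* suc t) x) y ℤ.≤? C) (range (ℕ.pred p)))))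
      (ℤ.≤-trans (ℤ.≤-reflexive (trans (sym (∑-* (grid M k) (pos d₃) (λ x → ∑ (grid M k) (λ y → ∑ (range (ℕ.pred p)) (term x y)))))
          (∑-cong (grid M k) (λ x → trans (cong (pos d₃ *_) (∑-swap (grid M k) (range (ℕ.pred p)) (term x)))
            (sym (∑-* (range (ℕ.pred p)) (pos d₃) (λ t → ∑ (grid M k) (λ y → term x y t))))))))
        (ℤ.≤-trans (∑∑-mono (grid M k) (range (ℕ.pred p)) (λ x t → rare-pairs (sh (8 ℕ.* suc t) x)))
          (ℤ.≤-trans (ℤ.≤-reflexive (trans (∑-cong (grid M k) (λ _ → ∑-range-const (ℕ.pred p) N)) (∑-const (grid M k) (pos (ℕ.pred p) * N))))
            (certify (0≤* (≤⇒0≤ (+≤+ (ℕ.pred[n]≤n {p}))) (0≤* N≥0 N≥0)) (eq (pos p) (pos (ℕ.pred p)) N)))))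
      where
      N≥0 : 0ℤ ≤ N
      N≥0 = 0≤⁺ (length (grid M k))
      term : V → V → ℕ → ℤ
      term x y t = atMost C (D (sh (8 ℕ.* suc t) x) y)
      eq : ∀ p q N → (p - q) * (N * N) ≡ p * (N * N) - N * (q * N)
      eq = solve 3 (λ p q N → (p :- q) :* (N :* N) := p :* (N :* N) :- N :* (q :* N)) refl

    sparse : pos d * ∑ (grid M k) (λ x → ∑ (grid M k) (λ y → bit (link x y))) ≤ N * N
    sparse = ℤ.≤-trans (*-monoˡ (pos d) (0≤⁺ d) twice) (*-cancelˡ (pos p) (+≤+ 1≤p)
      (ℤ.≤-trans (ℤ.≤-reflexive (trans (eq (pos p) (pos d) closeness) (cong (_* closeness) (sym (trans (ℤ.pos-* (2 ℕ.* p) d) (cong (_* pos d) (ℤ.pos-* 2 p)))))))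
        closeness-rare))
      where
      eq : ∀ p d c → p * (d * (c + c)) ≡ pos 2 * p * d * c
      eq = solve-∀
      twice : ∑ (grid M k) (λ x → ∑ (grid M k) (λ y → bit (link x y))) ≤ closeness + closeness
      twice = ℤ.≤-trans (∑∑-mono (grid M k) (grid M k) (λ x y → bit-∨ (does (close? x y)) (does (close? y x))))
        (ℤ.≤-reflexive (trans (∑-cong (grid M k) (λ x → ∑-+ (grid M k) (λ y → bit (does (close? x y))) (λ y → bit (does (close? y x)))))
          (trans (∑-+ (grid M k) (λ x → ∑ (grid M k) (λ y → bit (does (close? x y)))) (λ x → ∑ (grid M k) (λ y → bit (does (close? y x)))))
            (cong (closeness +_) (∑-swap (grid M k) (grid M k) (λ x y → bit (does (close? y x))))))))

    Z : V → List V → V → ℤ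
    Z a as = Conc.Distance.Z a as

    M²-large : k ℕ.≤ M ℕ.* M
    M²-large = ℕ.≤-trans (ℕ.m≤n*m k Q) (ℕ.m≤m*n M M {{ℕ.>-nonZero Conc.M≥1}})

    -- Turning `u` by the difference of the angles brings it near the rotation of `x` that `v` is
    -- near. The two errors `B` and the factor 2 in `D-triangle` make `4 B`.
    between : ∀ (x u v : V) B i j → i ℕ.< j → D (sh (8 ℕ.* i) x) u ≤ B → D (sh (8 ℕ.* j) x) v ≤ B → D (sh (8 ℕ.* (j ℕ.∸ i)) u) v ≤ pos 4 * B
    between x u v B i j i<j du dv = ℤ.≤-trans (D-triangle (sh (8 ℕ.* t) u) y v)
        (certify (0≤* (0≤⁺ 2) (0≤+ (≤⇒0≤ first) (≤⇒0≤ dv))) (eq B (D (sh (8 ℕ.* t) u) y) (D y v)))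
      where
      t = j ℕ.∸ i
      y = sh (8 ℕ.* j) x
      turn : sh (8 ℕ.* t) (sh (8 ℕ.* i) x) ≡ y
      turn = trans (sh-+ (8 ℕ.* t) (8 ℕ.* i) x) (cong (λ r → sh r x) (trans (sym (ℕ.*-distribˡ-+ 8 i t)) (cong (8 ℕ.*_) (ℕ.m+[n∸m]≡n (ℕ.<⇒≤ i<j)))))
      first : D (sh (8 ℕ.* t) u) y ≤ B
      first = ℤ.≤-trans (ℤ.≤-reflexive (trans (cong (D (sh (8 ℕ.* t) u)) (sym turn))
        (trans (D-sh (8 ℕ.* t) u (sh (8 ℕ.* i) x)) (D-sym u (sh (8 ℕ.* i) x))))) du
      eq : ∀ C a b → pos 2 * (C - a + (C - b)) ≡ pos 4 * C - pos 2 * (a + b)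
      eq = solve 3 (λ C a b → con (pos 2) :* (C :- a :+ (C :- b)) := con (pos 4) :* C :- con (pos 2) :* (a :+ b)) refl

    find-clique : ∀ a as → N ≤ pos d * ∑ (grid M k) (Z a as) →
                  ∃ λ (c : Fin p → V) → (∀ j → c j ∈ a ∷ as) × (∀ i j → i ≢ j → link (c i) (c j) ≡ true)
    find-clique a as dense = c , (λ j → near∈ (sh (8 ℕ.* toℕ j) x)) , linked
      where
      open Conc.Distance a as using (rotations) renaming (nearest to near; nearest∈ to near∈)
      found = rotations d p 8 1≤d M²-large dense
      x = proj₁ found
      c : Fin p → V
      c j = near (sh (8 ℕ.* toℕ j) x)
      C₀ : ℤ
      C₀ = pos p * (pos 64 * (pos d * (pos M * pos M)))
      C₀≡ : pos 4 * C₀ ≡ C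
      C₀≡ = rescale 4 64 8 p d n c₀ {pos M} c₀≡ (trans (ℤ.pos-* Q n) (cong (_* pos n) pos-Q))
      c-close : ∀ j → D (sh (8 ℕ.* toℕ j) x) (c j) ≤ C₀
      c-close j = proj₂ found (toℕ j) (Fin.toℕ<n j)
      ordered : ∀ i j → toℕ i ℕ.< toℕ j → link (c i) (c j) ≡ true
      ordered i j i<j = close⇒link (c i) (c j) (toℕ j ℕ.∸ toℕ i) (ℕ.m<n⇒0<n∸m i<j) (ℕ.≤-<-trans (ℕ.m∸n≤m (toℕ j) (toℕ i)) (Fin.toℕ<n j))
        (subst (D (sh (8 ℕ.* (toℕ j ℕ.∸ toℕ i)) (c i)) (c j) ≤_) C₀≡ (between x (c i) (c j) C₀ (toℕ i) (toℕ j) i<j (c-close i) (c-close j)))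
      linked : ∀ i j → i ≢ j → link (c i) (c j) ≡ true
      linked i j i≢j = go (ℕ.<-cmp (toℕ i) (toℕ j))
        where
        go : Tri (toℕ i ℕ.< toℕ j) (toℕ i ≡ toℕ j) (toℕ j ℕ.< toℕ i) → link (c i) (c j) ≡ true
        go (tri< i<j _ _) = ordered i j i<j
        go (tri≈ _ eq _)  = ⊥-elim (i≢j (Fin.toℕ-injective eq))
        go (tri> _ _ j<i) = trans (link-sym (c i) (c j)) (ordered j i j<i)

    template : Template p ℓ d
    template = record
      { M = M ; k = k ; 1≤M = Conc.M≥1
      ; link = link ; link-sym = link-sym ; link-irrefl = link-irrefl ; cross = crossᵇ
      ; Z = Z ; Z≥0 = λ a as x → indicator≥0 (Conc.Distance.h a as x ℤ.≟ 0ℤ)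
      ; Z-member = λ a as {x} m → indicator-yes (Conc.Distance.h a as x ℤ.≟ 0ℤ) (Conc.Distance.h-member a as m)
      ; find-clique = find-clique ; sparse = sparse ; dense≤ = dense≤ ; dense≥ = dense≥
      ; clique-free = λ A B x z sum lx lz cr → no-clique 1≤Λ 2≤C separated fine A B x z sum
          (λ a b a≢b → link⇒linked (x a) (x b) (lx a b a≢b)) (λ a b a≢b → link⇒linked (z a) (z b) (lz a b a≢b))
          (λ a b → cross-true (x a) (z b) (cr a b)) }

  -- Abstract, so that the dimension stays an opaque number and is not evaluated during type
  -- checking.
  abstract
    above : ∀ a b (z : ℤ) → ∃ λ k → (a ℕ.≤ k) × (b ℕ.≤ k) × (z ≤ pos k)
    above a b z = a ℕ.+ (b ℕ.+ ∣ z ∣) , ℕ.m≤m+n a (b ℕ.+ ∣ z ∣) , ℕ.≤-trans (ℕ.m≤m+n b ∣ z ∣) (ℕ.m≤n+m (b ℕ.+ ∣ z ∣) a)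
      , ℤ.≤-trans (≤abs z) (+≤+ (ℕ.≤-trans (ℕ.m≤n+m ∣ z ∣ b) (ℕ.m≤n+m (b ℕ.+ ∣ z ∣) a)))

  template : ∀ p ℓ d → 1 ℕ.≤ ℓ → ℓ ℕ.+ ℓ ℕ.≤ p → 1 ℕ.≤ d → Template p ℓ d
  template p ℓ d 1≤ℓ 2ℓ≤p 1≤d = Build.template p ℓ d k Λ {{ℕ.>-nonZero (ℕ.≤-trans (ℕ.s≤s ℕ.z≤n) (proj₁ (proj₂ large)))}} 4≤P 1≤ℓ 2ℓ≤p 1≤d κ
      (sine (p ℕ.+ p) Λ (ℕ.≤-trans (ℕ.s≤s (ℕ.s≤s ℕ.z≤n)) 4≤P) (ℕ.s≤s ℕ.z≤n)) (ℕ.s≤s ℕ.z≤n)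
      c₀ refl (proj₁ (proj₂ large)) W refl d₂ refl (proj₁ (proj₂ (proj₂ large))) r refl (proj₂ (proj₂ (proj₂ large))) ℕ.≤-refl
    where
    4≤P : 4 ℕ.≤ p ℕ.+ p
    4≤P = ℕ.+-mono-≤ (ℕ.≤-trans (ℕ.+-mono-≤ 1≤ℓ 1≤ℓ) 2ℓ≤p) (ℕ.≤-trans (ℕ.+-mono-≤ 1≤ℓ 1≤ℓ) 2ℓ≤p)
    κ c₀ W d₂ r L k Λ : ℕ
    κ = 4 ℕ.* (p ℕ.+ p)
    c₀ = p ℕ.* (64 ℕ.* (d ℕ.* ((8 ℕ.* p) ℕ.* (8 ℕ.* p))))
    W = 1 ℕ.+ 2 ℕ.* (κ ℕ.* (4 ℕ.* c₀))
    d₂ = 8 ℕ.* (p ℕ.* p) ℕ.* d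
    r = 1 ℕ.+ 4 ℕ.* (4 ℕ.* c₀)
    L = 2 ℕ.* (W ℕ.* d₂)
    large = above (1 ℕ.+ 10 ℕ.* (4 ℕ.* c₀)) ((2 ℕ.* (L ℕ.* L)) ℕ.* (2 ℕ.* (L ℕ.* L))) (pos 3 * (pos (2 ℕ.* p ℕ.* d) * pow (pos 2) r))
    k = proj₁ large
    Λ = 1 ℕ.+ 3 ℕ.* (k ℕ.* (k ℕ.* (k ℕ.* (κ ℕ.* κ))))

-- Blowing up a template to a graph

module BlowUp where

  open Prelude
  open Sums
  open Grid
  open Rotation using (≤⊎>; 1≤⇒0≤)
  open Concentrate using (1≤size)
  open Templates
  open import Defs
  open import Data.Bool using (if_then_else_)
  open import Data.Fin using (_↑ˡ_; _↑ʳ_; splitAt)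
  open import Data.Fin.Subset using (Subset)
  open import Data.List using (map; filter; allFin)
  open import Data.List.Membership.Propositional.Properties using (∈-map⁺; ∈-map⁻; ∈-filter⁺; ∈-filter⁻; ∈-allFin)

  ∑-range-mono : ∀ {m n} (f : ℕ → ℤ) → (∀ i → 0ℤ ≤ f i) → m ℕ.≤ n → ∑ (range m) f ≤ ∑ (range n) f
  ∑-range-mono {m} {n} f f≥0 m≤n = ℤ.≤-trans
    (certify (∑-0≤ (range (n ℕ.∸ m)) (λ i → f≥0 (m ℕ.+ i))) (eq (∑ (range m) f) (∑ (range (n ℕ.∸ m)) (λ i → f (m ℕ.+ i)))))
    (ℤ.≤-reflexive (trans (sym (∑-range-+ m (n ℕ.∸ m) f)) (cong (λ l → ∑ (range l) f) (ℕ.m+[n∸m]≡n m≤n))))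
    where
    eq : ∀ a b → b ≡ a + b - a
    eq = solve-∀

  ∑-range-* : ∀ M m (f : ℕ → ℤ) → ∑ (range (m ℕ.* M)) f ≡ ∑ (range m) (λ j → ∑ (range M) (λ u → f (u ℕ.+ j ℕ.* M)))
  ∑-range-* M zero    f = refl
  ∑-range-* M (suc m) f = trans (cong (λ l → ∑ (range l) f) (ℕ.+-comm M (m ℕ.* M)))
    (trans (∑-range-+ (m ℕ.* M) M f) (trans (ℤ.+-comm (∑ (range (m ℕ.* M)) f) _)
      (cong₂ _+_ (∑-cong (range M) (λ u → cong f (ℕ.+-comm (m ℕ.* M) u))) (∑-range-* M m f))))

  ∑-periods : ∀ M m {f : ℕ → ℤ} → Periodic M f → ∑ (range (m ℕ.* M)) f ≡ pos m * ∑ (range M) f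
  ∑-periods M m {f} per = trans (∑-range-* M m f) (trans (∑-cong (range m) (λ j → ∑-cong (range M) (λ u → many j u))) (∑-range-const m (∑ (range M) f)))
    where
    many : ∀ j u → f (u ℕ.+ j ℕ.* M) ≡ f u
    many zero    u = cong f (ℕ.+-identityʳ u)
    many (suc j) u = trans (cong f (eq u M (j ℕ.* M))) (trans (per (u ℕ.+ j ℕ.* M)) (many j u))
      where
      eq : ∀ u M x → u ℕ.+ (M ℕ.+ x) ≡ u ℕ.+ x ℕ.+ M
      eq = ℕSolver.solve-∀

  module Digits (M : ℕ) .{{_ : ℕ.NonZero M}} where

    -- Vertex number `i` is placed at the grid point given by the last `k` digits of `i` in base
    -- `M`, so any `M^k` consecutive vertices meet every grid point once.
    digits : ∀ k → ℕ → Vec ℕ k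
    digits zero    i = []
    digits (suc k) i = (i ℕ.% M) ∷ digits k (i ℕ./ M)

    total : ℕ → ℕ
    total zero    = 1
    total (suc k) = total k ℕ.* M

    total-size : ∀ k → pos (total k) ≡ size M k
    total-size zero    = refl
    total-size (suc k) = trans (ℤ.pos-* (total k) M) (trans (ℤ.*-comm (pos (total k)) (pos M)) (trans (cong (pos M *_) (total-size k)) (sym (size-suc M k))))

    /-+* : ∀ u j → (u ℕ.+ j ℕ.* M) ℕ./ M ≡ u ℕ./ M ℕ.+ j
    /-+* u zero    = trans (cong (ℕ._/ M) (ℕ.+-identityʳ u)) (sym (ℕ.+-identityʳ (u ℕ./ M)))
    /-+* u (suc j) = trans (cong (ℕ._/ M) (eq u M (j ℕ.* M)))
      (trans (ℕ.m/n≡1+[m∸n]/n (ℕ.m≤n+m M (u ℕ.+ j ℕ.* M)))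
        (trans (cong (λ z → suc (z ℕ./ M)) (ℕ.m+n∸n≡m (u ℕ.+ j ℕ.* M) M)) (trans (cong suc (/-+* u j)) (sym (ℕ.+-suc (u ℕ./ M) j)))))
      where
      eq : ∀ u M x → u ℕ.+ (M ℕ.+ x) ≡ u ℕ.+ x ℕ.+ M
      eq = ℕSolver.solve-∀

    digits-periodic : ∀ k → Periodic (total k) (digits k)
    digits-periodic zero    i = refl
    digits-periodic (suc k) i = cong₂ _∷_ (ℕ.[m+kn]%n≡m%n i (total k) M)
      (trans (cong (digits k) (/-+* i (total k))) (digits-periodic k (i ℕ./ M)))

    ∑-digits : ∀ k (F : Vec ℕ k → ℤ) → ∑ (range (total k)) (F ∘ digits k) ≡ ∑ (grid M k) F
    ∑-digits zero    F = refl
    ∑-digits (suc k) F = trans (∑-range-* M (total k) (F ∘ digits (suc k)))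
      (trans (∑-cong (range (total k)) (λ j → ∑-cong∈ (range M) (λ u u∈ → cong F (cong₂ _∷_
          (trans (ℕ.[m+kn]%n≡m%n u j M) (ℕ.m<n⇒m%n≡m (∈-range⁻ u∈)))
          (cong (digits k) (trans (/-+* u j) (cong (ℕ._+ j) (ℕ.m<n⇒m/n≡0 (∈-range⁻ u∈)))))))))
        (trans (∑-swap (range (total k)) (range M) (λ j u → F (u ∷ digits k j)))
          (trans (∑-cong (range M) (λ u → ∑-digits k (λ v → F (u ∷ v)))) (sym (∑-grid M F)))))

    -- As `F` is nonnegative, `n` may be rounded up to a multiple of the grid size. Only upper
    -- bounds arise in this way; lower bounds are obtained later from complements.
    sample-≤ : ∀ k n (F : Vec ℕ k → ℤ) → (∀ x → 0ℤ ≤ F x) →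
      size M k * ∑ (range n) (F ∘ digits k) ≤ (pos n + size M k) * ∑ (grid M k) F
    sample-≤ k n F F≥0 = ℤ.≤-trans (*-monoˡ (size M k) (0≤⁺ (length (grid M k)))
        (ℤ.≤-trans (∑-range-mono (F ∘ digits k) (λ i → F≥0 (digits k i)) n≤)
          (ℤ.≤-reflexive (trans (∑-periods T q (λ i → cong F (digits-periodic k i))) (cong (pos q *_) (∑-digits k F))))))
      (ℤ.≤-trans (ℤ.≤-reflexive (eq (size M k) (pos q) G)) (certify (0≤* (≤⇒0≤ q≤) (∑-0≤ (grid M k) F≥0)) (eq′ (pos n + size M k) (pos q * size M k) G)))
      where
      T = total k
      T≥1 : 1 ℕ.≤ T
      T≥1 = ℤ.drop‿+≤+ (ℤ.≤-trans (1≤size M (ℕ.>-nonZero⁻¹ M) k) (ℤ.≤-reflexive (sym (total-size k))))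
      instance
        T≢0 : ℕ.NonZero T
        T≢0 = ℕ.>-nonZero T≥1
      q = suc (n ℕ./ T)
      G = ∑ (grid M k) F
      n≤ : n ℕ.≤ q ℕ.* T
      n≤ = ℕ.≤-trans (ℕ.≤-reflexive (ℕ.m≡m%n+[m/n]*n n T)) (ℕ.+-monoˡ-≤ (n ℕ./ T ℕ.* T) (ℕ.<⇒≤ (ℕ.m%n<n n T)))
      q≤ : pos q * size M k ≤ pos n + size M k
      q≤ = ℤ.≤-trans (ℤ.≤-reflexive (trans (cong (pos q *_) (sym (total-size k))) (sym (ℤ.pos-* q T))))
        (ℤ.≤-trans (+≤+ (ℕ.≤-trans (ℕ.+-monoʳ-≤ T (ℕ.m/n*n≤m n T)) (ℕ.≤-reflexive (ℕ.+-comm T n))))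
          (ℤ.≤-reflexive (trans (ℤ.pos-+ n T) (cong (pos n +_) (total-size k)))))
      eq : ∀ s q g → s * (q * g) ≡ q * s * g
      eq = solve-∀
      eq′ : ∀ a b g → (a - b) * g ≡ a * g - b * g
      eq′ = solve-∀

    sample₂-≤ : ∀ k n₁ n₂ (F : Vec ℕ k → Vec ℕ k → ℤ) → (∀ x y → 0ℤ ≤ F x y) →
      size M k * size M k * ∑ (range n₁) (λ i → ∑ (range n₂) (λ j → F (digits k i) (digits k j)))
      ≤ (pos n₁ + size M k) * (pos n₂ + size M k) * ∑ (grid M k) (λ x → ∑ (grid M k) (F x))
    sample₂-≤ k n₁ n₂ F F≥0 = ℤ.≤-trans (ℤ.≤-reflexive (ℤ.*-assoc N N (∑ (range n₁) (λ i → inner (digits k i)))))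
      (ℤ.≤-trans (*-monoˡ N (0≤⁺ (length (grid M k))) (sample-≤ k n₁ inner (λ x → ∑-0≤ (range n₂) (λ j → F≥0 x (digits k j)))))
        (ℤ.≤-trans (ℤ.≤-reflexive (trans (eq N (pos n₁ + N) (∑ (grid M k) inner)) (cong ((pos n₁ + N) *_) (sym (∑-* (grid M k) N inner)))))
          (ℤ.≤-trans (*-monoˡ (pos n₁ + N) (0≤+ (0≤⁺ n₁) (0≤⁺ (length (grid M k)))) (∑-mono (grid M k) (λ x → sample-≤ k n₂ (F x) (F≥0 x))))
            (ℤ.≤-reflexive (trans (cong ((pos n₁ + N) *_) (∑-* (grid M k) (pos n₂ + N) (λ x → ∑ (grid M k) (F x)))) (sym (ℤ.*-assoc (pos n₁ + N) (pos n₂ + N) _)))))))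
      where
      N = size M k
      inner : Vec ℕ k → ℤ
      inner x = ∑ (range n₂) (λ j → F x (digits k j))
      eq : ∀ a b c → a * (b * c) ≡ b * (a * c)
      eq = solve-∀

  ∑-allFin-suc : ∀ n (f : Fin (suc n) → ℤ) → ∑ (allFin (suc n)) f ≡ f zero + ∑ (allFin n) (f ∘ suc)
  ∑-allFin-suc n f = cong (f zero +_) (trans (cong (λ xs → ∑ xs f) (sym (List.map-tabulate (λ i → i) suc))) (∑-map suc (allFin n) f))

  ∑-allFin-range : ∀ n (f : ℕ → ℤ) → ∑ (allFin n) (f ∘ toℕ) ≡ ∑ (range n) f
  ∑-allFin-range zero    f = refl
  ∑-allFin-range (suc n) f = trans (∑-allFin-suc n (f ∘ toℕ)) (trans (cong (f 0 +_) (∑-allFin-range n (f ∘ suc))) (∑-range-suc n f))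

  ∑-allFin-+ : ∀ m n (f : Fin (m ℕ.+ n) → ℤ) → ∑ (allFin (m ℕ.+ n)) f ≡ ∑ (allFin m) (λ i → f (i ↑ˡ n)) + ∑ (allFin n) (λ j → f (m ↑ʳ j))
  ∑-allFin-+ zero    n f = sym (ℤ.+-identityˡ _)
  ∑-allFin-+ (suc m) n f = trans (∑-allFin-suc (m ℕ.+ n) f) (trans (cong (f zero +_) (∑-allFin-+ m n (f ∘ suc)))
    (trans (sym (ℤ.+-assoc (f zero) _ _)) (cong (_+ ∑ (allFin n) (λ j → f (suc m ↑ʳ j))) (sym (∑-allFin-suc m (λ i → f (i ↑ˡ n)))))))

  pos-sum : ∀ {A : Set} (f : A → ℕ) xs → pos (ℕ.sum (map f xs)) ≡ ∑ xs (λ x → pos (f x))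
  pos-sum f []       = refl
  pos-sum f (x ∷ xs) = trans (ℤ.pos-+ (f x) (ℕ.sum (map f xs))) (cong (pos (f x) +_) (pos-sum f xs))

  pos-b2n : ∀ b → pos (b2n b) ≡ bit b
  pos-b2n true  = refl
  pos-b2n false = refl

  pos-∣∣ : ∀ {n} (U : Subset n) → pos Subset.∣ U ∣ ≡ ∑ (allFin n) (λ i → bit (lookup U i))
  pos-∣∣ []          = refl
  pos-∣∣ {suc n} (true  ∷ U) = trans (cong (1ℤ +_) (pos-∣∣ U)) (sym (∑-allFin-suc n (λ i → bit (lookup (true ∷ U) i))))
  pos-∣∣ {suc n} (false ∷ U) = trans (trans (pos-∣∣ U) (sym (ℤ.+-identityˡ _))) (sym (∑-allFin-suc n (λ i → bit (lookup (false ∷ U) i))))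

  -- A family sorted by class. The original positions are kept, so that distinct members of a clique
  -- stay distinct.
  record Split {A B : Set} (q : ℕ) (f : Fin q → A ⊎ B) : Set where
    field
      a b    : ℕ
      a+b    : a ℕ.+ b ≡ q
      left   : Fin a → Fin q
      right  : Fin b → Fin q
      left-injective  : ∀ i j → i ≢ j → left i ≢ left j
      right-injective : ∀ i j → i ≢ j → right i ≢ right j
      x      : Fin a → A
      y      : Fin b → B
      f-left  : ∀ i → f (left i) ≡ inj₁ (x i)
      f-right : ∀ i → f (right i) ≡ inj₂ (y i)

  split : ∀ {A B : Set} q (f : Fin q → A ⊎ B) → Split q f
  split zero    f = record { a = 0 ; b = 0 ; a+b = refl ; left = λ () ; right = λ () ; left-injective = λ () ; right-injective = λ ()
                           ; x = λ () ; y = λ () ; f-left = λ () ; f-right = λ () }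
  split {A} {B} (suc q) f = go (f zero) refl
    where
    open Split (split q (f ∘ suc))
    extend : ∀ {m} → (Fin m → Fin q) → Fin (suc m) → Fin (suc q)
    extend h zero    = zero
    extend h (suc i) = suc (h i)
    extend-injective : ∀ {m} (h : Fin m → Fin q) → (∀ i j → i ≢ j → h i ≢ h j) → ∀ i j → i ≢ j → extend h i ≢ extend h j
    extend-injective h inj zero    zero    ne _ = ne refl
    extend-injective h inj (suc i) (suc j) ne e = inj i j (λ { refl → ne refl }) (Fin.suc-injective e)
    cons : ∀ {C : Set} {m} → C → (Fin m → C) → Fin (suc m) → C
    cons c h zero    = c
    cons c h (suc i) = h i
    go : ∀ z → f zero ≡ z → Split (suc q) f
    go (inj₁ u) e = record
      { a = suc a ; b = b ; a+b = cong suc a+b ; left = extend left ; right = suc ∘ right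
      ; left-injective = extend-injective left left-injective ; right-injective = λ i j ne eq → right-injective i j ne (Fin.suc-injective eq)
      ; x = cons u x ; y = y ; f-left = λ { zero → e ; (suc i) → f-left i } ; f-right = f-right }
    go (inj₂ v) e = record
      { a = a ; b = suc b ; a+b = trans (ℕ.+-suc a b) (cong suc a+b) ; left = suc ∘ left ; right = extend right
      ; left-injective = λ i j ne eq → left-injective i j ne (Fin.suc-injective eq) ; right-injective = extend-injective right right-injective
      ; x = x ; y = cons v y ; f-left = f-left ; f-right = λ { zero → e ; (suc i) → f-right i } }

  module BlownUp {p ℓ d : ℕ} (T : Template p ℓ d) (cross′ : Template.V T → Template.V T → Bool) (n₁ n₂ : ℕ) where

    open Template T

    instance
      M≢0 : ℕ.NonZero M
      M≢0 = ℕ.>-nonZero 1≤M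

    open Digits M

    vertex : ∀ {n} → Fin n → V
    vertex i = digits k (toℕ i)

    side : Fin n₁ ⊎ Fin n₂ → Fin n₁ ⊎ Fin n₂ → Bool
    side (inj₁ i) (inj₁ j) = link (vertex i) (vertex j)
    side (inj₁ i) (inj₂ j) = cross′ (vertex i) (vertex j)
    side (inj₂ i) (inj₁ j) = cross′ (vertex j) (vertex i)
    side (inj₂ i) (inj₂ j) = link (vertex i) (vertex j)

    side-sym : ∀ u v → side u v ≡ side v u
    side-sym (inj₁ i) (inj₁ j) = link-sym (vertex i) (vertex j)
    side-sym (inj₁ i) (inj₂ j) = refl
    side-sym (inj₂ i) (inj₁ j) = refl
    side-sym (inj₂ i) (inj₂ j) = link-sym (vertex i) (vertex j)

    side-irrefl : ∀ u → side u u ≡ false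
    side-irrefl (inj₁ i) = link-irrefl (vertex i)
    side-irrefl (inj₂ i) = link-irrefl (vertex i)

    G : Graph (n₁ ℕ.+ n₂)
    G = record { adj = λ u v → side (splitAt n₁ u) (splitAt n₁ v)
               ; symm = λ u v → side-sym (splitAt n₁ u) (splitAt n₁ v)
               ; irrefl = λ u → side-irrefl (splitAt n₁ u) }

    adj-WW : ∀ i j → adj G (i ↑ˡ n₂) (j ↑ˡ n₂) ≡ link (vertex i) (vertex j)
    adj-WW i j = cong₂ side (Fin.splitAt-↑ˡ n₁ i n₂) (Fin.splitAt-↑ˡ n₁ j n₂)

    adj-ZZ : ∀ i j → adj G (n₁ ↑ʳ i) (n₁ ↑ʳ j) ≡ link (vertex i) (vertex j)
    adj-ZZ i j = cong₂ side (Fin.splitAt-↑ʳ n₁ n₂ i) (Fin.splitAt-↑ʳ n₁ n₂ j)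

    adj-WZ : ∀ i j → adj G (i ↑ˡ n₂) (n₁ ↑ʳ j) ≡ cross′ (vertex i) (vertex j)
    adj-WZ i j = cong₂ side (Fin.splitAt-↑ˡ n₁ i n₂) (Fin.splitAt-↑ʳ n₁ n₂ j)

    k-free : (∀ x z → cross′ x z ≡ cross x z) → KFree (p ℕ.+ ℓ ℕ.+ 1) G
    k-free same (f , _ , adjacent) = clique-free (Split.a S) (Split.b S) (λ i → vertex (Split.x S i)) (λ i → vertex (Split.y S i)) (Split.a+b S)
      (λ i j ne → trans (sym (cong₂ side (Split.f-left S i) (Split.f-left S j))) (adjacent _ _ (Split.left-injective S i j ne)))
      (λ i j ne → trans (sym (cong₂ side (Split.f-right S i) (Split.f-right S j))) (adjacent _ _ (Split.right-injective S i j ne)))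
      (λ i j → trans (sym (same _ _)) (trans (sym (cong₂ side (Split.f-left S i) (Split.f-right S j)))
        (adjacent _ _ (λ e → distinct (trans (sym (Split.f-left S i)) (trans (cong (splitAt n₁ ∘ f) e) (Split.f-right S j)))))))
      where
      S = split (p ℕ.+ ℓ ℕ.+ 1) (splitAt n₁ ∘ f)
      distinct : ∀ {i j} → inj₁ i ≡ inj₂ j → ⊥
      distinct ()

    links : ℕ → ℤ
    links n = ∑ (range n) (λ i → ∑ (range n) (λ j → bit (link (digits k i) (digits k j))))

    within-≤ : ∀ n (v : Fin n → Fin (n₁ ℕ.+ n₂)) → (∀ i j → adj G (v i) (v j) ≡ link (vertex i) (vertex j)) →
               pos (edgesWithin G n v) ≤ links n
    within-≤ n v e = ℤ.≤-trans (ℤ.≤-reflexive (trans (pos-sum _ (allFin n)) (∑-cong (allFin n) (λ i → pos-sum _ (allFin n)))))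
      (ℤ.≤-trans (∑-mono (allFin n) (λ i → ∑-mono (allFin n) (λ j → bound i j (does (i Fin.<? j)))))
        (ℤ.≤-reflexive (trans (∑-cong (allFin n) (λ i → ∑-allFin-range n (λ j → bit (link (vertex i) (digits k j)))))
          (∑-allFin-range n (λ i → ∑ (range n) (λ j → bit (link (digits k i) (digits k j))))))))
      where
      bound : ∀ i j b → pos (if b then b2n (adj G (v i) (v j)) else 0) ≤ bit (link (vertex i) (vertex j))
      bound i j true  = ℤ.≤-reflexive (trans (pos-b2n (adj G (v i) (v j))) (cong bit (e i j)))
      bound i j false = bit≥0 (link (vertex i) (vertex j))

    crossings : ℤ
    crossings = ∑ (range n₁) (λ i → ∑ (range n₂) (λ j → bit (cross′ (digits k i) (digits k j))))

    between-≡ : pos (edgesBetween G n₁ n₂ (λ i → i ↑ˡ n₂) (λ j → n₁ ↑ʳ j)) ≡ crossings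
    between-≡ = trans (pos-sum _ (allFin n₁)) (trans (∑-cong (allFin n₁) (λ i → trans (pos-sum _ (allFin n₂))
        (trans (∑-cong (allFin n₂) (λ j → trans (pos-b2n _) (cong bit (adj-WZ i j)))) (∑-allFin-range n₂ (λ j → bit (cross′ (vertex i) (digits k j)))))))
      (∑-allFin-range n₁ (λ i → ∑ (range n₂) (λ j → bit (cross′ (digits k i) (digits k j))))))

    -- In `Fin (n₁ + n₂)` the first class precedes the second, so each crossing pair occurs in
    -- increasing order, as `edges` counts it.
    crossings≤edges : crossings ≤ pos (edges G)
    crossings≤edges = ℤ.≤-trans (ℤ.≤-reflexive (sym between-≡)) (ℤ.≤-trans
      (ℤ.≤-reflexive (trans (pos-sum _ (allFin n₁)) (∑-cong (allFin n₁) (λ i → pos-sum _ (allFin n₂)))))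
      (ℤ.≤-trans (∑-mono (allFin n₁) (λ i → ℤ.≤-trans (∑-mono (allFin n₂) (λ j → ℤ.≤-reflexive (cong pos (sym (ordered i j)))))
          (ℤ.≤-trans (certify (∑-0≤ (allFin n₁) (λ j → 0≤⁺ (pair (i ↑ˡ n₂) (j ↑ˡ n₂)))) (eq (∑ (allFin n₂) (λ j → pos (pair (i ↑ˡ n₂) (n₁ ↑ʳ j)))) (∑ (allFin n₁) (λ j → pos (pair (i ↑ˡ n₂) (j ↑ˡ n₂))))))
            (ℤ.≤-reflexive (sym (∑-allFin-+ n₁ n₂ (λ v → pos (pair (i ↑ˡ n₂) v))))))))
        (ℤ.≤-trans (certify (∑-0≤ (allFin n₂) (λ i → ∑-0≤ (allFin (n₁ ℕ.+ n₂)) (λ v → 0≤⁺ (pair (n₁ ↑ʳ i) v))))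
            (eq′ (∑ (allFin n₁) (λ i → row (i ↑ˡ n₂))) (∑ (allFin n₂) (λ i → row (n₁ ↑ʳ i)))))
          (ℤ.≤-reflexive (trans (sym (∑-allFin-+ n₁ n₂ row)) (sym (trans (pos-sum _ (allFin (n₁ ℕ.+ n₂))) (∑-cong (allFin (n₁ ℕ.+ n₂)) (λ u → pos-sum _ (allFin (n₁ ℕ.+ n₂)))))))))))
      where
      pair : Fin (n₁ ℕ.+ n₂) → Fin (n₁ ℕ.+ n₂) → ℕ
      pair u v = if does (u Fin.<? v) then b2n (adj G u v) else 0
      row : Fin (n₁ ℕ.+ n₂) → ℤ
      row u = ∑ (allFin (n₁ ℕ.+ n₂)) (λ v → pos (pair u v))
      ordered : ∀ i j → pair (i ↑ˡ n₂) (n₁ ↑ʳ j) ≡ b2n (adj G (i ↑ˡ n₂) (n₁ ↑ʳ j))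
      ordered i j = cong (λ b → if b then b2n (adj G (i ↑ˡ n₂) (n₁ ↑ʳ j)) else 0)
        (⇒does ((i ↑ˡ n₂) Fin.<? (n₁ ↑ʳ j)) (subst₂ ℕ._<_ (sym (Fin.toℕ-↑ˡ i n₂)) (sym (Fin.toℕ-↑ʳ n₁ j)) (ℕ.≤-trans (Fin.toℕ<n i) (ℕ.m≤m+n n₁ (toℕ j)))))
      eq : ∀ a b → b ≡ b + a - a
      eq = solve-∀
      eq′ : ∀ a b → b ≡ a + b - a
      eq′ = solve-∀

    -- If the zero set of the distance to the grid points under `U` has density at least `1 / d`,
    -- the template gives a clique among those points. Vertices of `U` chosen over them form a
    -- `K_p`; they are distinct because adjacent vertices of a loopless graph are. Otherwise the
    -- density is below `1 / d = 1 / 2d′`, and sampling loses at most a factor 2 since `N ≤ n`.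
    part-bound : ∀ (d′ : ℕ) → d ≡ 2 ℕ.* d′ → ∀ n → N ≤ pos n → (v : Fin n → Fin (n₁ ℕ.+ n₂)) →
      (∀ i j → adj G (v i) (v j) ≡ link (vertex i) (vertex j)) → (U : Subset (n₁ ℕ.+ n₂)) → KFreeSet p G U →
      pos d′ * ∑ (allFin n) (λ i → bit (lookup U (v i))) ≤ pos n
    part-bound d′ d≡ n N≤n v e U free = go members refl
      where
      chosen : ∀ i → Dec (lookup U (v i) ≡ true)
      chosen i = lookup U (v i) Bool.≟ true
      members : List V
      members = map vertex (filter chosen (allFin n))
      member⁺ : ∀ i → lookup U (v i) ≡ true → vertex i ∈ members
      member⁺ i t = ∈-map⁺ vertex (∈-filter⁺ chosen (∈-allFin i) t)
      member⁻ : ∀ {x} → x ∈ members → ∃ λ i → (lookup U (v i) ≡ true) × (x ≡ vertex i)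
      member⁻ m = unpack (∈-map⁻ vertex m)
        where
        unpack : ∀ {x} → (∃ λ i → (i ∈ filter chosen (allFin n)) × (x ≡ vertex i)) → ∃ λ i → (lookup U (v i) ≡ true) × (x ≡ vertex i)
        unpack (i , i∈ , q) = i , proj₂ (∈-filter⁻ chosen {xs = allFin n} i∈) , q
      size-U : ℤ
      size-U = ∑ (allFin n) (λ i → bit (lookup U (v i)))
      no-clique : ∀ a as → a ∷ as ≡ members → (∃ λ (c : Fin p → V) → (∀ j → c j ∈ a ∷ as) × (∀ i j → i ≢ j → link (c i) (c j) ≡ true)) → ⊥
      no-clique a as q (c , c∈ , c-link) = free (f , ((λ {i} {j} → f-injective i j) , f-adj) , λ j → Vec.lookup⇒[]= (f j) U (proj₁ (proj₂ (at j))))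
        where
        at : ∀ j → ∃ λ i → (lookup U (v i) ≡ true) × (c j ≡ vertex i)
        at j = member⁻ (subst (c j ∈_) q (c∈ j))
        f : Fin p → Fin (n₁ ℕ.+ n₂)
        f j = v (proj₁ (at j))
        f-adj : ∀ i j → i ≢ j → adj G (f i) (f j) ≡ true
        f-adj i j ne = trans (e (proj₁ (at i)) (proj₁ (at j))) (trans (sym (cong₂ link (proj₂ (proj₂ (at i))) (proj₂ (proj₂ (at j))))) (c-link i j ne))
        f-injective : ∀ i j → f i ≡ f j → i ≡ j
        f-injective i j q = decide (i Fin.≟ j)
          where
          decide : Dec (i ≡ j) → i ≡ j
          decide (yes r) = r
          decide (no ne) = ⊥-elim (true≢false (trans (sym (f-adj i j ne)) (trans (cong (adj G (f i)) (sym q)) (irrefl G (f i)))))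
            where
            true≢false : true ≡ false → ⊥
            true≢false ()
      go : ∀ xs → xs ≡ members → pos d′ * size-U ≤ pos n
      go [] q = ℤ.≤-trans (ℤ.≤-reflexive (trans (cong (pos d′ *_) (trans (∑-cong (allFin n) none) (∑-0 (allFin n)))) (ℤ.*-zeroʳ (pos d′)))) (0≤⁺ n)
        where
        none : ∀ i → bit (lookup U (v i)) ≡ 0ℤ
        none i = by (lookup U (v i)) refl
          where
          by : ∀ b → lookup U (v i) ≡ b → bit (lookup U (v i)) ≡ 0ℤ
          by false t = cong bit t
          by true  t = ⊥-elim (empty (subst (vertex i ∈_) (sym q) (member⁺ i t)))
            where
            empty : ∀ {x : V} → x ∈ [] → ⊥
            empty ()
      go (a ∷ as) q = [ (λ dense → ⊥-elim (no-clique a as q (find-clique a as dense))) , bounded ]′ (≤⊎> N (pos d * W))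
        where
        W : ℤ
        W = ∑ (grid M k) (Z a as)
        N≥1 : 1ℤ ≤ N
        N≥1 = 1≤size M 1≤M k
        covered : size-U ≤ ∑ (range n) (λ i → Z a as (digits k i))
        covered = ℤ.≤-trans (∑-mono (allFin n) (λ i → by i (lookup U (v i)) refl)) (ℤ.≤-reflexive (∑-allFin-range n (λ i → Z a as (digits k i))))
          where
          by : ∀ i b → lookup U (v i) ≡ b → bit (lookup U (v i)) ≤ Z a as (vertex i)
          by i false t = ℤ.≤-trans (ℤ.≤-reflexive (cong bit t)) (Z≥0 a as (vertex i))
          by i true  t = ℤ.≤-reflexive (trans (cong bit t) (sym (Z-member a as (subst (vertex i ∈_) (sym q) (member⁺ i t)))))
        sampled : N * size-U ≤ (pos n + N) * W
        sampled = ℤ.≤-trans (*-monoˡ N (1≤⇒0≤ N≥1) covered) (sample-≤ k n (Z a as) (Z≥0 a as))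
        W≥0 : 0ℤ ≤ W
        W≥0 = ∑-0≤ (grid M k) (Z≥0 a as)
        bounded : 1ℤ + pos d * W ≤ N → pos d′ * size-U ≤ pos n
        bounded p = *-cancelˡ N N≥1 (certify
          (0≤+ (0≤+ (0≤* (0≤⁺ d′) (≤⇒0≤ sampled)) (0≤* (0≤* (0≤⁺ d′) W≥0) (≤⇒0≤ N≤n))) (0≤+ (0≤* (0≤⁺ n) (≤⇒0≤ p′)) (0≤⁺ n)))
          (eq (pos d′) N (pos n) W size-U))
          where
          p′ : 1ℤ + pos 2 * pos d′ * W ≤ N
          p′ = subst (λ z → 1ℤ + z * W ≤ N) (trans (cong pos d≡) (ℤ.pos-* 2 d′)) p
          eq : ∀ d N n W S → d * ((n + N) * W - N * S) + d * W * (n - N) + (n * (N - (1ℤ + pos 2 * d * W)) + n) ≡ N * n - N * (d * S)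
          eq = solve 5 (λ d N n W S → d :* ((n :+ N) :* W :- N :* S) :+ d :* W :* (n :- N) :+ (n :* (N :- (con 1ℤ :+ con (pos 2) :* d :* W)) :+ n) := N :* n :- N :* (d :* S)) refl

    α-bound : ∀ (d′ : ℕ) → d ≡ 2 ℕ.* d′ → N ≤ pos n₁ → N ≤ pos n₂ → ∀ U → KFreeSet p G U →
              pos d′ * pos Subset.∣ U ∣ ≤ pos (n₁ ℕ.+ n₂)
    α-bound d′ d≡ N≤n₁ N≤n₂ U free = ℤ.≤-trans
      (ℤ.≤-reflexive (trans (cong (pos d′ *_) (trans (pos-∣∣ U) (∑-allFin-+ n₁ n₂ (λ i → bit (lookup U i))))) (ℤ.*-distribˡ-+ (pos d′) _ _)))
      (ℤ.≤-trans (ℤ.+-mono-≤ (part-bound d′ d≡ n₁ N≤n₁ (_↑ˡ n₂) adj-WW U free) (part-bound d′ d≡ n₂ N≤n₂ (n₁ ↑ʳ_) adj-ZZ U free))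
        (ℤ.≤-reflexive (sym (ℤ.pos-+ n₁ n₂))))

-- Edge densities of the blown-up graphs

module Hosts where

  open Prelude
  open Sums
  open Grid
  open Rotation using (1≤⇒0≤)
  open Concentrate using (1≤size)
  open Templates
  open BlowUp
  open import Defs
  open import Data.Fin using (_↑ˡ_; _↑ʳ_)

  -- Rounding the two class sizes costs a factor `(1 + 1/D)²` with `D = 6d`, and the template itself
  -- errs by `1 / 4d`. As `p ≥ 1 + ℓ`, the result `(1 + 1/D)² (ℓ + 1/4d)` stays within `ℓ + p / d`.
  scaled-≤ : ∀ {d ℓ p D N n₁ n₂ G S} → 1ℤ ≤ d → 0ℤ ≤ ℓ → 1ℤ + ℓ ≤ p → D ≡ pos 6 * d → 1ℤ ≤ N → D * N ≤ n₁ → D * N ≤ n₂ → 0ℤ ≤ G →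
    N * N * S ≤ (n₁ + N) * (n₂ + N) * G →
    pos 4 * d * (p * G) ≤ pos 4 * d * (ℓ * (N * N)) + N * N →
    d * (p * S) ≤ (d * ℓ + p) * (n₁ * n₂)
  scaled-≤ {d} {ℓ} {p} {D} {N} {n₁} {n₂} {G} {S} d≥1 ℓ≥0 ℓ<p refl N≥1 D≤n₁ D≤n₂ G≥0 sampled dense =
    *-cancelˡ (D * D * (pos 4 * d)) (*-mono (0≤⁺ 1) (0≤⁺ 1) (*-mono (0≤⁺ 1) (0≤⁺ 1) D≥1 D≥1) (*-mono {1ℤ} {pos 4} (0≤⁺ 1) (0≤⁺ 1) (+≤+ (ℕ.s≤s ℕ.z≤n)) d≥1))
      (certify (0≤+ (0≤* d≥0 (≤⇒0≤ step)) (0≤* (0≤* n₁≥0 n₂≥0) (0≤* d≥0 (≤⇒0≤ constants)))) (eq₃ d ℓ p D S n₁ n₂))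
    where
    d≥0 = 1≤⇒0≤ d≥1
    D≥1 : 1ℤ ≤ D
    D≥1 = *-mono {1ℤ} {pos 6} (0≤⁺ 1) (0≤⁺ 1) (+≤+ (ℕ.s≤s ℕ.z≤n)) d≥1
    D≥0 = 1≤⇒0≤ D≥1
    N≥0 = 1≤⇒0≤ N≥1
    n₁≥0 = ℤ.≤-trans (0≤* D≥0 N≥0) D≤n₁
    n₂≥0 = ℤ.≤-trans (0≤* D≥0 N≥0) D≤n₂
    p≥0 = ℤ.≤-trans (0≤+ (0≤⁺ 1) ℓ≥0) ℓ<p
    grow : ∀ {n} → D * N ≤ n → D * (n + N) ≤ (1ℤ + D) * n
    grow {n} q = certify (≤⇒0≤ q) (eq D n N)
      where
      eq : ∀ D n N → n - D * N ≡ (1ℤ + D) * n - D * (n + N)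
      eq = solve-∀
    both : D * (n₁ + N) * (D * (n₂ + N)) ≤ (1ℤ + D) * n₁ * ((1ℤ + D) * n₂)
    both = *-mono (0≤* D≥0 (0≤+ n₁≥0 N≥0)) (0≤* D≥0 (0≤+ n₂≥0 N≥0)) (grow D≤n₁) (grow D≤n₂)
    step : pos 4 * d * p * (D * D) * S ≤ (1ℤ + D) * (1ℤ + D) * (pos 4 * d * ℓ + 1ℤ) * (n₁ * n₂)
    step = *-cancelˡ (N * N) (*-mono (0≤⁺ 1) (0≤⁺ 1) N≥1 N≥1) (certify
      (0≤+ (0≤+ (0≤* (0≤* (0≤* (0≤⁺ 4) d≥0) (0≤* p≥0 (0≤* D≥0 D≥0))) (≤⇒0≤ sampled))
                (0≤* (0≤* (0≤* (0≤⁺ 4) d≥0) (0≤* p≥0 G≥0)) (≤⇒0≤ both)))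
           (0≤* (0≤* (0≤* (0≤+ (0≤⁺ 1) D≥0) n₁≥0) (0≤* (0≤+ (0≤⁺ 1) D≥0) n₂≥0)) (≤⇒0≤ dense)))
      (trans (eq₁ d p (D * D) (N * N) S ((n₁ + N) * (n₂ + N)) G (D * (n₁ + N) * (D * (n₂ + N))) ((1ℤ + D) * n₁ * ((1ℤ + D) * n₂)) ℓ (eq₀ D (n₁ + N) (n₂ + N)))
             (eq₂ (N * N) (pos 4 * d * p * (D * D) * S) (pos 4 * d * ℓ) (1ℤ + D) n₁ n₂)))
      where
      eq₀ : ∀ D x y → D * x * (D * y) ≡ D * D * (x * y)
      eq₀ = solve-∀
      eq₁′ : ∀ d p q m S x G z ℓ → pos 4 * d * (p * q) * (x * G - m * S) + pos 4 * d * (p * G) * (z - q * x) + z * (pos 4 * d * (ℓ * m) + m - pos 4 * d * (p * G))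
             ≡ z * (pos 4 * d * (ℓ * m) + m) - m * (pos 4 * d * p * q * S)
      eq₁′ = solve 9 (λ d p q m S x G z ℓ → con (pos 4) :* d :* (p :* q) :* (x :* G :- m :* S) :+ con (pos 4) :* d :* (p :* G) :* (z :- q :* x) :+ z :* (con (pos 4) :* d :* (ℓ :* m) :+ m :- con (pos 4) :* d :* (p :* G)) := z :* (con (pos 4) :* d :* (ℓ :* m) :+ m) :- m :* (con (pos 4) :* d :* p :* q :* S)) refl
      eq₁ : ∀ d p q m S x G y z ℓ → y ≡ q * x → pos 4 * d * (p * q) * (x * G - m * S) + pos 4 * d * (p * G) * (z - y) + z * (pos 4 * d * (ℓ * m) + m - pos 4 * d * (p * G))
            ≡ z * (pos 4 * d * (ℓ * m) + m) - m * (pos 4 * d * p * q * S)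
      eq₁ d p q m S x G _ z ℓ refl = eq₁′ d p q m S x G z ℓ
      eq₂ : ∀ m L e E a b → E * a * (E * b) * (pos 4 * d * (ℓ * m) + m) - m * L ≡ m * (E * E * (pos 4 * d * ℓ + 1ℤ) * (a * b)) - m * L
      eq₂ m L e E a b = eq m L (pos 4 * d) ℓ E a b
        where
        eq : ∀ m L e ℓ E a b → E * a * (E * b) * (e * (ℓ * m) + m) - m * L ≡ m * (E * E * (e * ℓ + 1ℤ) * (a * b)) - m * L
        eq = solve 7 (λ m L e ℓ E a b → E :* a :* (E :* b) :* (e :* (ℓ :* m) :+ m) :- m :* L := m :* (E :* E :* (e :* ℓ :+ con 1ℤ) :* (a :* b)) :- m :* L) refl
    constants : D * D + (pos 2 * D + 1ℤ) * (pos 4 * d * ℓ + 1ℤ) ≤ pos 4 * (D * D) * p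
    constants = certify
      (0≤+ (0≤+ (0≤* (0≤* (0≤⁺ 144) (0≤* d≥0 d≥0)) (≤⇒0≤ ℓ<p)) (0≤* (0≤* (0≤⁺ 4) (0≤* d≥0 ℓ≥0)) (0≤+ (0≤* (0≤⁺ 24) (≤⇒0≤ d≥1)) (0≤⁺ 23))))
           (0≤+ (0≤+ (0≤* (0≤⁺ 108) (0≤² (d - 1ℤ))) (0≤* (0≤⁺ 204) (≤⇒0≤ d≥1))) (0≤⁺ 95)))
      (eq d ℓ p)
      where
      eq : ∀ d ℓ p → pos 144 * (d * d) * (p - (1ℤ + ℓ)) + pos 4 * (d * ℓ) * (pos 24 * (d - 1ℤ) + pos 23) + (pos 108 * ((d - 1ℤ) * (d - 1ℤ)) + pos 204 * (d - 1ℤ) + pos 95)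
           ≡ pos 4 * (pos 6 * d * (pos 6 * d)) * p - (pos 6 * d * (pos 6 * d) + (pos 2 * (pos 6 * d) + 1ℤ) * (pos 4 * d * ℓ + 1ℤ))
      eq = solve 3 (λ d ℓ p → con (pos 144) :* (d :* d) :* (p :- (con 1ℤ :+ ℓ)) :+ con (pos 4) :* (d :* ℓ) :* (con (pos 24) :* (d :- con 1ℤ) :+ con (pos 23)) :+ (con (pos 108) :* ((d :- con 1ℤ) :* (d :- con 1ℤ)) :+ con (pos 204) :* (d :- con 1ℤ) :+ con (pos 95)) := con (pos 4) :* (con (pos 6) :* d :* (con (pos 6) :* d)) :* p :- (con (pos 6) :* d :* (con (pos 6) :* d) :+ (con (pos 2) :* (con (pos 6) :* d) :+ con 1ℤ) :* (con (pos 4) :* d :* ℓ :+ con 1ℤ))) refl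
    eq₃ : ∀ d ℓ p D S a b →
      d * ((1ℤ + D) * (1ℤ + D) * (pos 4 * d * ℓ + 1ℤ) * (a * b) - pos 4 * d * p * (D * D) * S)
      + a * b * (d * (pos 4 * (D * D) * p - (D * D + (pos 2 * D + 1ℤ) * (pos 4 * d * ℓ + 1ℤ))))
      ≡ D * D * (pos 4 * d) * ((d * ℓ + p) * (a * b)) - D * D * (pos 4 * d) * (d * (p * S))
    eq₃ = solve 7 (λ d ℓ p D S a b → d :* ((con 1ℤ :+ D) :* (con 1ℤ :+ D) :* (con (pos 4) :* d :* ℓ :+ con 1ℤ) :* (a :* b) :- con (pos 4) :* d :* p :* (D :* D) :* S) :+ a :* b :* (d :* (con (pos 4) :* (D :* D) :* p :- (D :* D :+ (con (pos 2) :* D :+ con 1ℤ) :* (con (pos 4) :* d :* ℓ :+ con 1ℤ)))) := D :* D :* (con (pos 4) :* d) :* ((d :* ℓ :+ p) :* (a :* b)) :- D :* D :* (con (pos 4) :* d) :* (d :* (p :* S))) refl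

  bit-not : ∀ b → bit (not b) ≡ 1ℤ - bit b
  bit-not true  = refl
  bit-not false = refl

  ∑∑-not : ∀ {A B : Set} (xs : List A) (ys : List B) (c : A → B → Bool) →
    ∑ xs (λ x → ∑ ys (λ y → bit (not (c x y)))) ≡ pos (length xs) * pos (length ys) - ∑ xs (λ x → ∑ ys (λ y → bit (c x y)))
  ∑∑-not xs ys c = trans (∑-cong xs (λ x → trans (∑-cong ys (λ y → bit-not (c x y)))
      (trans (∑-- ys (λ _ → 1ℤ) (λ y → bit (c x y))) (cong (_- ∑ ys (λ y → bit (c x y))) (trans (∑-const ys 1ℤ) (ℤ.*-identityʳ (pos (length ys))))))))
    (trans (∑-- xs (λ _ → pos (length ys)) (λ x → ∑ ys (λ y → bit (c x y)))) (cong (_- ∑ xs (λ x → ∑ ys (λ y → bit (c x y)))) (∑-const xs (pos (length ys)))))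

  -- The graphs of the first part at precision 1/d, with classes of sizes n₁ and n₂ that need not be equal.
  record Host (p ℓ d : ℕ) : Set where
    field
      n₀ : ℕ
      G  : ∀ n₁ n₂ → Graph (n₁ ℕ.+ n₂)
    S : ℕ → ℕ → ℕ
    S n₁ n₂ = edgesBetween (G n₁ n₂) n₁ n₂ (λ i → i ↑ˡ n₂) (λ j → n₁ ↑ʳ j)
    field
      independent : ∀ {n₁ n₂} → n₀ ℕ.≤ n₁ → n₀ ℕ.≤ n₂ → ∀ U → KFreeSet p (G n₁ n₂) U → pos (2 ℕ.* d) * pos Subset.∣ U ∣ ≤ pos (n₁ ℕ.+ n₂)
      within-W    : ∀ {n₁ n₂} → n₀ ℕ.≤ n₁ → n₀ ℕ.≤ n₂ → pos d * pos (edgesWithin (G n₁ n₂) n₁ (λ i → i ↑ˡ n₂)) ≤ pos n₁ * pos n₁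
      within-Z    : ∀ {n₁ n₂} → n₀ ℕ.≤ n₁ → n₀ ℕ.≤ n₂ → pos d * pos (edgesWithin (G n₁ n₂) n₂ (λ j → n₁ ↑ʳ j)) ≤ pos n₂ * pos n₂
      between≤    : ∀ {n₁ n₂} → n₀ ℕ.≤ n₁ → n₀ ℕ.≤ n₂ → pos d * (pos p * pos (S n₁ n₂)) ≤ (pos d * pos ℓ + pos p) * (pos n₁ * pos n₂)
      between≥    : ∀ {n₁ n₂} → n₀ ℕ.≤ n₁ → n₀ ℕ.≤ n₂ → pos d * pos ℓ * (pos n₁ * pos n₂) ≤ pos d * (pos p * pos (S n₁ n₂)) + pos p * (pos n₁ * pos n₂)
      between≤all : ∀ n₁ n₂ → pos (S n₁ n₂) ≤ pos (edges (G n₁ n₂))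
      free        : ℓ ℕ.+ ℓ ℕ.≤ p → ∀ n₁ n₂ → KFree (p ℕ.+ ℓ ℕ.+ 1) (G n₁ n₂)

  -- The parameter `ℓ₀` of the template and its relation `cross` are kept apart from `ℓ` and
  -- `cross′`, because `host` also uses a template for `p - ℓ` with the complementary relation.
  module FromTemplate {p ℓ ℓ₀ d e : ℕ} (1≤ℓ : 1 ℕ.≤ ℓ) (ℓ<p : ℓ ℕ.< p) (1≤d : 1 ℕ.≤ d) (e≡ : e ≡ 2 ℕ.* (2 ℕ.* d)) (T : Template p ℓ₀ e)
                      (cross′ : Template.V T → Template.V T → Bool) where

    open Template T

    instance
      M≢0 : ℕ.NonZero M
      M≢0 = ℕ.>-nonZero 1≤M

    open Digits M

    E : ℤ
    E = ∑ (grid M k) (λ x → ∑ (grid M k) (λ z → bit (cross′ x z)))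

    threshold : ℕ
    threshold = 6 ℕ.* d ℕ.* total k

    N≥1 : 1ℤ ≤ N
    N≥1 = 1≤size M 1≤M k

    pos-e : pos e ≡ pos 4 * pos d
    pos-e = trans (cong pos e≡) (trans (ℤ.pos-* 2 (2 ℕ.* d)) (trans (cong (pos 2 *_) (ℤ.pos-* 2 d)) (sym (ℤ.*-assoc (pos 2) (pos 2) (pos d)))))

    beyond : ∀ {n} → threshold ℕ.≤ n → pos 6 * pos d * N ≤ pos n
    beyond t≤n = ℤ.≤-trans (ℤ.≤-reflexive (sym (trans (ℤ.pos-* (6 ℕ.* d) (total k)) (cong₂ _*_ (ℤ.pos-* 6 d) (total-size k))))) (+≤+ t≤n)

    N≤ : ∀ {n} → threshold ℕ.≤ n → N ≤ pos n
    N≤ t≤n = ℤ.≤-trans (certify (0≤* (≤⇒0≤ {1ℤ} {pos 6 * pos d} (*-mono {1ℤ} {pos 6} (0≤⁺ 1) (0≤⁺ 1) (+≤+ (ℕ.s≤s ℕ.z≤n)) (+≤+ 1≤d))) (1≤⇒0≤ N≥1))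
        (eq (pos 6 * pos d) N)) (beyond t≤n)
      where
      eq : ∀ a b → (a - 1ℤ) * b ≡ a * b - b
      eq = solve-∀

    crossing-≤ : ∀ (c : V → V → Bool) (q : ℤ) → 0ℤ ≤ q → 1ℤ + q ≤ pos p →
      pos e * (pos p * ∑ (grid M k) (λ x → ∑ (grid M k) (λ z → bit (c x z)))) ≤ pos e * (q * (N * N)) + N * N →
      ∀ {n₁ n₂} → threshold ℕ.≤ n₁ → threshold ℕ.≤ n₂ →
      pos d * (pos p * ∑ (range n₁) (λ i → ∑ (range n₂) (λ j → bit (c (digits k i) (digits k j))))) ≤ (pos d * q + pos p) * (pos n₁ * pos n₂)
    crossing-≤ c q q≥0 q<p dense {n₁} {n₂} t₁ t₂ = scaled-≤ (+≤+ 1≤d) q≥0 q<p refl N≥1 (beyond t₁) (beyond t₂)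
      (∑-0≤ (grid M k) (λ x → ∑-0≤ (grid M k) (λ z → bit≥0 (c x z))))
      (sample₂-≤ k n₁ n₂ (λ x z → bit (c x z)) (λ x z → bit≥0 (c x z)))
      (subst (λ w → w * (pos p * G) ≤ w * (q * (N * N)) + N * N) pos-e dense)
      where
      G = ∑ (grid M k) (λ x → ∑ (grid M k) (λ z → bit (c x z)))

    sparse-blow-up : ∀ {n₁ n₂ n} → threshold ℕ.≤ n → pos d * BlownUp.links T cross′ n₁ n₂ n ≤ pos n * pos n
    sparse-blow-up {n₁} {n₂} {n} t = *-cancelˡ (pos 4 * (N * N)) (*-mono {1ℤ} {pos 4} (0≤⁺ 1) (0≤⁺ 1) (+≤+ (ℕ.s≤s ℕ.z≤n)) (*-mono (0≤⁺ 1) (0≤⁺ 1) N≥1 N≥1)) (certify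
      (0≤+ (0≤+ (0≤* (0≤* (0≤⁺ 4) (0≤⁺ d)) (≤⇒0≤ (sample₂-≤ k n n (λ x y → bit (link x y)) (λ x y → bit≥0 (link x y)))))
                (0≤* (0≤* (0≤+ (0≤⁺ n) N≥0) (0≤+ (0≤⁺ n) N≥0)) (≤⇒0≤ (subst (λ w → w * A ≤ N * N) pos-e sparse))))
           (0≤* (0≤* N≥0 N≥0) (0≤* (≤⇒0≤ (N≤ t)) (0≤+ (0≤* (0≤⁺ 3) (0≤⁺ n)) N≥0))))
      (eq (pos d) (pos n) N A (BlownUp.links T cross′ n₁ n₂ n)))
      where
      N≥0 = 1≤⇒0≤ N≥1
      A = ∑ (grid M k) (λ x → ∑ (grid M k) (λ y → bit (link x y)))
      eq : ∀ d n N A L → pos 4 * d * ((n + N) * (n + N) * A - N * N * L) + (n + N) * (n + N) * (N * N - pos 4 * d * A) + N * N * ((n - N) * (pos 3 * n + N))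
           ≡ pos 4 * (N * N) * (n * n) - pos 4 * (N * N) * (d * L)
      eq = solve 5 (λ d n N A L → con (pos 4) :* d :* ((n :+ N) :* (n :+ N) :* A :- N :* N :* L) :+ (n :+ N) :* (n :+ N) :* (N :* N :- con (pos 4) :* d :* A) :+ N :* N :* ((n :- N) :* (con (pos 3) :* n :+ N)) := con (pos 4) :* (N :* N) :* (n :* n) :- con (pos 4) :* (N :* N) :* (d :* L)) refl

    host : pos e * (pos p * E) ≤ pos e * (pos ℓ * (N * N)) + N * N →
           pos e * (pos ℓ * (N * N)) ≤ pos e * (pos p * E) + N * N →
           (ℓ ℕ.+ ℓ ℕ.≤ p → ∀ n₁ n₂ → KFree (p ℕ.+ ℓ ℕ.+ 1) (BlownUp.G T cross′ n₁ n₂)) → Host p ℓ d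
    host dense≤ dense≥ free = record
      { n₀ = threshold
      ; G = λ n₁ n₂ → BlownUp.G T cross′ n₁ n₂
      ; independent = λ {n₁} {n₂} t₁ t₂ U free → BlownUp.α-bound T cross′ n₁ n₂ (2 ℕ.* d) e≡ (N≤ t₁) (N≤ t₂) U free
      ; within-W = λ {n₁} {n₂} t₁ t₂ → ℤ.≤-trans (*-monoˡ (pos d) (0≤⁺ d) (BlownUp.within-≤ T cross′ n₁ n₂ n₁ _ (BlownUp.adj-WW T cross′ n₁ n₂))) (sparse-blow-up {n₁} {n₂} t₁)
      ; within-Z = λ {n₁} {n₂} t₁ t₂ → ℤ.≤-trans (*-monoˡ (pos d) (0≤⁺ d) (BlownUp.within-≤ T cross′ n₁ n₂ n₂ _ (BlownUp.adj-ZZ T cross′ n₁ n₂))) (sparse-blow-up {n₁} {n₂} t₂)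
      ; between≤ = λ {n₁} {n₂} t₁ t₂ → subst (λ w → pos d * (pos p * w) ≤ (pos d * pos ℓ + pos p) * (pos n₁ * pos n₂)) (sym (BlownUp.between-≡ T cross′ n₁ n₂))
          (crossing-≤ cross′ (pos ℓ) (0≤⁺ ℓ) (+≤+ ℓ<p) dense≤ t₁ t₂)
      -- A lower bound on crossing pairs is an upper bound on the complementary ones, with `p - ℓ`
      -- in place of `ℓ`; this is at most `p - 1` because `ℓ` is positive.
      ; between≥ = λ {n₁} {n₂} t₁ t₂ → subst (λ w → pos d * pos ℓ * (pos n₁ * pos n₂) ≤ pos d * (pos p * w) + pos p * (pos n₁ * pos n₂)) (sym (BlownUp.between-≡ T cross′ n₁ n₂))
          (lower n₁ n₂ (crossing-≤ (λ x z → not (cross′ x z)) (pos p - pos ℓ) (≤⇒0≤ (+≤+ (ℕ.<⇒≤ ℓ<p))) (certify (≤⇒0≤ (+≤+ 1≤ℓ)) (eq₁ (pos p) (pos ℓ)))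
            (certify (≤⇒0≤ dense≥) (trans (eq₂ (pos e) (pos p) (pos ℓ) (N * N) E)
              (cong (λ w → pos e * ((pos p - pos ℓ) * (N * N)) + N * N - pos e * (pos p * w)) (sym (∑∑-not (grid M k) (grid M k) cross′))))) t₁ t₂))
      ; between≤all = λ n₁ n₂ → ℤ.≤-trans (ℤ.≤-reflexive (BlownUp.between-≡ T cross′ n₁ n₂)) (BlownUp.crossings≤edges T cross′ n₁ n₂)
      ; free = free }
      where
      eq₁ : ∀ p ℓ → ℓ - 1ℤ ≡ p - (1ℤ + (p - ℓ))
      eq₁ = solve-∀
      eq₂ : ∀ e p ℓ m E → e * (p * E) + m - e * (ℓ * m) ≡ e * ((p - ℓ) * m) + m - e * (p * (m - E))
      eq₂ = solve 5 (λ e p ℓ m E → e :* (p :* E) :+ m :- e :* (ℓ :* m) := e :* ((p :- ℓ) :* m) :+ m :- e :* (p :* (m :- E))) refl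
      lower : ∀ n₁ n₂ →
        pos d * (pos p * ∑ (range n₁) (λ i → ∑ (range n₂) (λ j → bit (not (cross′ (digits k i) (digits k j)))))) ≤ (pos d * (pos p - pos ℓ) + pos p) * (pos n₁ * pos n₂) →
        pos d * pos ℓ * (pos n₁ * pos n₂) ≤ pos d * (pos p * BlownUp.crossings T cross′ n₁ n₂) + pos p * (pos n₁ * pos n₂)
      lower n₁ n₂ q = certify (≤⇒0≤ (subst (λ w → pos d * (pos p * w) ≤ (pos d * (pos p - pos ℓ) + pos p) * (pos n₁ * pos n₂))
          (trans (∑∑-not (range n₁) (range n₂) (λ i j → cross′ (digits k i) (digits k j)))
            (cong₂ (λ a b → pos a * pos b - BlownUp.crossings T cross′ n₁ n₂) (length-range n₁) (length-range n₂))) q))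
        (eq (pos d) (pos p) (pos ℓ) (pos n₁ * pos n₂) (BlownUp.crossings T cross′ n₁ n₂))
        where
        eq : ∀ d p ℓ m s → (d * (p - ℓ) + p) * m - d * (p * (m - s)) ≡ d * (p * s) + p * m - d * ℓ * m
        eq = solve 5 (λ d p ℓ m s → (d :* (p :- ℓ) :+ p) :* m :- d :* (p :* (m :- s)) := d :* (p :* s) :+ p :* m :- d :* ℓ :* m) refl

  -- For 2ℓ > p no clique number is claimed, and complementing the edges between the two classes for p - ℓ does the job.
  host : ∀ p ℓ d → 1 ℕ.≤ ℓ → ℓ ℕ.< p → 1 ℕ.≤ d → Host p ℓ d
  host p ℓ d 1≤ℓ ℓ<p 1≤d = go (ℓ ℕ.+ ℓ ℕ.≤? p)
    where
    e : ℕ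
    e = 2 ℕ.* (2 ℕ.* d)
    1≤e : 1 ℕ.≤ e
    1≤e = ℕ.≤-trans 1≤d (ℕ.≤-trans (ℕ.m≤m+n d (d ℕ.+ 0)) (ℕ.m≤m+n (2 ℕ.* d) (2 ℕ.* d ℕ.+ 0)))
    go : Dec (ℓ ℕ.+ ℓ ℕ.≤ p) → Host p ℓ d
    go (yes 2ℓ≤p) = FromTemplate.host 1≤ℓ ℓ<p 1≤d refl T (Template.cross T) (Template.dense≤ T) (Template.dense≥ T)
        (λ _ n₁ n₂ → BlownUp.k-free T (Template.cross T) n₁ n₂ (λ _ _ → refl))
      where
      T = template p ℓ e 1≤ℓ 2ℓ≤p 1≤e
    go (no 2ℓ≰p) = FromTemplate.host 1≤ℓ ℓ<p 1≤d refl T (λ x z → not (Template.cross T x z))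
        (subst (λ w → pos e * (pos p * w) ≤ pos e * (pos ℓ * (N * N)) + N * N) (sym not≡)
          (certify (≤⇒0≤ (Template.dense≥ T)) (trans (cong (λ w → pos e * (pos p * E) + N * N - pos e * (w * (N * N))) p∸ℓ) (eq (pos e) (pos p) (pos ℓ) (N * N) E))))
        (subst (λ w → pos e * (pos ℓ * (N * N)) ≤ pos e * (pos p * w) + N * N) (sym not≡)
          (certify (≤⇒0≤ (Template.dense≤ T)) (trans (cong (λ w → pos e * (w * (N * N)) + N * N - pos e * (pos p * E)) p∸ℓ) (eq′ (pos e) (pos p) (pos ℓ) (N * N) E))))
        (λ 2ℓ≤p → ⊥-elim (2ℓ≰p 2ℓ≤p))
      where
      T = template p (p ℕ.∸ ℓ) e (ℕ.m<n⇒0<n∸m ℓ<p)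
        (ℕ.≤-trans (ℕ.+-monoʳ-≤ (p ℕ.∸ ℓ) (ℕ.m≤n+o⇒m∸n≤o p ℓ (ℕ.<⇒≤ (ℕ.≰⇒> 2ℓ≰p)))) (ℕ.≤-reflexive (ℕ.m∸n+n≡m (ℕ.<⇒≤ ℓ<p)))) 1≤e
      N = Template.N T
      E = ∑ (grid (Template.M T) (Template.k T)) (λ x → ∑ (grid (Template.M T) (Template.k T)) (λ z → bit (Template.cross T x z)))
      not≡ : ∑ (grid (Template.M T) (Template.k T)) (λ x → ∑ (grid (Template.M T) (Template.k T)) (λ z → bit (not (Template.cross T x z)))) ≡ N * N - E
      not≡ = ∑∑-not (grid (Template.M T) (Template.k T)) (grid (Template.M T) (Template.k T)) (Template.cross T)
      p∸ℓ : pos (p ℕ.∸ ℓ) ≡ pos p - pos ℓ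
      p∸ℓ = sym (trans (ℤ.m-n≡m⊖n p ℓ) (ℤ.⊖-≥ (ℕ.<⇒≤ ℓ<p)))
      eq : ∀ e p ℓ m E → e * (p * E) + m - e * ((p - ℓ) * m) ≡ e * (ℓ * m) + m - e * (p * (m - E))
      eq = solve 5 (λ e p ℓ m E → e :* (p :* E) :+ m :- e :* ((p :- ℓ) :* m) := e :* (ℓ :* m) :+ m :- e :* (p :* (m :- E))) refl
      eq′ : ∀ e p ℓ m E → e * ((p - ℓ) * m) + m - e * (p * E) ≡ e * (p * (m - E)) + m - e * (ℓ * m)
      eq′ = solve 5 (λ e p ℓ m E → e :* ((p :- ℓ) :* m) :+ m :- e :* (p :* E) := e :* (p :* (m :- E)) :+ m :- e :* (ℓ :* m)) refl

-- Translation into rational inequalities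

module Rationals where

  open Prelude
  open Sums
  open import Defs
  open import Data.Rational using (ℚ; 0ℚ; mkℚ; toℚᵘ)
  open import Data.Rational.Unnormalised using (mkℚᵘ; *≤*; _≃_)

  ℕ→ℚ-≃ : ∀ k → toℚᵘ (ℕ→ℚ k) ≃ mkℚᵘ (pos k) 0
  ℕ→ℚ-≃ k = ℚ.toℚᵘ-fromℚᵘ (mkℚᵘ (pos k) 0)

  ratio-≃ : ∀ a b → toℚᵘ (ratio a (suc b)) ≃ mkℚᵘ (pos a) b
  ratio-≃ a b = ℚ.toℚᵘ-fromℚᵘ (mkℚᵘ (pos a) b)

  *-≃ : ∀ {x y u v} → toℚᵘ x ≃ u → toℚᵘ y ≃ v → toℚᵘ (x ℚ.* y) ≃ u ℚᵘ.* v
  *-≃ {x} {y} p q = ℚᵘ.≃-trans (ℚ.toℚᵘ-homo-* x y) (ℚᵘ.*-cong p q)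

  neg-≃ : ∀ {x u} → toℚᵘ x ≃ u → toℚᵘ (ℚ.- x) ≃ ℚᵘ.- u
  neg-≃ {x} p = ℚᵘ.≃-trans (ℚ.toℚᵘ-homo‿- x) (ℚᵘ.-‿cong p)

  minus-≃ : ∀ {x y u v} → toℚᵘ x ≃ u → toℚᵘ y ≃ v → toℚᵘ (x ℚ.- y) ≃ u ℚᵘ.- v
  minus-≃ {x} {y} p q = ℚᵘ.≃-trans (ℚ.toℚᵘ-homo-+ x (ℚ.- y)) (ℚᵘ.+-cong p (neg-≃ {y} q))

  ≤-≃ : ∀ {x y u v} → toℚᵘ x ≃ u → toℚᵘ y ≃ v → u ℚᵘ.≤ v → x ℚ.≤ y
  ≤-≃ p q u≤v = ℚ.toℚᵘ-cancel-≤ (ℚᵘ.≤-respˡ-≃ (ℚᵘ.≃-sym p) (ℚᵘ.≤-respʳ-≃ (ℚᵘ.≃-sym q) u≤v))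

  -- A positive fraction `(a + 1) / (e + 1)` is at least `1 / (e + 1)`, so its denominator serves as
  -- the bound.
  ratio≤ : ∀ ε → 0ℚ ℚ.< ε → ∃ λ e → ∀ d → e ℕ.≤ d → ratio 1 (suc d) ℚ.≤ ε
  ratio≤ (mkℚ (pos (suc a)) e c) _ = e , λ d e≤d → ≤-≃ (ratio-≃ 1 d) (ℚᵘ.≃-refl {mkℚᵘ (pos (suc a)) e})
    (*≤* (ℤ.≤-trans (ℤ.≤-reflexive (ℤ.*-identityˡ (pos (suc e)))) (ℤ.≤-trans (+≤+ (ℕ.≤-trans (ℕ.s≤s e≤d) (ℕ.m≤m+n (suc d) (a ℕ.* suc d)))) (ℤ.≤-reflexive (ℤ.pos-* (suc a) (suc d))))))
  ratio≤ (mkℚ (pos zero) e c) (ℚ.*<* p) with ℤ.<-irrefl refl p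
  ... | ()
  ratio≤ (mkℚ -[1+ a ] e c) (ℚ.*<* ())

  *-ε-mono : ∀ {d ε} k → ratio 1 (suc d) ℚ.≤ ε → ratio 1 (suc d) ℚ.* ℕ→ℚ k ℚ.≤ ε ℚ.* ℕ→ℚ k
  *-ε-mono k q = ℚ.*-monoʳ-≤-nonNeg (ℕ→ℚ k) {{ℚ.nonNegative (≤-≃ (ℚᵘ.≃-refl {mkℚᵘ 0ℤ 0}) (ℕ→ℚ-≃ k)
    (*≤* (ℤ.≤-trans (0≤⁺ k) (ℤ.≤-reflexive (sym (ℤ.*-identityʳ (pos k)))))))}} q

  fraction-≤ : ∀ d {x y} → pos (suc d) * pos x ≤ pos y → ℕ→ℚ x ℚ.≤ ratio 1 (suc d) ℚ.* ℕ→ℚ y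
  fraction-≤ d {x} {y} q = ≤-≃ (ℕ→ℚ-≃ x) (*-≃ {ratio 1 (suc d)} {ℕ→ℚ y} (ratio-≃ 1 d) (ℕ→ℚ-≃ y))
    (*≤* (subst (λ w → pos x * pos w ≤ 1ℤ * pos y * 1ℤ) (sym (ℕ.*-identityʳ (suc d))) (certify (≤⇒0≤ q) (eq (pos (suc d)) (pos x) (pos y)))))
    where
    eq : ∀ d x y → y - d * x ≡ 1ℤ * y * 1ℤ - x * d
    eq = solve-∀

  difference-≤ : ∀ d ℓ p {s m} →
    pos (suc d) * (pos (suc p) * pos s) ≤ (pos (suc d) * pos ℓ + pos (suc p)) * pos m →
    pos (suc d) * pos ℓ * pos m ≤ pos (suc d) * (pos (suc p) * pos s) + pos (suc p) * pos m →
    ℚ.∣ ℕ→ℚ s ℚ.- ratio ℓ (suc p) ℚ.* ℕ→ℚ m ∣ ℚ.≤ ratio 1 (suc d) ℚ.* ℕ→ℚ m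
  difference-≤ d ℓ p {s} {m} upper lower = [ (λ e → subst (ℚ._≤ bound) (sym e) above) , (λ e → subst (ℚ._≤ bound) (sym e) below) ]′ (ℚ.∣p∣≡p∨∣p∣≡-p gap)
    where
    gap   = ℕ→ℚ s ℚ.- ratio ℓ (suc p) ℚ.* ℕ→ℚ m
    bound = ratio 1 (suc d) ℚ.* ℕ→ℚ m
    gap-≃ = minus-≃ {ℕ→ℚ s} {ratio ℓ (suc p) ℚ.* ℕ→ℚ m} (ℕ→ℚ-≃ s) (*-≃ {ratio ℓ (suc p)} {ℕ→ℚ m} (ratio-≃ ℓ p) (ℕ→ℚ-≃ m))
    bound-≃ = *-≃ {ratio 1 (suc d)} {ℕ→ℚ m} (ratio-≃ 1 d) (ℕ→ℚ-≃ m)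
    -- Unnormalised arithmetic leaves factors 1 in the denominators; these equations remove them
    -- before the ring solver is called.
    P≡ : suc p ℕ.* 1 ≡ suc p
    P≡ = ℕ.*-identityʳ (suc p)
    1P≡ : 1 ℕ.* (suc p ℕ.* 1) ≡ suc p
    1P≡ = trans (ℕ.*-identityˡ _) P≡
    D≡ : suc d ℕ.* 1 ≡ suc d
    D≡ = ℕ.*-identityʳ (suc d)
    above : gap ℚ.≤ bound
    above = ≤-≃ gap-≃ bound-≃ (*≤* (go (sym P≡) (sym 1P≡) (sym D≡)))
      where
      go : ∀ {P P′ D} → suc p ≡ P → suc p ≡ P′ → suc d ≡ D → (pos s * pos P + - (pos ℓ * pos m) * pos 1) * pos D ≤ 1ℤ * pos m * pos P′
      go refl refl refl = certify (≤⇒0≤ upper) (eq (pos (suc d)) (pos ℓ) (pos (suc p)) (pos s) (pos m))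
        where
        eq : ∀ d ℓ p s m → (d * ℓ + p) * m - d * (p * s) ≡ 1ℤ * m * p - (s * p + - (ℓ * m) * 1ℤ) * d
        eq = solve 5 (λ d ℓ p s m → (d :* ℓ :+ p) :* m :- d :* (p :* s) := con 1ℤ :* m :* p :- (s :* p :+ :- (ℓ :* m) :* con 1ℤ) :* d) refl
    below : ℚ.- gap ℚ.≤ bound
    below = ≤-≃ (neg-≃ {gap} gap-≃) bound-≃ (*≤* (go (sym P≡) (sym 1P≡) (sym D≡)))
      where
      go : ∀ {P P′ D} → suc p ≡ P → suc p ≡ P′ → suc d ≡ D → - (pos s * pos P + - (pos ℓ * pos m) * pos 1) * pos D ≤ 1ℤ * pos m * pos P′
      go refl refl refl = certify (≤⇒0≤ lower) (eq (pos (suc d)) (pos ℓ) (pos (suc p)) (pos s) (pos m))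
        where
        eq : ∀ d ℓ p s m → d * (p * s) + p * m - d * ℓ * m ≡ 1ℤ * m * p - - (s * p + - (ℓ * m) * 1ℤ) * d
        eq = solve 5 (λ d ℓ p s m → d :* (p :* s) :+ p :* m :- d :* ℓ :* m := con 1ℤ :* m :* p :- :- (s :* p :+ :- (ℓ :* m) :* con 1ℤ) :* d) refl

  density-≤ : ∀ d ℓ p {δ c s} → ratio 1 (suc d) ℚ.≤ δ → pos (suc d) * pos ℓ * pos c ≤ pos (suc d) * (pos (suc p) * pos s) + pos (suc p) * pos c →
    (ratio ℓ (suc p) ℚ.- δ) ℚ.* ℕ→ℚ c ℚ.≤ ℕ→ℚ s
  density-≤ d ℓ p {δ} {c} {s} small lower = ℚ.≤-trans
      (ℚ.*-monoʳ-≤-nonNeg (ℕ→ℚ c) {{ℚ.nonNegative (≤-≃ (ℚᵘ.≃-refl {mkℚᵘ 0ℤ 0}) (ℕ→ℚ-≃ c) (*≤* (ℤ.≤-trans (0≤⁺ c) (ℤ.≤-reflexive (sym (ℤ.*-identityʳ (pos c)))))))}}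
        (ℚ.+-monoʳ-≤ (ratio ℓ (suc p)) (ℚ.neg-antimono-≤ small)))
      (≤-≃ (*-≃ {ratio ℓ (suc p) ℚ.- ratio 1 (suc d)} {ℕ→ℚ c} (minus-≃ {ratio ℓ (suc p)} {ratio 1 (suc d)} (ratio-≃ ℓ p) (ratio-≃ 1 d)) (ℕ→ℚ-≃ c)) (ℕ→ℚ-≃ s)
        (*≤* (subst (λ w → (pos ℓ * pos (suc d) + - 1ℤ * pos (suc p)) * pos c * 1ℤ ≤ pos s * w) (sym (trans (cong pos (ℕ.*-identityʳ (suc p ℕ.* suc d))) (ℤ.pos-* (suc p) (suc d))))
          (certify (≤⇒0≤ lower) (eq (pos (suc d)) (pos ℓ) (pos (suc p)) (pos s) (pos c))))))
    where
    eq : ∀ d ℓ p s c → d * (p * s) + p * c - d * ℓ * c ≡ s * (p * d) - (ℓ * d + - 1ℤ * p) * c * 1ℤ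
    eq = solve 5 (λ d ℓ p s c → d :* (p :* s) :+ p :* c :- d :* ℓ :* c := s :* (p :* d) :- (ℓ :* d :+ :- con 1ℤ :* p) :* c :* con 1ℤ) refl

-- The bipartite statement and the Ramsey-Turán density

module Assembly where

  open Prelude
  open Sums
  open Rationals
  open Hosts
  open import Defs
  open import Data.Nat using (⌊_/2⌋; ⌈_/2⌉)
  open import Data.Fin using (_↑ˡ_; _↑ʳ_)
  open import Data.Fin.Subset using (Subset)
  open import Data.Rational using (ℚ; 0ℚ)

  2*≡ : ∀ m → 2 ℕ.* m ≡ m ℕ.+ m
  2*≡ m = cong (m ℕ.+_) (ℕ.+-identityʳ m)

  ⌈n/2⌉-parity : ∀ n → ⌈ n /2⌉ ≡ ⌊ n /2⌋ ⊎ ⌈ n /2⌉ ≡ suc ⌊ n /2⌋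
  ⌈n/2⌉-parity zero          = inj₁ refl
  ⌈n/2⌉-parity (suc zero)    = inj₂ refl
  ⌈n/2⌉-parity (suc (suc n)) = [ (λ e → inj₁ (cong suc e)) , (λ e → inj₂ (cong suc e)) ]′ (⌈n/2⌉-parity n)

  choose2-bounds : ∀ N x → 2 ℕ.* x ℕ.≤ N ℕ.* (N ℕ.∸ 1) → N ℕ.* (N ℕ.∸ 1) ℕ.≤ 2 ℕ.* (2 ℕ.* x) →
    x ℕ.≤ choose2 N × choose2 N ℕ.≤ 2 ℕ.* x
  choose2-bounds N x lower upper =
      ℕ.≤-trans (ℕ.≤-reflexive (sym (2*/2 x))) (ℕ./-monoˡ-≤ 2 lower)
    , ℕ.≤-trans (ℕ./-monoˡ-≤ 2 upper) (ℕ.≤-reflexive (2*/2 (2 ℕ.* x)))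
    where
    2*/2 : ∀ m → (2 ℕ.* m) ℕ./ 2 ≡ m
    2*/2 m = trans (cong (ℕ._/ 2) (ℕ.*-comm 2 m)) (ℕ.m*n/n≡m m 2)

  -- When the classes are as equal as possible, at least half of all pairs go between them. A
  -- density of about `ℓ / p` between the classes is therefore at least about `ℓ / 2p` overall.
  balanced : ∀ {a b} → 1 ℕ.≤ a → b ≡ a ⊎ b ≡ suc a → a ℕ.* b ℕ.≤ choose2 (a ℕ.+ b) × choose2 (a ℕ.+ b) ℕ.≤ 2 ℕ.* (a ℕ.* b)
  balanced {suc c} _ (inj₁ refl) = choose2-bounds (suc c ℕ.+ suc c) (suc c ℕ.* suc c)
    (ℕ.≤-trans (ℕ.m≤m+n _ (2 ℕ.* (c ℕ.* suc c))) (ℕ.≤-reflexive (eq c)))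
    (ℕ.≤-trans (ℕ.m≤m+n _ (2 ℕ.* suc c)) (ℕ.≤-reflexive (eq′ c)))
    where
    eq : ∀ c → 2 ℕ.* (suc c ℕ.* suc c) ℕ.+ 2 ℕ.* (c ℕ.* suc c) ≡ (suc c ℕ.+ suc c) ℕ.* (c ℕ.+ suc c)
    eq = ℕSolver.solve-∀
    eq′ : ∀ c → (suc c ℕ.+ suc c) ℕ.* (c ℕ.+ suc c) ℕ.+ 2 ℕ.* suc c ≡ 2 ℕ.* (2 ℕ.* (suc c ℕ.* suc c))
    eq′ = ℕSolver.solve-∀
  balanced {suc c} _ (inj₂ refl) = choose2-bounds (suc c ℕ.+ suc (suc c)) (suc c ℕ.* suc (suc c))
    (ℕ.≤-trans (ℕ.m≤m+n _ (2 ℕ.* (suc c ℕ.* suc c))) (ℕ.≤-reflexive (eq c)))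
    (ℕ.≤-trans (ℕ.m≤m+n _ (2 ℕ.* suc c)) (ℕ.≤-reflexive (eq′ c)))
    where
    eq : ∀ c → 2 ℕ.* (suc c ℕ.* suc (suc c)) ℕ.+ 2 ℕ.* (suc c ℕ.* suc c) ≡ (suc c ℕ.+ suc (suc c)) ℕ.* (c ℕ.+ suc (suc c))
    eq = ℕSolver.solve-∀
    eq′ : ∀ c → (suc c ℕ.+ suc (suc c)) ℕ.* (c ℕ.+ suc (suc c)) ℕ.+ 2 ℕ.* suc c ≡ 2 ℕ.* (2 ℕ.* (suc c ℕ.* suc (suc c)))
    eq′ = ℕSolver.solve-∀

  half-≤ : ∀ d {u n₁ n₂ m} → pos (2 ℕ.* d) * pos u ≤ pos (n₁ ℕ.+ n₂) → n₁ ℕ.+ n₂ ℕ.≤ m ℕ.+ m → pos d * pos u ≤ pos m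
  half-≤ d {u} {n₁} {n₂} {m} q r = *-cancelˡ (pos 2) (+≤+ (ℕ.s≤s ℕ.z≤n)) (ℤ.≤-trans
    (ℤ.≤-reflexive (trans (sym (ℤ.*-assoc (pos 2) (pos d) (pos u))) (cong (_* pos u) (sym (ℤ.pos-* 2 d)))))
    (ℤ.≤-trans q (ℤ.≤-trans (+≤+ (ℕ.≤-trans r (ℕ.≤-reflexive (sym (2*≡ m))))) (ℤ.≤-reflexive (ℤ.pos-* 2 m)))))

  BipartitePart : (p ℓ : ℕ) → Set
  BipartitePart p ℓ = ∀ (ε : ℚ) → 0ℚ ℚ.< ε → ∃ λ n₀ → ∀ n → n₀ ℕ.≤ n →
    Σ (Graph (n ℕ.+ n)) λ G →
      αBound p G (ε ℚ.* ℕ→ℚ n)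
      × ℕ→ℚ (edgesWithin G n (λ i → i ↑ˡ n)) ℚ.≤ ε ℚ.* ℕ→ℚ (n ℕ.* n)
      × ℕ→ℚ (edgesWithin G n (λ j → n ↑ʳ j)) ℚ.≤ ε ℚ.* ℕ→ℚ (n ℕ.* n)
      × ℚ.∣ ℕ→ℚ (edgesBetween G n n (λ i → i ↑ˡ n) (λ j → n ↑ʳ j)) ℚ.- ratio ℓ p ℚ.* ℕ→ℚ (n ℕ.* n) ∣ ℚ.≤ ε ℚ.* ℕ→ℚ (n ℕ.* n)
      × (2 ℕ.* ℓ ℕ.≤ p → KFree (p ℕ.+ ℓ ℕ.+ 1) G)

  bipartite : ∀ p ℓ → 1 ℕ.≤ ℓ → ℓ ℕ.< suc p → BipartitePart (suc p) ℓ
  bipartite p ℓ 1≤ℓ ℓ<p ε 0<ε = n₀ , λ n n₀≤n → G n n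
      , (λ U free → fraction-trans {Subset.∣ U ∣} {n} (half-≤ (suc d) {Subset.∣ U ∣} {n} {n} {n} (independent n₀≤n n₀≤n U free) ℕ.≤-refl))
      , fraction-trans {edgesWithin (G n n) n (λ i → i ↑ˡ n)} {n ℕ.* n} (ℤ.≤-trans (within-W n₀≤n n₀≤n) (ℤ.≤-reflexive (sym (ℤ.pos-* n n))))
      , fraction-trans {edgesWithin (G n n) n (λ j → n ↑ʳ j)} {n ℕ.* n} (ℤ.≤-trans (within-Z n₀≤n n₀≤n) (ℤ.≤-reflexive (sym (ℤ.pos-* n n))))
      , ℚ.≤-trans (difference-≤ d ℓ p {S n n} {n ℕ.* n}
          (subst (λ w → pos (suc d) * (pos (suc p) * pos (S n n)) ≤ (pos (suc d) * pos ℓ + pos (suc p)) * w) (sym (ℤ.pos-* n n)) (between≤ n₀≤n n₀≤n))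
          (subst (λ w → pos (suc d) * pos ℓ * w ≤ pos (suc d) * (pos (suc p) * pos (S n n)) + pos (suc p) * w) (sym (ℤ.pos-* n n)) (between≥ n₀≤n n₀≤n)))
          (*-ε-mono {d} {ε} (n ℕ.* n) small)
      , λ 2ℓ≤p → free (ℕ.≤-trans (ℕ.≤-reflexive (sym (2*≡ ℓ))) 2ℓ≤p) n n
    where
    d : ℕ
    d = proj₁ (ratio≤ ε 0<ε)
    small : ratio 1 (suc d) ℚ.≤ ε
    small = proj₂ (ratio≤ ε 0<ε) d ℕ.≤-refl
    open Host (host (suc p) ℓ (suc d) 1≤ℓ ℓ<p (ℕ.s≤s ℕ.z≤n))
    fraction-trans : ∀ {x y} → pos (suc d) * pos x ≤ pos y → ℕ→ℚ x ℚ.≤ ε ℚ.* ℕ→ℚ y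
    fraction-trans {x} {y} q = ℚ.≤-trans (fraction-≤ d {x} {y} q) (*-ε-mono {d} {ε} y small)

  ramsey-turán : ∀ p ℓ → 1 ℕ.≤ ℓ → ℓ ℕ.< suc p → 2 ℕ.* ℓ ℕ.≤ suc p → RTDensityAtLeast (suc p) (suc p ℕ.+ ℓ ℕ.+ 1) (ratio ℓ (2 ℕ.* suc p))
  -- Both halves of `n` have to reach the threshold `n₀` of the host, and the successor also makes
  -- them positive, as `balanced` requires.
  ramsey-turán p ℓ 1≤ℓ ℓ<p 2ℓ≤p ε δ 0<ε 0<δ = suc n₀ ℕ.+ suc n₀ , λ n large →
      subst Conclusion (ℕ.⌊n/2⌋+⌈n/2⌉≡n n) (conclude ⌊ n /2⌋ ⌈ n /2⌉
        (ℕ.≤-trans (ℕ.≤-reflexive (ℕ.n≡⌊n+n/2⌋ (suc n₀))) (ℕ.⌊n/2⌋-mono large)) (ℕ.⌊n/2⌋≤⌈n/2⌉ n) (⌈n/2⌉-parity n))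
    where
    d₁ d₂ d : ℕ
    d₁ = proj₁ (ratio≤ ε 0<ε)
    d₂ = proj₁ (ratio≤ δ 0<δ)
    d  = d₁ ℕ.+ d₂
    open Host (host (suc p) ℓ (suc d) 1≤ℓ ℓ<p (ℕ.s≤s ℕ.z≤n)) renaming (free to K-free)
    Conclusion : ℕ → Set
    Conclusion n = Σ (Graph n) λ G → KFree (suc p ℕ.+ ℓ ℕ.+ 1) G × αBound (suc p) G (ε ℚ.* ℕ→ℚ n)
      × ((ratio ℓ (2 ℕ.* suc p) ℚ.- δ) ℚ.* ℕ→ℚ (choose2 n) ℚ.≤ ℕ→ℚ (edges G))
    conclude : ∀ a b → suc n₀ ℕ.≤ a → a ℕ.≤ b → b ≡ a ⊎ b ≡ suc a → Conclusion (a ℕ.+ b)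
    conclude a b n₀<a a≤b parity = G a b , K-free (ℕ.≤-trans (ℕ.≤-reflexive (sym (2*≡ ℓ))) 2ℓ≤p) a b
        , (λ U free → ℚ.≤-trans (fraction-≤ d {Subset.∣ U ∣} {a ℕ.+ b} (half-≤ (suc d) {Subset.∣ U ∣} {a} {b} {a ℕ.+ b} (independent n₀≤a n₀≤b U free) (ℕ.m≤m+n (a ℕ.+ b) (a ℕ.+ b))))
            (*-ε-mono {d} {ε} (a ℕ.+ b) (proj₂ (ratio≤ ε 0<ε) d (ℕ.m≤m+n d₁ d₂))))
        , density-≤ d ℓ (p ℕ.+ suc (p ℕ.+ 0)) {δ} {choose2 (a ℕ.+ b)} {edges (G a b)} (proj₂ (ratio≤ δ 0<δ) d (ℕ.m≤n+m d₂ d₁))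
            (subst (λ w → pos (suc d) * pos ℓ * c ≤ pos (suc d) * (w * e) + w * c) (sym (ℤ.pos-* 2 (suc p)))
              (certify (0≤+ (0≤+ (0≤+ (0≤* (0≤* (0≤⁺ (suc d)) (0≤⁺ ℓ)) (≤⇒0≤ c≤2x)) (0≤* (0≤⁺ 2) (≤⇒0≤ (between≥ n₀≤a n₀≤b))))
                  (0≤* (0≤* (0≤⁺ 2) (0≤⁺ (suc p))) (≤⇒0≤ x≤c))) (0≤* (0≤* (0≤* (0≤⁺ 2) (0≤⁺ (suc d))) (0≤⁺ (suc p))) (≤⇒0≤ (between≤all a b))))
                (eq (pos (suc d)) (pos ℓ) (pos (suc p)) c e (pos a * pos b) (pos (S a b)))))
      where
      n₀≤a = ℕ.≤-trans (ℕ.n≤1+n n₀) n₀<a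
      n₀≤b = ℕ.≤-trans n₀≤a a≤b
      c = pos (choose2 (a ℕ.+ b))
      e = pos (edges (G a b))
      sizes = balanced (ℕ.≤-trans (ℕ.s≤s ℕ.z≤n) n₀<a) parity
      x≤c : pos a * pos b ≤ c
      x≤c = ℤ.≤-trans (ℤ.≤-reflexive (sym (ℤ.pos-* a b))) (+≤+ (proj₁ sizes))
      c≤2x : c ≤ pos 2 * (pos a * pos b)
      c≤2x = ℤ.≤-trans (+≤+ (proj₂ sizes)) (ℤ.≤-reflexive (trans (ℤ.pos-* 2 (a ℕ.* b)) (cong (pos 2 *_) (ℤ.pos-* a b))))
      eq : ∀ d ℓ p c e x s →
        d * ℓ * (pos 2 * x - c) + pos 2 * (d * (p * s) + p * x - d * ℓ * x) + pos 2 * p * (c - x) + pos 2 * d * p * (e - s)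
        ≡ d * (pos 2 * p * e) + pos 2 * p * c - d * ℓ * c
      eq = solve 7 (λ d ℓ p c e x s → d :* ℓ :* (con (pos 2) :* x :- c) :+ con (pos 2) :* (d :* (p :* s) :+ p :* x :- d :* ℓ :* x) :+ con (pos 2) :* p :* (c :- x) :+ con (pos 2) :* d :* p :* (e :- s) := d :* (con (pos 2) :* p :* e) :+ con (pos 2) :* p :* c :- d :* ℓ :* c) refl

open import Defs
open import Data.Nat using (ℕ; _+_; _*_; _≤_; _<_)
open import Data.Fin using (_↑ˡ_; _↑ʳ_)
open import Data.Rational using (ℚ; 0ℚ; ∣_∣) renaming (_≤_ to _≤ℚ_; _<_ to _<ℚ_; _*_ to _*ℚ_; _-_ to _-ℚ_)
open import Data.Product using (Σ; ∃; _×_)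
open Prelude using (zero; suc; _,_)
open Assembly using (bipartite; ramsey-turán)

theorem1p1 : (p ℓ : ℕ) → 1 ≤ ℓ → ℓ < p →
    (∀ (ε : ℚ) → 0ℚ <ℚ ε → ∃ λ n₀ → ∀ n → n₀ ≤ n →
    Σ (Graph (n + n)) λ G →
    αBound p G (ε *ℚ ℕ→ℚ n)
    × ℕ→ℚ (edgesWithin G n (λ i → i ↑ˡ n)) ≤ℚ ε *ℚ ℕ→ℚ (n * n)
    × ℕ→ℚ (edgesWithin G n (λ j → n ↑ʳ j)) ≤ℚ ε *ℚ ℕ→ℚ (n * n)
    × ∣ ℕ→ℚ (edgesBetween G n n (λ i → i ↑ˡ n) (λ j → n ↑ʳ j)) -ℚ ratio ℓ p *ℚ ℕ→ℚ (n * n) ∣ ≤ℚ ε *ℚ ℕ→ℚ (n * n)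
    × (2 * ℓ ≤ p → KFree (p + ℓ + 1) G))
    × (2 * ℓ ≤ p → RTDensityAtLeast p (p + ℓ + 1) (ratio ℓ (2 * p)))
theorem1p1 zero    ℓ 1≤ℓ ()
theorem1p1 (suc p) ℓ 1≤ℓ ℓ<p = bipartite p ℓ 1≤ℓ ℓ<p , ramsey-turán p ℓ 1≤ℓ ℓ<p
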